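{- For $0<|q|<1$, \begin{align*} \overline{r}_0(2)&=\frac{2J_{6}^{12}}{3J_{1,6}^6J_{2}^4J_{3,6}^3}-\frac{4J^3_{6}}{3J_{2}J_{3,6}}+\frac{2J_{1,6}^6J_2^2J_{3,6}}{3J_{6}^6}-\frac{4}{J_{3,6}}\sum_{n=-\infty}^\infty\frac{(-1)^nq^{3n^2+3n}}{(1+q^{3n+1})^2}+\frac{4}{J_{3,6}}\sum_{n=-\infty}^\infty\frac{(-1)^n q^{3n^2+3n}}{1+q^{3n+1}},\\ \overline{r}_1(2)&=\frac{2J_{6}^{12}}{3J_{1,6}^6J_{2}^4J_{3,6}^3}+\frac{2J_{6}^3}{J_{2}J_{3,6}}-\frac{2J_{1,6}^6J_2^2J_{3,6}}{3J_{6}^6}+\frac{4}{J_{3,6}}\sum_{n=-\infty}^\infty\frac{(-1)^nq^{3n^2+3n}}{(1+q^{3n+1})^2}-\frac{4}{J_{3,6}}\sum_{n=-\infty}^\infty\frac{(-1)^n q^{3n^2+3n}}{1+q^{3n+1}},\\ \overline{r}_2(2)&=\frac{2J_{6}^{12}}{3J_{1,6}^6J_{2}^4J_{3,6}^3}+\frac{2J^3_{6}}{3J_{2}J_{3,6}}+\frac{2J_{1,6}^6J_2^2J_{3,6}}{3J_{6}^6}-\frac{4}{J_{3,6}}\sum_{n=-\infty}^\infty\frac{(-1)^nq^{3n^2+3n}}{(1+q^{3n+1})^2}+\frac{2}{J_{3,6}}\sum_{n=-\infty}^\infty\frac{(-1)^n q^{3n^2+3n}}{1+q^{3n+1}},\\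 \overline{r}_3(2)&=\frac{2J_{6}^{12}}{3J_{1,6}^6J_{2}^4J_{3,6}^3}-\frac{4J_{6}^3}{J_2J_{3,6}}-\frac{2J_{1,6}^6J_2^2J_{3,6}}{3J_{6}^6}+\frac{4}{J_{3,6}}\sum_{n=-\infty}^\infty\frac{(-1)^nq^{3n^2+3n}}{(1+q^{3n+1})^2}. \end{align*}
   Context: An overpartition of a non-negative integer $n$ is a partition of $n$ in which the first occurrence of each distinct part may be overlined; the empty overpartition of $0$ is counted and has rank $0$. The rank of an overpartition is its largest part minus its number of parts. $\overline N(s,6,n)$ is the number of overpartitions of $n$ with rank congruent to $s$ modulo $6$, and $\overline r_s(d)=\sum_{n\ge0}\overline N(s,6,3n+d)q^n$. Notation: $(a;q)_\infty=\prod_{n\ge0}(1-aq^n)$, $j(z;q)=(z;q)_\infty(q/z;q)_\infty(q;q)_\infty$, $J_{a,m}=j(q^a;q^m)$, $J_m=(q^m;q^m)_\infty$. -}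

module Defs where

open import Data.Nat as ℕ using (ℕ; zero; suc)
open import Data.Nat.Combinatorics using (_C_)
open import Data.Integer as ℤ using (ℤ; +_; -[1+_])
open import Data.Integer.DivMod as ℤD using ()
open import Data.Rational as ℚ using (ℚ; 0ℚ; 1ℚ)
open import Data.Bool using (Bool; true; false; if_then_else_)
open import Data.List using (List; []; _∷_; _++_; map; concatMap; foldr; length; filter; upTo; sum)
open import Data.Product using (_×_; _,_)
open import Relation.Nullary.Decidable using (⌊_⌋)
open import Relation.Binary.PropositionalEquality using (_≡_)

-- An overpartition is encoded canonically as a list of blocks
-- (p , m , b) with distinct parts p listed in strictly decreasing order:
-- the part p ≥ 1 occurs with multiplicity m ≥ 1, and b says whether the
-- first occurrence of p is overlined.
Block : Set
Block = ℕ × ℕ × Bool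

OvPtn : Set
OvPtn = List Block

ops : ℕ → ℕ → List OvPtn
ops zero zero = [] ∷ []
ops zero (suc n) = []
ops (suc p) n =
  ops p n ++
  concatMap (λ m →
    concatMap (λ b →
      map (λ rest → (suc p , suc m , b) ∷ rest)
          (ops p (n ℕ.∸ suc m ℕ.* suc p)))
      (false ∷ true ∷ []))
    (upTo (n ℕ./ suc p))

overpartitions : ℕ → List OvPtn
overpartitions n = ops n n

numParts : OvPtn → ℕ
numParts [] = 0
numParts ((p , m , b) ∷ rest) = m ℕ.+ numParts rest

largestPart : OvPtn → ℕ
largestPart [] = 0
largestPart ((p , m , b) ∷ rest) = p

rank : OvPtn → ℤ
rank π = + largestPart π ℤ.- + numParts π

Nbar6 : ℕ → ℕ → ℕ
Nbar6 s n = length (filter (λ π → (rank π ℤD.% + 6) ℕ.≟ s) (overpartitions n))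

PS : Set
PS = ℕ → ℚ

rbar : ℕ → ℕ → PS
rbar s d n = (+ Nbar6 s (3 ℕ.* n ℕ.+ d)) ℚ./ 1

_⊕_ : PS → PS → PS
(f ⊕ g) n = f n ℚ.+ g n

_⊖_ : PS → PS → PS
(f ⊖ g) n = f n ℚ.- g n

_·_ : ℚ → PS → PS
(c · f) n = c ℚ.* f n

infixl 6 _⊕_ _⊖_
infixl 7 _⊗_ _⊘_
infixr 8 _·_

_⊗_ : PS → PS → PS
(f ⊗ g) n = foldr ℚ._+_ 0ℚ (map (λ i → f i ℚ.* g (n ℕ.∸ i)) (upTo (suc n)))

oneS : PS
oneS zero = 1ℚ
oneS (suc n) = 0ℚ

mono : ℕ → PS
mono e n = if ⌊ n ℕ.≟ e ⌋ then 1ℚ else 0ℚ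

_^S_ : PS → ℕ → PS
f ^S zero = oneS
f ^S suc k = f ⊗ (f ^S k)

idx : List ℚ → ℕ → ℚ
idx [] n = 0ℚ
idx (x ∷ xs) zero = x
idx (x ∷ xs) (suc n) = idx xs n

-- Coefficients c₀ … cₙ of the multiplicative inverse of a series f with
-- constant term 1:  c₀ = 1,  cₙ = − Σ_{k=1}^{n} f k · c_{n−k}.
invList : PS → ℕ → List ℚ
invList f zero = 1ℚ ∷ []
invList f (suc n) =
  let v = invList f n in
  v ++ (ℚ.- foldr ℚ._+_ 0ℚ
          (map (λ k → f (suc k) ℚ.* idx v (n ℕ.∸ k)) (upTo (suc n)))) ∷ []

-- inverse of a power series with constant term 1 (all denominators in
-- the theorem have constant term 1)
inv : PS → PS
inv f n = idx (invList f n) n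

_⊘_ : PS → PS → PS
f ⊘ g = f ⊗ inv g

prodS : List PS → PS
prodS = foldr _⊗_ oneS

-- (q^a ; q^b)_∞ = Π_{i ≥ 0} (1 − q^{a+b i}), for a ≥ 1, b ≥ 1:
-- its q^n coefficient only involves the factors with i ≤ n.
poch : ℕ → ℕ → PS
poch a b n = prodS (map (λ i → oneS ⊖ mono (a ℕ.+ b ℕ.* i)) (upTo (suc n))) n

J : ℕ → PS
J m = poch m m

Jam : ℕ → ℕ → PS
Jam a m = poch a m ⊗ poch (m ℕ.∸ a) m ⊗ J m

sgn : ℕ → ℤ
sgn zero = + 1
sgn (suc j) = ℤ.- sgn j

-- q^N coefficient of q^A / (1 + q^e)^k  (A ∈ ℤ, e ≥ 1), i.e. of
-- Σ_{j≥0} (−1)^j C(j+k−1,k−1) q^{A + e j}.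
coeffGeom : ℤ → (e : ℕ) → .{{_ : ℕ.NonZero e}} → ℕ → ℕ → ℚ
coeffGeom A e k N with (+ N) ℤ.- A
... | -[1+ _ ] = 0ℚ
... | + d with d ℕ.% e
...   | suc _ = 0ℚ
...   | zero = (sgn (d ℕ./ e) ℤ.* + (((d ℕ./ e) ℕ.+ k ℕ.∸ 1) C (k ℕ.∸ 1))) ℚ./ 1

-- q^N coefficient of the Laurent expansion (in |q| < 1) of
-- q^A / (1 + q^B)^k,  A, B ∈ ℤ.  For B = −e < 0 one uses
-- 1/(1+q^{−e})^k = q^{ke}/(1+q^e)^k.  (B = 0 does not occur below.)
termCoeff : ℤ → ℤ → ℕ → ℕ → ℚ
termCoeff A (+ suc b) k N = coeffGeom A (suc b) k N
termCoeff A -[1+ b ] k N = coeffGeom (A ℤ.+ + (k ℕ.* suc b)) (suc b) k N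
termCoeff A (+ zero) k N =
  if ⌊ (+ N) ℤ.≟ A ⌋ then halfPow k else 0ℚ
  where
  halfPow : ℕ → ℚ
  halfPow zero = 1ℚ
  halfPow (suc j) = ℚ._*_ (+ 1 ℚ./ 2) (halfPow j)

-- q^N coefficient of Σ_{n=−∞}^{∞} (−1)^n q^{3n²+3n} / (1 + q^{3n+1})^k.
-- Only |n| ≤ N+1 can contribute to the q^N coefficient (every term with
-- index n is O(q^{|n|})), so the sum is truncated to that range.
bsum : ℕ → PS
bsum k N =
  foldr ℚ._+_ 0ℚ
    (map (λ i → let n = + i ℤ.- + suc N in
                ℚ._*_ (sgn ℤ.∣ n ∣ ℚ./ 1)
                      (termCoeff (+ 3 ℤ.* n ℤ.* n ℤ.+ + 3 ℤ.* n)
                                 (+ 3 ℤ.* n ℤ.+ + 1) k N))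
         (upTo (suc (suc (suc (2 ℕ.* N))))))

T1 : PS
T1 = (J 6 ^S 12) ⊘ ((Jam 1 6 ^S 6) ⊗ (J 2 ^S 4) ⊗ (Jam 3 6 ^S 3))

T2 : PS
T2 = (J 6 ^S 3) ⊘ (J 2 ⊗ Jam 3 6)

T3 : PS
T3 = ((Jam 1 6 ^S 6) ⊗ (J 2 ^S 2) ⊗ Jam 3 6) ⊘ (J 6 ^S 6)

S : ℕ → PS
S k = bsum k ⊘ Jam 3 6

q : ℤ → ℕ → ℚ
q a b = a ℚ./ suc b

rhs0 rhs1 rhs2 rhs3 : PS
rhs0 = q (+ 2) 2 · T1 ⊖ q (+ 4) 2 · T2 ⊕ q (+ 2) 2 · T3 ⊖ q (+ 4) 0 · S 2 ⊕ q (+ 4) 0 · S 1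
rhs1 = q (+ 2) 2 · T1 ⊕ q (+ 2) 0 · T2 ⊖ q (+ 2) 2 · T3 ⊕ q (+ 4) 0 · S 2 ⊖ q (+ 4) 0 · S 1
rhs2 = q (+ 2) 2 · T1 ⊕ q (+ 2) 2 · T2 ⊕ q (+ 2) 2 · T3 ⊖ q (+ 4) 0 · S 2 ⊕ q (+ 2) 0 · S 1
rhs3 = q (+ 2) 2 · T1 ⊖ q (+ 4) 0 · T2 ⊖ q (+ 2) 2 · T3 ⊕ q (+ 4) 0 · S 2

-- Overpartitions counted by largest part and number of parts satisfy a recursion that is symmetric in the two
-- statistics. It turns the rank generating functions, multiplied by φ = Σ (-1)ⁿ q^{n²} (the reciprocal of the
-- overpartition series), into partial theta series, and summing over the ranks of one class modulo 6 makes them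
-- combinations T̂ of bilateral Lambert-type sums. Combining the terms n and -n expresses these through three sums
-- X, Y, Z built from the kernels 1/(1 ± q^{3n}) and q^{3n}/(1 + q^{3n})².
--
-- To extract the exponents ≡ 2 (mod 3) of X/φ, Y/φ, Z/φ, put t³ = q. The sums T_m = Σ_l (-1)^l q^{l(l+1)/2} h(l + m) depend
-- on m only through a power of q and a linear factor, so the double sum Σ_m (-1)^m q^{w(m)} T_m is a product of theta
-- series; regrouping it by k = l + m modulo 3 yields linear equations for the components of X, Y and Z, whose
-- only non-theta terms are L⁺, L⁻ and L². The remaining relations between theta constants come from the triple product,
-- Jacobi's cube, and the cubic norm from series in t to series in q, which inverts φ(t).
module Submission where

open import Defs
open import Data.Nat as ℕ using (ℕ; zero; suc; z≤n; s≤s)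
import Data.Nat.Properties as ℕP
import Data.Nat.DivMod as ℕD
open import Data.Integer as ℤ using (ℤ; +_; -[1+_]; ∣_∣)
import Data.Integer.Properties as ℤP
import Data.Integer.DivMod as ℤD
open import Data.Rational as ℚ using (ℚ; 0ℚ; 1ℚ)
import Data.Rational.Properties as ℚP
import Data.Rational.Unnormalised as ℚᵘ
import Data.Rational.Unnormalised.Properties as ℚᵘP
open import Data.Bool using (Bool; true; false; if_then_else_)
open import Data.List using (List; []; _∷_; _++_; map; concatMap; foldr; upTo; applyUpTo; length; filter)
open import Data.List.Properties as ListP using (map-applyUpTo)
open import Data.Maybe.Base using (Maybe; just; nothing)
open import Data.Product using (Σ; _×_; _,_; proj₁; proj₂)
open import Data.Sum using (_⊎_; inj₁; inj₂)
open import Data.Empty using (⊥-elim)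
open import Function using (_∘_; id)
open import Level using (0ℓ)
open import Relation.Nullary using (Dec; yes; no; ¬_)
open import Relation.Nullary.Decidable using (⌊_⌋)
open import Relation.Binary.PropositionalEquality using (_≡_; refl; sym; trans; cong; cong₂; subst; module ≡-Reasoning)
open import Algebra.Bundles using (CommutativeRing; RawRing)
open import Algebra.Structures using (IsCommutativeRing)
open import Algebra.Solver.Ring.AlmostCommutativeRing using (fromCommutativeRing; _-Raw-AlmostCommutative⟶_)
import Algebra.Solver.Ring
import Algebra.Properties.Ring
import Relation.Binary.Reasoning.Setoid
open import Data.Nat.Solver renaming (module +-*-Solver to ℕSolver)
open import Data.Integer.Solver renaming (module +-*-Solver to ℤSolver)
open import Data.Rational.Solver renaming (module +-*-Solver to ℚSolver)
open ℕSolver using () renaming (solve to solveℕ; _:+_ to _+″_; _:*_ to _*″_; con to con″; _:=_ to _=″_)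
open ℤSolver using () renaming (solve to solveℤ; _:=_ to _='_; _:+_ to _+'_; _:*_ to _*'_; _:-_ to _-'_; :-_ to -'_; con to con')

-- Modulo 3 the sums with exponents j² + j have a component `G₀` in class 0 and a component -l in
-- class 2, where l is a Lambert series. Regrouping does not determine `G₀`: it gives only the
-- combination a·`G₀` - 2q b·l, where φ = a(t³) - 2t b(t³). With p₀, p₁, p₂ the components of 1/φ,
-- class 2 of the quotient is p₂·`G₀` - p₀·l, and φ·(1/φ) = 1 says a p₀ = 1 + 2q b p₂. Hence a times
-- this class is p₂(a·`G₀` - 2q b l) - l. The unknown enters only through the known combination,
-- which is why class 2 has a closed form with a single Lambert series left over.
--
-- The rank side has its own obstacle: the recursion controls only the sum of the series for rank ≤
-- m and rank ≤ m + 1. An identity for one m is recovered from its sum over two neighbours because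
-- the error at m has order at least m in q, and m can be raised indefinitely.
--
-- Formal series stand in for |q| < 1: a bilateral sum is a q-adic limit of symmetric partial sums,
-- and each exchange of summations carries an explicit bound on both indices.

-- Formal power series as a commutative ring with a polynomial solver.

module Series where
  sumTo : ℕ → (ℕ → ℚ) → ℚ
  sumTo zero f = 0ℚ
  sumTo (suc n) f = f 0 ℚ.+ sumTo n (f ∘ suc)

  foldr-upTo : ∀ n (f : ℕ → ℚ) → foldr ℚ._+_ 0ℚ (map f (upTo n)) ≡ sumTo n f
  foldr-upTo n f = trans (cong (foldr ℚ._+_ 0ℚ) (map-applyUpTo id f n)) (go n f)
    where
    go : ∀ n (f : ℕ → ℚ) → foldr ℚ._+_ 0ℚ (applyUpTo f n) ≡ sumTo n f
    go zero f = refl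
    go (suc n) f = cong (f 0 ℚ.+_) (go n (f ∘ suc))

  sumTo-cong : ∀ n {f g : ℕ → ℚ} → (∀ i → i ℕ.< n → f i ≡ g i) → sumTo n f ≡ sumTo n g
  sumTo-cong zero h = refl
  sumTo-cong (suc n) h = cong₂ ℚ._+_ (h 0 (s≤s z≤n)) (sumTo-cong n (λ i i<n → h (suc i) (s≤s i<n)))

  infix 4 _≈_
  -- A record keeps the two series visible to unification; the bare pointwise statement would unfold
  -- them.
  record _≈_ (f g : PS) : Set where
    constructor mk≈
    field at : ∀ n → f n ≡ g n
  open _≈_ public

  ≈-refl : ∀ {f} → f ≈ f
  ≈-refl .at n = refl

  ≈-reflexive : ∀ {f g} → f ≡ g → f ≈ g
  ≈-reflexive refl = ≈-refl

  ≈-sym : ∀ {f g} → f ≈ g → g ≈ f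
  ≈-sym p .at n = sym (p .at n)

  ≈-trans : ∀ {f g h} → f ≈ g → g ≈ h → f ≈ h
  ≈-trans p q .at n = trans (p .at n) (q .at n)

  tl : PS → PS
  tl f = f ∘ suc

  zeroS : PS
  zeroS _ = 0ℚ

  infix 9 ⊝_
  ⊝_ : PS → PS
  (⊝ f) n = ℚ.- f n

  private
    conv : PS → PS → PS
    conv f g n = sumTo (suc n) (λ i → f i ℚ.* g (n ℕ.∸ i))

    ⊗-conv : ∀ f g n → (f ⊗ g) n ≡ conv f g n
    ⊗-conv f g n = foldr-upTo (suc n) (λ i → f i ℚ.* g (n ℕ.∸ i))

  ⊗-0 : ∀ f g → (f ⊗ g) 0 ≡ f 0 ℚ.* g 0
  ⊗-0 f g = trans (⊗-conv f g 0) (ℚP.+-identityʳ _)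

  -- Peeling off the constant term of the left factor turns every ring law into an induction on the
  -- coefficient index.
  ⊗-suc : ∀ f g n → (f ⊗ g) (suc n) ≡ f 0 ℚ.* g (suc n) ℚ.+ (tl f ⊗ g) n
  ⊗-suc f g n = trans (⊗-conv f g (suc n)) (cong (f 0 ℚ.* g (suc n) ℚ.+_) (sym (⊗-conv (tl f) g n)))

  ⊗-ext : ∀ {f f′ g g′} → (∀ n → f n ≡ f′ n) → (∀ n → g n ≡ g′ n) → ∀ n → (f ⊗ g) n ≡ (f′ ⊗ g′) n
  ⊗-ext {f} {f′} {g} {g′} p q zero = trans (⊗-0 f g) (trans (cong₂ ℚ._*_ (p 0) (q 0)) (sym (⊗-0 f′ g′)))
  ⊗-ext {f} {f′} {g} {g′} p q (suc n) =
    trans (⊗-suc f g n)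
    (trans (cong₂ ℚ._+_ (cong₂ ℚ._*_ (p 0) (q (suc n))) (⊗-ext (p ∘ suc) q n))
    (sym (⊗-suc f′ g′ n)))

  private

    -- The same peeling on the right factor; played against `⊗-suc` it gives commutativity.
    ⊗-suc′ : ∀ f g n → (f ⊗ g) (suc n) ≡ f (suc n) ℚ.* g 0 ℚ.+ (f ⊗ tl g) n
    ⊗-suc′ f g zero = begin
      (f ⊗ g) 1 ≡⟨ ⊗-suc f g 0 ⟩
      f 0 ℚ.* g 1 ℚ.+ (tl f ⊗ g) 0 ≡⟨ cong (f 0 ℚ.* g 1 ℚ.+_) (⊗-0 (tl f) g) ⟩
      f 0 ℚ.* g 1 ℚ.+ f 1 ℚ.* g 0 ≡⟨ ℚP.+-comm (f 0 ℚ.* g 1) (f 1 ℚ.* g 0) ⟩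
      f 1 ℚ.* g 0 ℚ.+ f 0 ℚ.* g 1 ≡⟨ cong (f 1 ℚ.* g 0 ℚ.+_) (sym (⊗-0 f (tl g))) ⟩
      f 1 ℚ.* g 0 ℚ.+ (f ⊗ tl g) 0 ∎
      where open ≡-Reasoning
    ⊗-suc′ f g (suc n) = begin
      (f ⊗ g) (suc (suc n)) ≡⟨ ⊗-suc f g (suc n) ⟩
      f 0 ℚ.* g (suc (suc n)) ℚ.+ (tl f ⊗ g) (suc n)
        ≡⟨ cong (f 0 ℚ.* g (suc (suc n)) ℚ.+_) (⊗-suc′ (tl f) g n) ⟩
      f 0 ℚ.* g (suc (suc n)) ℚ.+ (f (suc (suc n)) ℚ.* g 0 ℚ.+ (tl f ⊗ tl g) n)
        ≡⟨ (let open ℚSolver in solve 3 (λ x y z → (x :+ (y :+ z)) := (y :+ (x :+ z))) refl (f 0 ℚ.* g (suc (suc n))) (f (suc (suc n)) ℚ.* g 0) ((tl f ⊗ tl g) n)) ⟩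
      f (suc (suc n)) ℚ.* g 0 ℚ.+ (f 0 ℚ.* g (suc (suc n)) ℚ.+ (tl f ⊗ tl g) n)
        ≡⟨ cong (f (suc (suc n)) ℚ.* g 0 ℚ.+_) (sym (⊗-suc f (tl g) n)) ⟩
      f (suc (suc n)) ℚ.* g 0 ℚ.+ (f ⊗ tl g) (suc n) ∎
      where open ≡-Reasoning

    comm : ∀ f g n → (f ⊗ g) n ≡ (g ⊗ f) n
    comm f g zero = trans (⊗-0 f g) (trans (ℚP.*-comm (f 0) (g 0)) (sym (⊗-0 g f)))
    comm f g (suc n) = trans (⊗-suc f g n)
      (trans (cong₂ ℚ._+_ (ℚP.*-comm (f 0) (g (suc n))) (comm (tl f) g n)) (sym (⊗-suc′ g f n)))

    scale : ∀ c f g n → ((c · f) ⊗ g) n ≡ c ℚ.* (f ⊗ g) n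
    scale c f g zero = trans (⊗-0 (c · f) g) (trans (ℚP.*-assoc c _ _) (cong (c ℚ.*_) (sym (⊗-0 f g))))
    scale c f g (suc n) = begin
      ((c · f) ⊗ g) (suc n) ≡⟨ ⊗-suc (c · f) g n ⟩
      c ℚ.* f 0 ℚ.* g (suc n) ℚ.+ ((c · tl f) ⊗ g) n ≡⟨ cong₂ ℚ._+_ (ℚP.*-assoc c _ _) (scale c (tl f) g n) ⟩
      c ℚ.* (f 0 ℚ.* g (suc n)) ℚ.+ c ℚ.* (tl f ⊗ g) n ≡⟨ sym (ℚP.*-distribˡ-+ c _ _) ⟩
      c ℚ.* (f 0 ℚ.* g (suc n) ℚ.+ (tl f ⊗ g) n) ≡⟨ cong (c ℚ.*_) (sym (⊗-suc f g n)) ⟩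
      c ℚ.* (f ⊗ g) (suc n) ∎
      where open ≡-Reasoning

    distribʳ : ∀ f g h n → ((f ⊕ g) ⊗ h) n ≡ (f ⊗ h) n ℚ.+ (g ⊗ h) n
    distribʳ f g h zero = trans (⊗-0 (f ⊕ g) h) (trans (ℚP.*-distribʳ-+ (h 0) (f 0) (g 0)) (sym (cong₂ ℚ._+_ (⊗-0 f h) (⊗-0 g h))))
    distribʳ f g h (suc n) = begin
      ((f ⊕ g) ⊗ h) (suc n) ≡⟨ ⊗-suc (f ⊕ g) h n ⟩
      (f 0 ℚ.+ g 0) ℚ.* h (suc n) ℚ.+ ((tl f ⊕ tl g) ⊗ h) n
        ≡⟨ cong ((f 0 ℚ.+ g 0) ℚ.* h (suc n) ℚ.+_) (distribʳ (tl f) (tl g) h n) ⟩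
      (f 0 ℚ.+ g 0) ℚ.* h (suc n) ℚ.+ ((tl f ⊗ h) n ℚ.+ (tl g ⊗ h) n)
        ≡⟨ (let open ℚSolver in solve 5 (λ a b x y z → ((a :+ b) :* x :+ (y :+ z)) := ((a :* x :+ y) :+ (b :* x :+ z))) refl (f 0) (g 0) (h (suc n)) _ _) ⟩
      (f 0 ℚ.* h (suc n) ℚ.+ (tl f ⊗ h) n) ℚ.+ (g 0 ℚ.* h (suc n) ℚ.+ (tl g ⊗ h) n)
        ≡⟨ sym (cong₂ ℚ._+_ (⊗-suc f h n) (⊗-suc g h n)) ⟩
      (f ⊗ h) (suc n) ℚ.+ (g ⊗ h) (suc n) ∎
      where open ≡-Reasoning

    assoc : ∀ f g h n → ((f ⊗ g) ⊗ h) n ≡ (f ⊗ (g ⊗ h)) n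
    assoc f g h zero = begin
      ((f ⊗ g) ⊗ h) 0 ≡⟨ ⊗-0 (f ⊗ g) h ⟩
      (f ⊗ g) 0 ℚ.* h 0 ≡⟨ cong (ℚ._* h 0) (⊗-0 f g) ⟩
      f 0 ℚ.* g 0 ℚ.* h 0 ≡⟨ ℚP.*-assoc (f 0) _ _ ⟩
      f 0 ℚ.* (g 0 ℚ.* h 0) ≡⟨ cong (f 0 ℚ.*_) (sym (⊗-0 g h)) ⟩
      f 0 ℚ.* (g ⊗ h) 0 ≡⟨ sym (⊗-0 f (g ⊗ h)) ⟩
      (f ⊗ (g ⊗ h)) 0 ∎
      where open ≡-Reasoning
    assoc f g h (suc n) = begin
      ((f ⊗ g) ⊗ h) (suc n) ≡⟨ ⊗-suc (f ⊗ g) h n ⟩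
      (f ⊗ g) 0 ℚ.* h (suc n) ℚ.+ (tl (f ⊗ g) ⊗ h) n
        ≡⟨ cong₂ ℚ._+_ (cong (ℚ._* h (suc n)) (⊗-0 f g))
             (trans (⊗-ext {g = h} (⊗-suc f g) (λ _ → refl) n) (distribʳ (f 0 · tl g) (tl f ⊗ g) h n)) ⟩
      f 0 ℚ.* g 0 ℚ.* h (suc n) ℚ.+ (((f 0 · tl g) ⊗ h) n ℚ.+ ((tl f ⊗ g) ⊗ h) n)
        ≡⟨ cong (f 0 ℚ.* g 0 ℚ.* h (suc n) ℚ.+_) (cong₂ ℚ._+_ (scale (f 0) (tl g) h n) (assoc (tl f) g h n)) ⟩
      f 0 ℚ.* g 0 ℚ.* h (suc n) ℚ.+ (f 0 ℚ.* (tl g ⊗ h) n ℚ.+ (tl f ⊗ (g ⊗ h)) n)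
        ≡⟨ (let open ℚSolver in solve 5 (λ a b x y z → (a :* b :* x :+ (a :* y :+ z)) := (a :* (b :* x :+ y) :+ z)) refl (f 0) (g 0) (h (suc n)) _ _) ⟩
      f 0 ℚ.* (g 0 ℚ.* h (suc n) ℚ.+ (tl g ⊗ h) n) ℚ.+ (tl f ⊗ (g ⊗ h)) n
        ≡⟨ cong (λ x → f 0 ℚ.* x ℚ.+ (tl f ⊗ (g ⊗ h)) n) (sym (⊗-suc g h n)) ⟩
      f 0 ℚ.* (g ⊗ h) (suc n) ℚ.+ (tl f ⊗ (g ⊗ h)) n ≡⟨ sym (⊗-suc f (g ⊗ h) n) ⟩
      (f ⊗ (g ⊗ h)) (suc n) ∎
      where open ≡-Reasoning

    zeroˡ : ∀ f n → (zeroS ⊗ f) n ≡ 0ℚ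
    zeroˡ f zero = trans (⊗-0 zeroS f) (ℚP.*-zeroˡ (f 0))
    zeroˡ f (suc n) = trans (⊗-suc zeroS f n) (trans (cong₂ ℚ._+_ (ℚP.*-zeroˡ (f (suc n))) (zeroˡ f n)) (ℚP.+-identityˡ 0ℚ))

  constS : ℚ → PS
  constS c zero = c
  constS c (suc n) = 0ℚ

  constS-⊗ : ∀ c f n → (constS c ⊗ f) n ≡ c ℚ.* f n
  constS-⊗ c f zero = ⊗-0 (constS c) f
  constS-⊗ c f (suc n) = trans (⊗-suc (constS c) f n)
    (trans (cong (c ℚ.* f (suc n) ℚ.+_) (zeroˡ f n)) (ℚP.+-identityʳ _))

  oneS-constS : ∀ n → oneS n ≡ constS 1ℚ n
  oneS-constS zero = refl
  oneS-constS (suc n) = refl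

  private
    identityˡ : ∀ f n → (oneS ⊗ f) n ≡ f n
    identityˡ f n = trans (⊗-ext {g = f} oneS-constS (λ _ → refl) n) (trans (constS-⊗ 1ℚ f n) (ℚP.*-identityˡ _))

  infixl 6 _⊞_
  infixl 7 _⊠_
  infix 9 ⊟_
  infix 10 q^_

  -- Sealed copies of the operations on series: unification would otherwise unfold the convolution.
  opaque
    _⊞_ _⊠_ : PS → PS → PS
    _⊞_ = _⊕_
    _⊠_ = _⊗_

    ⊟_ : PS → PS
    ⊟_ = ⊝_

    𝟘 𝟙 : PS
    𝟘 = zeroS
    𝟙 = oneS

    q^_ : ℕ → PS
    q^_ = mono

  opaque
    unfolding _⊞_

    ⊞-at : ∀ f g n → (f ⊞ g) n ≡ f n ℚ.+ g n
    ⊞-at f g n = refl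

    ⊟-at : ∀ f n → (⊟ f) n ≡ ℚ.- f n
    ⊟-at f n = refl

    𝟘-at : ∀ n → 𝟘 n ≡ 0ℚ
    𝟘-at n = refl

    𝟙-at : ∀ n → 𝟙 n ≡ oneS n
    𝟙-at n = refl

    q^-at : ∀ e n → (q^ e) n ≡ mono e n
    q^-at e n = refl

    ⊠-at : ∀ f g n → (f ⊠ g) n ≡ (f ⊗ g) n
    ⊠-at f g n = refl

    ⊠-0 : ∀ f g → (f ⊠ g) 0 ≡ f 0 ℚ.* g 0
    ⊠-0 = ⊗-0

    ⊠-suc : ∀ f g n → (f ⊠ g) (suc n) ≡ f 0 ℚ.* g (suc n) ℚ.+ (tl f ⊠ g) n
    ⊠-suc = ⊗-suc

    ⊠-ext : ∀ {f f′ g g′} → (∀ n → f n ≡ f′ n) → (∀ n → g n ≡ g′ n) → ∀ n → (f ⊠ g) n ≡ (f′ ⊠ g′) n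
    ⊠-ext = ⊗-ext

    constS-⊠ : ∀ c f n → (constS c ⊠ f) n ≡ c ℚ.* f n
    constS-⊠ = constS-⊗

    PS-isCommutativeRing : IsCommutativeRing _≈_ _⊞_ _⊠_ ⊟_ 𝟘 𝟙
    PS-isCommutativeRing = record
      { isRing = record
        { +-isAbelianGroup = record
          { isGroup = record
            { isMonoid = record
              { isSemigroup = record
                { isMagma = record
                  { isEquivalence = record { refl = ≈-refl ; sym = ≈-sym ; trans = ≈-trans }
                  ; ∙-cong = λ p q → mk≈ λ n → cong₂ ℚ._+_ (p .at n) (q .at n) }
                ; assoc = λ f g h → mk≈ λ n → ℚP.+-assoc (f n) (g n) (h n) }
              ; identity = (λ f → mk≈ λ n → ℚP.+-identityˡ (f n)) , (λ f → mk≈ λ n → ℚP.+-identityʳ (f n)) }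
            ; inverse = (λ f → mk≈ λ n → ℚP.+-inverseˡ (f n)) , (λ f → mk≈ λ n → ℚP.+-inverseʳ (f n))
            ; ⁻¹-cong = λ p → mk≈ λ n → cong ℚ.-_ (p .at n) }
          ; comm = λ f g → mk≈ λ n → ℚP.+-comm (f n) (g n) }
        ; *-cong = λ p q → mk≈ (⊗-ext (p .at) (q .at))
        ; *-assoc = λ f g h → mk≈ (assoc f g h)
        ; *-identity = (λ f → mk≈ (identityˡ f)) , (λ f → mk≈ λ n → trans (comm f 𝟙 n) (identityˡ f n))
        ; distrib = (λ f g h → mk≈ λ n → trans (comm f (g ⊞ h) n)
                       (trans (distribʳ g h f n) (cong₂ ℚ._+_ (comm g f n) (comm h f n))))
                  , (λ f g h → mk≈ (distribʳ g h f)) }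
      ; *-comm = λ f g → mk≈ (comm f g) }

  PS-ring : CommutativeRing 0ℓ 0ℓ
  PS-ring = record { isCommutativeRing = PS-isCommutativeRing }

  module R = CommutativeRing PS-ring
  module ≈-Reasoning = Relation.Binary.Reasoning.Setoid R.setoid

  ℤ→ℚ : ℤ → ℚ
  ℤ→ℚ z = z ℚ./ 1

  private
    toᵘ : ∀ z → ℚ.toℚᵘ (ℤ→ℚ z) ℚᵘ.≃ (z ℚᵘ./ 1)
    toᵘ z = ℚP.toℚᵘ-fromℚᵘ (z ℚᵘ./ 1)

  ℤ→ℚ-+ : ∀ x y → ℤ→ℚ (x ℤ.+ y) ≡ ℤ→ℚ x ℚ.+ ℤ→ℚ y
  ℤ→ℚ-+ x y = ℚP.toℚᵘ-injective (ℚᵘP.≃-trans (toᵘ (x ℤ.+ y))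
    (ℚᵘP.≃-trans (ℚᵘ.*≡* (cong (ℤ._* + 1) (sym (cong₂ ℤ._+_ (ℤP.*-identityʳ x) (ℤP.*-identityʳ y)))))
    (ℚᵘP.≃-sym (ℚᵘP.≃-trans (ℚP.toℚᵘ-homo-+ (ℤ→ℚ x) (ℤ→ℚ y)) (ℚᵘP.+-cong (toᵘ x) (toᵘ y))))))

  ℤ→ℚ-* : ∀ x y → ℤ→ℚ (x ℤ.* y) ≡ ℤ→ℚ x ℚ.* ℤ→ℚ y
  ℤ→ℚ-* x y = ℚP.toℚᵘ-injective (ℚᵘP.≃-trans (toᵘ (x ℤ.* y))
    (ℚᵘP.≃-sym (ℚᵘP.≃-trans (ℚP.toℚᵘ-homo-* (ℤ→ℚ x) (ℤ→ℚ y)) (ℚᵘP.*-cong (toᵘ x) (toᵘ y)))))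

  ℤ→ℚ-neg : ∀ x → ℤ→ℚ (ℤ.- x) ≡ ℚ.- ℤ→ℚ x
  ℤ→ℚ-neg x = ℚP.toℚᵘ-injective (ℚᵘP.≃-trans (toᵘ (ℤ.- x))
    (ℚᵘP.≃-sym (ℚᵘP.≃-trans (ℚP.toℚᵘ-homo‿- (ℤ→ℚ x)) (ℚᵘP.-‿cong (toᵘ x)))))

  -- 0 and 1 go to the ring's own `𝟘` and `𝟙` by definition, so that solver constants match these
  -- terms without conversion.
  fromℤ : ℤ → PS
  fromℤ (+ 0) = 𝟘
  fromℤ (+ 1) = 𝟙
  fromℤ z = constS (ℤ→ℚ z)

  fromℤ-constS : ∀ z n → fromℤ z n ≡ constS (ℤ→ℚ z) n
  fromℤ-constS (+ 0) zero = 𝟘-at 0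
  fromℤ-constS (+ 0) (suc n) = 𝟘-at (suc n)
  fromℤ-constS (+ 1) zero = 𝟙-at 0
  fromℤ-constS (+ 1) (suc n) = 𝟙-at (suc n)
  fromℤ-constS (+ suc (suc _)) n = refl
  fromℤ-constS -[1+ _ ] n = refl

  ℤ→ℚ-*-/ : ∀ n z → ℤ→ℚ (+ suc n) ℚ.* (z ℚ./ suc n) ≡ ℤ→ℚ z
  ℤ→ℚ-*-/ n z = ℚP.toℚᵘ-injective (ℚᵘP.≃-trans (ℚP.toℚᵘ-homo-* (ℤ→ℚ (+ suc n)) (z ℚ./ suc n))
    (ℚᵘP.≃-trans (ℚᵘP.*-cong (toᵘ (+ suc n)) (ℚP.toℚᵘ-fromℚᵘ (z ℚᵘ./ suc n)))
    (ℚᵘP.≃-trans (ℚᵘ.*≡* (trans (ℤP.*-identityʳ (+ suc n ℤ.* z)) (trans (ℤP.*-comm (+ suc n) z) (cong (λ k → z ℤ.* + k) (sym (ℕP.+-identityʳ (suc n)))))))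
    (ℚᵘP.≃-sym (toᵘ z)))))

  private
    ℤ-raw : RawRing 0ℓ 0ℓ
    ℤ-raw = ℤ.+-*-rawRing

    morphism : ℤ-raw -Raw-AlmostCommutative⟶ fromCommutativeRing PS-ring
    morphism = record
      { ⟦_⟧ = fromℤ
      ; +-homo = λ x y → mk≈ λ n → trans (fromℤ-constS (x ℤ.+ y) n)
          (trans (add x y n) (trans (sym (cong₂ ℚ._+_ (fromℤ-constS x n) (fromℤ-constS y n))) (sym (⊞-at (fromℤ x) (fromℤ y) n))))
      ; *-homo = λ x y → mk≈ λ n → trans (fromℤ-constS (x ℤ.* y) n) (sym
          (trans (⊠-at (fromℤ x) (fromℤ y) n) (trans (⊗-ext (fromℤ-constS x) (fromℤ-constS y) n)
          (trans (constS-⊗ (ℤ→ℚ x) (constS (ℤ→ℚ y)) n) (mul x y n)))))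
      ; -‿homo = λ x → mk≈ λ n → trans (fromℤ-constS (ℤ.- x) n)
          (trans (neg x n) (trans (cong ℚ.-_ (sym (fromℤ-constS x n))) (sym (⊟-at (fromℤ x) n))))
      ; 0-homo = ≈-refl
      ; 1-homo = ≈-refl
      }
      where
      add : ∀ x y n → constS (ℤ→ℚ (x ℤ.+ y)) n ≡ constS (ℤ→ℚ x) n ℚ.+ constS (ℤ→ℚ y) n
      add x y zero = ℤ→ℚ-+ x y
      add x y (suc n) = refl
      mul : ∀ x y n → ℤ→ℚ x ℚ.* constS (ℤ→ℚ y) n ≡ constS (ℤ→ℚ (x ℤ.* y)) n
      mul x y zero = sym (ℤ→ℚ-* x y)
      mul x y (suc n) = ℚP.*-zeroʳ (ℤ→ℚ x)
      neg : ∀ x n → constS (ℤ→ℚ (ℤ.- x)) n ≡ ℚ.- constS (ℤ→ℚ x) n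
      neg x zero = ℤ→ℚ-neg x
      neg x (suc n) = refl

    module M = _-Raw-AlmostCommutative⟶_ morphism

    _≟c_ : ∀ x y → Maybe (fromℤ x ≈ fromℤ y)
    x ≟c y with x ℤP.≟ y
    ... | yes p = just (≈-reflexive (cong fromℤ p))
    ... | no _ = nothing

  fromℤ-+ : ∀ x y → fromℤ (x ℤ.+ y) ≈ fromℤ x ⊞ fromℤ y
  fromℤ-+ = M.+-homo

  fromℤ-* : ∀ x y → fromℤ (x ℤ.* y) ≈ fromℤ x ⊠ fromℤ y
  fromℤ-* = M.*-homo

  fromℤ-neg : ∀ x → fromℤ (ℤ.- x) ≈ ⊟ fromℤ x
  fromℤ-neg = M.-‿homo

  open Algebra.Solver.Ring ℤ-raw (fromCommutativeRing PS-ring) morphism _≟c_ public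
    using (solve; _:=_; _:+_; _:*_; _:-_; :-_; con; _:^_)

open Series

-- Congruence modulo powers of q, order, inverses and units.

module Truncation where
  infix 4 _≈[_]_
  record _≈[_]_ (f : PS) (N : ℕ) (g : PS) : Set where
    constructor mk≈[]
    field below : ∀ n → n ℕ.< N → f n ≡ g n
  open _≈[_]_ public

  Ord : ℕ → PS → Set
  Ord N f = f ≈[ N ] 𝟘

  ord-at : ∀ {N f n} → Ord N f → n ℕ.< N → f n ≡ 0ℚ
  ord-at {n = n} p l = trans (p .below n l) (𝟘-at n)

  ord-intro : ∀ {N f} → (∀ n → n ℕ.< N → f n ≡ 0ℚ) → Ord N f
  ord-intro p .below n l = trans (p n l) (sym (𝟘-at n))

  ≈⇒≈[] : ∀ {N f g} → f ≈ g → f ≈[ N ] g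
  ≈⇒≈[] p .below n _ = p .at n

  ≈[]⇒≈ : ∀ {f g} → (∀ N → f ≈[ N ] g) → f ≈ g
  ≈[]⇒≈ p .at n = p (suc n) .below n ℕP.≤-refl

  ≈[]-sym : ∀ {N f g} → f ≈[ N ] g → g ≈[ N ] f
  ≈[]-sym p .below n l = sym (p .below n l)

  ≈[]-trans : ∀ {N f g h} → f ≈[ N ] g → g ≈[ N ] h → f ≈[ N ] h
  ≈[]-trans p q .below n l = trans (p .below n l) (q .below n l)

  ≈[]-weaken : ∀ {M N f g} → M ℕ.≤ N → f ≈[ N ] g → f ≈[ M ] g
  ≈[]-weaken M≤N p .below n l = p .below n (ℕP.≤-trans l M≤N)

  opaque
    unfolding _⊞_

    ≈[]-⊞ : ∀ {N f f′ g g′} → f ≈[ N ] f′ → g ≈[ N ] g′ → f ⊞ g ≈[ N ] f′ ⊞ g′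
    ≈[]-⊞ p q .below n l = cong₂ ℚ._+_ (p .below n l) (q .below n l)

    ≈[]-⊟ : ∀ {N f f′} → f ≈[ N ] f′ → ⊟ f ≈[ N ] ⊟ f′
    ≈[]-⊟ p .below n l = cong ℚ.-_ (p .below n l)

  ≈[]-tl : ∀ {N f g} → f ≈[ suc N ] g → tl f ≈[ N ] tl g
  ≈[]-tl p .below n l = p .below (suc n) (s≤s l)

  ≈[]-⊠ : ∀ {N f f′ g g′} → f ≈[ N ] f′ → g ≈[ N ] g′ → f ⊠ g ≈[ N ] f′ ⊠ g′
  ≈[]-⊠ {N} {f} {f′} {g} {g′} p q .below zero l =
    trans (⊠-0 f g) (trans (cong₂ ℚ._*_ (p .below 0 l) (q .below 0 l)) (sym (⊠-0 f′ g′)))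
  ≈[]-⊠ {suc N} {f} {f′} {g} {g′} p q .below (suc n) l@(s≤s l′) =
    trans (⊠-suc f g n) (trans (cong₂ ℚ._+_
      (cong₂ ℚ._*_ (p .below 0 (s≤s z≤n)) (q .below (suc n) l))
      (≈[]-⊠ {N} {tl f} {tl f′} {g} {g′} (≈[]-tl p) (≈[]-weaken (ℕP.n≤1+n N) q) .below n l′))
    (sym (⊠-suc f′ g′ n)))

  ord-⊠ˡ : ∀ {N f} g → Ord N f → Ord N (f ⊠ g)
  ord-⊠ˡ {N} {f} g p = ≈[]-trans (≈[]-⊠ p (≈⇒≈[] (≈-refl {g}))) (≈⇒≈[] (R.zeroˡ g))

  ord-⊠ʳ : ∀ {N g} f → Ord N g → Ord N (f ⊠ g)
  ord-⊠ʳ {N} {g} f p = ≈[]-trans (≈⇒≈[] (R.*-comm f g)) (ord-⊠ˡ f p)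

  ord-⊞ : ∀ {N f g} → Ord N f → Ord N g → Ord N (f ⊞ g)
  ord-⊞ p q = ≈[]-trans (≈[]-⊞ p q) (≈⇒≈[] (R.+-identityˡ 𝟘))

  opaque
    unfolding _⊞_

    ord-⊟ : ∀ {N f} → Ord N f → Ord N (⊟ f)
    ord-⊟ p .below n l = cong ℚ.-_ (p .below n l)

  ord-≈ : ∀ {N f g} → f ≈ g → Ord N f → Ord N g
  ord-≈ p q = ≈[]-trans (≈⇒≈[] (≈-sym p)) q

  opaque
    unfolding _⊞_

    ord-diff : ∀ {N f g} → Ord N (f ⊞ ⊟ g) → f ≈[ N ] g
    ord-diff {N} {f} {g} p .below n l = begin
      f n ≡⟨ sym (ℚP.+-identityʳ (f n)) ⟩
      f n ℚ.+ 0ℚ ≡⟨ cong (f n ℚ.+_) (sym (ℚP.+-inverseˡ (g n))) ⟩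
      f n ℚ.+ (ℚ.- g n ℚ.+ g n) ≡⟨ sym (ℚP.+-assoc (f n) (ℚ.- g n) (g n)) ⟩
      (f n ℚ.- g n) ℚ.+ g n ≡⟨ cong (ℚ._+ g n) (p .below n l) ⟩
      0ℚ ℚ.+ g n ≡⟨ ℚP.+-identityˡ (g n) ⟩
      g n ∎
      where open ≡-Reasoning

    ≈[]-diff : ∀ {N f g} → f ≈[ N ] g → Ord N (f ⊞ ⊟ g)
    ≈[]-diff {N} {f} {g} p .below n l = trans (cong (ℚ._- g n) (p .below n l)) (ℚP.+-inverseʳ (g n))

  ord-⊠ : ∀ {M N f g} → Ord M f → Ord N g → Ord (M ℕ.+ N) (f ⊠ g)
  ord-⊠ {zero} {N} {f} {g} p q = ord-⊠ʳ f q
  ord-⊠ {suc M} {N} {f} {g} p q = ord-intro λ where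
      zero l → trans (⊠-0 f g) (trans (cong (ℚ._* g 0) f0) (ℚP.*-zeroˡ (g 0)))
      (suc n) (s≤s l) → trans (⊠-suc f g n) (trans (cong₂ ℚ._+_
        (trans (cong (ℚ._* g (suc n)) f0) (ℚP.*-zeroˡ (g (suc n))))
        (ord-at (ord-⊠ {M} {N} {tl f} {g} (ord-intro λ m l → ord-at p (s≤s l)) q) l))
        (ℚP.+-identityʳ 0ℚ))
    where
    f0 : f 0 ≡ 0ℚ
    f0 = ord-at p (s≤s z≤n)

  opaque
    unfolding _⊞_

    q^-suc : ∀ e n → (q^ (suc e)) (suc n) ≡ (q^ e) n
    q^-suc e n with n ℕ.≟ e | suc n ℕ.≟ suc e
    ... | yes p | yes q = refl
    ... | no p | no q = refl
    ... | yes p | no q = ⊥-elim (q (cong suc p))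
    ... | no p | yes q = ⊥-elim (p (ℕP.suc-injective q))

    q^-0 : q^ 0 ≈ 𝟙
    q^-0 .at zero = refl
    q^-0 .at (suc n) = refl

  opaque
    unfolding _⊞_

    q^-ord : ∀ e → Ord e (q^ e)
    q^-ord (suc e) .below zero l = refl
    q^-ord (suc e) .below (suc n) (s≤s l) = trans (q^-suc e n) (q^-ord e .below n l)

  q^-⊠-low : ∀ e f n → n ℕ.< e → (q^ e ⊠ f) n ≡ 0ℚ
  q^-⊠-low e f n l = ord-at (ord-⊠ˡ f (q^-ord e)) l

  q^-⊠-suc : ∀ e f n → (q^ suc e ⊠ f) (suc n) ≡ (q^ e ⊠ f) n
  q^-⊠-suc e f n = trans (⊠-suc (q^ suc e) f n)
    (trans (cong₂ ℚ._+_ (trans (cong (ℚ._* f (suc n)) (ord-at (q^-ord (suc e)) (s≤s z≤n))) (ℚP.*-zeroˡ (f (suc n))))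
      (⊠-ext {g = f} (q^-suc e) (λ _ → refl) n)) (ℚP.+-identityˡ ((q^ e ⊠ f) n)))

  q^-⊠-high : ∀ e f n → (q^ e ⊠ f) (e ℕ.+ n) ≡ f n
  q^-⊠-high zero f n = ≈-trans (R.*-cong q^-0 ≈-refl) (R.*-identityˡ f) .at n
  q^-⊠-high (suc e) f n = trans (q^-⊠-suc e f (e ℕ.+ n)) (q^-⊠-high e f n)

  q^-+ : ∀ a b → q^ (a ℕ.+ b) ≈ q^ a ⊠ q^ b
  q^-+ zero b = ≈-sym (≈-trans (R.*-cong q^-0 ≈-refl) (R.*-identityˡ (q^ b)))
  q^-+ (suc a) b .at zero = trans (ord-at (q^-ord (suc a ℕ.+ b)) (s≤s z≤n)) (sym (q^-⊠-low (suc a) (q^ b) 0 (s≤s z≤n)))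
  q^-+ (suc a) b .at (suc n) = trans (q^-suc (a ℕ.+ b) n) (trans (q^-+ a b .at n) (sym (q^-⊠-suc a (q^ b) n)))

  -- A power of q is not a unit, but it only shifts coefficients and so can be cancelled. Recursions
  -- are therefore stated multiplied out, with no negative exponents.
  q^-cancel : ∀ e {f g} → q^ e ⊠ f ≈ q^ e ⊠ g → f ≈ g
  q^-cancel e {f} {g} p .at n = trans (sym (q^-⊠-high e f n)) (trans (p .at (e ℕ.+ n)) (q^-⊠-high e g n))

  private
    length-invList : ∀ f n → length (invList f n) ≡ suc n
    length-invList f zero = refl
    length-invList f (suc n) = trans (ListP.length-++ (invList f n)) (trans (cong (ℕ._+ 1) (length-invList f n)) (ℕP.+-comm (suc n) 1))

    idx-++ˡ : ∀ xs {ys} i → i ℕ.< length xs → idx (xs ++ ys) i ≡ idx xs i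
    idx-++ˡ (x ∷ xs) zero l = refl
    idx-++ˡ (x ∷ xs) (suc i) (s≤s l) = idx-++ˡ xs i l

    idx-++ʳ : ∀ xs {y} i → i ≡ length xs → idx (xs ++ y ∷ []) i ≡ y
    idx-++ʳ [] zero refl = refl
    idx-++ʳ (x ∷ xs) (suc i) p = idx-++ʳ xs i (ℕP.suc-injective p)

    -- The list for n + 1 extends the list for n at its end, so an entry never changes after it is
    -- written.
    idx-inv : ∀ f n i → i ℕ.≤ n → idx (invList f n) i ≡ inv f i
    idx-inv f zero zero z≤n = refl
    idx-inv f (suc n) i l with ℕP.m≤n⇒m<n∨m≡n l
    ... | inj₂ refl = refl
    ... | inj₁ (s≤s i≤n) = trans (idx-++ˡ (invList f n) i (subst (i ℕ.<_) (sym (length-invList f n)) (s≤s i≤n))) (idx-inv f n i i≤n)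

  opaque
    unfolding _⊞_

    inv-suc : ∀ f n → inv f (suc n) ≡ ℚ.- (tl f ⊠ inv f) n
    inv-suc f n = trans (idx-++ʳ (invList f n) (suc n) (sym (length-invList f n)))
      (cong ℚ.-_ (trans (foldr-upTo (suc n) (λ k → f (suc k) ℚ.* idx (invList f n) (n ℕ.∸ k)))
      (trans (sumTo-cong (suc n) (λ k _ → cong (f (suc k) ℚ.*_) (idx-inv f n (n ℕ.∸ k) (ℕP.m∸n≤m n k))))
      (sym (foldr-upTo (suc n) (λ k → f (suc k) ℚ.* inv f (n ℕ.∸ k)))))))

  opaque
    unfolding _⊞_

    inv-⊠ : ∀ {f} → f 0 ≡ 1ℚ → f ⊠ inv f ≈ 𝟙
    inv-⊠ {f} f0 .at zero = trans (⊠-0 f (inv f)) (cong (ℚ._* 1ℚ) f0)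
    inv-⊠ {f} f0 .at (suc n) = begin
      (f ⊠ inv f) (suc n) ≡⟨ ⊠-suc f (inv f) n ⟩
      f 0 ℚ.* inv f (suc n) ℚ.+ (tl f ⊠ inv f) n
        ≡⟨ cong (ℚ._+ (tl f ⊠ inv f) n) (trans (cong₂ ℚ._*_ f0 (inv-suc f n)) (ℚP.*-identityˡ (ℚ.- (tl f ⊠ inv f) n))) ⟩
      ℚ.- (tl f ⊠ inv f) n ℚ.+ (tl f ⊠ inv f) n ≡⟨ ℚP.+-inverseˡ ((tl f ⊠ inv f) n) ⟩
      0ℚ ∎
      where open ≡-Reasoning

  -- Carrying the reciprocal covers the integers 2, 3, 6 as well as the series with constant term 1.
  record IsUnit (f : PS) : Set where
    constructor unit
    field
      recip : PS
      recip-⊠ : f ⊠ recip ≈ 𝟙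
  open IsUnit public

  unit-one : ∀ {f} → f 0 ≡ 1ℚ → IsUnit f
  unit-one {f} f0 = unit (inv f) (inv-⊠ f0)

  unit-⊠ : ∀ {f g} → IsUnit f → IsUnit g → IsUnit (f ⊠ g)
  unit-⊠ {f} {g} (unit f′ p) (unit g′ q) = unit (f′ ⊠ g′) (begin
    (f ⊠ g) ⊠ (f′ ⊠ g′) ≈⟨ solve 4 (λ f g f′ g′ → (f :* g) :* (f′ :* g′) := (f :* f′) :* (g :* g′)) ≈-refl f g f′ g′ ⟩
    (f ⊠ f′) ⊠ (g ⊠ g′) ≈⟨ R.*-cong p q ⟩
    𝟙 ⊠ 𝟙 ≈⟨ R.*-identityˡ 𝟙 ⟩
    𝟙 ∎)
    where open ≈-Reasoning

  unit-≈ : ∀ {f g} → f ≈ g → IsUnit f → IsUnit g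
  unit-≈ p (unit r q) = unit r (≈-trans (R.*-cong (≈-sym p) ≈-refl) q)

  cancelˡ-[] : ∀ {N f g h} → IsUnit f → f ⊠ g ≈[ N ] f ⊠ h → g ≈[ N ] h
  cancelˡ-[] {N} {f} {g} {h} (unit r p) q =
    ≈[]-trans (≈⇒≈[] (≈-sym (lem g))) (≈[]-trans (≈[]-⊠ (≈⇒≈[] (≈-refl {r})) q) (≈⇒≈[] (lem h)))
    where
    lem : ∀ x → r ⊠ (f ⊠ x) ≈ x
    lem x = ≈-trans (solve 3 (λ r f x → r :* (f :* x) := (f :* r) :* x) ≈-refl r f x)
      (≈-trans (R.*-cong p ≈-refl) (R.*-identityˡ x))

  cancelˡ : ∀ {f g h} → IsUnit f → f ⊠ g ≈ f ⊠ h → g ≈ h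
  cancelˡ u p = ≈[]⇒≈ λ N → cancelˡ-[] u (≈⇒≈[] p)

  unit-fromℤ : ∀ n → IsUnit (fromℤ (+ suc n))
  unit-fromℤ n = unit (constS (+ 1 ℚ./ suc n)) (mk≈ λ m →
    trans (⊠-ext {g = constS (+ 1 ℚ./ suc n)} (fromℤ-constS (+ suc n)) (λ _ → refl) m) (trans (constS-⊠ (ℤ→ℚ (+ suc n)) (constS (+ 1 ℚ./ suc n)) m) (h m)))
    where
    h : ∀ m → ℤ→ℚ (+ suc n) ℚ.* constS (+ 1 ℚ./ suc n) m ≡ 𝟙 m
    h zero = trans (ℤ→ℚ-*-/ n (+ 1)) (sym (𝟙-at 0))
    h (suc m) = trans (ℚP.*-zeroʳ (ℤ→ℚ (+ suc n))) (sym (𝟙-at (suc m)))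

open Truncation

-- Sums over all integers and exchange of summation.

module BilateralSum where
  symSum : ℕ → (ℤ → PS) → PS
  symSum zero F = F (+ 0)
  symSum (suc B) F = symSum B F ⊞ (F (+ suc B) ⊞ F -[1+ B ])

  symSum-cong : ∀ B {F G} → (∀ k → F k ≈ G k) → symSum B F ≈ symSum B G
  symSum-cong zero h = h (+ 0)
  symSum-cong (suc B) h = R.+-cong (symSum-cong B h) (R.+-cong (h (+ suc B)) (h -[1+ B ]))

  symSum-cong[] : ∀ {N} B {F G} → (∀ k → F k ≈[ N ] G k) → symSum B F ≈[ N ] symSum B G
  symSum-cong[] zero h = h (+ 0)
  symSum-cong[] (suc B) h = ≈[]-⊞ (symSum-cong[] B h) (≈[]-⊞ (h (+ suc B)) (h -[1+ B ]))

  symSum-⊞ : ∀ B F G → symSum B (λ k → F k ⊞ G k) ≈ symSum B F ⊞ symSum B G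
  symSum-⊞ zero F G = ≈-refl
  symSum-⊞ (suc B) F G = ≈-trans (R.+-cong (symSum-⊞ B F G) ≈-refl)
    (solve 6 (λ s t a b c d → (s :+ t) :+ ((a :+ b) :+ (c :+ d)) := (s :+ (a :+ c)) :+ (t :+ (b :+ d))) ≈-refl
      (symSum B F) (symSum B G) (F (+ suc B)) (G (+ suc B)) (F -[1+ B ]) (G -[1+ B ]))

  symSum-⊠ : ∀ B p F → symSum B (λ k → p ⊠ F k) ≈ p ⊠ symSum B F
  symSum-⊠ zero p F = ≈-refl
  symSum-⊠ (suc B) p F = ≈-trans (R.+-cong (symSum-⊠ B p F) ≈-refl)
    (solve 4 (λ p s a b → p :* s :+ (p :* a :+ p :* b) := p :* (s :+ (a :+ b))) ≈-refl p (symSum B F) (F (+ suc B)) (F -[1+ B ]))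

  symSum-swap : ∀ A B (F : ℤ → ℤ → PS) →
    symSum A (λ k → symSum B (F k)) ≈ symSum B (λ m → symSum A (λ k → F k m))
  symSum-swap zero B F = ≈-refl
  symSum-swap (suc A) B F = ≈-trans (R.+-cong (symSum-swap A B F) (≈-sym (symSum-⊞ B (F (+ suc A)) (F -[1+ A ]))))
    (≈-sym (symSum-⊞ B (λ m → symSum A (λ k → F k m)) (λ m → F (+ suc A) m ⊞ F -[1+ A ] m)))

  symSum-neg : ∀ B F → symSum B (F ∘ ℤ.-_) ≈ symSum B F
  symSum-neg zero F = ≈-refl
  symSum-neg (suc B) F = R.+-cong (symSum-neg B F) (R.+-comm (F -[1+ B ]) (F (+ suc B)))

  -- The shifted window drops its left end and gains a new right end; both end terms are kept in the
  -- equation, which avoids subtraction.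
  symSum-suc : ∀ B F → symSum B (F ∘ ℤ.suc) ⊞ F (ℤ.- (+ B)) ≈ symSum B F ⊞ F (+ suc B)
  symSum-suc zero F = R.+-comm (F (+ 1)) (F (+ 0))
  symSum-suc (suc B) F = begin
    symSum B (F ∘ ℤ.suc) ⊞ (F (+ suc (suc B)) ⊞ F (ℤ.suc -[1+ B ])) ⊞ F -[1+ B ]
      ≈⟨ R.+-cong (R.+-cong ≈-refl (R.+-cong ≈-refl (≈-reflexive (cong F (e B))))) ≈-refl ⟩
    symSum B (F ∘ ℤ.suc) ⊞ (F (+ suc (suc B)) ⊞ F (ℤ.- (+ B))) ⊞ F -[1+ B ]
      ≈⟨ solve 4 (λ s a b c → s :+ (a :+ b) :+ c := s :+ b :+ (a :+ c)) ≈-refl (symSum B (F ∘ ℤ.suc)) (F (+ suc (suc B))) (F (ℤ.- (+ B))) (F -[1+ B ]) ⟩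
    symSum B (F ∘ ℤ.suc) ⊞ F (ℤ.- (+ B)) ⊞ (F (+ suc (suc B)) ⊞ F -[1+ B ])
      ≈⟨ R.+-cong (symSum-suc B F) ≈-refl ⟩
    symSum B F ⊞ F (+ suc B) ⊞ (F (+ suc (suc B)) ⊞ F -[1+ B ])
      ≈⟨ solve 4 (λ s a b c → s :+ a :+ (b :+ c) := s :+ (a :+ c) :+ b) ≈-refl (symSum B F) (F (+ suc B)) (F (+ suc (suc B))) (F -[1+ B ]) ⟩
    symSum B F ⊞ (F (+ suc B) ⊞ F -[1+ B ]) ⊞ F (+ suc (suc B)) ∎
    where
    open ≈-Reasoning
    e : ∀ B → ℤ.suc -[1+ B ] ≡ ℤ.- (+ B)
    e zero = refl
    e (suc B) = refl

  -- The window |k| ≤ 3B + 1 is exactly the disjoint union of 3j, 3j + 1 and 3j - 1 over |j| ≤ B.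
  symSum-split3 : ∀ B F → symSum (suc (3 ℕ.* B)) F ≈
    symSum B (λ j → F (+ 3 ℤ.* j)) ⊞ symSum B (λ j → F (+ 3 ℤ.* j ℤ.+ + 1)) ⊞ symSum B (λ j → F (+ 3 ℤ.* j ℤ.- + 1))
  symSum-split3 zero F = ≈-sym (R.+-assoc (F (+ 0)) (F (+ 1)) (F -[1+ 0 ]))
  symSum-split3 (suc B) F = begin
    symSum (suc (3 ℕ.* suc B)) F ≈⟨ ≈-reflexive (cong (λ k → symSum (suc k) F) 3sB) ⟩
    symSum (suc (suc (suc (suc (3 ℕ.* B))))) F
      ≈⟨ R.+-cong (R.+-cong (R.+-cong (symSum-split3 B F) (R.+-cong (F≈ p1) (F≈ n1))) (R.+-cong (F≈ p2) (F≈ n2))) (R.+-cong (F≈ p3) (F≈ n3)) ⟩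
    symSum B F0 ⊞ symSum B F1 ⊞ symSum B F2 ⊞ (F2 (+ suc B) ⊞ F1 -[1+ B ]) ⊞ (F0 (+ suc B) ⊞ F0 -[1+ B ]) ⊞ (F1 (+ suc B) ⊞ F2 -[1+ B ])
      ≈⟨ solve 9 (λ s0 s1 s2 a b c d e f → s0 :+ s1 :+ s2 :+ (a :+ b) :+ (c :+ d) :+ (e :+ f) := (s0 :+ (c :+ d)) :+ (s1 :+ (e :+ b)) :+ (s2 :+ (a :+ f)))
          ≈-refl (symSum B F0) (symSum B F1) (symSum B F2) (F2 (+ suc B)) (F1 -[1+ B ]) (F0 (+ suc B)) (F0 -[1+ B ]) (F1 (+ suc B)) (F2 -[1+ B ]) ⟩
    symSum (suc B) F0 ⊞ symSum (suc B) F1 ⊞ symSum (suc B) F2 ∎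
    where
    open ≈-Reasoning
    F0 F1 F2 : ℤ → PS
    F0 j = F (+ 3 ℤ.* j)
    F1 j = F (+ 3 ℤ.* j ℤ.+ + 1)
    F2 j = F (+ 3 ℤ.* j ℤ.- + 1)
    3sB : 3 ℕ.* suc B ≡ suc (suc (suc (3 ℕ.* B)))
    3sB = ℕP.*-distribˡ-+ 3 1 B
    F≈ : ∀ {x y} → x ≡ y → F x ≈ F y
    F≈ p = ≈-reflexive (cong F p)
    +3 : + 3 ℤ.* + suc B ≡ + (suc (suc (suc (3 ℕ.* B))))
    +3 = trans (sym (ℤP.pos-* 3 (suc B))) (cong +_ 3sB)
    -3s : + 3 ℤ.* -[1+ B ] ≡ -[1+ suc (suc (3 ℕ.* B)) ]
    -3s = trans (sym (ℤP.neg-distribʳ-* (+ 3) (+ suc B))) (cong ℤ.-_ +3)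
    p1 : + suc (suc (3 ℕ.* B)) ≡ + 3 ℤ.* + suc B ℤ.- + 1
    p1 = sym (cong (ℤ._- + 1) +3)
    p2 : + suc (suc (suc (3 ℕ.* B))) ≡ + 3 ℤ.* + suc B
    p2 = sym +3
    p3 : + suc (suc (suc (suc (3 ℕ.* B)))) ≡ + 3 ℤ.* + suc B ℤ.+ + 1
    p3 = sym (trans (cong (ℤ._+ + 1) +3) (cong +_ (ℕP.+-comm (suc (suc (suc (3 ℕ.* B)))) 1)))
    n1 : -[1+ suc (3 ℕ.* B) ] ≡ + 3 ℤ.* -[1+ B ] ℤ.+ + 1
    n1 = sym (cong (ℤ._+ + 1) -3s)
    n2 : -[1+ suc (suc (3 ℕ.* B)) ] ≡ + 3 ℤ.* -[1+ B ]
    n2 = sym -3s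
    n3 : -[1+ suc (suc (suc (3 ℕ.* B))) ] ≡ + 3 ℤ.* -[1+ B ] ℤ.- + 1
    n3 = sym (trans (cong (ℤ._- + 1) -3s) (cong -[1+_] (cong (suc ∘ suc ∘ suc) (ℕP.+-identityʳ (3 ℕ.* B)))))

  symSum-extend : ∀ {N} B B′ F → B ℕ.≤ B′ → (∀ k → B ℕ.< ∣ k ∣ → Ord N (F k)) → symSum B′ F ≈[ N ] symSum B F
  symSum-extend B B′ F l h with ℕP.m≤n⇒m<n∨m≡n l
  ... | inj₂ refl = ≈⇒≈[] ≈-refl
  symSum-extend {N} B (suc B′) F l h | inj₁ (s≤s B≤B′) = ≈[]-trans
    (≈[]-⊞ (symSum-extend B B′ F B≤B′ h) (ord-⊞ (h (+ suc B′) (s≤s B≤B′)) (h -[1+ B′ ] (s≤s B≤B′))))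
    (≈⇒≈[] (R.+-identityʳ (symSum B F)))

  -- `small` bounds single terms, not only tails: modulo q^N every window that contains `bound N`
  -- gives the same value, so reindexing is unconditional.
  record IsSum (F : ℤ → PS) (s : PS) : Set where
    constructor isSum
    field
      bound : ℕ → ℕ
      small : ∀ N k → bound N ℕ.< ∣ k ∣ → Ord N (F k)
      sums : ∀ N → symSum (bound N) F ≈[ N ] s
  open IsSum public

  sums-beyond : ∀ {F s} (p : IsSum F s) N B → bound p N ℕ.≤ B → symSum B F ≈[ N ] s
  sums-beyond {F} p N B l = ≈[]-trans (symSum-extend (bound p N) B F l (small p N)) (sums p N)

  sum-unique : ∀ {F s t} → IsSum F s → IsSum F t → s ≈ t
  sum-unique p q = ≈[]⇒≈ λ N → ≈[]-trans
    (≈[]-sym (sums-beyond p N (bound p N ℕ.⊔ bound q N) (ℕP.m≤m⊔n _ _)))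
    (sums-beyond q N (bound p N ℕ.⊔ bound q N) (ℕP.m≤n⊔m _ _))

  sum-cong : ∀ {F G s t} → (∀ k → F k ≈ G k) → s ≈ t → IsSum F s → IsSum G t
  sum-cong {F} {G} h e p = isSum (bound p)
    (λ N k l → ord-≈ (h k) (small p N k l))
    (λ N → ≈[]-trans (≈⇒≈[] (symSum-cong (bound p N) (λ k → ≈-sym (h k)))) (≈[]-trans (sums p N) (≈⇒≈[] e)))

  sum-⊞ : ∀ {F G s t} → IsSum F s → IsSum G t → IsSum (λ k → F k ⊞ G k) (s ⊞ t)
  sum-⊞ {F} {G} p q = isSum B
    (λ N k l → ord-⊞ (small p N k (ℕP.≤-<-trans (ℕP.m≤m⊔n _ _) l)) (small q N k (ℕP.≤-<-trans (ℕP.m≤n⊔m (bound p N) _) l)))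
    (λ N → ≈[]-trans (≈⇒≈[] (symSum-⊞ (B N) F G))
      (≈[]-⊞ (sums-beyond p N (B N) (ℕP.m≤m⊔n _ _)) (sums-beyond q N (B N) (ℕP.m≤n⊔m (bound p N) _))))
    where
    B : ℕ → ℕ
    B N = bound p N ℕ.⊔ bound q N

  sum-⊠ : ∀ {F s} p → IsSum F s → IsSum (λ k → p ⊠ F k) (p ⊠ s)
  sum-⊠ {F} p h = isSum (bound h) (λ N k l → ord-⊠ʳ p (small h N k l))
    (λ N → ≈[]-trans (≈⇒≈[] (symSum-⊠ (bound h N) p F)) (≈[]-⊠ (≈⇒≈[] (≈-refl {p})) (sums h N)))

  sum-⊟ : ∀ {F s} → IsSum F s → IsSum (λ k → ⊟ F k) (⊟ s)
  sum-⊟ {F} {s} h = sum-cong (λ k → lem (F k)) (lem s) (sum-⊠ (⊟ 𝟙) h)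
    where
    lem : ∀ x → ⊟ 𝟙 ⊠ x ≈ ⊟ x
    lem = solve 1 (λ x → :- con (+ 1) :* x := :- x) ≈-refl

  sum-neg : ∀ {F s} → IsSum F s → IsSum (F ∘ ℤ.-_) s
  sum-neg {F} h = isSum (bound h) (λ N k l → small h N (ℤ.- k) (subst (bound h N ℕ.<_) (sym (ℤP.∣-i∣≡∣i∣ k)) l))
    (λ N → ≈[]-trans (≈⇒≈[] (symSum-neg (bound h N) F)) (sums h N))

  private
    ∣suc∣ : ∀ k → ∣ k ∣ ℕ.≤ suc ∣ ℤ.suc k ∣
    ∣suc∣ (+ n) = ℕP.≤-trans (ℕP.n≤1+n n) (ℕP.n≤1+n (suc n))
    ∣suc∣ -[1+ zero ] = s≤s z≤n
    ∣suc∣ -[1+ suc n ] = ℕP.≤-refl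

  sum-suc : ∀ {F s} → IsSum F s → IsSum (F ∘ ℤ.suc) s
  sum-suc {F} {s} h = isSum B
    (λ N k l → small h N (ℤ.suc k) (ℕP.≤-pred (ℕP.≤-trans l (∣suc∣ k))))
    (λ N → ≈[]-trans (≈[]-trans (≈⇒≈[] (≈-sym (R.+-identityʳ _)))
             (≈[]-⊞ (≈⇒≈[] ≈-refl) (≈[]-sym (small h N (ℤ.- (+ B N)) ℕP.≤-refl))))
      (≈[]-trans (≈⇒≈[] (symSum-suc (B N) F))
      (≈[]-trans (≈[]-⊞ (sums-beyond h N (B N) (ℕP.n≤1+n _)) (small h N (+ suc (B N)) (ℕP.n≤1+n _)))
      (≈⇒≈[] (R.+-identityʳ s)))))
    where
    B : ℕ → ℕ
    B N = suc (bound h N)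

  sum-pred : ∀ {F s} → IsSum F s → IsSum (F ∘ ℤ.pred) s
  sum-pred {F} h = sum-cong (λ k → ≈-reflexive (cong F (e k))) ≈-refl (sum-neg (sum-suc (sum-neg h)))
    where
    e : ∀ k → ℤ.- (ℤ.suc (ℤ.- k)) ≡ ℤ.pred k
    e k = trans (ℤP.neg-distrib-+ (+ 1) (ℤ.- k)) (cong (λ x → -[1+ 0 ] ℤ.+ x) (ℤP.neg-involutive k))

  sum-shift : ∀ {F s} c → IsSum F s → IsSum (λ k → F (k ℤ.+ c)) s
  sum-shift {F} (+ zero) h = sum-cong (λ k → ≈-reflexive (cong F (sym (ℤP.+-identityʳ k)))) ≈-refl h
  sum-shift {F} (+ suc n) h = sum-cong (λ k → ≈-reflexive (cong F (e k))) ≈-refl (sum-suc (sum-shift (+ n) h))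
    where
    e : ∀ k → ℤ.suc k ℤ.+ + n ≡ k ℤ.+ + suc n
    e k = trans (cong (ℤ._+ + n) (ℤP.+-comm (+ 1) k)) (ℤP.+-assoc k (+ 1) (+ n))
  sum-shift {F} -[1+ zero ] h = sum-cong (λ k → ≈-reflexive (cong F (ℤP.+-comm -[1+ 0 ] k))) ≈-refl (sum-pred h)
  sum-shift {F} -[1+ suc n ] h = sum-cong (λ k → ≈-reflexive (cong F (e k))) ≈-refl (sum-pred (sum-shift -[1+ n ] h))
    where
    e : ∀ k → ℤ.pred k ℤ.+ -[1+ n ] ≡ k ℤ.+ -[1+ suc n ]
    e k = trans (cong (ℤ._+ -[1+ n ]) (ℤP.+-comm -[1+ 0 ] k)) (ℤP.+-assoc k -[1+ 0 ] -[1+ n ])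

  Mod3 : ℤ → Set
  Mod3 k = Σ ℤ λ j → k ≡ + 3 ℤ.* j ⊎ (k ≡ + 3 ℤ.* j ℤ.+ + 1 ⊎ k ≡ + 3 ℤ.* j ℤ.- + 1)

  mod3ℕ : ∀ n → Mod3 (+ n)
  mod3ℕ zero = + 0 , inj₁ refl
  mod3ℕ (suc n) with mod3ℕ n
  ... | j , inj₁ p = j , inj₂ (inj₁ (trans (ℤP.+-comm (+ 1) (+ n)) (cong (ℤ._+ + 1) p)))
  ... | j , inj₂ (inj₁ p) = j ℤ.+ + 1 , inj₂ (inj₂ (trans (cong ℤ.suc p) (lem j)))
    where
    lem : ∀ j → + 1 ℤ.+ (+ 3 ℤ.* j ℤ.+ + 1) ≡ + 3 ℤ.* (j ℤ.+ + 1) ℤ.- + 1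
    lem = solveℤ 1 (λ j → con' (+ 1) +' (con' (+ 3) *' j +' con' (+ 1)) =' con' (+ 3) *' (j +' con' (+ 1)) +' con' -[1+ 0 ]) refl
  ... | j , inj₂ (inj₂ p) = j , inj₁ (trans (cong ℤ.suc p) (lem j))
    where
    lem : ∀ j → + 1 ℤ.+ (+ 3 ℤ.* j ℤ.- + 1) ≡ + 3 ℤ.* j
    lem = solveℤ 1 (λ j → con' (+ 1) +' (con' (+ 3) *' j +' con' -[1+ 0 ]) =' con' (+ 3) *' j) refl

  mod3 : ∀ k → Mod3 k
  mod3 (+ n) = mod3ℕ n
  mod3 -[1+ n ] with mod3ℕ (suc n)
  ... | j , inj₁ p = ℤ.- j , inj₁ (trans (cong ℤ.-_ p) (ℤP.neg-distribʳ-* (+ 3) j))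
  ... | j , inj₂ (inj₁ p) = ℤ.- j , inj₂ (inj₂ (trans (cong ℤ.-_ p) (trans (ℤP.neg-distrib-+ (+ 3 ℤ.* j) (+ 1)) (cong (ℤ._- + 1) (ℤP.neg-distribʳ-* (+ 3) j)))))
  ... | j , inj₂ (inj₂ p) = ℤ.- j , inj₂ (inj₁ (trans (cong ℤ.-_ p) (trans (ℤP.neg-distrib-+ (+ 3 ℤ.* j) -[1+ 0 ]) (cong (ℤ._+ + 1) (ℤP.neg-distribʳ-* (+ 3) j)))))

  private
    ∣3j∣≤ : ∀ j d B → ∣ d ∣ ℕ.≤ 1 → suc (3 ℕ.* B) ℕ.< ∣ + 3 ℤ.* j ℤ.+ d ∣ → B ℕ.< ∣ j ∣
    ∣3j∣≤ j d B d≤1 l with B ℕ.<? ∣ j ∣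
    ... | yes p = p
    ... | no ¬p = ⊥-elim (ℕP.<-irrefl refl (ℕP.<-≤-trans l (begin
      ∣ + 3 ℤ.* j ℤ.+ d ∣ ≤⟨ ℤP.∣i+j∣≤∣i∣+∣j∣ (+ 3 ℤ.* j) d ⟩
      ∣ + 3 ℤ.* j ∣ ℕ.+ ∣ d ∣ ≤⟨ ℕP.+-mono-≤ (ℕP.≤-reflexive (ℤP.∣i*j∣≡∣i∣*∣j∣ (+ 3) j)) d≤1 ⟩
      3 ℕ.* ∣ j ∣ ℕ.+ 1 ≡⟨ ℕP.+-comm (3 ℕ.* ∣ j ∣) 1 ⟩
      suc (3 ℕ.* ∣ j ∣) ≤⟨ s≤s (ℕP.*-monoʳ-≤ 3 (ℕP.≮⇒≥ ¬p)) ⟩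
      suc (3 ℕ.* B) ∎)))
      where open ℕP.≤-Reasoning

  sum-split3 : ∀ {F s₀ s₁ s₂} → IsSum (λ j → F (+ 3 ℤ.* j)) s₀ → IsSum (λ j → F (+ 3 ℤ.* j ℤ.+ + 1)) s₁ →
    IsSum (λ j → F (+ 3 ℤ.* j ℤ.- + 1)) s₂ → IsSum F (s₀ ⊞ s₁ ⊞ s₂)
  sum-split3 {F} {s₀} {s₁} {s₂} p₀ p₁ p₂ = isSum (λ N → suc (3 ℕ.* B N)) sm
    (λ N → ≈[]-trans (≈⇒≈[] (symSum-split3 (B N) F))
      (≈[]-⊞ (≈[]-⊞ (sums-beyond p₀ N (B N) (b₀ N)) (sums-beyond p₁ N (B N) (b₁ N))) (sums-beyond p₂ N (B N) (b₂ N))))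
    where
    B : ℕ → ℕ
    B N = bound p₀ N ℕ.⊔ bound p₁ N ℕ.⊔ bound p₂ N
    b₀ : ∀ N → bound p₀ N ℕ.≤ B N
    b₀ N = ℕP.≤-trans (ℕP.m≤m⊔n _ _) (ℕP.m≤m⊔n _ _)
    b₁ : ∀ N → bound p₁ N ℕ.≤ B N
    b₁ N = ℕP.≤-trans (ℕP.m≤n⊔m (bound p₀ N) _) (ℕP.m≤m⊔n _ _)
    b₂ : ∀ N → bound p₂ N ℕ.≤ B N
    b₂ N = ℕP.m≤n⊔m (bound p₀ N ℕ.⊔ bound p₁ N) _
    sm : ∀ N k → suc (3 ℕ.* B N) ℕ.< ∣ k ∣ → Ord N (F k)
    sm N k l with mod3 k
    ... | j , inj₁ refl = small p₀ N j (ℕP.≤-<-trans (b₀ N) (∣3j∣≤ j (+ 0) (B N) z≤n (subst (λ x → suc (3 ℕ.* B N) ℕ.< ∣ x ∣) (sym (ℤP.+-identityʳ (+ 3 ℤ.* j))) l)))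
    ... | j , inj₂ (inj₁ refl) = small p₁ N j (ℕP.≤-<-trans (b₁ N) (∣3j∣≤ j (+ 1) (B N) ℕP.≤-refl l))
    ... | j , inj₂ (inj₂ refl) = small p₂ N j (ℕP.≤-<-trans (b₂ N) (∣3j∣≤ j -[1+ 0 ] (B N) ℕP.≤-refl l))

  symSum-ord : ∀ {N} B {F} → (∀ k → Ord N (F k)) → Ord N (symSum B F)
  symSum-ord zero h = h (+ 0)
  symSum-ord (suc B) h = ord-⊞ (symSum-ord B h) (ord-⊞ (h (+ suc B)) (h -[1+ B ]))

  sums-at : ∀ {F s} → IsSum F s → ∀ N B → (∀ k → B ℕ.< ∣ k ∣ → Ord N (F k)) → symSum B F ≈[ N ] s
  sums-at {F} p N B h = ≈[]-trans (≈[]-sym (symSum-extend B (B ℕ.⊔ bound p N) F (ℕP.m≤m⊔n _ _) h))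
    (sums-beyond p N (B ℕ.⊔ bound p N) (ℕP.m≤n⊔m B _))

  sum-ord : ∀ {F s N} → (∀ k → Ord N (F k)) → IsSum F s → Ord N s
  sum-ord {N = N} h p = ≈[]-trans (≈[]-sym (sums p N)) (symSum-ord (bound p N) h)

  -- Modulo q^N the function `B` confines both indices to one finite square, inside which the order
  -- of summation is immaterial.
  fubini : ∀ {F : ℤ → ℤ → PS} {r c s} (B : ℕ → ℕ) →
    (∀ N k m → B N ℕ.< ∣ k ∣ ⊎ B N ℕ.< ∣ m ∣ → Ord N (F k m)) →
    (∀ k → IsSum (F k) (r k)) → (∀ m → IsSum (λ k → F k m) (c m)) → IsSum r s → IsSum c s
  fubini {F} {r} {c} {s} B joint rows cols p = isSum B
    (λ N m l → sum-ord (λ k → joint N k m (inj₂ l)) (cols m))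
    (λ N → ≈[]-trans (symSum-cong[] (B N) (λ m → ≈[]-sym (sums-at (cols m) N (B N) (λ k l → joint N k m (inj₁ l)))))
      (≈[]-trans (≈⇒≈[] (symSum-swap (B N) (B N) (λ m k → F k m)))
      (≈[]-trans (symSum-cong[] (B N) (λ k → sums-at (rows k) N (B N) (λ m l → joint N k m (inj₂ l))))
      (sums-at p N (B N) (λ k l → sum-ord (λ m → joint N k m (inj₁ l)) (rows k))))))

  -- Passes from the columns m to the diagonals k = l + m. The bound doubles because |k| ≤ |l| +
  -- |m|.
  shear : ∀ {F : ℤ → ℤ → PS} {c r s} (B : ℕ → ℕ) →
    (∀ N l m → B N ℕ.< ∣ l ∣ ⊎ B N ℕ.< ∣ m ∣ → Ord N (F l m)) →
    (∀ m → IsSum (λ l → F l m) (c m)) → (∀ k → IsSum (λ m → F (k ℤ.- m) m) (r k)) → IsSum c s → IsSum r s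
  shear {F} B joint cols diags p = fubini {F = λ m k → F (k ℤ.- m) m} (λ N → B N ℕ.+ B N) bd (λ m → sum-shift (ℤ.- m) (cols m)) diags p
    where
    bd : ∀ N m k → B N ℕ.+ B N ℕ.< ∣ m ∣ ⊎ B N ℕ.+ B N ℕ.< ∣ k ∣ → Ord N (F (k ℤ.- m) m)
    bd N m k (inj₁ l) = joint N _ m (inj₂ (ℕP.≤-<-trans (ℕP.m≤m+n (B N) (B N)) l))
    bd N m k (inj₂ l) with B N ℕ.<? ∣ m ∣ | B N ℕ.<? ∣ k ℤ.- m ∣
    ... | yes x | _ = joint N _ m (inj₂ x)
    ... | no _ | yes y = joint N _ m (inj₁ y)
    ... | no x | no y = ⊥-elim (ℕP.<-irrefl refl (ℕP.<-≤-trans l (begin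
      ∣ k ∣ ≡⟨ cong ∣_∣ (sym (trans (ℤP.+-assoc k (ℤ.- m) m) (trans (cong (λ x → k ℤ.+ x) (ℤP.+-inverseˡ m)) (ℤP.+-identityʳ k)))) ⟩
      ∣ k ℤ.- m ℤ.+ m ∣ ≤⟨ ℤP.∣i+j∣≤∣i∣+∣j∣ (k ℤ.- m) m ⟩
      ∣ k ℤ.- m ∣ ℕ.+ ∣ m ∣ ≤⟨ ℕP.+-mono-≤ (ℕP.≮⇒≥ y) (ℕP.≮⇒≥ x) ⟩
      B N ℕ.+ B N ∎)))
      where open ℕP.≤-Reasoning

  -- The coefficient of q^n is read off in the window n + c, which is enough when term k has order
  -- at least |k| - c. The slack c absorbs exponents such as k(k+1)/2, which vanish at k = -1.
  sumℤ : ℕ → (ℤ → PS) → PS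
  sumℤ c F n = symSum (n ℕ.+ c) F n

  sumℤ-isSum : ∀ c {F} → (∀ k → Ord (∣ k ∣ ℕ.∸ c) (F k)) → IsSum F (sumℤ c F)
  sumℤ-isSum c {F} h = isSum (ℕ._+ c)
    (λ N k l → ≈[]-weaken (ℕP.m+n≤o⇒m≤o∸n N (ℕP.<⇒≤ l)) (h k))
    (λ N → mk≈[] λ n n<N → symSum-extend (n ℕ.+ c) (N ℕ.+ c) F (ℕP.+-monoˡ-≤ c (ℕP.<⇒≤ n<N))
      (λ k l → ≈[]-weaken (ℕP.m+n≤o⇒m≤o∸n (suc n) l) (h k)) .below n ℕP.≤-refl)

  -- With a non-zero limit at one end neither `f` nor its shift is summable alone, so finite windows
  -- are telescoped before passing to the limit.
  sum-telescope : ∀ {f : ℤ → PS} {top bot} (B : ℕ → ℕ) →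
    (∀ N k → B N ℕ.≤ k → f (+ k) ≈[ N ] top) → (∀ N k → B N ℕ.≤ k → f (ℤ.- (+ k)) ≈[ N ] bot) →
    IsSum (λ m → f (ℤ.suc m) ⊞ ⊟ f m) (top ⊞ ⊟ bot)
  sum-telescope {f} {top} {bot} B ht hb = isSum B sm sums′
    where
    sm : ∀ N k → B N ℕ.< ∣ k ∣ → Ord N (f (ℤ.suc k) ⊞ ⊟ f k)
    sm N (+ k) l = ≈[]-diff (≈[]-trans (ht N (suc k) (ℕP.≤-trans (ℕP.<⇒≤ l) (ℕP.n≤1+n k))) (≈[]-sym (ht N k (ℕP.<⇒≤ l))))
    sm N -[1+ k ] l = ≈[]-diff (≈[]-trans (≈[]-trans (≈⇒≈[] (≈-reflexive (cong f (e k)))) (hb N k (ℕP.≤-pred l))) (≈[]-sym (hb N (suc k) (ℕP.<⇒≤ l))))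
      where
      e : ∀ k → ℤ.suc -[1+ k ] ≡ ℤ.- (+ k)
      e zero = refl
      e (suc k) = refl
    sums′ : ∀ N → symSum (B N) (λ m → f (ℤ.suc m) ⊞ ⊟ f m) ≈[ N ] (top ⊞ ⊟ bot)
    sums′ N = ≈[]-trans (≈⇒≈[] eq) (≈[]-⊞ (ht N _ (ℕP.n≤1+n _)) (≈[]-⊟ (hb N _ ℕP.≤-refl)))
      where
      b = B N
      open ≈-Reasoning
      eq : symSum b (λ m → f (ℤ.suc m) ⊞ ⊟ f m) ≈ f (+ suc b) ⊞ ⊟ f (ℤ.- (+ b))
      eq = begin
        symSum b (λ m → f (ℤ.suc m) ⊞ ⊟ f m)
          ≈⟨ symSum-⊞ b (f ∘ ℤ.suc) (⊟_ ∘ f) ⟩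
        symSum b (f ∘ ℤ.suc) ⊞ symSum b (λ m → ⊟ f m)
          ≈⟨ R.+-cong ≈-refl (≈-trans (symSum-cong b (λ k → neg1 (f k))) (symSum-⊠ b (⊟ 𝟙) f)) ⟩
        symSum b (f ∘ ℤ.suc) ⊞ ⊟ 𝟙 ⊠ symSum b f
          ≈⟨ solve 3 (λ x y z → x :+ :- con (+ 1) :* y := (x :+ z) :+ :- y :+ :- z) ≈-refl (symSum b (f ∘ ℤ.suc)) (symSum b f) (f (ℤ.- (+ b))) ⟩
        (symSum b (f ∘ ℤ.suc) ⊞ f (ℤ.- (+ b))) ⊞ ⊟ symSum b f ⊞ ⊟ f (ℤ.- (+ b))
          ≈⟨ R.+-cong (R.+-cong (symSum-suc b f) ≈-refl) ≈-refl ⟩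
        (symSum b f ⊞ f (+ suc b)) ⊞ ⊟ symSum b f ⊞ ⊟ f (ℤ.- (+ b))
          ≈⟨ solve 3 (λ x y z → (x :+ y) :+ :- x :+ :- z := y :+ :- z) ≈-refl (symSum b f) (f (+ suc b)) (f (ℤ.- (+ b))) ⟩
        f (+ suc b) ⊞ ⊟ f (ℤ.- (+ b)) ∎
        where
        neg1 : ∀ x → ⊟ x ≈ ⊟ 𝟙 ⊠ x
        neg1 = solve 1 (λ x → :- x := :- con (+ 1) :* x) ≈-refl

open BilateralSum

-- Exponents, signs and the kernels 1/(1 ± q^k).

module Kernel where
  triℕ : ℕ → ℕ
  triℕ zero = 0
  triℕ (suc n) = suc n ℕ.+ triℕ n

  tri : ℤ → ℕ
  tri (+ n) = triℕ n
  tri -[1+ n ] = triℕ n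

  sq : ℤ → ℕ
  sq k = ∣ k ∣ ℕ.* ∣ k ∣

  -- Exponents have two values, one in ℕ and, doubled, one in ℤ: equalities of the former follow from polynomial identities between the latter.
  data Ex : Set where
    triE sqE : ℤ → Ex
    lit : ℕ → Ex
    _+E_ : Ex → Ex → Ex
    _*E_ : ℕ → Ex → Ex
  infixl 6 _+E_
  infixl 7 _*E_

  ⟦_⟧ℕ : Ex → ℕ
  ⟦ triE k ⟧ℕ = tri k
  ⟦ sqE k ⟧ℕ = sq k
  ⟦ lit n ⟧ℕ = n
  ⟦ e +E f ⟧ℕ = ⟦ e ⟧ℕ ℕ.+ ⟦ f ⟧ℕ
  ⟦ c *E e ⟧ℕ = c ℕ.* ⟦ e ⟧ℕ

  ⟦_⟧² : Ex → ℤ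
  ⟦ triE k ⟧² = k ℤ.* (k ℤ.+ + 1)
  ⟦ sqE k ⟧² = + 2 ℤ.* (k ℤ.* k)
  ⟦ lit n ⟧² = + 2 ℤ.* + n
  ⟦ e +E f ⟧² = ⟦ e ⟧² ℤ.+ ⟦ f ⟧²
  ⟦ c *E e ⟧² = + c ℤ.* ⟦ e ⟧²

  private
    tri² : ∀ n → + 2 ℤ.* + triℕ n ≡ + n ℤ.* (+ n ℤ.+ + 1)
    tri² zero = refl
    tri² (suc n) = begin
      + 2 ℤ.* + (suc n ℕ.+ triℕ n) ≡⟨ cong (λ x → + 2 ℤ.* x) (ℤP.pos-+ (suc n) (triℕ n)) ⟩
      + 2 ℤ.* (+ suc n ℤ.+ + triℕ n) ≡⟨ ℤP.*-distribˡ-+ (+ 2) (+ suc n) (+ triℕ n) ⟩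
      + 2 ℤ.* + suc n ℤ.+ + 2 ℤ.* + triℕ n ≡⟨ cong (λ x → + 2 ℤ.* + suc n ℤ.+ x) (tri² n) ⟩
      + 2 ℤ.* (+ 1 ℤ.+ + n) ℤ.+ + n ℤ.* (+ n ℤ.+ + 1)
        ≡⟨ solveℤ 1 (λ x → con' (+ 2) *' (con' (+ 1) +' x) +' x *' (x +' con' (+ 1)) =' (con' (+ 1) +' x) *' ((con' (+ 1) +' x) +' con' (+ 1))) refl (+ n) ⟩
      + suc n ℤ.* (+ suc n ℤ.+ + 1) ∎
      where open ≡-Reasoning

  ⟦⟧²-ℕ : ∀ e → + 2 ℤ.* + ⟦ e ⟧ℕ ≡ ⟦ e ⟧²
  ⟦⟧²-ℕ (triE (+ n)) = tri² n
  ⟦⟧²-ℕ (triE -[1+ n ]) = trans (tri² n)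
    (solveℤ 1 (λ x → x *' (x +' con' (+ 1)) =' (-' (con' (+ 1) +' x)) *' ((-' (con' (+ 1) +' x)) +' con' (+ 1))) refl (+ n))
  ⟦⟧²-ℕ (sqE (+ n)) = cong (λ x → + 2 ℤ.* x) (ℤP.pos-* n n)
  ⟦⟧²-ℕ (sqE -[1+ n ]) = refl
  ⟦⟧²-ℕ (lit n) = refl
  ⟦⟧²-ℕ (e +E f) = trans (cong (λ x → + 2 ℤ.* x) (ℤP.pos-+ ⟦ e ⟧ℕ ⟦ f ⟧ℕ))
    (trans (ℤP.*-distribˡ-+ (+ 2) (+ ⟦ e ⟧ℕ) (+ ⟦ f ⟧ℕ)) (cong₂ ℤ._+_ (⟦⟧²-ℕ e) (⟦⟧²-ℕ f)))
  ⟦⟧²-ℕ (c *E e) = trans (cong (λ x → + 2 ℤ.* x) (ℤP.pos-* c ⟦ e ⟧ℕ))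
    (trans (solveℤ 3 (λ x y z → x *' (y *' z) =' y *' (x *' z)) refl (+ 2) (+ c) (+ ⟦ e ⟧ℕ)) (cong (λ x → + c ℤ.* x) (⟦⟧²-ℕ e)))

  ex-≡ : ∀ e f → ⟦ e ⟧² ≡ ⟦ f ⟧² → ⟦ e ⟧ℕ ≡ ⟦ f ⟧ℕ
  ex-≡ e f p = ℤP.+-injective (ℤP.*-cancelˡ-≡ (+ 2) _ _ (trans (⟦⟧²-ℕ e) (trans p (sym (⟦⟧²-ℕ f)))))

  ex-shift : ∀ e f k → ⟦ e ⟧² ≡ ⟦ f ⟧² ℤ.+ + 2 ℤ.* k → + ⟦ e ⟧ℕ ≡ + ⟦ f ⟧ℕ ℤ.+ k
  ex-shift e f k p = ℤP.*-cancelˡ-≡ (+ 2) _ _ (trans (⟦⟧²-ℕ e) (trans p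
    (trans (cong (ℤ._+ + 2 ℤ.* k) (sym (⟦⟧²-ℕ f))) (sym (ℤP.*-distribˡ-+ (+ 2) (+ ⟦ f ⟧ℕ) k)))))

  q^≡ : ∀ {a b} → a ≡ b → q^ a ≈ q^ b
  q^≡ p = ≈-reflexive (cong q^_ p)

  tri-≥ : ∀ k → ∣ k ∣ ℕ.∸ 1 ℕ.≤ tri k
  tri-≥ (+ zero) = z≤n
  tri-≥ (+ suc n) = ℕP.≤-trans (ℕP.n≤1+n n) (ℕP.m≤m+n (suc n) (triℕ n))
  tri-≥ -[1+ zero ] = z≤n
  tri-≥ -[1+ suc n ] = ℕP.m≤m+n (suc n) (triℕ n)

  tri-neg : ∀ k → tri (ℤ.- k) ≡ tri (k ℤ.- + 1)
  tri-neg k = ex-≡ (triE (ℤ.- k)) (triE (k ℤ.- + 1))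
    (solveℤ 1 (λ k → -' k *' (-' k +' con' (+ 1)) =' (k +' con' -[1+ 0 ]) *' ((k +' con' -[1+ 0 ]) +' con' (+ 1))) refl k)

  tri-pred-≥ : ∀ k → ∣ k ∣ ℕ.∸ 1 ℕ.≤ tri (k ℤ.- + 1)
  tri-pred-≥ k = subst (∣ k ∣ ℕ.∸ 1 ℕ.≤_) (tri-neg k) (subst (λ x → x ℕ.∸ 1 ℕ.≤ tri (ℤ.- k)) (ℤP.∣-i∣≡∣i∣ k) (tri-≥ (ℤ.- k)))

  sq-≥ : ∀ k → ∣ k ∣ ℕ.≤ sq k
  sq-≥ k with ∣ k ∣
  ... | zero = z≤n
  ... | suc n = ℕP.m≤m*n (suc n) (suc n)

  εℕ : ℕ → PS
  εℕ zero = 𝟙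
  εℕ (suc n) = ⊟ εℕ n

  ε : ℤ → PS
  ε k = εℕ ∣ k ∣

  ⊟⊟ : ∀ x → ⊟ (⊟ x) ≈ x
  ⊟⊟ = solve 1 (λ x → :- (:- x) := x) ≈-refl

  ε-suc : ∀ k → ε (ℤ.suc k) ≈ ⊟ ε k
  ε-suc (+ n) = ≈-refl
  ε-suc -[1+ zero ] = ≈-sym (⊟⊟ 𝟙)
  ε-suc -[1+ suc n ] = ≈-sym (⊟⊟ (ε -[1+ n ]))

  ε-pred : ∀ k → ε (ℤ.pred k) ≈ ⊟ ε k
  ε-pred k = ≈-trans (≈-sym (⊟⊟ (ε (ℤ.pred k)))) (R.-‿cong (≈-trans (≈-sym (ε-suc (ℤ.pred k))) (≈-reflexive (cong ε (ℤP.suc-pred k)))))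

  ε-neg : ∀ k → ε (ℤ.- k) ≈ ε k
  ε-neg (+ zero) = ≈-refl
  ε-neg (+ suc n) = ≈-refl
  ε-neg -[1+ n ] = ≈-refl

  ℤ-ind : (P : ℤ → Set) → P (+ 0) → (∀ k → P k → P (ℤ.suc k)) → (∀ k → P (ℤ.suc k) → P k) → ∀ k → P k
  ℤ-ind P z up down (+ zero) = z
  ℤ-ind P z up down (+ suc n) = up (+ n) (ℤ-ind P z up down (+ n))
  ℤ-ind P z up down -[1+ zero ] = down -[1+ 0 ] z
  ℤ-ind P z up down -[1+ suc n ] = down -[1+ suc n ] (ℤ-ind P z up down -[1+ n ])

  ⊟-cancel : ∀ {x y} → ⊟ x ≈ ⊟ y → x ≈ y
  ⊟-cancel {x} {y} p = ≈-trans (≈-sym (⊟⊟ x)) (≈-trans (R.-‿cong p) (⊟⊟ y))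

  ε-+ : ∀ k m → ε (k ℤ.+ m) ≈ ε k ⊠ ε m
  ε-+ k m = ℤ-ind (λ k → ε (k ℤ.+ m) ≈ ε k ⊠ ε m) base up down k
    where
    base : ε (+ 0 ℤ.+ m) ≈ 𝟙 ⊠ ε m
    base = ≈-trans (≈-reflexive (cong ε (ℤP.+-identityˡ m))) (≈-sym (R.*-identityˡ (ε m)))
    st : ∀ k → ε (ℤ.suc k ℤ.+ m) ≈ ⊟ ε (k ℤ.+ m)
    st k = ≈-trans (≈-reflexive (cong ε (ℤP.+-assoc (+ 1) k m))) (ε-suc (k ℤ.+ m))
    rt : ∀ k → ε (ℤ.suc k) ⊠ ε m ≈ ⊟ (ε k ⊠ ε m)
    rt k = ≈-trans (R.*-cong (ε-suc k) ≈-refl) (solve 2 (λ a b → :- a :* b := :- (a :* b)) ≈-refl (ε k) (ε m))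
    up : ∀ k → ε (k ℤ.+ m) ≈ ε k ⊠ ε m → ε (ℤ.suc k ℤ.+ m) ≈ ε (ℤ.suc k) ⊠ ε m
    up k p = ≈-trans (st k) (≈-trans (R.-‿cong p) (≈-sym (rt k)))
    down : ∀ k → ε (ℤ.suc k ℤ.+ m) ≈ ε (ℤ.suc k) ⊠ ε m → ε (k ℤ.+ m) ≈ ε k ⊠ ε m
    down k p = ⊟-cancel (≈-trans (≈-sym (st k)) (≈-trans p (rt k)))

  ε² : ∀ k → ε k ⊠ ε k ≈ 𝟙
  ε² k = ≈-trans (R.*-cong (≈-sym (ε-neg k)) ≈-refl) (≈-trans (≈-sym (ε-+ (ℤ.- k) k)) (≈-reflexive (cong ε (ℤP.+-inverseˡ k))))

  half : PS
  half = constS (+ 1 ℚ./ 2)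

  two : PS
  two = fromℤ (+ 2)

  half-two : two ⊠ half ≈ 𝟙
  half-two = recip-⊠ (unit-fromℤ 1)

  two≈ : ∀ x → x ⊞ x ≈ two ⊠ x
  two≈ = solve 1 (λ x → x :+ x := con (+ 2) :* x) ≈-refl

  unit-two : IsUnit two
  unit-two = unit-fromℤ 1

  1+q 1-q : ℕ → PS
  1+q n = 𝟙 ⊞ q^ suc n
  1-q n = 𝟙 ⊞ ⊟ q^ suc n

  one-at-0 : ∀ n → (1+q n) 0 ≡ 1ℚ
  one-at-0 n = trans (⊞-at 𝟙 (q^ suc n) 0) (trans (cong₂ ℚ._+_ (𝟙-at 0) (ord-at (q^-ord (suc n)) (s≤s z≤n))) (ℚP.+-identityʳ 1ℚ))

  one-at-0′ : ∀ n → (1-q n) 0 ≡ 1ℚ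
  one-at-0′ n = trans (⊞-at 𝟙 (⊟ q^ suc n) 0) (trans (cong₂ ℚ._+_ (𝟙-at 0) (ord-at (ord-⊟ (q^-ord (suc n))) (s≤s z≤n))) (ℚP.+-identityʳ 1ℚ))

  -- h⁺ k = 1/(1+q^k) and h⁻ k = 1/(1-q^k), with h⁻ 0 = 0.
  h⁺ h⁻ : ℤ → PS
  h⁺ (+ zero) = half
  h⁺ (+ suc n) = inv (1+q n)
  h⁺ -[1+ n ] = q^ suc n ⊠ inv (1+q n)
  h⁻ (+ zero) = 𝟘
  h⁻ (+ suc n) = inv (1-q n)
  h⁻ -[1+ n ] = ⊟ (q^ suc n ⊠ inv (1-q n))

  private
    inv⁺ : ∀ n → inv (1+q n) ⊞ q^ suc n ⊠ inv (1+q n) ≈ 𝟙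
    inv⁺ n = ≈-trans (solve 2 (λ x y → x :+ y :* x := (con (+ 1) :+ y) :* x) ≈-refl (inv (1+q n)) (q^ suc n)) (inv-⊠ (one-at-0 n))

    inv⁻ : ∀ n → inv (1-q n) ⊞ ⊟ (q^ suc n ⊠ inv (1-q n)) ≈ 𝟙
    inv⁻ n = ≈-trans (solve 2 (λ x y → x :+ :- (y :* x) := (con (+ 1) :+ :- y) :* x) ≈-refl (inv (1-q n)) (q^ suc n)) (inv-⊠ (one-at-0′ n))

  h⁺-neg : ∀ k → h⁺ k ⊞ h⁺ (ℤ.- k) ≈ 𝟙
  h⁺-neg (+ zero) = ≈-trans (two≈ half) half-two
  h⁺-neg (+ suc n) = inv⁺ n
  h⁺-neg -[1+ n ] = ≈-trans (R.+-comm (h⁺ -[1+ n ]) (h⁺ (+ suc n))) (inv⁺ n)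

  h⁻-neg : ∀ k → ¬ k ≡ + 0 → h⁻ k ⊞ h⁻ (ℤ.- k) ≈ 𝟙
  h⁻-neg (+ zero) k≢0 = ⊥-elim (k≢0 refl)
  h⁻-neg (+ suc n) _ = inv⁻ n
  h⁻-neg -[1+ n ] _ = ≈-trans (R.+-comm (h⁻ -[1+ n ]) (h⁻ (+ suc n))) (inv⁻ n)

  private
    B≡ : ∀ {A B n} → + B ≡ + A ℤ.+ + n → B ≡ A ℕ.+ n
    B≡ p = ℤP.+-injective p

    A≡ : ∀ {A B n} → + B ≡ + A ℤ.+ -[1+ n ] → A ≡ B ℕ.+ suc n
    A≡ {A} {B} {n} p = ℤP.+-injective (begin
      + A ≡⟨ solveℤ 2 (λ a k → a =' (a +' -' k) +' k) refl (+ A) (+ suc n) ⟩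
      + A ℤ.+ -[1+ n ] ℤ.+ + suc n ≡⟨ cong (ℤ._+ + suc n) (sym p) ⟩
      + B ℤ.+ + suc n ∎)
      where open ≡-Reasoning

  -- `h⁺ k` stands for 1/(1 + q^k), and q^B for q^A·q^k. Keeping both exponents in ℕ states q^A(1 +
  -- q^k)·`h⁺ k` = q^A for negative k as well.
  h⁺-balance : ∀ A B k → + B ≡ + A ℤ.+ k → q^ A ⊠ h⁺ k ⊞ q^ B ⊠ h⁺ k ≈ q^ A
  h⁺-balance A B (+ zero) p = begin
    q^ A ⊠ half ⊞ q^ B ⊠ half ≈⟨ R.+-cong ≈-refl (R.*-cong (q^≡ (trans (B≡ {A} {B} {0} p) (ℕP.+-identityʳ A))) ≈-refl) ⟩
    q^ A ⊠ half ⊞ q^ A ⊠ half ≈⟨ solve 2 (λ a h → a :* h :+ a :* h := a :* (con (+ 2) :* h)) ≈-refl (q^ A) half ⟩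
    q^ A ⊠ (two ⊠ half) ≈⟨ R.*-cong ≈-refl half-two ⟩
    q^ A ⊠ 𝟙 ≈⟨ R.*-identityʳ (q^ A) ⟩
    q^ A ∎
    where open ≈-Reasoning
  h⁺-balance A B (+ suc n) p = begin
    q^ A ⊠ r ⊞ q^ B ⊠ r ≈⟨ R.+-cong ≈-refl (R.*-cong (≈-trans (q^≡ (B≡ {A} {B} {suc n} p)) (q^-+ A (suc n))) ≈-refl) ⟩
    q^ A ⊠ r ⊞ q^ A ⊠ q^ suc n ⊠ r ≈⟨ solve 3 (λ a h y → a :* h :+ a :* y :* h := a :* (h :+ y :* h)) ≈-refl (q^ A) r (q^ suc n) ⟩
    q^ A ⊠ (r ⊞ q^ suc n ⊠ r) ≈⟨ R.*-cong ≈-refl (inv⁺ n) ⟩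
    q^ A ⊠ 𝟙 ≈⟨ R.*-identityʳ (q^ A) ⟩
    q^ A ∎
    where
    open ≈-Reasoning
    r = inv (1+q n)
  h⁺-balance A B -[1+ n ] p = begin
    q^ A ⊠ (y ⊠ r) ⊞ q^ B ⊠ (y ⊠ r) ≈⟨ R.+-cong (R.*-cong A≈ ≈-refl) ≈-refl ⟩
    q^ B ⊠ y ⊠ (y ⊠ r) ⊞ q^ B ⊠ (y ⊠ r) ≈⟨ solve 3 (λ b h y → b :* y :* (y :* h) :+ b :* (y :* h) := b :* y :* (h :+ y :* h)) ≈-refl (q^ B) r y ⟩
    q^ B ⊠ y ⊠ (r ⊞ y ⊠ r) ≈⟨ R.*-cong ≈-refl (inv⁺ n) ⟩
    q^ B ⊠ y ⊠ 𝟙 ≈⟨ R.*-identityʳ (q^ B ⊠ y) ⟩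
    q^ B ⊠ y ≈⟨ ≈-sym A≈ ⟩
    q^ A ∎
    where
    open ≈-Reasoning
    r = inv (1+q n)
    y = q^ suc n
    A≈ : q^ A ≈ q^ B ⊠ y
    A≈ = ≈-trans (q^≡ (A≡ {A} {B} p)) (q^-+ B (suc n))

  h⁻-balance : ∀ A B k → ¬ k ≡ + 0 → + B ≡ + A ℤ.+ k → q^ A ⊠ h⁻ k ⊞ ⊟ (q^ B ⊠ h⁻ k) ≈ q^ A
  h⁻-balance A B (+ zero) k≢0 p = ⊥-elim (k≢0 refl)
  h⁻-balance A B (+ suc n) _ p = begin
    q^ A ⊠ r ⊞ ⊟ (q^ B ⊠ r) ≈⟨ R.+-cong ≈-refl (R.-‿cong (R.*-cong (≈-trans (q^≡ (B≡ {A} {B} {suc n} p)) (q^-+ A (suc n))) ≈-refl)) ⟩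
    q^ A ⊠ r ⊞ ⊟ (q^ A ⊠ q^ suc n ⊠ r) ≈⟨ solve 3 (λ a h y → a :* h :+ :- (a :* y :* h) := a :* (h :+ :- (y :* h))) ≈-refl (q^ A) r (q^ suc n) ⟩
    q^ A ⊠ (r ⊞ ⊟ (q^ suc n ⊠ r)) ≈⟨ R.*-cong ≈-refl (inv⁻ n) ⟩
    q^ A ⊠ 𝟙 ≈⟨ R.*-identityʳ (q^ A) ⟩
    q^ A ∎
    where
    open ≈-Reasoning
    r = inv (1-q n)
  h⁻-balance A B -[1+ n ] _ p = begin
    q^ A ⊠ ⊟ (y ⊠ r) ⊞ ⊟ (q^ B ⊠ ⊟ (y ⊠ r)) ≈⟨ R.+-cong (R.*-cong A≈ ≈-refl) ≈-refl ⟩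
    q^ B ⊠ y ⊠ ⊟ (y ⊠ r) ⊞ ⊟ (q^ B ⊠ ⊟ (y ⊠ r)) ≈⟨ solve 3 (λ b h y → b :* y :* :- (y :* h) :+ :- (b :* :- (y :* h)) := b :* y :* (h :+ :- (y :* h))) ≈-refl (q^ B) r y ⟩
    q^ B ⊠ y ⊠ (r ⊞ ⊟ (y ⊠ r)) ≈⟨ R.*-cong ≈-refl (inv⁻ n) ⟩
    q^ B ⊠ y ⊠ 𝟙 ≈⟨ R.*-identityʳ (q^ B ⊠ y) ⟩
    q^ B ⊠ y ≈⟨ ≈-sym A≈ ⟩
    q^ A ∎
    where
    open ≈-Reasoning
    r = inv (1-q n)
    y = q^ suc n
    A≈ : q^ A ≈ q^ B ⊠ y
    A≈ = ≈-trans (q^≡ (A≡ {A} {B} p)) (q^-+ B (suc n))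

open Kernel

-- Alternating sums of a translated kernel, and how they depend on the translation.

module Translates where
  sum-reflect : ∀ {F s} c → IsSum F s → IsSum (λ k → F (c ℤ.- k)) s
  sum-reflect {F} c h = sum-cong (λ k → ≈-reflexive (cong F (e k))) ≈-refl (sum-shift (ℤ.- c) (sum-neg h))
    where
    e : ∀ k → ℤ.- (k ℤ.- c) ≡ c ℤ.- k
    e k = solveℤ 2 (λ k c → -' (k +' -' c) =' c +' -' k) refl k c

  sum-antisym : ∀ {F s} c → (∀ k → F (c ℤ.- k) ≈ ⊟ F k) → IsSum F s → s ≈ 𝟘
  sum-antisym {F} {s} c a h = cancelˡ unit-two (begin
    two ⊠ s ≈⟨ ≈-sym (two≈ s) ⟩
    s ⊞ s ≈⟨ R.+-cong (sum-unique (sum-reflect c h) (sum-cong (λ k → ≈-sym (a k)) ≈-refl (sum-⊟ h))) ≈-refl ⟩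
    ⊟ s ⊞ s ≈⟨ solve 1 (λ s → :- s :+ s := con (+ 2) :* con (+ 0)) ≈-refl s ⟩
    two ⊠ 𝟘 ∎)
    where open ≈-Reasoning

  ord-q^ : ∀ {N e} → N ℕ.≤ e → Ord N (q^ e)
  ord-q^ {N} {e} l = ≈[]-weaken l (q^-ord e)

  s*tri-≥ : ∀ s .{{_ : ℕ.NonZero s}} k → ∣ k ∣ ℕ.∸ 1 ℕ.≤ s ℕ.* tri k
  s*tri-≥ s k = ℕP.≤-trans (tri-≥ k) (ℕP.m≤n*m (tri k) s)

  t : ℕ → ℤ → PS
  t s l = ε l ⊠ q^ (s ℕ.* tri l)

  t-ord : ∀ s .{{_ : ℕ.NonZero s}} k → Ord (∣ k ∣ ℕ.∸ 1) (t s k)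
  t-ord s k = ord-⊠ʳ (ε k) (ord-q^ (s*tri-≥ s k))

  ε-reflect : ∀ k → ε (-[1+ 0 ] ℤ.- k) ≈ ⊟ ε k
  ε-reflect k = ≈-trans (ε-pred (ℤ.- k)) (R.-‿cong (ε-neg k))

  tri-reflect : ∀ k → tri (-[1+ 0 ] ℤ.- k) ≡ tri k
  tri-reflect k = ex-≡ (triE (-[1+ 0 ] ℤ.- k)) (triE k)
    (solveℤ 1 (λ k → (con' -[1+ 0 ] +' -' k) *' ((con' -[1+ 0 ] +' -' k) +' con' (+ 1)) =' k *' (k +' con' (+ 1))) refl k)

  t-reflect : ∀ s k → t s (-[1+ 0 ] ℤ.- k) ≈ ⊟ t s k
  t-reflect s k = ≈-trans (R.*-cong (ε-reflect k) (q^≡ (cong (s ℕ.*_) (tri-reflect k))))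
    (solve 2 (λ a b → :- a :* b := :- (a :* b)) ≈-refl (ε k) (q^ (s ℕ.* tri k)))

  t-sum : ∀ s .{{_ : ℕ.NonZero s}} → IsSum (t s) 𝟘
  t-sum s = sum-cong (λ _ → ≈-refl) (sum-antisym -[1+ 0 ] (t-reflect s) p) p
    where
    p : IsSum (t s) (sumℤ 1 (t s))
    p = sumℤ-isSum 1 (t-ord s)

  -- Divided by q^(e m)·q^(e (m+1)), the hypothesis says that X m / q^(e m) grows by `c` at each
  -- step. It is solved upwards and downwards from 0, with the powers of q multiplied out.
  affine : ∀ (e : ℤ → ℕ) (X : ℤ → PS) c → e (+ 0) ≡ 0 →
    (∀ m → q^ e m ⊠ X (ℤ.suc m) ≈ q^ e (ℤ.suc m) ⊠ X m ⊞ q^ e m ⊠ q^ e (ℤ.suc m) ⊠ c) →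
    ∀ m → X m ≈ q^ e m ⊠ (X (+ 0) ⊞ fromℤ m ⊠ c)
  affine e X c e0 h = ℤ-ind _ base up down
    where
    open ≈-Reasoning
    x₀ = X (+ 0)
    base : x₀ ≈ q^ e (+ 0) ⊠ (x₀ ⊞ 𝟘 ⊠ c)
    base = ≈-sym (≈-trans (R.*-cong (≈-trans (q^≡ e0) q^-0) ≈-refl)
      (solve 2 (λ x c → con (+ 1) :* (x :+ con (+ 0) :* c) := x) ≈-refl x₀ c))
    fs : ∀ m → fromℤ (ℤ.suc m) ≈ 𝟙 ⊞ fromℤ m
    fs m = fromℤ-+ (+ 1) m
    up : ∀ m → X m ≈ q^ e m ⊠ (x₀ ⊞ fromℤ m ⊠ c) → X (ℤ.suc m) ≈ q^ e (ℤ.suc m) ⊠ (x₀ ⊞ fromℤ (ℤ.suc m) ⊠ c)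
    up m p = q^-cancel (e m) (begin
      q^ e m ⊠ X (ℤ.suc m) ≈⟨ h m ⟩
      b ⊠ X m ⊞ a ⊠ b ⊠ c ≈⟨ R.+-cong (R.*-cong ≈-refl p) ≈-refl ⟩
      b ⊠ (a ⊠ (x₀ ⊞ fromℤ m ⊠ c)) ⊞ a ⊠ b ⊠ c
        ≈⟨ solve 5 (λ a b x f c → b :* (a :* (x :+ f :* c)) :+ a :* b :* c := a :* (b :* (x :+ (con (+ 1) :+ f) :* c))) ≈-refl a b x₀ (fromℤ m) c ⟩
      a ⊠ (b ⊠ (x₀ ⊞ (𝟙 ⊞ fromℤ m) ⊠ c)) ≈⟨ R.*-cong ≈-refl (R.*-cong ≈-refl (R.+-cong ≈-refl (R.*-cong (≈-sym (fs m)) ≈-refl))) ⟩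
      a ⊠ (b ⊠ (x₀ ⊞ fromℤ (ℤ.suc m) ⊠ c)) ∎)
      where
      a = q^ e m
      b = q^ e (ℤ.suc m)
    down : ∀ m → X (ℤ.suc m) ≈ q^ e (ℤ.suc m) ⊠ (x₀ ⊞ fromℤ (ℤ.suc m) ⊠ c) → X m ≈ q^ e m ⊠ (x₀ ⊞ fromℤ m ⊠ c)
    down m p = q^-cancel (e (ℤ.suc m)) (begin
      b ⊠ X m ≈⟨ solve 2 (λ x y → x := x :+ y :+ :- y) ≈-refl (b ⊠ X m) (a ⊠ b ⊠ c) ⟩
      b ⊠ X m ⊞ a ⊠ b ⊠ c ⊞ ⊟ (a ⊠ b ⊠ c) ≈⟨ R.+-cong (≈-sym (h m)) ≈-refl ⟩
      a ⊠ X (ℤ.suc m) ⊞ ⊟ (a ⊠ b ⊠ c) ≈⟨ R.+-cong (R.*-cong ≈-refl (≈-trans p (R.*-cong ≈-refl (R.+-cong ≈-refl (R.*-cong (fs m) ≈-refl))))) ≈-refl ⟩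
      a ⊠ (b ⊠ (x₀ ⊞ (𝟙 ⊞ fromℤ m) ⊠ c)) ⊞ ⊟ (a ⊠ b ⊠ c)
        ≈⟨ solve 5 (λ a b x f c → a :* (b :* (x :+ (con (+ 1) :+ f) :* c)) :+ :- (a :* b :* c) := b :* (a :* (x :+ f :* c))) ≈-refl a b x₀ (fromℤ m) c ⟩
      b ⊠ (a ⊠ (x₀ ⊞ fromℤ m ⊠ c)) ∎)
      where
      a = q^ e m
      b = q^ e (ℤ.suc m)

  T : ℕ → (ℤ → PS) → ℤ → PS
  T s f m = sumℤ 1 (λ l → t s l ⊠ f (l ℤ.+ m))

  T-isSum : ∀ s .{{_ : ℕ.NonZero s}} f m → IsSum (λ l → t s l ⊠ f (l ℤ.+ m)) (T s f m)
  T-isSum s f m = sumℤ-isSum 1 (λ l → ord-⊠ˡ (f (l ℤ.+ m)) (t-ord s l))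

  -- Replacing l by l - 1 in the sum for m + 1 restores the argument l + m, so the kernel relation
  -- `rel` applies term by term. The minus sign is ε(l - 1) = -ε(l).
  T-step : ∀ s .{{_ : ℕ.NonZero s}} (f f′ : ℤ → PS) (e : ℤ → ℕ) (P : ℤ → ℤ → PS) (p : ℤ → PS) →
    (∀ l m → q^ (e m ℕ.+ s ℕ.* tri (l ℤ.- + 1)) ⊠ f (l ℤ.+ m) ≈ P l m ⊞ q^ (e (ℤ.suc m) ℕ.+ s ℕ.* tri l) ⊠ f′ (l ℤ.+ m)) →
    (∀ m → IsSum (λ l → ε l ⊠ P l m) (p m)) →
    ∀ m → q^ e m ⊠ T s f (ℤ.suc m) ≈ ⊟ (p m ⊞ q^ e (ℤ.suc m) ⊠ T s f′ m)
  T-step s f f′ e P p rel hp m = sum-unique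
    (sum-⊠ (q^ e m) (sum-shift (-[1+ 0 ]) (T-isSum s f (ℤ.suc m))))
    (sum-cong (λ l → ≈-sym (term l)) ≈-refl (sum-⊟ (sum-⊞ (hp m) (sum-⊠ (q^ e (ℤ.suc m)) (T-isSum s f′ m)))))
    where
    open ≈-Reasoning
    idx-eq : ∀ l → l ℤ.+ -[1+ 0 ] ℤ.+ ℤ.suc m ≡ l ℤ.+ m
    idx-eq l = solveℤ 2 (λ l m → l +' con' -[1+ 0 ] +' (con' (+ 1) +' m) =' l +' m) refl l m
    term : ∀ l → q^ e m ⊠ (t s (l ℤ.- + 1) ⊠ f (l ℤ.- + 1 ℤ.+ ℤ.suc m))
      ≈ ⊟ (ε l ⊠ P l m ⊞ q^ e (ℤ.suc m) ⊠ (t s l ⊠ f′ (l ℤ.+ m)))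
    term l = begin
      q^ e m ⊠ (ε (l ℤ.- + 1) ⊠ y ⊠ f (l ℤ.- + 1 ℤ.+ ℤ.suc m))
        ≈⟨ R.*-cong ≈-refl (R.*-cong (R.*-cong (≈-trans (≈-reflexive (cong ε (ℤP.+-comm l -[1+ 0 ]))) (ε-pred l)) ≈-refl) (≈-reflexive (cong f (idx-eq l)))) ⟩
      q^ e m ⊠ (⊟ ε l ⊠ y ⊠ f k)
        ≈⟨ solve 4 (λ a x y f → a :* (:- x :* y :* f) := :- (x :* (a :* y :* f))) ≈-refl (q^ e m) (ε l) y (f k) ⟩
      ⊟ (ε l ⊠ (q^ e m ⊠ y ⊠ f k))
        ≈⟨ R.-‿cong (R.*-cong ≈-refl (≈-trans (R.*-cong (≈-sym (q^-+ (e m) _)) ≈-refl) (≈-trans (rel l m) (R.+-cong ≈-refl (R.*-cong (q^-+ (e (ℤ.suc m)) _) ≈-refl))))) ⟩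
      ⊟ (ε l ⊠ (P l m ⊞ q^ e (ℤ.suc m) ⊠ z ⊠ f′ k))
        ≈⟨ solve 5 (λ x p b z f → :- (x :* (p :+ b :* z :* f)) := :- (x :* p :+ b :* (x :* z :* f))) ≈-refl (ε l) (P l m) (q^ e (ℤ.suc m)) z (f′ k) ⟩
      ⊟ (ε l ⊠ P l m ⊞ q^ e (ℤ.suc m) ⊠ (ε l ⊠ z ⊠ f′ k)) ∎
      where
      k = l ℤ.+ m
      y = q^ (s ℕ.* tri (l ℤ.- + 1))
      z = q^ (s ℕ.* tri l)

  t-pred-sum : ∀ s .{{_ : ℕ.NonZero s}} → IsSum (λ l → ε l ⊠ q^ (s ℕ.* tri (l ℤ.- + 1))) 𝟘
  t-pred-sum s = sum-cong
    (λ l → R.*-cong (ε-neg l) (q^≡ (cong (s ℕ.*_) (tri-neg l)))) ≈-refl (sum-neg (t-sum s))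

  T-⊟ : ∀ s .{{_ : ℕ.NonZero s}} f m → T s (λ k → ⊟ f k) m ≈ ⊟ T s f m
  T-⊟ s f m = sum-unique (T-isSum s (λ k → ⊟ f k) m)
    (sum-cong (λ l → solve 2 (λ a b → :- (a :* b) := a :* :- b) ≈-refl (t s l) (f (l ℤ.+ m))) ≈-refl (sum-⊟ (T-isSum s f m)))

  T-⊞ : ∀ s .{{_ : ℕ.NonZero s}} f g m → T s (λ k → f k ⊞ g k) m ≈ T s f m ⊞ T s g m
  T-⊞ s f g m = sum-unique (T-isSum s (λ k → f k ⊞ g k) m)
    (sum-cong (λ l → solve 3 (λ a b c → a :* b :+ a :* c := a :* (b :+ c)) ≈-refl (t s l) (f (l ℤ.+ m)) (g (l ℤ.+ m))) ≈-refl
      (sum-⊞ (T-isSum s f m) (T-isSum s g m)))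

  private
    e₁ : ℤ → ℕ
    e₁ m = tri (m ℤ.- + 1)

    E₁ : ℤ → ℤ → Ex
    E₁ l m = triE (m ℤ.- + 1) +E 1 *E triE (l ℤ.- + 1)
    E₁′ : ℤ → ℤ → Ex
    E₁′ l m = triE (ℤ.suc m ℤ.- + 1) +E 1 *E triE l

    E₁-shift : ∀ l m → + ⟦ E₁′ l m ⟧ℕ ≡ + ⟦ E₁ l m ⟧ℕ ℤ.+ (l ℤ.+ m)
    E₁-shift l m = ex-shift (E₁′ l m) (E₁ l m) (l ℤ.+ m) (solveℤ 2 (λ l m →
      ((con' (+ 1) +' m) +' con' -[1+ 0 ]) *' (((con' (+ 1) +' m) +' con' -[1+ 0 ]) +' con' (+ 1)) +' con' (+ 1) *' (l *' (l +' con' (+ 1)))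
      =' ((m +' con' -[1+ 0 ]) *' ((m +' con' -[1+ 0 ]) +' con' (+ 1)) +' con' (+ 1) *' ((l +' con' -[1+ 0 ]) *' ((l +' con' -[1+ 0 ]) +' con' (+ 1)))) +' con' (+ 2) *' (l +' m)) refl l m)

    P₁ : ℤ → ℤ → PS
    P₁ l m = q^ ⟦ E₁ l m ⟧ℕ

    P₁-sum : ∀ m → IsSum (λ l → ε l ⊠ P₁ l m) 𝟘
    P₁-sum m = sum-cong (λ l → ≈-trans (solve 3 (λ a x y → a :* (x :* y) := x :* (a :* y)) ≈-refl (q^ e₁ m) (ε l) (q^ (1 ℕ.* tri (l ℤ.- + 1))))
        (R.*-cong ≈-refl (≈-sym (q^-+ (e₁ m) _)))) (R.zeroʳ (q^ e₁ m)) (sum-⊠ (q^ e₁ m) (t-pred-sum 1))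

  -- The part without kernel sums to zero, because l ↦ 1 - l reverses the sign of (-1)^l
  -- q^(l(l-1)/2).
  T⁺-step : ∀ m → q^ e₁ m ⊠ T 1 h⁺ (ℤ.suc m) ≈ q^ e₁ (ℤ.suc m) ⊠ T 1 h⁺ m
  T⁺-step m = ≈-trans (T-step 1 h⁺ (λ k → ⊟ h⁺ k) e₁ P₁ (λ _ → 𝟘) rel P₁-sum m)
    (≈-trans (R.-‿cong (R.+-cong ≈-refl (R.*-cong ≈-refl (T-⊟ 1 h⁺ m))))
      (solve 2 (λ a b → :- (con (+ 0) :+ a :* :- b) := a :* b) ≈-refl (q^ e₁ (ℤ.suc m)) (T 1 h⁺ m)))
    where
    rel : ∀ l m → q^ ⟦ E₁ l m ⟧ℕ ⊠ h⁺ (l ℤ.+ m) ≈ P₁ l m ⊞ q^ ⟦ E₁′ l m ⟧ℕ ⊠ ⊟ h⁺ (l ℤ.+ m)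
    rel l m = ≈-trans (solve 3 (λ a b h → a :* h := (a :* h :+ b :* h) :+ b :* :- h) ≈-refl (q^ ⟦ E₁ l m ⟧ℕ) (q^ ⟦ E₁′ l m ⟧ℕ) (h⁺ (l ℤ.+ m)))
      (R.+-cong (h⁺-balance ⟦ E₁ l m ⟧ℕ ⟦ E₁′ l m ⟧ℕ (l ℤ.+ m) (E₁-shift l m)) ≈-refl)

  T⁺ : ∀ m → T 1 h⁺ m ≈ q^ tri (m ℤ.- + 1) ⊠ T 1 h⁺ (+ 0)
  T⁺ m = ≈-trans (affine e₁ (T 1 h⁺) 𝟘 refl
      (λ m → ≈-trans (T⁺-step m) (solve 2 (λ a b → a := a :+ b :* con (+ 0)) ≈-refl (q^ e₁ (ℤ.suc m) ⊠ T 1 h⁺ m) (q^ e₁ m ⊠ q^ e₁ (ℤ.suc m)))) m)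
    (solve 3 (λ a x f → a :* (x :+ f :* con (+ 0)) := a :* x) ≈-refl (q^ e₁ m) (T 1 h⁺ (+ 0)) (fromℤ m))

  -- Equals q^k/(1 + q^k)², an even function of k.
  h² : ℤ → PS
  h² k = h⁺ k ⊠ h⁺ (ℤ.- k)

  -- As `h⁺ k` + `h⁺ (- k)` = 1, the difference h⁺ - h² is the square of `h⁺`, and q^k times it is
  -- `h²` again. The sum for `h⁺` thus enters as inhomogeneity, which creates the linear factor in
  -- m.
  T²-step : ∀ m → q^ e₁ m ⊠ T 1 h² (ℤ.suc m) ≈ q^ e₁ (ℤ.suc m) ⊠ (T 1 h² m ⊞ ⊟ T 1 h⁺ m)
  T²-step m = ≈-trans (T-step 1 h² (λ k → h⁺ k ⊞ ⊟ h² k) e₁ (λ _ _ → 𝟘) (λ _ → 𝟘) rel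
      (λ m → sum-cong (λ l → ≈-trans (R.zeroˡ (t 1 l)) (≈-sym (R.zeroʳ (ε l)))) (R.zeroˡ 𝟘) (sum-⊠ 𝟘 (t-sum 1))) m)
    (≈-trans (R.-‿cong (R.+-cong ≈-refl (R.*-cong ≈-refl (≈-trans (T-⊞ 1 h⁺ (λ k → ⊟ h² k) m) (R.+-cong ≈-refl (T-⊟ 1 h² m))))))
      (solve 3 (λ a b c → :- (con (+ 0) :+ a :* (c :+ :- b)) := a :* (b :+ :- c)) ≈-refl (q^ e₁ (ℤ.suc m)) (T 1 h² m) (T 1 h⁺ m)))
    where
    open ≈-Reasoning
    rel : ∀ l m → q^ ⟦ E₁ l m ⟧ℕ ⊠ h² (l ℤ.+ m) ≈ 𝟘 ⊞ q^ ⟦ E₁′ l m ⟧ℕ ⊠ (h⁺ (l ℤ.+ m) ⊞ ⊟ h² (l ℤ.+ m))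
    rel l m = begin
      A ⊠ (x ⊠ y) ≈⟨ solve 4 (λ A x y B → A :* (x :* y) := x :* (A :* (x :+ y) :+ :- (A :* x :+ B :* x)) :+ B :* (x :* x)) ≈-refl A x y B ⟩
      x ⊠ (A ⊠ (x ⊞ y) ⊞ ⊟ (A ⊠ x ⊞ B ⊠ x)) ⊞ B ⊠ (x ⊠ x)
        ≈⟨ R.+-cong (R.*-cong ≈-refl (R.+-cong (R.*-cong ≈-refl (h⁺-neg k)) (R.-‿cong (h⁺-balance ⟦ E₁ l m ⟧ℕ ⟦ E₁′ l m ⟧ℕ k (E₁-shift l m))))) ≈-refl ⟩
      x ⊠ (A ⊠ 𝟙 ⊞ ⊟ A) ⊞ B ⊠ (x ⊠ x)
        ≈⟨ solve 4 (λ A x y B → x :* (A :* con (+ 1) :+ :- A) :+ B :* (x :* x) := B :* (x :* (x :+ y) :+ :- (x :* y))) ≈-refl A x y B ⟩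
      B ⊠ (x ⊠ (x ⊞ y) ⊞ ⊟ (x ⊠ y)) ≈⟨ R.*-cong ≈-refl (R.+-cong (≈-trans (R.*-cong ≈-refl (h⁺-neg k)) (R.*-identityʳ x)) ≈-refl) ⟩
      B ⊠ (x ⊞ ⊟ (x ⊠ y)) ≈⟨ ≈-sym (R.+-identityˡ (B ⊠ (x ⊞ ⊟ (x ⊠ y)))) ⟩
      𝟘 ⊞ B ⊠ (x ⊞ ⊟ (x ⊠ y)) ∎
      where
      k = l ℤ.+ m
      A = q^ ⟦ E₁ l m ⟧ℕ
      B = q^ ⟦ E₁′ l m ⟧ℕ
      x = h⁺ k
      y = h⁺ (ℤ.- k)

  T-reflect : ∀ s .{{_ : ℕ.NonZero s}} f m → IsSum (λ l → ⊟ (t s l ⊠ f (m ℤ.- + 1 ℤ.- l))) (T s f m)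
  T-reflect s f m = sum-cong (λ l → ≈-trans (R.*-cong (t-reflect s l) (≈-reflexive (cong f (e l))))
      (solve 2 (λ a b → :- a :* b := :- (a :* b)) ≈-refl (t s l) (f (m ℤ.- + 1 ℤ.- l)))) ≈-refl (sum-reflect -[1+ 0 ] (T-isSum s f m))
    where
    e : ∀ l → -[1+ 0 ] ℤ.- l ℤ.+ m ≡ m ℤ.- + 1 ℤ.- l
    e l = solveℤ 2 (λ l m → (con' -[1+ 0 ] +' -' l) +' m =' m +' con' -[1+ 0 ] +' -' l) refl l m

  -- Parity fixes the initial value: `h²` is even, so reflection gives T(1) = -T(0), while the step
  -- at 0 gives T(1) = T(0) - τ with τ the sum for `h⁺`. Hence 2T(0) = τ.
  T² : ∀ m → two ⊠ T 1 h² m ≈ q^ tri (m ℤ.- + 1) ⊠ ((𝟙 ⊞ ⊟ (two ⊠ fromℤ m)) ⊠ T 1 h⁺ (+ 0))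
  T² m = ≈-trans (R.*-cong ≈-refl (affine e₁ (T 1 h²) (⊟ x) refl st m))
    (≈-trans (solve 5 (λ c a y f x → c :* (a :* (y :+ f :* :- x)) := a :* (c :* y :+ :- (c :* f :* x))) ≈-refl two (q^ e₁ m) y (fromℤ m) x)
    (R.*-cong ≈-refl (≈-trans (R.+-cong 2y≈x ≈-refl) (solve 3 (λ c f x → x :+ :- (c :* f :* x) := (con (+ 1) :+ :- (c :* f)) :* x) ≈-refl two (fromℤ m) x))))
    where
    open ≈-Reasoning
    x = T 1 h⁺ (+ 0)
    y = T 1 h² (+ 0)
    st : ∀ m → q^ e₁ m ⊠ T 1 h² (ℤ.suc m) ≈ q^ e₁ (ℤ.suc m) ⊠ T 1 h² m ⊞ q^ e₁ m ⊠ q^ e₁ (ℤ.suc m) ⊠ ⊟ x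
    st m = ≈-trans (T²-step m) (≈-trans (R.*-cong ≈-refl (R.+-cong ≈-refl (R.-‿cong (T⁺ m))))
      (solve 4 (λ a b c d → b :* (c :+ :- (a :* d)) := b :* c :+ a :* b :* :- d) ≈-refl (q^ e₁ m) (q^ e₁ (ℤ.suc m)) (T 1 h² m) x))
    sym1 : T 1 h² (+ 1) ≈ ⊟ y
    sym1 = sum-unique (T-reflect 1 h² (+ 1)) (sum-cong
      (λ l → R.-‿cong (R.*-cong ≈-refl (≈-trans (R.*-comm (h⁺ (l ℤ.+ + 0)) (h⁺ (ℤ.- (l ℤ.+ + 0))))
        (≈-reflexive (cong₂ (λ a b → h⁺ a ⊠ h⁺ b)
          (solveℤ 1 (λ l → -' (l +' con' (+ 0)) =' con' (+ 0) +' -' l) refl l)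
          (solveℤ 1 (λ l → l +' con' (+ 0) =' -' (con' (+ 0) +' -' l)) refl l)))))) ≈-refl
      (sum-⊟ (T-isSum 1 h² (+ 0))))
    2y≈x : two ⊠ y ≈ x
    2y≈x = begin
      two ⊠ y ≈⟨ solve 2 (λ x y → con (+ 2) :* y := con (+ 1) :* (y :+ :- x) :+ (x :+ y)) ≈-refl x y ⟩
      𝟙 ⊠ (y ⊞ ⊟ x) ⊞ (x ⊞ y) ≈⟨ R.+-cong (R.*-cong (≈-sym q^-0) ≈-refl) ≈-refl ⟩
      q^ 0 ⊠ (y ⊞ ⊟ x) ⊞ (x ⊞ y) ≈⟨ R.+-cong (≈-sym (T²-step (+ 0))) ≈-refl ⟩
      q^ 0 ⊠ T 1 h² (+ 1) ⊞ (x ⊞ y) ≈⟨ R.+-cong (≈-trans (R.*-cong q^-0 sym1) (R.*-identityˡ (⊟ y))) ≈-refl ⟩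
      ⊟ y ⊞ (x ⊞ y) ≈⟨ solve 2 (λ x y → :- y :+ (x :+ y) := x) ≈-refl x y ⟩
      x ∎

open Translates

-- The kernel 1/(1 - q^k) with its pole removed, and totals over all translates.

module Odd-kernel where
  δ : ℤ → PS
  δ (+ zero) = 𝟙
  δ (+ suc n) = 𝟘
  δ -[1+ n ] = 𝟘

  δ-≢ : ∀ {k} → ¬ k ≡ + 0 → δ k ≈ 𝟘
  δ-≢ {+ zero} p = ⊥-elim (p refl)
  δ-≢ {+ suc n} p = ≈-refl
  δ-≢ { -[1+ n ]} p = ≈-refl

  sum-δ : ∀ G m → IsSum (λ l → G l ⊠ δ (l ℤ.+ m)) (G (ℤ.- m))
  sum-δ G m = sum-cong (λ l → R.*-cong (≈-reflexive (cong G (e l))) ≈-refl) (≈-reflexive (cong G (ℤP.+-identityˡ (ℤ.- m)))) (sum-shift m at-0)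
    where
    e : ∀ l → l ℤ.+ m ℤ.- m ≡ l
    e l = solveℤ 2 (λ l m → l +' m +' -' m =' l) refl l m
    G′ : ℤ → PS
    G′ k = G (k ℤ.- m)
    at-0 : IsSum (λ k → G′ k ⊠ δ k) (G′ (+ 0))
    at-0 = isSum (λ _ → 0) (λ N → λ { (+ suc n) _ → ≈⇒≈[] (R.zeroʳ (G′ (+ suc n))) ; -[1+ n ] _ → ≈⇒≈[] (R.zeroʳ (G′ -[1+ n ])) })
      (λ N → ≈⇒≈[] (R.*-identityʳ (G′ (+ 0))))

  h⁻-neg-δ : ∀ k → h⁻ k ⊞ h⁻ (ℤ.- k) ≈ 𝟙 ⊞ ⊟ δ k
  h⁻-neg-δ k with k ℤ.≟ + 0
  ... | yes refl = solve 1 (λ x → con (+ 0) :+ con (+ 0) := x :+ :- x) ≈-refl 𝟙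
  ... | no p = ≈-trans (h⁻-neg k p) (≈-trans (solve 1 (λ x → x := x :+ :- con (+ 0)) ≈-refl 𝟙) (R.+-cong ≈-refl (R.-‿cong (≈-sym (δ-≢ p)))))

  -- At k = 0 the pole of 1/(1 - q^k) is replaced by the value 0; `δ` records the resulting defect,
  -- so that one relation serves every term of a bilateral sum.
  h⁻-balance-δ : ∀ A B k → + B ≡ + A ℤ.+ k → q^ A ⊠ h⁻ k ≈ q^ A ⊠ (𝟙 ⊞ ⊟ δ k) ⊞ q^ B ⊠ h⁻ k
  h⁻-balance-δ A B k p with k ℤ.≟ + 0
  ... | yes refl = solve 2 (λ a b → a :* con (+ 0) := a :* (con (+ 1) :+ :- con (+ 1)) :+ b :* con (+ 0)) ≈-refl (q^ A) (q^ B)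
  ... | no k≢0 = begin
    q^ A ⊠ h⁻ k ≈⟨ solve 3 (λ a b h → a :* h := (a :* h :+ :- (b :* h)) :+ b :* h) ≈-refl (q^ A) (q^ B) (h⁻ k) ⟩
    (q^ A ⊠ h⁻ k ⊞ ⊟ (q^ B ⊠ h⁻ k)) ⊞ q^ B ⊠ h⁻ k ≈⟨ R.+-cong (h⁻-balance A B k k≢0 p) ≈-refl ⟩
    q^ A ⊞ q^ B ⊠ h⁻ k ≈⟨ R.+-cong (solve 1 (λ a → a := a :* (con (+ 1) :+ :- con (+ 0))) ≈-refl (q^ A)) ≈-refl ⟩
    q^ A ⊠ (𝟙 ⊞ ⊟ 𝟘) ⊞ q^ B ⊠ h⁻ k ≈⟨ R.+-cong (R.*-cong ≈-refl (R.+-cong ≈-refl (R.-‿cong (≈-sym (δ-≢ k≢0))))) ≈-refl ⟩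
    q^ A ⊠ (𝟙 ⊞ ⊟ δ k) ⊞ q^ B ⊠ h⁻ k ∎
    where open ≈-Reasoning

  private
    e₁ : ℤ → ℕ
    e₁ m = tri (m ℤ.- + 1)

    E₁ E₁′ : ℤ → ℤ → Ex
    E₁ l m = triE (m ℤ.- + 1) +E 1 *E triE (l ℤ.- + 1)
    E₁′ l m = triE (ℤ.suc m ℤ.- + 1) +E 1 *E triE l

  T⁻-step : ∀ m → q^ e₁ m ⊠ T 1 h⁻ (ℤ.suc m) ≈ ε m ⊠ (q^ e₁ m ⊠ q^ e₁ (ℤ.suc m)) ⊞ ⊟ (q^ e₁ (ℤ.suc m) ⊠ T 1 h⁻ m)
  T⁻-step m = ≈-trans (T-step 1 h⁻ h⁻ e₁ P p rel hp m)
    (solve 2 (λ a b → :- (:- a :+ b) := a :+ :- b) ≈-refl (ε m ⊠ (q^ e₁ m ⊠ q^ e₁ (ℤ.suc m))) (q^ e₁ (ℤ.suc m) ⊠ T 1 h⁻ m))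
    where
    P : ℤ → ℤ → PS
    P l m = q^ ⟦ E₁ l m ⟧ℕ ⊠ (𝟙 ⊞ ⊟ δ (l ℤ.+ m))
    p : ℤ → PS
    p m = ⊟ (ε m ⊠ (q^ e₁ m ⊠ q^ e₁ (ℤ.suc m)))
    rel : ∀ l m → q^ ⟦ E₁ l m ⟧ℕ ⊠ h⁻ (l ℤ.+ m) ≈ P l m ⊞ q^ ⟦ E₁′ l m ⟧ℕ ⊠ h⁻ (l ℤ.+ m)
    rel l m = h⁻-balance-δ ⟦ E₁ l m ⟧ℕ ⟦ E₁′ l m ⟧ℕ (l ℤ.+ m) (ex-shift (E₁′ l m) (E₁ l m) (l ℤ.+ m) (solveℤ 2 (λ l m →
      ((con' (+ 1) +' m) +' con' -[1+ 0 ]) *' (((con' (+ 1) +' m) +' con' -[1+ 0 ]) +' con' (+ 1)) +' con' (+ 1) *' (l *' (l +' con' (+ 1)))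
      =' ((m +' con' -[1+ 0 ]) *' ((m +' con' -[1+ 0 ]) +' con' (+ 1)) +' con' (+ 1) *' ((l +' con' -[1+ 0 ]) *' ((l +' con' -[1+ 0 ]) +' con' (+ 1)))) +' con' (+ 2) *' (l +' m)) refl l m))
    hp : ∀ m → IsSum (λ l → ε l ⊠ P l m) (p m)
    hp m = sum-cong
      (λ l → ≈-trans (solve 4 (λ a x y d → a :* (x :* y) :+ :- ((a :* (x :* y)) :* d) := x :* (a :* y :* (con (+ 1) :+ :- d))) ≈-refl (q^ e₁ m) (ε l) (y l) (δ (l ℤ.+ m)))
        (R.*-cong ≈-refl (R.*-cong (≈-sym (q^-+ (e₁ m) _)) ≈-refl)))
      (≈-trans (solve 2 (λ a g → a :* con (+ 0) :+ :- g := :- g) ≈-refl (q^ e₁ m) (G (ℤ.- m)))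
        (R.-‿cong (≈-trans (R.*-cong ≈-refl (R.*-cong (ε-neg m) (q^≡ e))) (solve 3 (λ a x b → a :* (x :* b) := x :* (a :* b)) ≈-refl (q^ e₁ m) (ε m) (q^ e₁ (ℤ.suc m))))))
      (sum-⊞ (sum-⊠ (q^ e₁ m) (t-pred-sum 1)) (sum-⊟ (sum-δ G m)))
      where
      y : ℤ → PS
      y l = q^ (1 ℕ.* tri (l ℤ.- + 1))
      G : ℤ → PS
      G l = q^ e₁ m ⊠ (ε l ⊠ y l)
      e : 1 ℕ.* tri (ℤ.- m ℤ.- + 1) ≡ e₁ (ℤ.suc m)
      e = ex-≡ (1 *E triE (ℤ.- m ℤ.- + 1)) (triE (ℤ.suc m ℤ.- + 1)) (solveℤ 1 (λ m →
        con' (+ 1) *' ((-' m +' con' -[1+ 0 ]) *' ((-' m +' con' -[1+ 0 ]) +' con' (+ 1))) =' ((con' (+ 1) +' m) +' con' -[1+ 0 ]) *' (((con' (+ 1) +' m) +' con' -[1+ 0 ]) +' con' (+ 1))) refl m)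

  -- Only the defect at l = -m survives the summation, and it adds one unit per step. The value at 0
  -- vanishes: reflection gives T(1) = 1 + T(0), the step at 0 gives T(1) = 1 - T(0).
  T⁻ : ∀ m → ε m ⊠ T 1 h⁻ m ≈ ⊟ (fromℤ m ⊠ q^ tri (m ℤ.- + 1))
  T⁻ m = ≈-trans (affine e₁ X (⊟ 𝟙) refl st m)
    (≈-trans (R.*-cong ≈-refl (R.+-cong (≈-trans (R.*-identityˡ (T 1 h⁻ (+ 0))) x≈0) ≈-refl))
      (solve 2 (λ a f → a :* (con (+ 0) :+ f :* :- con (+ 1)) := :- (f :* a)) ≈-refl (q^ e₁ m) (fromℤ m)))
    where
    open ≈-Reasoning
    X : ℤ → PS
    X m = ε m ⊠ T 1 h⁻ m
    x = T 1 h⁻ (+ 0)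
    st : ∀ m → q^ e₁ m ⊠ X (ℤ.suc m) ≈ q^ e₁ (ℤ.suc m) ⊠ X m ⊞ q^ e₁ m ⊠ q^ e₁ (ℤ.suc m) ⊠ ⊟ 𝟙
    st m = begin
      a ⊠ (ε (ℤ.suc m) ⊠ T 1 h⁻ (ℤ.suc m)) ≈⟨ R.*-cong ≈-refl (R.*-cong (ε-suc m) ≈-refl) ⟩
      a ⊠ (⊟ ε m ⊠ T 1 h⁻ (ℤ.suc m)) ≈⟨ solve 3 (λ a x y → a :* (:- x :* y) := :- (x :* (a :* y))) ≈-refl a (ε m) (T 1 h⁻ (ℤ.suc m)) ⟩
      ⊟ (ε m ⊠ (a ⊠ T 1 h⁻ (ℤ.suc m))) ≈⟨ R.-‿cong (R.*-cong ≈-refl (T⁻-step m)) ⟩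
      ⊟ (ε m ⊠ (ε m ⊠ (a ⊠ b) ⊞ ⊟ (b ⊠ T 1 h⁻ m)))
        ≈⟨ solve 4 (λ x a b y → :- (x :* (x :* (a :* b) :+ :- (b :* y))) := b :* (x :* y) :+ a :* b :* :- (x :* x)) ≈-refl (ε m) a b (T 1 h⁻ m) ⟩
      b ⊠ X m ⊞ a ⊠ b ⊠ ⊟ (ε m ⊠ ε m) ≈⟨ R.+-cong ≈-refl (R.*-cong ≈-refl (R.-‿cong (ε² m))) ⟩
      b ⊠ X m ⊞ a ⊠ b ⊠ ⊟ 𝟙 ∎
      where
      a = q^ e₁ m
      b = q^ e₁ (ℤ.suc m)
    sym1 : T 1 h⁻ (+ 1) ≈ 𝟙 ⊞ x
    sym1 = sum-unique (T-reflect 1 h⁻ (+ 1)) (sum-cong term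
        (≈-trans (R.+-cong (R.+-cong ≈-refl (≈-trans (R.*-cong ≈-refl q^-0) (R.*-identityˡ 𝟙))) ≈-refl)
          (solve 1 (λ x → :- con (+ 0) :+ con (+ 1) :+ x := con (+ 1) :+ x) ≈-refl x))
        (sum-⊞ (sum-⊞ (sum-⊟ (t-sum 1)) (sum-δ (t 1) (+ 0))) (T-isSum 1 h⁻ (+ 0))))
      where
      term : ∀ l → ⊟ t 1 l ⊞ t 1 l ⊠ δ (l ℤ.+ + 0) ⊞ t 1 l ⊠ h⁻ (l ℤ.+ + 0) ≈ ⊟ (t 1 l ⊠ h⁻ (+ 1 ℤ.- + 1 ℤ.- l))
      term l = begin
        ⊟ t 1 l ⊞ t 1 l ⊠ δ k ⊞ t 1 l ⊠ h⁻ k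
          ≈⟨ solve 3 (λ a d h → :- a :+ a :* d :+ a :* h := :- (a :* ((con (+ 1) :+ :- d) :+ :- h))) ≈-refl (t 1 l) (δ k) (h⁻ k) ⟩
        ⊟ (t 1 l ⊠ ((𝟙 ⊞ ⊟ δ k) ⊞ ⊟ h⁻ k)) ≈⟨ R.-‿cong (R.*-cong ≈-refl (R.+-cong (≈-sym (h⁻-neg-δ k)) ≈-refl)) ⟩
        ⊟ (t 1 l ⊠ (h⁻ k ⊞ h⁻ (ℤ.- k) ⊞ ⊟ h⁻ k)) ≈⟨ solve 3 (λ a g h → :- (a :* (h :+ g :+ :- h)) := :- (a :* g)) ≈-refl (t 1 l) (h⁻ (ℤ.- k)) (h⁻ k) ⟩
        ⊟ (t 1 l ⊠ h⁻ (ℤ.- k)) ≈⟨ R.-‿cong (R.*-cong ≈-refl (≈-reflexive (cong h⁻ (solveℤ 1 (λ l → -' (l +' con' (+ 0)) =' con' (+ 0) +' -' l) refl l)))) ⟩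
        ⊟ (t 1 l ⊠ h⁻ (+ 1 ℤ.- + 1 ℤ.- l)) ∎
        where k = l ℤ.+ + 0
    x≈0 : x ≈ 𝟘
    x≈0 = cancelˡ unit-two (begin
      two ⊠ x ≈⟨ solve 1 (λ x → con (+ 2) :* x := x :+ (con (+ 1) :+ x) :+ :- con (+ 1)) ≈-refl x ⟩
      x ⊞ (𝟙 ⊞ x) ⊞ ⊟ 𝟙 ≈⟨ R.+-cong (R.+-cong ≈-refl (≈-sym sym1)) ≈-refl ⟩
      x ⊞ T 1 h⁻ (+ 1) ⊞ ⊟ 𝟙 ≈⟨ R.+-cong (R.+-cong ≈-refl (≈-trans (≈-sym (≈-trans (R.*-cong q^-0 ≈-refl) (R.*-identityˡ _))) (T⁻-step (+ 0)))) ≈-refl ⟩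
      x ⊞ (𝟙 ⊠ (q^ 0 ⊠ q^ 0) ⊞ ⊟ (q^ 0 ⊠ x)) ⊞ ⊟ 𝟙
        ≈⟨ R.+-cong (R.+-cong ≈-refl (R.+-cong (R.*-cong ≈-refl (R.*-cong q^-0 q^-0)) (R.-‿cong (R.*-cong q^-0 ≈-refl)))) ≈-refl ⟩
      x ⊞ (𝟙 ⊠ (𝟙 ⊠ 𝟙) ⊞ ⊟ (𝟙 ⊠ x)) ⊞ ⊟ 𝟙
        ≈⟨ solve 1 (λ x → x :+ (con (+ 1) :* (con (+ 1) :* con (+ 1)) :+ :- (con (+ 1) :* x)) :+ :- con (+ 1) := con (+ 2) :* con (+ 0)) ≈-refl x ⟩
      two ⊠ 𝟘 ∎)

  6k+2≢0 : ∀ k → ¬ + 6 ℤ.* k ℤ.+ + 2 ≡ + 0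
  6k+2≢0 k p = 6n≢2 ∣ k ∣ (trans (sym (ℤP.∣i*j∣≡∣i∣*∣j∣ (+ 6) k)) (cong ∣_∣ e))
    where
    e : + 6 ℤ.* k ≡ -[1+ 1 ]
    e = trans (solveℤ 1 (λ k → con' (+ 6) *' k =' (con' (+ 6) *' k +' con' (+ 2)) +' con' -[1+ 1 ]) refl k) (cong (ℤ._+ -[1+ 1 ]) p)
    6n≢2 : ∀ n → ¬ 6 ℕ.* n ≡ 2
    6n≢2 (suc n) p with trans (sym (ℕP.*-comm 6 (suc n))) p
    ... | ()

  -- The kernel 1/(1 - x²) at x = q^(3k+1); it arises from adding 1/(1 + x) and 1/(1 - x).
  h₆ : ℤ → PS
  h₆ k = h⁻ (+ 6 ℤ.* k ℤ.+ + 2)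

  T₆ : ∀ m → ε m ⊠ T 6 h₆ m ≈ q^ (2 ℕ.* tri m ℕ.+ 4 ℕ.* tri (m ℤ.- + 1)) ⊠ T 6 h₆ (+ 0)
  T₆ m = ≈-trans (affine e X 𝟘 refl st m)
    (solve 3 (λ a x f → a :* (con (+ 1) :* x :+ f :* con (+ 0)) := a :* x) ≈-refl (q^ e m) (T 6 h₆ (+ 0)) (fromℤ m))
    where
    open ≈-Reasoning
    e : ℤ → ℕ
    e m = 2 ℕ.* tri m ℕ.+ 4 ℕ.* tri (m ℤ.- + 1)
    X : ℤ → PS
    X m = ε m ⊠ T 6 h₆ m
    E E′ : ℤ → ℤ → Ex
    E l m = (2 *E triE m +E 4 *E triE (m ℤ.- + 1)) +E 6 *E triE (l ℤ.- + 1)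
    E′ l m = (2 *E triE (ℤ.suc m) +E 4 *E triE (ℤ.suc m ℤ.- + 1)) +E 6 *E triE l
    P : ℤ → ℤ → PS
    P l m = q^ ⟦ E l m ⟧ℕ
    rel : ∀ l m → q^ ⟦ E l m ⟧ℕ ⊠ h₆ (l ℤ.+ m) ≈ P l m ⊞ q^ ⟦ E′ l m ⟧ℕ ⊠ h₆ (l ℤ.+ m)
    rel l m = ≈-trans (solve 3 (λ a b h → a :* h := (a :* h :+ :- (b :* h)) :+ b :* h) ≈-refl (q^ ⟦ E l m ⟧ℕ) (q^ ⟦ E′ l m ⟧ℕ) (h₆ (l ℤ.+ m)))
      (R.+-cong (h⁻-balance ⟦ E l m ⟧ℕ ⟦ E′ l m ⟧ℕ _ (6k+2≢0 (l ℤ.+ m)) (ex-shift (E′ l m) (E l m) (+ 6 ℤ.* (l ℤ.+ m) ℤ.+ + 2)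
        (solveℤ 2 (λ l m → let tr = λ x → x *' (x +' con' (+ 1)) ; one = con' (+ 1) ; -one = con' -[1+ 0 ] in
          con' (+ 2) *' tr (one +' m) +' con' (+ 4) *' tr ((one +' m) +' -one) +' con' (+ 6) *' tr l
          =' (con' (+ 2) *' tr m +' con' (+ 4) *' tr (m +' -one) +' con' (+ 6) *' tr (l +' -one)) +' con' (+ 2) *' (con' (+ 6) *' (l +' m) +' con' (+ 2))) refl l m))) ≈-refl)
    hp : ∀ m → IsSum (λ l → ε l ⊠ P l m) 𝟘
    hp m = sum-cong (λ l → ≈-trans (solve 3 (λ a x y → a :* (x :* y) := x :* (a :* y)) ≈-refl (q^ e m) (ε l) (q^ (6 ℕ.* tri (l ℤ.- + 1))))
        (R.*-cong ≈-refl (≈-sym (q^-+ (e m) _)))) (R.zeroʳ (q^ e m)) (sum-⊠ (q^ e m) (t-pred-sum 6))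
    st : ∀ m → q^ e m ⊠ X (ℤ.suc m) ≈ q^ e (ℤ.suc m) ⊠ X m ⊞ q^ e m ⊠ q^ e (ℤ.suc m) ⊠ 𝟘
    st m = begin
      a ⊠ (ε (ℤ.suc m) ⊠ T 6 h₆ (ℤ.suc m)) ≈⟨ R.*-cong ≈-refl (R.*-cong (ε-suc m) ≈-refl) ⟩
      a ⊠ (⊟ ε m ⊠ T 6 h₆ (ℤ.suc m)) ≈⟨ solve 3 (λ a x y → a :* (:- x :* y) := :- (x :* (a :* y))) ≈-refl a (ε m) (T 6 h₆ (ℤ.suc m)) ⟩
      ⊟ (ε m ⊠ (a ⊠ T 6 h₆ (ℤ.suc m))) ≈⟨ R.-‿cong (R.*-cong ≈-refl (T-step 6 h₆ h₆ e P (λ _ → 𝟘) rel hp m)) ⟩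
      ⊟ (ε m ⊠ ⊟ (𝟘 ⊞ b ⊠ T 6 h₆ m))
        ≈⟨ solve 4 (λ x a b y → :- (x :* :- (con (+ 0) :+ b :* y)) := b :* (x :* y) :+ a :* b :* con (+ 0)) ≈-refl (ε m) a b (T 6 h₆ m) ⟩
      b ⊠ X m ⊞ a ⊠ b ⊠ 𝟘 ∎
      where
      a = q^ e m
      b = q^ e (ℤ.suc m)

  sum-𝟘 : IsSum (λ _ → 𝟘) 𝟘
  sum-𝟘 = sum-cong (λ k → R.zeroˡ (t 1 k)) (R.zeroˡ 𝟘) (sum-⊠ 𝟘 (t-sum 1))

  2l+1 : ℤ → ℤ
  2l+1 l = l ℤ.+ (l ℤ.+ + 1)

  jac : ℕ → ℤ → PS
  jac s l = t s l ⊠ fromℤ (2l+1 l)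

  jac-isSum : ∀ s .{{_ : ℕ.NonZero s}} → IsSum (jac s) (sumℤ 1 (jac s))
  jac-isSum s = sumℤ-isSum 1 (λ l → ord-⊠ˡ (fromℤ (2l+1 l)) (t-ord s l))

  private
    +-large : ∀ n l → ∣ l ∣ ℕ.≤ n → Σ ℕ λ k → (l ℤ.+ + n ≡ + k) × (n ℕ.∸ ∣ l ∣ ℕ.≤ k)
    +-large n (+ a) _ = a ℕ.+ n , refl , ℕP.≤-trans (ℕP.m∸n≤m n a) (ℕP.m≤n+m n a)
    +-large n -[1+ a ] l = n ℕ.∸ suc a , ℤP.⊖-≥ l , ℕP.≤-refl

  -- Summed over m, the differences f(m+l) - f(m-1-l) telescope to 2l+1.
  T-total : ∀ s .{{_ : ℕ.NonZero s}} f (b : ℕ → ℕ) →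
    (∀ N k → b N ℕ.≤ k → f (+ k) ≈[ N ] 𝟙) → (∀ N k → b N ℕ.≤ k → f (ℤ.- (+ k)) ≈[ N ] 𝟘) →
    IsSum (λ m → two ⊠ T s f m) (sumℤ 1 (jac s))
  T-total s f b top bot = fubini {F = F} B joint rows cols (jac-isSum s)
    where
    B : ℕ → ℕ
    -- For |l| ≤ N this pushes l + m and m - 1 - l past `b N` on the same side, where the two kernel
    -- values agree modulo q^N. Larger |l| are suppressed by `t`.
    B N = b N ℕ.+ (N ℕ.+ suc N)
    F : ℤ → ℤ → PS
    F l m = t s l ⊠ (f (l ℤ.+ m) ⊞ ⊟ f (m ℤ.- + 1 ℤ.- l))
    W : ∀ d → IsSum (λ m → f (m ℤ.+ d) ⊞ ⊟ f m) (fromℤ d)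
    W = ℤ-ind _ base up down
      where
      D : ∀ d → IsSum (λ m → f (ℤ.suc (m ℤ.+ d)) ⊞ ⊟ f (m ℤ.+ d)) (𝟙 ⊞ ⊟ 𝟘)
      D d = sum-shift d (sum-telescope {f} b top bot)
      se : ∀ d m → ℤ.suc (m ℤ.+ d) ≡ m ℤ.+ ℤ.suc d
      se d m = solveℤ 2 (λ d m → con' (+ 1) +' (m +' d) =' m +' (con' (+ 1) +' d)) refl d m
      base : IsSum (λ m → f (m ℤ.+ + 0) ⊞ ⊟ f m) 𝟘
      base = sum-cong (λ m → ≈-trans (solve 1 (λ x → con (+ 0) := x :+ :- x) ≈-refl (f m)) (R.+-cong (≈-reflexive (cong f (sym (ℤP.+-identityʳ m)))) ≈-refl)) ≈-refl sum-𝟘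
      up : ∀ d → IsSum (λ m → f (m ℤ.+ d) ⊞ ⊟ f m) (fromℤ d) → IsSum (λ m → f (m ℤ.+ ℤ.suc d) ⊞ ⊟ f m) (fromℤ (ℤ.suc d))
      up d p = sum-cong
        (λ m → ≈-trans (solve 3 (λ x y z → (x :+ :- y) :+ (y :+ :- z) := x :+ :- z) ≈-refl (f (ℤ.suc (m ℤ.+ d))) (f (m ℤ.+ d)) (f m))
          (R.+-cong (≈-reflexive (cong f (se d m))) ≈-refl))
        (≈-trans (solve 1 (λ x → con (+ 1) :+ :- con (+ 0) :+ x := con (+ 1) :+ x) ≈-refl (fromℤ d)) (≈-sym (fromℤ-+ (+ 1) d))) (sum-⊞ (D d) p)
      down : ∀ d → IsSum (λ m → f (m ℤ.+ ℤ.suc d) ⊞ ⊟ f m) (fromℤ (ℤ.suc d)) → IsSum (λ m → f (m ℤ.+ d) ⊞ ⊟ f m) (fromℤ d)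
      down d p = sum-cong
        (λ m → ≈-trans (R.+-cong ≈-refl (R.+-cong (≈-reflexive (cong f (sym (se d m)))) ≈-refl))
          (solve 3 (λ x y z → :- (x :+ :- y) :+ (x :+ :- z) := y :+ :- z) ≈-refl (f (ℤ.suc (m ℤ.+ d))) (f (m ℤ.+ d)) (f m)))
        (≈-trans (R.+-cong ≈-refl (fromℤ-+ (+ 1) d)) (solve 1 (λ x → :- (con (+ 1) :+ :- con (+ 0)) :+ (con (+ 1) :+ x) := x) ≈-refl (fromℤ d)))
        (sum-⊞ (sum-⊟ (D d)) p)
    rows : ∀ l → IsSum (F l) (jac s l)
    rows l = sum-⊠ (t s l) (sum-cong
      (λ m → R.+-cong (≈-reflexive (cong f (solveℤ 2 (λ m l → m +' (con' -[1+ 0 ] +' -' l) +' (l +' (l +' con' (+ 1))) =' l +' m) refl m l)))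
        (R.-‿cong (≈-reflexive (cong f (sym (ℤP.+-assoc m -[1+ 0 ] (ℤ.- l))))))) ≈-refl
      (sum-shift (-[1+ 0 ] ℤ.- l) (W (2l+1 l))))
    cols : ∀ m → IsSum (λ l → F l m) (two ⊠ T s f m)
    cols m = sum-cong (λ l → solve 3 (λ a x y → a :* x :+ :- (a :* y) := a :* (x :+ :- y)) ≈-refl (t s l) (f (l ℤ.+ m)) (f (m ℤ.- + 1 ℤ.- l)))
      (two≈ (T s f m)) (sum-⊞ (T-isSum s f m) (T-reflect s f m))
    joint : ∀ N l m → B N ℕ.< ∣ l ∣ ⊎ B N ℕ.< ∣ m ∣ → Ord N (F l m)
    joint N l m h with N ℕ.<? ∣ l ∣
    ... | yes N<l = ord-⊠ˡ _ (≈[]-weaken (ℕP.∸-monoˡ-≤ 1 N<l) (t-ord s l))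
    joint N l m (inj₁ h) | no N≮l = ⊥-elim (N≮l (ℕP.≤-<-trans (ℕP.≤-trans (ℕP.m≤m+n N (suc N)) (ℕP.m≤n+m _ (b N))) h))
    joint N l m (inj₂ h) | no N≮l = ord-⊠ʳ (t s l) (≈[]-diff (go m h))
      where
      l≤N : ∣ l ∣ ℕ.≤ N
      l≤N = ℕP.≮⇒≥ N≮l
      l′≤N : ∀ x → ∣ x ∣ ℕ.≤ suc N → ∀ n → B N ℕ.< n → Σ ℕ λ k → (x ℤ.+ + n ≡ + k) × (b N ℕ.≤ k)
      l′≤N x x≤N n n>B with +-large n x (ℕP.≤-trans x≤N (ℕP.≤-trans (ℕP.m≤n+m (suc N) N) (ℕP.≤-trans (ℕP.m≤n+m _ (b N)) (ℕP.<⇒≤ n>B))))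
      ... | k , e , k≥ = k , e , ℕP.≤-trans (ℕP.m+n≤o⇒m≤o∸n (b N) (ℕP.≤-trans (ℕP.+-monoʳ-≤ (b N) (ℕP.≤-trans x≤N (ℕP.m≤n+m (suc N) N))) (ℕP.<⇒≤ n>B))) k≥
      ∣-1-l∣ : ∣ -[1+ 0 ] ℤ.- l ∣ ℕ.≤ suc N
      ∣-1-l∣ = ℕP.≤-trans (ℤP.∣i+j∣≤∣i∣+∣j∣ -[1+ 0 ] (ℤ.- l)) (s≤s (subst (ℕ._≤ N) (sym (ℤP.∣-i∣≡∣i∣ l)) l≤N))
      ∣1+l∣ : ∣ + 1 ℤ.+ l ∣ ℕ.≤ suc N
      ∣1+l∣ = ℕP.≤-trans (ℤP.∣i+j∣≤∣i∣+∣j∣ (+ 1) l) (s≤s l≤N)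
      up-to : ∀ {k} x → x ≡ + k → b N ℕ.≤ k → f x ≈[ N ] 𝟙
      up-to x refl p = top N _ p
      down-to : ∀ {k} x → x ≡ ℤ.- (+ k) → b N ℕ.≤ k → f x ≈[ N ] 𝟘
      down-to x refl p = bot N _ p
      go : ∀ m → B N ℕ.< ∣ m ∣ → f (l ℤ.+ m) ≈[ N ] f (m ℤ.- + 1 ℤ.- l)
      go (+ n) h with l′≤N l (ℕP.≤-trans l≤N (ℕP.n≤1+n N)) n h | l′≤N (-[1+ 0 ] ℤ.- l) ∣-1-l∣ n h
      ... | k , e , p | k′ , e′ , p′ = ≈[]-trans (up-to _ e p) (≈[]-sym (up-to _
        (trans (solveℤ 2 (λ m l → m +' con' -[1+ 0 ] +' -' l =' (con' -[1+ 0 ] +' -' l) +' m) refl (+ n) l) e′) p′))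
      go -[1+ n ] h with l′≤N (ℤ.- l) (subst (ℕ._≤ suc N) (sym (ℤP.∣-i∣≡∣i∣ l)) (ℕP.≤-trans l≤N (ℕP.n≤1+n N))) (suc n) h | l′≤N (+ 1 ℤ.+ l) ∣1+l∣ (suc n) h
      ... | k , e , p | k′ , e′ , p′ = ≈[]-trans
        (down-to _ (trans (solveℤ 2 (λ m l → l +' -' m =' -' (-' l +' m)) refl (+ suc n) l) (cong ℤ.-_ e)) p)
        (≈[]-sym (down-to _ (trans (solveℤ 2 (λ m l → -' m +' con' -[1+ 0 ] +' -' l =' -' ((con' (+ 1) +' l) +' m)) refl (+ suc n) l) (cong ℤ.-_ e′)) p′))

open Odd-kernel

-- Theta series and the regrouping of double sums modulo 3.

module Theta where
  -- In this parametrisation the alternating series `Θ⁻ α β` is j(q^α; q^(α+β)), and `Θ⁺ α β` is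
  -- j(-q^α; q^(α+β)).
  θE : ℕ → ℕ → ℤ → Ex
  θE α β k = α *E triE k +E β *E triE (k ℤ.- + 1)

  θe : ℕ → ℕ → ℤ → ℕ
  θe α β k = ⟦ θE α β k ⟧ℕ

  θe-≥ : ∀ α β .{{_ : ℕ.NonZero (α ℕ.+ β)}} k → ∣ k ∣ ℕ.∸ 1 ℕ.≤ θe α β k
  θe-≥ (suc α) β k = ℕP.≤-trans (s*tri-≥ (suc α) k) (ℕP.m≤m+n _ _)
  θe-≥ zero (suc β) k = ℕP.≤-trans (tri-pred-≥ k) (ℕP.m≤n*m (tri (k ℤ.- + 1)) (suc β))

  θ⁺ θ⁻ : ℕ → ℕ → ℤ → PS
  θ⁺ α β k = q^ θe α β k
  θ⁻ α β k = ε k ⊠ q^ θe α β k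

  θ⁺-ord : ∀ α β .{{_ : ℕ.NonZero (α ℕ.+ β)}} k → Ord (∣ k ∣ ℕ.∸ 1) (θ⁺ α β k)
  θ⁺-ord α β k = ord-q^ (θe-≥ α β k)

  θ⁻-ord : ∀ α β .{{_ : ℕ.NonZero (α ℕ.+ β)}} k → Ord (∣ k ∣ ℕ.∸ 1) (θ⁻ α β k)
  θ⁻-ord α β k = ord-⊠ʳ (ε k) (θ⁺-ord α β k)

  Θ⁺ Θ⁻ : ℕ → ℕ → PS
  Θ⁺ α β = sumℤ 1 (θ⁺ α β)
  Θ⁻ α β = sumℤ 1 (θ⁻ α β)

  Θ⁺-isSum : ∀ α β .{{_ : ℕ.NonZero (α ℕ.+ β)}} → IsSum (θ⁺ α β) (Θ⁺ α β)
  Θ⁺-isSum α β = sumℤ-isSum 1 (θ⁺-ord α β)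

  Θ⁻-isSum : ∀ α β .{{_ : ℕ.NonZero (α ℕ.+ β)}} → IsSum (θ⁻ α β) (Θ⁻ α β)
  Θ⁻-isSum α β = sumℤ-isSum 1 (θ⁻-ord α β)

  θe-neg : ∀ α β k → θe α β (ℤ.- k) ≡ θe β α k
  θe-neg α β k = ex-≡ (θE α β (ℤ.- k)) (θE β α k) (solveℤ 3 (λ a b k → let tr = λ x → x *' (x +' con' (+ 1)) in
    a *' tr (-' k) +' b *' tr (-' k +' con' -[1+ 0 ]) =' b *' tr k +' a *' tr (k +' con' -[1+ 0 ])) refl (+ α) (+ β) k)

  Θ⁺-comm : ∀ α β .{{_ : ℕ.NonZero (α ℕ.+ β)}} .{{_ : ℕ.NonZero (β ℕ.+ α)}} → Θ⁺ α β ≈ Θ⁺ β α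
  Θ⁺-comm α β = sum-unique (sum-neg (Θ⁺-isSum α β)) (sum-cong (λ k → q^≡ (sym (θe-neg α β k))) ≈-refl (Θ⁺-isSum β α))

  Θ⁻-comm : ∀ α β .{{_ : ℕ.NonZero (α ℕ.+ β)}} .{{_ : ℕ.NonZero (β ℕ.+ α)}} → Θ⁻ α β ≈ Θ⁻ β α
  Θ⁻-comm α β = sum-unique (sum-neg (Θ⁻-isSum α β)) (sum-cong (λ k → R.*-cong (≈-sym (ε-neg k)) (q^≡ (sym (θe-neg α β k)))) ≈-refl (Θ⁻-isSum β α))

  Λ : ℕ → ℕ → (ℤ → PS) → PS
  Λ α β g = sumℤ 1 (λ j → θ⁻ α β j ⊠ g j)

  Λ-isSum : ∀ α β .{{_ : ℕ.NonZero (α ℕ.+ β)}} g → IsSum (λ j → θ⁻ α β j ⊠ g j) (Λ α β g)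
  Λ-isSum α β g = sumℤ-isSum 1 (λ j → ord-⊠ˡ (g j) (θ⁻-ord α β j))

  3j 3j+1 3j-1 : ℤ → ℤ
  3j j = + 3 ℤ.* j
  3j+1 j = + 3 ℤ.* j ℤ.+ + 1
  3j-1 j = + 3 ℤ.* j ℤ.- + 1

  ε-3j : ∀ j → ε (3j j) ≈ ε j
  ε-3j j = begin
    ε (+ 3 ℤ.* j) ≈⟨ ≈-reflexive (cong ε (solveℤ 1 (λ j → con' (+ 3) *' j =' (j +' j) +' j) refl j)) ⟩
    ε (j ℤ.+ j ℤ.+ j) ≈⟨ ≈-trans (ε-+ (j ℤ.+ j) j) (R.*-cong (ε-+ j j) ≈-refl) ⟩
    ε j ⊠ ε j ⊠ ε j ≈⟨ R.*-cong (ε² j) ≈-refl ⟩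
    𝟙 ⊠ ε j ≈⟨ R.*-identityˡ (ε j) ⟩
    ε j ∎
    where open ≈-Reasoning

  ε-3j+1 : ∀ j → ε (3j+1 j) ≈ ⊟ ε j
  ε-3j+1 j = ≈-trans (≈-reflexive (cong ε (ℤP.+-comm (3j j) (+ 1)))) (≈-trans (ε-suc (3j j)) (R.-‿cong (ε-3j j)))

  ε-3j-1 : ∀ j → ε (3j-1 j) ≈ ⊟ ε j
  ε-3j-1 j = ≈-trans (≈-reflexive (cong ε (ℤP.+-comm (3j j) -[1+ 0 ]))) (≈-trans (ε-pred (3j j)) (R.-‿cong (ε-3j j)))

  private
    w₀ w₁ : ℤ → Ex
    w₀ m = sqE m
    w₁ m = 2 *E triE (m ℤ.- + 1)

    D : (ℤ → Ex) → ℤ → ℤ → Ex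
    D w k m = w m +E 1 *E triE (k ℤ.- m)

    shifted : ∀ {F : ℤ → PS} {s} (E : ℤ → Ex) α β (x : Ex) c → IsSum (λ m → F m ⊠ θ⁺ α β m) s →
      (∀ m → ⟦ E m ⟧² ≡ ⟦ x +E θE α β (m ℤ.+ c) ⟧²) → IsSum (λ m → F (m ℤ.+ c) ⊠ q^ ⟦ E m ⟧ℕ) (q^ ⟦ x ⟧ℕ ⊠ s)
    shifted {F} E α β x c p h = sum-cong
      (λ m → ≈-trans (solve 3 (λ a f b → a :* (f :* b) := f :* (a :* b)) ≈-refl (q^ ⟦ x ⟧ℕ) (F (m ℤ.+ c)) (θ⁺ α β (m ℤ.+ c)))
        (R.*-cong ≈-refl (≈-trans (≈-sym (q^-+ ⟦ x ⟧ℕ _)) (q^≡ (ex-≡ (x +E θE α β (m ℤ.+ c)) (E m) (sym (h m)))))))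
      ≈-refl (sum-⊠ (q^ ⟦ x ⟧ℕ) (sum-shift c p))

    -- Completing the square in m: the exponent has leading term (3/2)m², so its centre moves with
    -- k/3. Once k is fixed modulo 3 the shift is integral and the inner sum is one fixed theta
    -- constant times a power of q. The next five identities are the other cases.
    D₀-0 : ∀ j m → ⟦ D w₀ (3j j) m ⟧² ≡ ⟦ θE 4 2 j +E θE 1 2 (m ℤ.- j) ⟧²
    D₀-0 = solveℤ 2 (λ j m → let tr = λ x → x *' (x +' con' (+ 1)) ; th = λ a b x → con' a *' tr x +' con' b *' tr (x +' con' -[1+ 0 ]) in
      con' (+ 2) *' (m *' m) +' con' (+ 1) *' tr (con' (+ 3) *' j +' -' m) =' th (+ 4) (+ 2) j +' th (+ 1) (+ 2) (m +' -' j)) refl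

    D₀-1 : ∀ j m → ⟦ D w₀ (3j+1 j) m ⟧² ≡ ⟦ (lit 1 +E θE 6 0 j) +E θE 0 3 (m ℤ.- j) ⟧²
    D₀-1 = solveℤ 2 (λ j m → let tr = λ x → x *' (x +' con' (+ 1)) ; th = λ a b x → con' a *' tr x +' con' b *' tr (x +' con' -[1+ 0 ]) in
      con' (+ 2) *' (m *' m) +' con' (+ 1) *' tr (con' (+ 3) *' j +' con' (+ 1) +' -' m) =' (con' (+ 2) *' con' (+ 1) +' th (+ 6) (+ 0) j) +' th (+ 0) (+ 3) (m +' -' j)) refl

    D₀-2 : ∀ j m → ⟦ D w₀ (3j-1 j) m ⟧² ≡ ⟦ θE 2 4 j +E θE 2 1 (m ℤ.- j) ⟧²
    D₀-2 = solveℤ 2 (λ j m → let tr = λ x → x *' (x +' con' (+ 1)) ; th = λ a b x → con' a *' tr x +' con' b *' tr (x +' con' -[1+ 0 ]) in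
      con' (+ 2) *' (m *' m) +' con' (+ 1) *' tr (con' (+ 3) *' j +' con' -[1+ 0 ] +' -' m) =' th (+ 2) (+ 4) j +' th (+ 2) (+ 1) (m +' -' j)) refl

    D₁-0 : ∀ j m → ⟦ D w₁ (3j j) m ⟧² ≡ ⟦ θE 3 3 j +E θE 0 3 (m ℤ.- j) ⟧²
    D₁-0 = solveℤ 2 (λ j m → let tr = λ x → x *' (x +' con' (+ 1)) ; th = λ a b x → con' a *' tr x +' con' b *' tr (x +' con' -[1+ 0 ]) in
      con' (+ 2) *' tr (m +' con' -[1+ 0 ]) +' con' (+ 1) *' tr (con' (+ 3) *' j +' -' m) =' th (+ 3) (+ 3) j +' th (+ 0) (+ 3) (m +' -' j)) refl

    D₁-1 : ∀ j m → ⟦ D w₁ (3j+1 j) m ⟧² ≡ ⟦ θE 5 1 j +E θE 2 1 (m ℤ.+ (-[1+ 0 ] ℤ.- j)) ⟧²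
    D₁-1 = solveℤ 2 (λ j m → let tr = λ x → x *' (x +' con' (+ 1)) ; th = λ a b x → con' a *' tr x +' con' b *' tr (x +' con' -[1+ 0 ]) in
      con' (+ 2) *' tr (m +' con' -[1+ 0 ]) +' con' (+ 1) *' tr (con' (+ 3) *' j +' con' (+ 1) +' -' m) =' th (+ 5) (+ 1) j +' th (+ 2) (+ 1) (m +' (con' -[1+ 0 ] +' -' j))) refl

    D₁-2 : ∀ j m → ⟦ D w₁ (3j-1 j) m ⟧² ≡ ⟦ θE 1 5 j +E θE 1 2 (m ℤ.- j) ⟧²
    D₁-2 = solveℤ 2 (λ j m → let tr = λ x → x *' (x +' con' (+ 1)) ; th = λ a b x → con' a *' tr x +' con' b *' tr (x +' con' -[1+ 0 ]) in
      con' (+ 2) *' tr (m +' con' -[1+ 0 ]) +' con' (+ 1) *' tr (con' (+ 3) *' j +' con' -[1+ 0 ] +' -' m) =' th (+ 1) (+ 5) j +' th (+ 1) (+ 2) (m +' -' j)) refl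

    diag : ∀ {s} (E : ℤ → Ex) α β (x : Ex) c .{{_ : ℕ.NonZero (α ℕ.+ β)}} → Θ⁺ α β ≈ s →
      (∀ m → ⟦ E m ⟧² ≡ ⟦ x +E θE α β (m ℤ.+ c) ⟧²) → IsSum (λ m → q^ ⟦ E m ⟧ℕ) (q^ ⟦ x ⟧ℕ ⊠ s)
    diag E α β x c e h = sum-cong (λ m → R.*-identityˡ (q^ ⟦ E m ⟧ℕ)) ≈-refl
      (shifted {F = λ _ → 𝟙} E α β x c (sum-cong (λ m → ≈-sym (R.*-identityˡ (θ⁺ α β m))) e (Θ⁺-isSum α β)) h)

    w₀-≥ : ∀ m → ∣ m ∣ ℕ.∸ 1 ℕ.≤ ⟦ w₀ m ⟧ℕ
    w₀-≥ m = ℕP.≤-trans (ℕP.m∸n≤m ∣ m ∣ 1) (sq-≥ m)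

    w₁-≥ : ∀ m → ∣ m ∣ ℕ.∸ 1 ℕ.≤ ⟦ w₁ m ⟧ℕ
    w₁-≥ m = ℕP.≤-trans (tri-pred-≥ m) (ℕP.m≤n*m (tri (m ℤ.- + 1)) 2)

    -- Along k = l + m the kernel value f(k) and the sign ε(k) are constant and leave the inner sum,
    -- which becomes a pure theta series in m.
    regroup : ∀ (w : ℤ → Ex) (f : ℤ → PS) {s} {r : ℤ → PS} → (∀ m → ∣ m ∣ ℕ.∸ 1 ℕ.≤ ⟦ w m ⟧ℕ) →
      IsSum (λ m → ε m ⊠ q^ ⟦ w m ⟧ℕ ⊠ T 1 f m) s → (∀ k → IsSum (λ m → q^ ⟦ D w k m ⟧ℕ) (r k)) →
      IsSum (λ k → ε k ⊠ f k ⊠ r k) s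
    regroup w f {s} {r} w≥ p d = shear {F = F} suc joint (λ m → sum-⊠ (ε m ⊠ q^ ⟦ w m ⟧ℕ) (T-isSum 1 f m)) diags p
      where
      open ≈-Reasoning
      F : ℤ → ℤ → PS
      F l m = ε m ⊠ q^ ⟦ w m ⟧ℕ ⊠ (t 1 l ⊠ f (l ℤ.+ m))
      joint : ∀ N l m → suc N ℕ.< ∣ l ∣ ⊎ suc N ℕ.< ∣ m ∣ → Ord N (F l m)
      joint N l m (inj₁ h) = ord-⊠ʳ (ε m ⊠ q^ ⟦ w m ⟧ℕ) (ord-⊠ˡ (f (l ℤ.+ m)) (≈[]-weaken (ℕP.∸-monoˡ-≤ 1 (ℕP.<⇒≤ h)) (t-ord 1 l)))
      joint N l m (inj₂ h) = ord-⊠ˡ (t 1 l ⊠ f (l ℤ.+ m)) (ord-⊠ʳ (ε m) (ord-q^ (ℕP.≤-trans (ℕP.∸-monoˡ-≤ 1 (ℕP.<⇒≤ h)) (w≥ m))))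
      km : ∀ k m → k ℤ.- m ℤ.+ m ≡ k
      km k m = solveℤ 2 (λ k m → k +' -' m +' m =' k) refl k m
      εε : ∀ k m → ε m ⊠ ε (k ℤ.- m) ≈ ε k
      εε k m = ≈-trans (R.*-comm (ε m) (ε (k ℤ.- m))) (≈-trans (≈-sym (ε-+ (k ℤ.- m) m)) (≈-reflexive (cong ε (km k m))))
      diags : ∀ k → IsSum (λ m → F (k ℤ.- m) m) (ε k ⊠ f k ⊠ r k)
      diags k = sum-cong (λ m → begin
        ε k ⊠ f k ⊠ q^ ⟦ D w k m ⟧ℕ
          ≈⟨ R.*-cong (R.*-cong (≈-sym (εε k m)) (≈-reflexive (cong f (sym (km k m))))) (q^-+ ⟦ w m ⟧ℕ (1 ℕ.* tri (k ℤ.- m))) ⟩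
        ε m ⊠ ε (k ℤ.- m) ⊠ f (k ℤ.- m ℤ.+ m) ⊠ (q^ ⟦ w m ⟧ℕ ⊠ q^ (1 ℕ.* tri (k ℤ.- m)))
          ≈⟨ solve 5 (λ x y f a b → x :* y :* f :* (a :* b) := x :* a :* (y :* b :* f)) ≈-refl (ε m) (ε (k ℤ.- m)) (f (k ℤ.- m ℤ.+ m)) (q^ ⟦ w m ⟧ℕ) (q^ (1 ℕ.* tri (k ℤ.- m))) ⟩
        F (k ℤ.- m) m ∎) ≈-refl (sum-⊠ (ε k ⊠ f k) (d k))

    -- The value at k is chosen by running `mod3`; uniqueness of sums then identifies it on each
    -- progression, whichever representation `mod3` returned.
    by-class : (r₀ r₁ r₂ : ℤ → PS) → (F : ℤ → ℤ → PS) →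
      (∀ j → IsSum (F (3j j)) (r₀ j)) → (∀ j → IsSum (F (3j+1 j)) (r₁ j)) → (∀ j → IsSum (F (3j-1 j)) (r₂ j)) →
      Σ (ℤ → PS) λ r → (∀ k → IsSum (F k) (r k)) × (∀ j → r (3j j) ≈ r₀ j) × (∀ j → r (3j+1 j) ≈ r₁ j) × (∀ j → r (3j-1 j) ≈ r₂ j)
    by-class r₀ r₁ r₂ F p₀ p₁ p₂ = (λ k → proj₁ (val k)) , (λ k → proj₂ (val k)) ,
      (λ j → sum-unique (proj₂ (val (3j j))) (p₀ j)) , (λ j → sum-unique (proj₂ (val (3j+1 j))) (p₁ j)) , (λ j → sum-unique (proj₂ (val (3j-1 j))) (p₂ j))
      where
      val : ∀ k → Σ PS (IsSum (F k))
      val k with mod3 k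
      ... | j , inj₁ refl = r₀ j , p₀ j
      ... | j , inj₂ (inj₁ refl) = r₁ j , p₁ j
      ... | j , inj₂ (inj₂ refl) = r₂ j , p₂ j

    classes : ∀ (w : ℤ → Ex) (f : ℤ → PS) {s} → (∀ m → ∣ m ∣ ℕ.∸ 1 ℕ.≤ ⟦ w m ⟧ℕ) →
      IsSum (λ m → ε m ⊠ q^ ⟦ w m ⟧ℕ ⊠ T 1 f m) s → (r₀ r₁ r₂ : ℤ → PS) →
      (∀ j → IsSum (λ m → q^ ⟦ D w (3j j) m ⟧ℕ) (r₀ j)) → (∀ j → IsSum (λ m → q^ ⟦ D w (3j+1 j) m ⟧ℕ) (r₁ j)) →
      (∀ j → IsSum (λ m → q^ ⟦ D w (3j-1 j) m ⟧ℕ) (r₂ j)) → ∀ {S₀ S₁ S₂} →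
      IsSum (λ j → ε j ⊠ f (3j j) ⊠ r₀ j) S₀ → IsSum (λ j → ε j ⊠ f (3j+1 j) ⊠ r₁ j) S₁ → IsSum (λ j → ε j ⊠ f (3j-1 j) ⊠ r₂ j) S₂ →
      s ≈ S₀ ⊞ ⊟ S₁ ⊞ ⊟ S₂
    classes w f {s} w≥ p r₀ r₁ r₂ d₀ d₁ d₂ p₀ p₁ p₂ = go (by-class r₀ r₁ r₂ (λ k m → q^ ⟦ D w k m ⟧ℕ) d₀ d₁ d₂)
      where
      neg : ∀ x f r → ⊟ (x ⊠ f ⊠ r) ≈ ⊟ x ⊠ f ⊠ r
      neg = solve 3 (λ x f r → :- (x :* f :* r) := :- x :* f :* r) ≈-refl
      go : (Σ (ℤ → PS) λ r → (∀ k → IsSum (λ m → q^ ⟦ D w k m ⟧ℕ) (r k)) × (∀ j → r (3j j) ≈ r₀ j) × (∀ j → r (3j+1 j) ≈ r₁ j) × (∀ j → r (3j-1 j) ≈ r₂ j)) → s ≈ _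
      go (r , d , e₀ , e₁ , e₂) = sum-unique (regroup w f {r = r} w≥ p d) (sum-split3
        (sum-cong (λ j → R.*-cong (R.*-cong (≈-sym (ε-3j j)) ≈-refl) (≈-sym (e₀ j))) ≈-refl p₀)
        (sum-cong (λ j → ≈-trans (neg (ε j) (f (3j+1 j)) (r₁ j)) (R.*-cong (R.*-cong (≈-sym (ε-3j+1 j)) ≈-refl) (≈-sym (e₁ j)))) ≈-refl (sum-⊟ p₁))
        (sum-cong (λ j → ≈-trans (neg (ε j) (f (3j-1 j)) (r₂ j)) (R.*-cong (R.*-cong (≈-sym (ε-3j-1 j)) ≈-refl) (≈-sym (e₂ j)))) ≈-refl (sum-⊟ p₂)))

    scaled : ∀ (x a f c : PS) → c ⊠ (x ⊠ a ⊠ f) ≈ x ⊠ f ⊠ (a ⊠ c)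
    scaled = solve 4 (λ x a f c → c :* (x :* a :* f) := x :* f :* (a :* c)) ≈-refl

    Λ-scaled : ∀ α β .{{_ : ℕ.NonZero (α ℕ.+ β)}} (g : ℤ → PS) c → IsSum (λ j → ε j ⊠ g j ⊠ (q^ θe α β j ⊠ c)) (c ⊠ Λ α β g)
    Λ-scaled α β g c = sum-cong (λ j → scaled (ε j) (q^ θe α β j) (g j) c) ≈-refl (sum-⊠ c (Λ-isSum α β g))

  regroup₀ : ∀ f {s} → IsSum (λ m → ε m ⊠ q^ sq m ⊠ T 1 f m) s →
    s ≈ Θ⁺ 1 2 ⊠ Λ 4 2 (f ∘ 3j) ⊞ ⊟ (q^ 1 ⊠ Θ⁺ 0 3 ⊠ Λ 6 0 (f ∘ 3j+1)) ⊞ ⊟ (Θ⁺ 1 2 ⊠ Λ 2 4 (f ∘ 3j-1))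
  regroup₀ f p = classes w₀ f w₀-≥ p (λ j → q^ ⟦ θE 4 2 j ⟧ℕ ⊠ Θ⁺ 1 2) (λ j → q^ ⟦ lit 1 +E θE 6 0 j ⟧ℕ ⊠ Θ⁺ 0 3) (λ j → q^ ⟦ θE 2 4 j ⟧ℕ ⊠ Θ⁺ 1 2)
    (λ j → diag (D w₀ (3j j)) 1 2 (θE 4 2 j) (ℤ.- j) ≈-refl (D₀-0 j))
    (λ j → diag (D w₀ (3j+1 j)) 0 3 (lit 1 +E θE 6 0 j) (ℤ.- j) ≈-refl (D₀-1 j))
    (λ j → diag (D w₀ (3j-1 j)) 2 1 (θE 2 4 j) (ℤ.- j) (Θ⁺-comm 2 1) (D₀-2 j))
    (Λ-scaled 4 2 (f ∘ 3j) (Θ⁺ 1 2))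
    (sum-cong (λ j → R.*-cong ≈-refl (≈-trans (solve 3 (λ a b c → a :* (b :* c) := b :* a :* c) ≈-refl (q^ θe 6 0 j) (q^ 1) (Θ⁺ 0 3))
      (R.*-cong (≈-sym (q^-+ 1 (θe 6 0 j))) ≈-refl))) ≈-refl (Λ-scaled 6 0 (f ∘ 3j+1) (q^ 1 ⊠ Θ⁺ 0 3)))
    (Λ-scaled 2 4 (f ∘ 3j-1) (Θ⁺ 1 2))

  -- The weight m(m - 1) in place of m² produces `Λ 3 3`, `Λ 5 1` and `Λ 1 5`, the sums into which
  -- `Λ 1 1` splits modulo 3.
  regroup₁ : ∀ f {s} → IsSum (λ m → ε m ⊠ q^ (2 ℕ.* tri (m ℤ.- + 1)) ⊠ T 1 f m) s →
    s ≈ Θ⁺ 0 3 ⊠ Λ 3 3 (f ∘ 3j) ⊞ ⊟ (Θ⁺ 1 2 ⊠ Λ 5 1 (f ∘ 3j+1)) ⊞ ⊟ (Θ⁺ 1 2 ⊠ Λ 1 5 (f ∘ 3j-1))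
  regroup₁ f p = classes w₁ f w₁-≥ p (λ j → q^ ⟦ θE 3 3 j ⟧ℕ ⊠ Θ⁺ 0 3) (λ j → q^ ⟦ θE 5 1 j ⟧ℕ ⊠ Θ⁺ 1 2) (λ j → q^ ⟦ θE 1 5 j ⟧ℕ ⊠ Θ⁺ 1 2)
    (λ j → diag (D w₁ (3j j)) 0 3 (θE 3 3 j) (ℤ.- j) ≈-refl (D₁-0 j))
    (λ j → diag (D w₁ (3j+1 j)) 2 1 (θE 5 1 j) (-[1+ 0 ] ℤ.- j) (Θ⁺-comm 2 1) (D₁-1 j))
    (λ j → diag (D w₁ (3j-1 j)) 1 2 (θE 1 5 j) (ℤ.- j) ≈-refl (D₁-2 j))
    (Λ-scaled 3 3 (f ∘ 3j) (Θ⁺ 0 3)) (Λ-scaled 5 1 (f ∘ 3j+1) (Θ⁺ 1 2)) (Λ-scaled 1 5 (f ∘ 3j-1) (Θ⁺ 1 2))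

  1-6m : ℤ → ℤ
  1-6m m = + 1 ℤ.- + 6 ℤ.* m

  -- The exponents are the pentagonal numbers P = m(3m - 1)/2, and 24P + 1 = (1 - 6m)²: the weights
  -- are the natural linear forms of this lattice coset.
  Ξ Ψ : PS
  Ξ = sumℤ 1 (λ m → fromℤ (1-6m m) ⊠ θ⁺ 1 2 m)
  Ψ = sumℤ 1 (λ m → fromℤ (1-6m m) ⊠ θ⁻ 1 2 m)

  Ξ-isSum : IsSum (λ m → fromℤ (1-6m m) ⊠ θ⁺ 1 2 m) Ξ
  Ξ-isSum = sumℤ-isSum 1 (λ m → ord-⊠ʳ (fromℤ (1-6m m)) (θ⁺-ord 1 2 m))

  Ψ-isSum : IsSum (λ m → fromℤ (1-6m m) ⊠ θ⁻ 1 2 m) Ψ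
  Ψ-isSum = sumℤ-isSum 1 (λ m → ord-⊠ʳ (fromℤ (1-6m m)) (θ⁻-ord 1 2 m))

  Jac : ℕ → PS
  Jac s = sumℤ 1 (jac s)

  sq-θe : ∀ m → sq m ≡ θe 1 1 m
  sq-θe m = ex-≡ (sqE m) (θE 1 1 m) (solveℤ 1 (λ m → let tr = λ x → x *' (x +' con' (+ 1)) in
    con' (+ 2) *' (m *' m) =' con' (+ 1) *' tr m +' con' (+ 1) *' tr (m +' con' -[1+ 0 ])) refl m)

  -- Both sides are theta series of one binary lattice, weighted by a linear form; l = m + 2i, k = i - m
  -- carries the right-hand side to the classes l + k ≢ 1 (mod 3) of the left-hand one, the third class cancels.
  Θ⁻11-Jac : Θ⁻ 1 1 ⊠ Jac 1 ≈ two ⊠ (Θ⁻ 4 2 ⊠ Ξ)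
  Θ⁻11-Jac = go (by-class r₀ r₁ r₂ (λ k m → ω k m ⊠ q^ ⟦ D w₀ k m ⟧ℕ) d₀ d₁ d₂)
    where
    open ≈-Reasoning
    r₀ r₁ r₂ : ℤ → PS
    r₀ j = q^ ⟦ θE 4 2 j ⟧ℕ ⊠ Ξ
    r₁ j = q^ ⟦ lit 1 +E θE 6 0 j ⟧ℕ ⊠ 𝟘
    r₂ j = q^ ⟦ θE 2 4 j ⟧ℕ ⊠ ⊟ Ξ
    -- The term -4m may be added because Σ (-1)^l q^(l(l+1)/2) = 0. It turns the weight on the
    -- diagonal l + m = k into 2k + 1 - 6m, which is 1 - 6(m - j) for k = 3j and antisymmetric about
    -- the centre for k = 3j + 1.
    weight : ℤ → ℤ → PS
    weight l m = fromℤ (2l+1 l ℤ.- + 4 ℤ.* m)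
    ω : ℤ → ℤ → PS
    ω k m = weight (k ℤ.- m) m
    F : ℤ → ℤ → PS
    F l m = ε m ⊠ q^ sq m ⊠ (t 1 l ⊠ weight l m)
    joint : ∀ N l m → suc N ℕ.< ∣ l ∣ ⊎ suc N ℕ.< ∣ m ∣ → Ord N (F l m)
    joint N l m (inj₁ h) = ord-⊠ʳ (ε m ⊠ q^ sq m) (ord-⊠ˡ (weight l m) (≈[]-weaken (ℕP.∸-monoˡ-≤ 1 (ℕP.<⇒≤ h)) (t-ord 1 l)))
    joint N l m (inj₂ h) = ord-⊠ˡ (t 1 l ⊠ weight l m) (ord-⊠ʳ (ε m) (ord-q^ (ℕP.≤-trans (ℕP.∸-monoˡ-≤ 1 (ℕP.<⇒≤ h)) (w₀-≥ m))))
    cols : ∀ m → IsSum (λ l → F l m) (ε m ⊠ q^ sq m ⊠ Jac 1)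
    cols m = sum-⊠ (ε m ⊠ q^ sq m) (sum-cong
      (λ l → ≈-trans (solve 3 (λ x a c → x :* a :+ c :* x := x :* (a :+ c)) ≈-refl (t 1 l) (fromℤ (2l+1 l)) (fromℤ (ℤ.- (+ 4 ℤ.* m))))
        (R.*-cong ≈-refl (≈-sym (fromℤ-+ (2l+1 l) (ℤ.- (+ 4 ℤ.* m))))))
      (≈-trans (R.+-cong ≈-refl (R.zeroʳ (fromℤ (ℤ.- (+ 4 ℤ.* m))))) (R.+-identityʳ (Jac 1)))
      (sum-⊞ (jac-isSum 1) (sum-⊠ (fromℤ (ℤ.- (+ 4 ℤ.* m))) (t-sum 1))))
    total : IsSum (λ m → ε m ⊠ q^ sq m ⊠ Jac 1) (Θ⁻ 1 1 ⊠ Jac 1)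
    total = sum-cong (λ m → ≈-trans (R.*-comm (Jac 1) (θ⁻ 1 1 m)) (R.*-cong (R.*-cong ≈-refl (q^≡ (sym (sq-θe m)))) ≈-refl))
      (R.*-comm (Jac 1) (Θ⁻ 1 1)) (sum-⊠ (Jac 1) (Θ⁻-isSum 1 1))
    d₀ : ∀ j → IsSum (λ m → ω (3j j) m ⊠ q^ ⟦ D w₀ (3j j) m ⟧ℕ) (r₀ j)
    d₀ j = sum-cong (λ m → R.*-cong (≈-reflexive (cong fromℤ (e m))) ≈-refl) ≈-refl
      (shifted {F = λ m → fromℤ (1-6m m)} (D w₀ (3j j)) 1 2 (θE 4 2 j) (ℤ.- j) Ξ-isSum (D₀-0 j))
      where
      e : ∀ m → 1-6m (m ℤ.- j) ≡ 2l+1 (3j j ℤ.- m) ℤ.- + 4 ℤ.* m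
      e m = solveℤ 2 (λ m j → con' (+ 1) +' -' (con' (+ 6) *' (m +' -' j)) =' (con' (+ 3) *' j +' -' m) +' ((con' (+ 3) *' j +' -' m) +' con' (+ 1)) +' -' (con' (+ 4) *' m)) refl m j
    d₁ : ∀ j → IsSum (λ m → ω (3j+1 j) m ⊠ q^ ⟦ D w₀ (3j+1 j) m ⟧ℕ) (r₁ j)
    d₁ j = sum-cong (λ m → R.*-cong (≈-reflexive (cong fromℤ (e m))) ≈-refl) ≈-refl
      (shifted {F = λ m → fromℤ (+ 3 ℤ.- + 6 ℤ.* m)} (D w₀ (3j+1 j)) 0 3 (lit 1 +E θE 6 0 j) (ℤ.- j)
        (sum-cong (λ _ → ≈-refl) (sum-antisym (+ 1) anti p) p) (D₀-1 j))
      where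
      e : ∀ m → + 3 ℤ.- + 6 ℤ.* (m ℤ.- j) ≡ 2l+1 (3j+1 j ℤ.- m) ℤ.- + 4 ℤ.* m
      e m = solveℤ 2 (λ m j → con' (+ 3) +' -' (con' (+ 6) *' (m +' -' j)) =' (con' (+ 3) *' j +' con' (+ 1) +' -' m) +' ((con' (+ 3) *' j +' con' (+ 1) +' -' m) +' con' (+ 1)) +' -' (con' (+ 4) *' m)) refl m j
      G : ℤ → PS
      G m = fromℤ (+ 3 ℤ.- + 6 ℤ.* m) ⊠ θ⁺ 0 3 m
      p : IsSum G (sumℤ 1 G)
      p = sumℤ-isSum 1 (λ m → ord-⊠ʳ (fromℤ (+ 3 ℤ.- + 6 ℤ.* m)) (θ⁺-ord 0 3 m))
      anti : ∀ m → G (+ 1 ℤ.- m) ≈ ⊟ G m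
      anti m = ≈-trans (R.*-cong (≈-trans (≈-reflexive (cong fromℤ (solveℤ 1 (λ m → con' (+ 3) +' -' (con' (+ 6) *' (con' (+ 1) +' -' m)) =' -' (con' (+ 3) +' -' (con' (+ 6) *' m))) refl m)))
          (fromℤ-neg (+ 3 ℤ.- + 6 ℤ.* m)))
        (q^≡ (ex-≡ (θE 0 3 (+ 1 ℤ.- m)) (θE 0 3 m) (solveℤ 1 (λ m → let tr = λ x → x *' (x +' con' (+ 1)) ; th = λ x → con' (+ 0) *' tr x +' con' (+ 3) *' tr (x +' con' -[1+ 0 ]) in
          th (con' (+ 1) +' -' m) =' th m) refl m))))
        (solve 2 (λ a b → :- a :* b := :- (a :* b)) ≈-refl (fromℤ (+ 3 ℤ.- + 6 ℤ.* m)) (θ⁺ 0 3 m))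
    d₂ : ∀ j → IsSum (λ m → ω (3j-1 j) m ⊠ q^ ⟦ D w₀ (3j-1 j) m ⟧ℕ) (r₂ j)
    d₂ j = sum-cong (λ m → R.*-cong (≈-reflexive (cong fromℤ (e m))) ≈-refl) ≈-refl
      (shifted {F = λ m → fromℤ (-[1+ 0 ] ℤ.- + 6 ℤ.* m)} (D w₀ (3j-1 j)) 2 1 (θE 2 4 j) (ℤ.- j)
        (sum-cong (λ m → ≈-trans (solve 2 (λ a b → :- (a :* b) := :- a :* b) ≈-refl (fromℤ (1-6m (ℤ.- m))) (θ⁺ 1 2 (ℤ.- m)))
          (R.*-cong (≈-trans (≈-sym (fromℤ-neg (1-6m (ℤ.- m)))) (≈-reflexive (cong fromℤ (solveℤ 1 (λ m → -' (con' (+ 1) +' -' (con' (+ 6) *' (-' m))) =' con' -[1+ 0 ] +' -' (con' (+ 6) *' m)) refl m))))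
            (q^≡ (θe-neg 1 2 m)))) ≈-refl (sum-⊟ (sum-neg Ξ-isSum))) (D₀-2 j))
      where
      e : ∀ m → -[1+ 0 ] ℤ.- + 6 ℤ.* (m ℤ.- j) ≡ 2l+1 (3j-1 j ℤ.- m) ℤ.- + 4 ℤ.* m
      e m = solveℤ 2 (λ m j → con' -[1+ 0 ] +' -' (con' (+ 6) *' (m +' -' j)) =' (con' (+ 3) *' j +' con' -[1+ 0 ] +' -' m) +' ((con' (+ 3) *' j +' con' -[1+ 0 ] +' -' m) +' con' (+ 1)) +' -' (con' (+ 4) *' m)) refl m j
    km : ∀ k m → k ℤ.- m ℤ.+ m ≡ k
    km k m = solveℤ 2 (λ k m → k +' -' m +' m =' k) refl k m
    εε : ∀ k m → ε m ⊠ ε (k ℤ.- m) ≈ ε k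
    εε k m = ≈-trans (R.*-comm (ε m) (ε (k ℤ.- m))) (≈-trans (≈-sym (ε-+ (k ℤ.- m) m)) (≈-reflexive (cong ε (km k m))))
    go : (Σ (ℤ → PS) λ r → (∀ k → IsSum (λ m → ω k m ⊠ q^ ⟦ D w₀ k m ⟧ℕ) (r k)) × (∀ j → r (3j j) ≈ r₀ j) × (∀ j → r (3j+1 j) ≈ r₁ j) × (∀ j → r (3j-1 j) ≈ r₂ j)) →
      Θ⁻ 1 1 ⊠ Jac 1 ≈ two ⊠ (Θ⁻ 4 2 ⊠ Ξ)
    go (r , d , e₀ , e₁ , e₂) = ≈-trans (sum-unique diag-total (sum-split3
        (sum-cong (λ j → ≈-trans (solve 3 (λ x e a → x :* (e :* a) := e :* (a :* x)) ≈-refl Ξ (ε j) (q^ θe 4 2 j)) (R.*-cong (≈-sym (ε-3j j)) (≈-sym (e₀ j)))) ≈-refl (sum-⊠ Ξ (Θ⁻-isSum 4 2)))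
        (sum-cong (λ j → ≈-trans (solve 2 (λ e a → con (+ 0) := e :* (a :* con (+ 0))) ≈-refl (ε (3j+1 j)) (q^ ⟦ lit 1 +E θE 6 0 j ⟧ℕ)) (R.*-cong ≈-refl (≈-sym (e₁ j)))) ≈-refl sum-𝟘)
        (sum-cong (λ j → ≈-trans (solve 3 (λ x e a → x :* (e :* a) := :- e :* (a :* :- x)) ≈-refl Ξ (ε j) (q^ θe 2 4 j)) (R.*-cong (≈-sym (ε-3j-1 j)) (≈-sym (e₂ j)))) ≈-refl (sum-⊠ Ξ (Θ⁻-isSum 2 4)))))
      (≈-trans (R.+-cong ≈-refl (R.*-cong ≈-refl (Θ⁻-comm 2 4)))
        (solve 2 (λ x a → x :* a :+ con (+ 0) :+ x :* a := con (+ 2) :* (a :* x)) ≈-refl Ξ (Θ⁻ 4 2)))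
      where
      diag-total : IsSum (λ k → ε k ⊠ r k) (Θ⁻ 1 1 ⊠ Jac 1)
      diag-total = shear {F = F} suc joint cols (λ k → sum-cong
        (λ m → ≈-trans (R.*-cong (≈-sym (εε k m)) (R.*-cong ≈-refl (q^-+ (sq m) (1 ℕ.* tri (k ℤ.- m)))))
          (solve 5 (λ x y w a b → x :* y :* (w :* (a :* b)) := x :* a :* (y :* b :* w)) ≈-refl (ε m) (ε (k ℤ.- m)) (ω k m) (q^ sq m) (q^ (1 ℕ.* tri (k ℤ.- m))))) ≈-refl
        (sum-⊠ (ε k) (d k))) total

open Theta

-- The regrouped sums evaluated for each kernel.

module Kernel-theta where
  lam₀ lam₁ : (ℤ → PS) → PS
  lam₀ f = Θ⁺ 1 2 ⊠ Λ 4 2 (f ∘ 3j) ⊞ ⊟ (q^ 1 ⊠ Θ⁺ 0 3 ⊠ Λ 6 0 (f ∘ 3j+1)) ⊞ ⊟ (Θ⁺ 1 2 ⊠ Λ 2 4 (f ∘ 3j-1))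
  lam₁ f = Θ⁺ 0 3 ⊠ Λ 3 3 (f ∘ 3j) ⊞ ⊟ (Θ⁺ 1 2 ⊠ Λ 5 1 (f ∘ 3j+1)) ⊞ ⊟ (Θ⁺ 1 2 ⊠ Λ 1 5 (f ∘ 3j-1))

  τ τ₆ : PS
  τ = T 1 h⁺ (+ 0)
  τ₆ = T 6 h₆ (+ 0)

  six : PS
  six = fromℤ (+ 6)

  private
    open ≈-Reasoning

    sq+tri : ∀ m → q^ sq m ⊠ q^ tri (m ℤ.- + 1) ≈ q^ θe 1 2 m
    sq+tri m = ≈-trans (≈-sym (q^-+ (sq m) _)) (q^≡ (ex-≡ (sqE m +E triE (m ℤ.- + 1)) (θE 1 2 m)
      (solveℤ 1 (λ m → let tr = λ x → x *' (x +' con' (+ 1)) in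
        con' (+ 2) *' (m *' m) +' tr (m +' con' -[1+ 0 ]) =' con' (+ 1) *' tr m +' con' (+ 2) *' tr (m +' con' -[1+ 0 ])) refl m)))

    weight-h⁻ : ∀ m → ε m ⊠ q^ sq m ⊠ T 1 h⁻ m ≈ ⊟ (fromℤ m ⊠ θ⁺ 1 2 m)
    weight-h⁻ m = begin
      ε m ⊠ q^ sq m ⊠ T 1 h⁻ m ≈⟨ solve 3 (λ x a y → x :* a :* y := a :* (x :* y)) ≈-refl (ε m) (q^ sq m) (T 1 h⁻ m) ⟩
      q^ sq m ⊠ (ε m ⊠ T 1 h⁻ m) ≈⟨ R.*-cong ≈-refl (T⁻ m) ⟩
      q^ sq m ⊠ ⊟ (fromℤ m ⊠ q^ tri (m ℤ.- + 1)) ≈⟨ solve 3 (λ a f b → a :* :- (f :* b) := :- (f :* (a :* b))) ≈-refl (q^ sq m) (fromℤ m) (q^ tri (m ℤ.- + 1)) ⟩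
      ⊟ (fromℤ m ⊠ (q^ sq m ⊠ q^ tri (m ℤ.- + 1))) ≈⟨ R.-‿cong (R.*-cong ≈-refl (sq+tri m)) ⟩
      ⊟ (fromℤ m ⊠ θ⁺ 1 2 m) ∎

    fromℤ-1-6m : ∀ m → fromℤ (1-6m m) ≈ 𝟙 ⊞ ⊟ (six ⊠ fromℤ m)
    fromℤ-1-6m m = ≈-trans (fromℤ-+ (+ 1) (ℤ.- (+ 6 ℤ.* m)))
      (R.+-cong ≈-refl (≈-trans (fromℤ-neg (+ 6 ℤ.* m)) (R.-‿cong (fromℤ-* (+ 6) m))))

    divide : ∀ {c F s} → IsUnit c → IsSum (λ k → c ⊠ F k) s → Σ PS λ s′ → IsSum F s′ × (c ⊠ s′ ≈ s)
    divide {c} {F} {s} (unit r p) h = r ⊠ s , sum-cong (λ k → cr (F k)) ≈-refl (sum-⊠ r h) , ≈-trans (solve 3 (λ c r s → c :* (r :* s) := c :* r :* s) ≈-refl c r s)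
        (≈-trans (R.*-cong p ≈-refl) (R.*-identityˡ s))
      where
      cr : ∀ x → r ⊠ (c ⊠ x) ≈ x
      cr x = ≈-trans (solve 3 (λ r c x → r :* (c :* x) := c :* r :* x) ≈-refl r c x) (≈-trans (R.*-cong p ≈-refl) (R.*-identityˡ x))

    -- Only `c` times the summand is recognised as a theta series. As `c` is a unit, the sum of `F`
    -- itself exists, and the regrouping can be applied to it.
    by-division : ∀ {c F s x} → IsUnit c → IsSum (λ k → c ⊠ F k) s → (∀ {s′} → IsSum F s′ → s′ ≈ x) → c ⊠ x ≈ s
    by-division {c} {F} {s} {x} u h g = go (divide u h)
      where
      go : (Σ PS λ s′ → IsSum F s′ × (c ⊠ s′ ≈ s)) → c ⊠ x ≈ s
      go (s′ , p , e) = ≈-trans (R.*-cong ≈-refl (≈-sym (g p))) e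

  lam₀-h⁺ : lam₀ h⁺ ≈ Θ⁻ 1 2 ⊠ τ
  lam₀-h⁺ = ≈-sym (regroup₀ h⁺ (sum-cong term (R.*-comm τ (Θ⁻ 1 2)) (sum-⊠ τ (Θ⁻-isSum 1 2))))
    where
    term : ∀ m → τ ⊠ θ⁻ 1 2 m ≈ ε m ⊠ q^ sq m ⊠ T 1 h⁺ m
    term m = ≈-sym (begin
      ε m ⊠ q^ sq m ⊠ T 1 h⁺ m ≈⟨ R.*-cong ≈-refl (T⁺ m) ⟩
      ε m ⊠ q^ sq m ⊠ (q^ tri (m ℤ.- + 1) ⊠ τ) ≈⟨ solve 4 (λ x a b c → x :* a :* (b :* c) := c :* (x :* (a :* b))) ≈-refl (ε m) (q^ sq m) (q^ tri (m ℤ.- + 1)) τ ⟩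
      τ ⊠ (ε m ⊠ (q^ sq m ⊠ q^ tri (m ℤ.- + 1))) ≈⟨ R.*-cong ≈-refl (R.*-cong ≈-refl (sq+tri m)) ⟩
      τ ⊠ θ⁻ 1 2 m ∎)

  -- `T⁻` cancels the sign and leaves the weight -m. Writing -6m = (1 - 6m) - 1 explains the factor
  -- 6 and the two theta series.
  lam₀-h⁻ : six ⊠ lam₀ h⁻ ≈ Ξ ⊞ ⊟ Θ⁺ 1 2
  lam₀-h⁻ = by-division (unit-fromℤ 5) (sum-cong term ≈-refl (sum-⊞ Ξ-isSum (sum-⊟ (Θ⁺-isSum 1 2)))) (regroup₀ h⁻)
    where
    term : ∀ m → fromℤ (1-6m m) ⊠ θ⁺ 1 2 m ⊞ ⊟ θ⁺ 1 2 m ≈ six ⊠ (ε m ⊠ q^ sq m ⊠ T 1 h⁻ m)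
    term m = ≈-trans (R.+-cong (R.*-cong (fromℤ-1-6m m) ≈-refl) ≈-refl)
      (≈-trans (solve 2 (λ f x → (con (+ 1) :+ :- (con (+ 6) :* f)) :* x :+ :- x := con (+ 6) :* :- (f :* x)) ≈-refl (fromℤ m) (θ⁺ 1 2 m))
        (R.*-cong ≈-refl (≈-sym (weight-h⁻ m))))

  -- `T²` brings in the weight 1 - 2m, and 3(1 - 2m) = (1 - 6m) + 2.
  lam₀-h² : six ⊠ lam₀ h² ≈ (Ψ ⊞ two ⊠ Θ⁻ 1 2) ⊠ τ
  lam₀-h² = by-division (unit-fromℤ 5) (sum-cong term (R.*-comm τ _) (sum-⊠ τ (sum-⊞ Ψ-isSum (sum-⊠ two (Θ⁻-isSum 1 2))))) (regroup₀ h²)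
    where
    term : ∀ m → τ ⊠ (fromℤ (1-6m m) ⊠ θ⁻ 1 2 m ⊞ two ⊠ θ⁻ 1 2 m) ≈ six ⊠ (ε m ⊠ q^ sq m ⊠ T 1 h² m)
    term m = ≈-sym (begin
      six ⊠ (ε m ⊠ q^ sq m ⊠ T 1 h² m)
        ≈⟨ solve 3 (λ x a y → con (+ 6) :* (x :* a :* y) := con (+ 3) :* (x :* a :* (con (+ 2) :* y))) ≈-refl (ε m) (q^ sq m) (T 1 h² m) ⟩
      fromℤ (+ 3) ⊠ (ε m ⊠ q^ sq m ⊠ (two ⊠ T 1 h² m)) ≈⟨ R.*-cong ≈-refl (R.*-cong ≈-refl (T² m)) ⟩
      fromℤ (+ 3) ⊠ (ε m ⊠ q^ sq m ⊠ (q^ tri (m ℤ.- + 1) ⊠ ((𝟙 ⊞ ⊟ (two ⊠ fromℤ m)) ⊠ τ)))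
        ≈⟨ solve 5 (λ x a b f c → con (+ 3) :* (x :* a :* (b :* ((con (+ 1) :+ :- (con (+ 2) :* f)) :* c)))
             := c :* ((con (+ 1) :+ :- (con (+ 6) :* f)) :* (x :* (a :* b)) :+ con (+ 2) :* (x :* (a :* b)))) ≈-refl (ε m) (q^ sq m) (q^ tri (m ℤ.- + 1)) (fromℤ m) τ ⟩
      τ ⊠ ((𝟙 ⊞ ⊟ (six ⊠ fromℤ m)) ⊠ (ε m ⊠ (q^ sq m ⊠ q^ tri (m ℤ.- + 1))) ⊞ two ⊠ (ε m ⊠ (q^ sq m ⊠ q^ tri (m ℤ.- + 1))))
        ≈⟨ R.*-cong ≈-refl (R.+-cong (R.*-cong (≈-sym (fromℤ-1-6m m)) (R.*-cong ≈-refl (sq+tri m))) (R.*-cong ≈-refl (R.*-cong ≈-refl (sq+tri m)))) ⟩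
      τ ⊠ (fromℤ (1-6m m) ⊠ θ⁻ 1 2 m ⊞ two ⊠ θ⁻ 1 2 m) ∎)

  -- The exponents add up to 3·m(m-1)/2. With l = m - 1 the weight 1 - 2m is -(2l + 1) and ε(m) =
  -- -ε(l); the two signs cancel and Jacobi's series remains.
  lam₁-h² : two ⊠ lam₁ h² ≈ Jac 3 ⊠ τ
  lam₁-h² = by-division unit-two (sum-cong term (R.*-comm τ (Jac 3)) (sum-⊠ τ (sum-shift -[1+ 0 ] (jac-isSum 3)))) (regroup₁ h²)
    where
    ex : ∀ m → q^ (2 ℕ.* tri (m ℤ.- + 1)) ⊠ q^ tri (m ℤ.- + 1) ≈ q^ (3 ℕ.* tri (m ℤ.- + 1))
    ex m = ≈-trans (≈-sym (q^-+ (2 ℕ.* x) x)) (q^≡ (ℕP.+-comm (2 ℕ.* x) x))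
      where x = tri (m ℤ.- + 1)
    wt : ∀ m → fromℤ (2l+1 (m ℤ.- + 1)) ≈ ⊟ (𝟙 ⊞ ⊟ (two ⊠ fromℤ m))
    wt m = ≈-trans (≈-reflexive (cong fromℤ (solveℤ 1 (λ m → (m +' con' -[1+ 0 ]) +' ((m +' con' -[1+ 0 ]) +' con' (+ 1)) =' -' (con' (+ 1) +' -' (con' (+ 2) *' m))) refl m)))
      (≈-trans (fromℤ-neg (+ 1 ℤ.+ ℤ.- (+ 2 ℤ.* m))) (R.-‿cong (≈-trans (fromℤ-+ (+ 1) (ℤ.- (+ 2 ℤ.* m))) (R.+-cong ≈-refl (≈-trans (fromℤ-neg (+ 2 ℤ.* m)) (R.-‿cong (fromℤ-* (+ 2) m)))))))
    term : ∀ m → τ ⊠ jac 3 (m ℤ.+ -[1+ 0 ]) ≈ two ⊠ (ε m ⊠ q^ (2 ℕ.* tri (m ℤ.- + 1)) ⊠ T 1 h² m)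
    term m = ≈-sym (begin
      two ⊠ (ε m ⊠ a ⊠ T 1 h² m) ≈⟨ solve 4 (λ c x a y → c :* (x :* a :* y) := x :* a :* (c :* y)) ≈-refl two (ε m) a (T 1 h² m) ⟩
      ε m ⊠ a ⊠ (two ⊠ T 1 h² m) ≈⟨ R.*-cong ≈-refl (T² m) ⟩
      ε m ⊠ a ⊠ (b ⊠ ((𝟙 ⊞ ⊟ (two ⊠ fromℤ m)) ⊠ τ))
        ≈⟨ solve 5 (λ x a b f c → x :* a :* (b :* (f :* c)) := c :* (:- x :* (a :* b) :* :- f)) ≈-refl (ε m) a b (𝟙 ⊞ ⊟ (two ⊠ fromℤ m)) τ ⟩
      τ ⊠ (⊟ ε m ⊠ (a ⊠ b) ⊠ ⊟ (𝟙 ⊞ ⊟ (two ⊠ fromℤ m)))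
        ≈⟨ R.*-cong ≈-refl (R.*-cong (R.*-cong (≈-trans (≈-sym (ε-pred m)) (≈-reflexive (cong ε (ℤP.+-comm -[1+ 0 ] m)))) (ex m)) (≈-sym (wt m))) ⟩
      τ ⊠ jac 3 (m ℤ.+ -[1+ 0 ]) ∎)
      where
      a = q^ (2 ℕ.* tri (m ℤ.- + 1))
      b = q^ tri (m ℤ.- + 1)

  private
    h⁺-top : ∀ N k → suc N ℕ.≤ k → h⁺ (+ k) ≈[ N ] 𝟙
    h⁺-top N (suc n) l = ord-diff (≈[]-weaken (ℕP.<⇒≤ l) (ord-≈
      (≈-trans (solve 2 (λ x y → :- y := x :+ :- (x :+ y)) ≈-refl (h⁺ (+ suc n)) (h⁺ -[1+ n ])) (R.+-cong ≈-refl (R.-‿cong (h⁺-neg (+ suc n)))))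
      (ord-⊟ (ord-⊠ˡ (inv (1+q n)) (q^-ord (suc n))))))

    h⁺-bot : ∀ N k → suc N ℕ.≤ k → h⁺ (ℤ.- (+ k)) ≈[ N ] 𝟘
    h⁺-bot N (suc n) l = ≈[]-weaken (ℕP.<⇒≤ l) (ord-⊠ˡ (inv (1+q n)) (q^-ord (suc n)))

    h⁻-top : ∀ N n x → x ≡ + suc n → N ℕ.≤ suc n → h⁻ x ≈[ N ] 𝟙
    h⁻-top N n x refl l = ord-diff (≈[]-weaken l (ord-≈
      (≈-trans (solve 2 (λ x y → :- y := x :+ :- (x :+ y)) ≈-refl (h⁻ (+ suc n)) (h⁻ -[1+ n ])) (R.+-cong ≈-refl (R.-‿cong (h⁻-neg (+ suc n) λ ()))))
      (ord-⊟ (ord-⊟ (ord-⊠ˡ (inv (1-q n)) (q^-ord (suc n)))))))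

    h⁻-bot : ∀ N n x → x ≡ -[1+ n ] → N ℕ.≤ suc n → h⁻ x ≈[ N ] 𝟘
    h⁻-bot N n x refl l = ≈[]-weaken l (ord-⊟ (ord-⊠ˡ (inv (1-q n)) (q^-ord (suc n))))

    6k≥k : ∀ k → k ℕ.≤ 6 ℕ.* k
    6k≥k k = ℕP.m≤n*m k 6

    h₆-top : ∀ N k → suc N ℕ.≤ k → h₆ (+ k) ≈[ N ] 𝟙
    h₆-top N k l = h⁻-top N (suc (6 ℕ.* k)) _ (trans (cong (ℤ._+ + 2) (sym (ℤP.pos-* 6 k))) (cong +_ (ℕP.+-comm (6 ℕ.* k) 2)))
      (ℕP.≤-trans (ℕP.≤-trans (ℕP.n≤1+n N) l) (ℕP.≤-trans (6k≥k k) (ℕP.m≤n+m (6 ℕ.* k) 2)))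

    h₆-bot : ∀ N k → suc N ℕ.≤ k → h₆ (ℤ.- (+ k)) ≈[ N ] 𝟘
    h₆-bot N (suc n) l = h⁻-bot N (3 ℕ.+ 6 ℕ.* n) _
      (trans (solveℤ 1 (λ n → con' (+ 6) *' (-' (con' (+ 1) +' n)) +' con' (+ 2) =' -' (con' (+ 4) +' con' (+ 6) *' n)) refl (+ n))
        (cong (λ x → ℤ.- (+ 4 ℤ.+ x)) (sym (ℤP.pos-* 6 n))))
      (ℕP.≤-trans (ℕP.≤-pred l) (ℕP.≤-trans (6k≥k n) (ℕP.m≤n+m (6 ℕ.* n) 4)))

  -- Σ 2·`T 1 h⁺ m` over all m is evaluated twice: through `T⁺` it is 2τ times a theta series,
  -- through `T-total` it is Jacobi's series. This determines τ.
  τ-Jac : two ⊠ τ ⊠ Θ⁺ 0 1 ≈ Jac 1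
  τ-Jac = sum-unique (sum-⊠ (two ⊠ τ) (Θ⁺-isSum 0 1)) (sum-cong term ≈-refl (T-total 1 h⁺ suc h⁺-top h⁺-bot))
    where
    term : ∀ m → two ⊠ T 1 h⁺ m ≈ two ⊠ τ ⊠ θ⁺ 0 1 m
    term m = ≈-trans (R.*-cong ≈-refl (T⁺ m)) (≈-trans (solve 3 (λ c a x → c :* (a :* x) := c :* x :* a) ≈-refl two (q^ tri (m ℤ.- + 1)) τ)
      (R.*-cong ≈-refl (q^≡ (sym (ℕP.+-identityʳ (tri (m ℤ.- + 1)))))))

  τ₆-Jac : two ⊠ τ₆ ⊠ Θ⁻ 2 4 ≈ Jac 6
  τ₆-Jac = sum-unique (sum-⊠ (two ⊠ τ₆) (Θ⁻-isSum 2 4)) (sum-cong term ≈-refl (T-total 6 h₆ suc h₆-top h₆-bot))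
    where
    term : ∀ m → two ⊠ T 6 h₆ m ≈ two ⊠ τ₆ ⊠ θ⁻ 2 4 m
    term m = begin
      two ⊠ T 6 h₆ m ≈⟨ R.*-cong ≈-refl (≈-trans (≈-sym (R.*-identityˡ (T 6 h₆ m))) (R.*-cong (≈-sym (ε² m)) ≈-refl)) ⟩
      two ⊠ (ε m ⊠ ε m ⊠ T 6 h₆ m) ≈⟨ R.*-cong ≈-refl (≈-trans (R.*-assoc (ε m) (ε m) (T 6 h₆ m)) (R.*-cong ≈-refl (T₆ m))) ⟩
      two ⊠ (ε m ⊠ (q^ θe 2 4 m ⊠ τ₆)) ≈⟨ solve 4 (λ c x a y → c :* (x :* (a :* y)) := c :* y :* (x :* a)) ≈-refl two (ε m) (q^ θe 2 4 m) τ₆ ⟩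
      two ⊠ τ₆ ⊠ θ⁻ 2 4 m ∎

  private
    h⁺+h⁻-pos : ∀ n → h⁺ (+ suc n) ⊞ h⁻ (+ suc n) ≈ two ⊠ h⁻ (+ suc n ℤ.+ + suc n)
    h⁺+h⁻-pos n = cancelˡ (unit-⊠ (unit-one (one-at-0 n)) (unit-one (one-at-0′ n))) (begin
      P ⊠ M ⊠ (x ⊞ y) ≈⟨ solve 4 (λ P M x y → P :* M :* (x :+ y) := M :* (P :* x) :+ P :* (M :* y)) ≈-refl P M x y ⟩
      M ⊠ (P ⊠ x) ⊞ P ⊠ (M ⊠ y) ≈⟨ R.+-cong (R.*-cong ≈-refl (inv-⊠ (one-at-0 n))) (R.*-cong ≈-refl (inv-⊠ (one-at-0′ n))) ⟩
      M ⊠ 𝟙 ⊞ P ⊠ 𝟙 ≈⟨ solve 1 (λ a → (con (+ 1) :+ :- a) :* con (+ 1) :+ (con (+ 1) :+ a) :* con (+ 1) := con (+ 2) :* con (+ 1)) ≈-refl (q^ suc n) ⟩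
      two ⊠ 𝟙 ≈⟨ R.*-cong ≈-refl (≈-sym (inv-⊠ (one-at-0′ (n ℕ.+ suc n)))) ⟩
      two ⊠ (1-q (n ℕ.+ suc n) ⊠ z) ≈⟨ R.*-cong ≈-refl (R.*-cong (R.+-cong ≈-refl (R.-‿cong (q^-+ (suc n) (suc n)))) ≈-refl) ⟩
      two ⊠ ((𝟙 ⊞ ⊟ (q^ suc n ⊠ q^ suc n)) ⊠ z)
        ≈⟨ solve 2 (λ a z → con (+ 2) :* ((con (+ 1) :+ :- (a :* a)) :* z) := (con (+ 1) :+ a) :* (con (+ 1) :+ :- a) :* (con (+ 2) :* z)) ≈-refl (q^ suc n) z ⟩
      P ⊠ M ⊠ (two ⊠ z) ∎)
      where
      P = 1+q n
      M = 1-q n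
      x = inv (1+q n)
      y = inv (1-q n)
      z = inv (1-q (n ℕ.+ suc n))

  h⁺+h⁻ : ∀ k → ¬ k ≡ + 0 → h⁺ k ⊞ h⁻ k ≈ two ⊠ h⁻ (k ℤ.+ k)
  h⁺+h⁻ (+ zero) k≢0 = ⊥-elim (k≢0 refl)
  h⁺+h⁻ (+ suc n) _ = h⁺+h⁻-pos n
  h⁺+h⁻ -[1+ n ] _ = begin
    x′ ⊞ y′ ≈⟨ solve 4 (λ x y x′ y′ → x′ :+ y′ := (x :+ x′) :+ (y :+ y′) :+ :- (x :+ y)) ≈-refl x y x′ y′ ⟩
    (x ⊞ x′) ⊞ (y ⊞ y′) ⊞ ⊟ (x ⊞ y) ≈⟨ R.+-cong (R.+-cong (h⁺-neg (+ suc n)) (h⁻-neg (+ suc n) λ ())) (R.-‿cong (h⁺+h⁻-pos n)) ⟩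
    𝟙 ⊞ 𝟙 ⊞ ⊟ (two ⊠ z) ≈⟨ R.+-cong (R.+-cong (≈-sym e) (≈-sym e)) ≈-refl ⟩
    (z ⊞ z′) ⊞ (z ⊞ z′) ⊞ ⊟ (two ⊠ z) ≈⟨ solve 2 (λ z z′ → (z :+ z′) :+ (z :+ z′) :+ :- (con (+ 2) :* z) := con (+ 2) :* z′) ≈-refl z z′ ⟩
    two ⊠ z′ ≈⟨ R.*-cong ≈-refl (≈-reflexive (cong (h⁻ ∘ -[1+_]) (ℕP.+-suc n n))) ⟩
    two ⊠ h⁻ -[1+ suc (n ℕ.+ n) ] ∎
    where
    x = h⁺ (+ suc n)
    y = h⁻ (+ suc n)
    x′ = h⁺ -[1+ n ]
    y′ = h⁻ -[1+ n ]
    z = h⁻ (+ suc n ℤ.+ + suc n)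
    z′ = h⁻ -[1+ n ℕ.+ suc n ]
    e : z ⊞ z′ ≈ 𝟙
    e = h⁻-neg (+ suc n ℤ.+ + suc n) λ ()

  3j+1≢0 : ∀ j → ¬ 3j+1 j ≡ + 0
  3j+1≢0 j p = 6k+2≢0 j (trans (solveℤ 1 (λ j → con' (+ 6) *' j +' con' (+ 2) =' (con' (+ 3) *' j +' con' (+ 1)) +' (con' (+ 3) *' j +' con' (+ 1))) refl j) (cong₂ ℤ._+_ p p))

  -- 1/(1+x) + 1/(1-x) = 2/(1-x²) at x = q^(3j+1), where 3j + 1 never vanishes. The relation later
  -- trades the sum over 1 - q^(3j+1) for the one over 1 + q^(3j+1).
  Λ-h⁺+h⁻ : Λ 6 0 (h⁺ ∘ 3j+1) ⊞ Λ 6 0 (h⁻ ∘ 3j+1) ≈ two ⊠ τ₆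
  Λ-h⁺+h⁻ = sum-unique (sum-⊞ (Λ-isSum 6 0 (h⁺ ∘ 3j+1)) (Λ-isSum 6 0 (h⁻ ∘ 3j+1)))
    (sum-cong term ≈-refl (sum-⊠ two (T-isSum 6 h₆ (+ 0))))
    where
    term : ∀ j → two ⊠ (t 6 j ⊠ h₆ (j ℤ.+ + 0)) ≈ θ⁻ 6 0 j ⊠ h⁺ (3j+1 j) ⊞ θ⁻ 6 0 j ⊠ h⁻ (3j+1 j)
    term j = ≈-sym (begin
      θ⁻ 6 0 j ⊠ h⁺ (3j+1 j) ⊞ θ⁻ 6 0 j ⊠ h⁻ (3j+1 j) ≈⟨ ≈-sym (R.distribˡ (θ⁻ 6 0 j) _ _) ⟩
      θ⁻ 6 0 j ⊠ (h⁺ (3j+1 j) ⊞ h⁻ (3j+1 j)) ≈⟨ R.*-cong (R.*-cong ≈-refl (q^≡ (ℕP.+-identityʳ (6 ℕ.* tri j)))) (h⁺+h⁻ (3j+1 j) (3j+1≢0 j)) ⟩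
      t 6 j ⊠ (two ⊠ h⁻ (3j+1 j ℤ.+ 3j+1 j))
        ≈⟨ R.*-cong ≈-refl (R.*-cong ≈-refl (≈-reflexive (cong h⁻ (solveℤ 1 (λ j → (con' (+ 3) *' j +' con' (+ 1)) +' (con' (+ 3) *' j +' con' (+ 1)) =' con' (+ 6) *' (j +' con' (+ 0)) +' con' (+ 2)) refl j)))) ⟩
      t 6 j ⊠ (two ⊠ h₆ (j ℤ.+ + 0)) ≈⟨ solve 3 (λ a b c → a :* (b :* c) := b :* (a :* c)) ≈-refl (t 6 j) two (h₆ (j ℤ.+ + 0)) ⟩
      two ⊠ (t 6 j ⊠ h₆ (j ℤ.+ + 0)) ∎)

open Kernel-theta

-- Gaussian binomials and the Jacobi triple product.

module Triple-product where
  fac : PS → ℕ → PS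
  fac σ e = 𝟙 ⊞ ⊟ (σ ⊠ q^ e)

  pf : PS → ℕ → ℕ → ℕ → PS
  pf σ α s zero = 𝟙
  pf σ α s (suc n) = pf σ α s n ⊠ fac σ (α ℕ.+ s ℕ.* n)

  -- Factor i differs from 1 first at the exponent α + s·i ≥ i (for s ≥ 1), so the n + 1 factors
  -- with i ≤ n decide the coefficient of q^n. The cut-off is that of `poch`.
  pf∞ : PS → ℕ → ℕ → PS
  pf∞ σ α s n = pf σ α s (suc n) n

  fac-1 : ∀ {N} σ {e} → N ℕ.≤ e → fac σ e ≈[ N ] 𝟙
  fac-1 σ {e} l = ≈[]-trans (≈[]-⊞ (≈⇒≈[] (≈-refl {𝟙})) (ord-⊟ (ord-⊠ʳ σ (ord-q^ l)))) (≈⇒≈[] (R.+-identityʳ 𝟙))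

  pf-stable : ∀ σ α s .{{_ : ℕ.NonZero s}} {N} M M′ → N ℕ.≤ M → M ℕ.≤ M′ → pf σ α s M′ ≈[ N ] pf σ α s M
  pf-stable σ α s M M′ l l′ with ℕP.m≤n⇒m<n∨m≡n l′
  ... | inj₂ refl = ≈⇒≈[] ≈-refl
  pf-stable σ α s {N} M (suc M′) l l′ | inj₁ (s≤s M≤M′) = ≈[]-trans
    (≈[]-⊠ (pf-stable σ α s M M′ l M≤M′) (fac-1 σ (ℕP.≤-trans (ℕP.≤-trans l M≤M′) (ℕP.≤-trans (ℕP.m≤n*m M′ s) (ℕP.m≤n+m _ α)))))
    (≈⇒≈[] (R.*-identityʳ (pf σ α s M)))

  pf-limit : ∀ σ α s .{{_ : ℕ.NonZero s}} {N} M → N ℕ.≤ M → pf σ α s M ≈[ N ] pf∞ σ α s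
  pf-limit σ α s {N} M l = mk≈[] λ n n<N → pf-stable σ α s {suc n} (suc n) M ℕP.≤-refl (ℕP.≤-trans n<N l) .below n ℕP.≤-refl

  private
    fac-at-0 : ∀ σ e → 1 ℕ.≤ e → (fac σ e) 0 ≡ 1ℚ
    fac-at-0 σ e l = trans (fac-1 σ l .below 0 (s≤s z≤n)) (𝟙-at 0)

    pf-at-0 : ∀ σ α s → 1 ℕ.≤ α → ∀ n → pf σ α s n 0 ≡ 1ℚ
    pf-at-0 σ α s l zero = 𝟙-at 0
    pf-at-0 σ α s l (suc n) = trans (⊠-0 (pf σ α s n) (fac σ (α ℕ.+ s ℕ.* n)))
      (cong₂ ℚ._*_ (pf-at-0 σ α s l n) (fac-at-0 σ _ (ℕP.≤-trans l (ℕP.m≤m+n α _))))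

  pf-unit : ∀ σ α s n .{{_ : ℕ.NonZero α}} → IsUnit (pf σ α s n)
  pf-unit σ (suc α) s n = unit-one (pf-at-0 σ (suc α) s (s≤s z≤n) n)

  pf∞-unit : ∀ σ α s .{{_ : ℕ.NonZero α}} → IsUnit (pf∞ σ α s)
  pf∞-unit σ (suc α) s = unit-one (pf-at-0 σ (suc α) s (s≤s z≤n) 1)

  -- Gaussian binomial coefficients [i+j choose i] in the base q^s.
  G : ℕ → ℕ → ℕ → PS
  G s zero j = 𝟙
  G s (suc i) zero = 𝟙
  G s (suc i) (suc j) = G s i (suc j) ⊞ q^ (s ℕ.* suc i) ⊠ G s (suc i) j

  Pf : ℕ → ℕ → PS
  Pf s n = pf 𝟙 s s n

  private
    s*suc : ∀ s n → s ℕ.+ s ℕ.* n ≡ s ℕ.* suc n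
    s*suc s n = sym (ℕP.*-suc s n)

    Pf-suc : ∀ s n → Pf s (suc n) ≈ Pf s n ⊠ (𝟙 ⊞ ⊟ q^ (s ℕ.* suc n))
    Pf-suc s n = R.*-cong ≈-refl (R.+-cong ≈-refl (R.-‿cong (≈-trans (R.*-identityˡ _) (q^≡ (s*suc s n)))))

    s*+ : ∀ s i j → q^ (s ℕ.* (i ℕ.+ j)) ≈ q^ (s ℕ.* i) ⊠ q^ (s ℕ.* j)
    s*+ s i j = ≈-trans (q^≡ (ℕP.*-distribˡ-+ s i j)) (q^-+ (s ℕ.* i) (s ℕ.* j))

  -- The q-factorial formula with denominators cleared. The Pascal rule closes the induction because
  -- (1 - x) + x(1 - y) = 1 - xy.
  G-product : ∀ s i j → G s i j ⊠ (Pf s i ⊠ Pf s j) ≈ Pf s (i ℕ.+ j)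
  G-product s zero j = solve 1 (λ x → con (+ 1) :* (con (+ 1) :* x) := x) ≈-refl (Pf s j)
  G-product s (suc i) zero = ≈-trans (solve 1 (λ x → con (+ 1) :* (x :* con (+ 1)) := x) ≈-refl (Pf s (suc i)))
    (≈-reflexive (cong (λ n → Pf s (suc n)) (sym (ℕP.+-identityʳ i))))
  G-product s (suc i) (suc j) = begin
    (g ⊞ x ⊠ g′) ⊠ (Pf s (suc i) ⊠ Pf s (suc j))
      ≈⟨ solve 5 (λ g x g′ a b → (g :+ x :* g′) :* (a :* b) := g :* (a :* b) :+ x :* (g′ :* (a :* b))) ≈-refl g x g′ (Pf s (suc i)) (Pf s (suc j)) ⟩
    g ⊠ (Pf s (suc i) ⊠ Pf s (suc j)) ⊞ x ⊠ (g′ ⊠ (Pf s (suc i) ⊠ Pf s (suc j)))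
      ≈⟨ R.+-cong (R.*-cong ≈-refl (R.*-cong (Pf-suc s i) ≈-refl)) (R.*-cong ≈-refl (R.*-cong ≈-refl (R.*-cong ≈-refl (Pf-suc s j)))) ⟩
    g ⊠ (Pf s i ⊠ (𝟙 ⊞ ⊟ x) ⊠ Pf s (suc j)) ⊞ x ⊠ (g′ ⊠ (Pf s (suc i) ⊠ (Pf s j ⊠ (𝟙 ⊞ ⊟ y))))
      ≈⟨ solve 8 (λ g x y g′ a b c d → g :* (a :* (con (+ 1) :+ :- x) :* b) :+ x :* (g′ :* (c :* (d :* (con (+ 1) :+ :- y)))) := (con (+ 1) :+ :- x) :* (g :* (a :* b)) :+ x :* (con (+ 1) :+ :- y) :* (g′ :* (c :* d)))
          ≈-refl g x y g′ (Pf s i) (Pf s (suc j)) (Pf s (suc i)) (Pf s j) ⟩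
    (𝟙 ⊞ ⊟ x) ⊠ (g ⊠ (Pf s i ⊠ Pf s (suc j))) ⊞ x ⊠ (𝟙 ⊞ ⊟ y) ⊠ (g′ ⊠ (Pf s (suc i) ⊠ Pf s j))
      ≈⟨ R.+-cong (R.*-cong ≈-refl (G-product s i (suc j))) (R.*-cong ≈-refl (≈-trans (G-product s (suc i) j) (≈-reflexive (cong (Pf s) (sym (ℕP.+-suc i j)))))) ⟩
    (𝟙 ⊞ ⊟ x) ⊠ P ⊞ x ⊠ (𝟙 ⊞ ⊟ y) ⊠ P
      ≈⟨ solve 3 (λ x y P → (con (+ 1) :+ :- x) :* P :+ x :* (con (+ 1) :+ :- y) :* P := P :* (con (+ 1) :+ :- (x :* y))) ≈-refl x y P ⟩
    P ⊠ (𝟙 ⊞ ⊟ (x ⊠ y)) ≈⟨ R.*-cong ≈-refl (R.+-cong ≈-refl (R.-‿cong (≈-sym (s*+ s (suc i) (suc j))))) ⟩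
    P ⊠ (𝟙 ⊞ ⊟ q^ (s ℕ.* suc (i ℕ.+ suc j))) ≈⟨ ≈-sym (Pf-suc s (i ℕ.+ suc j)) ⟩
    Pf s (suc i ℕ.+ suc j) ∎
    where
    open ≈-Reasoning
    g = G s i (suc j)
    g′ = G s (suc i) j
    x = q^ (s ℕ.* suc i)
    y = q^ (s ℕ.* suc j)
    P = Pf s (i ℕ.+ suc j)

  Pf-unit : ∀ s .{{_ : ℕ.NonZero s}} n → IsUnit (Pf s n)
  Pf-unit s n = pf-unit 𝟙 s s n

  G-comm : ∀ s .{{_ : ℕ.NonZero s}} i j → G s i j ≈ G s j i
  G-comm s i j = cancelˡ (unit-⊠ (Pf-unit s i) (Pf-unit s j)) (begin
    Pf s i ⊠ Pf s j ⊠ G s i j ≈⟨ R.*-comm _ _ ⟩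
    G s i j ⊠ (Pf s i ⊠ Pf s j) ≈⟨ G-product s i j ⟩
    Pf s (i ℕ.+ j) ≈⟨ ≈-reflexive (cong (Pf s) (ℕP.+-comm i j)) ⟩
    Pf s (j ℕ.+ i) ≈⟨ ≈-sym (G-product s j i) ⟩
    G s j i ⊠ (Pf s j ⊠ Pf s i) ≈⟨ solve 3 (λ g a b → g :* (b :* a) := a :* b :* g) ≈-refl (G s j i) (Pf s i) (Pf s j) ⟩
    Pf s i ⊠ Pf s j ⊠ G s j i ∎)
    where open ≈-Reasoning

  -- The second q-Pascal rule is the mirror image of the defining one under the symmetry `G-comm`.
  G-pascal : ∀ s .{{_ : ℕ.NonZero s}} i j → G s (suc i) (suc j) ≈ G s (suc i) j ⊞ q^ (s ℕ.* suc j) ⊠ G s i (suc j)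
  G-pascal s i j = ≈-trans (G-comm s (suc i) (suc j)) (R.+-cong (G-comm s j (suc i)) (R.*-cong ≈-refl (G-comm s (suc j) i)))

  Ad : ℕ → (ℕ → ℕ → PS) → PS
  Ad zero F = F 0 0
  Ad (suc N) F = F 0 (suc N) ⊞ Ad N (λ i j → F (suc i) j)

  Ad-cong : ∀ N {F H : ℕ → ℕ → PS} → (∀ i j → i ℕ.+ j ≡ N → F i j ≈ H i j) → Ad N F ≈ Ad N H
  Ad-cong zero h = h 0 0 refl
  Ad-cong (suc N) h = R.+-cong (h 0 (suc N) refl) (Ad-cong N (λ i j p → h (suc i) j (cong suc p)))

  Ad-cong[] : ∀ {M} N {F H : ℕ → ℕ → PS} → (∀ i j → i ℕ.+ j ≡ N → F i j ≈[ M ] H i j) → Ad N F ≈[ M ] Ad N H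
  Ad-cong[] zero h = h 0 0 refl
  Ad-cong[] (suc N) h = ≈[]-⊞ (h 0 (suc N) refl) (Ad-cong[] N (λ i j p → h (suc i) j (cong suc p)))

  Ad-⊞ : ∀ N (F H : ℕ → ℕ → PS) → Ad N (λ i j → F i j ⊞ H i j) ≈ Ad N F ⊞ Ad N H
  Ad-⊞ zero F H = ≈-refl
  Ad-⊞ (suc N) F H = ≈-trans (R.+-cong ≈-refl (Ad-⊞ N (λ i → F (suc i)) (λ i → H (suc i))))
    (solve 4 (λ a b c d → (a :+ b) :+ (c :+ d) := (a :+ c) :+ (b :+ d)) ≈-refl (F 0 (suc N)) (H 0 (suc N)) (Ad N (λ i → F (suc i))) (Ad N (λ i → H (suc i))))

  Ad-⊠ : ∀ N c (F : ℕ → ℕ → PS) → Ad N (λ i j → c ⊠ F i j) ≈ c ⊠ Ad N F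
  Ad-⊠ zero c F = ≈-refl
  Ad-⊠ (suc N) c F = ≈-trans (R.+-cong ≈-refl (Ad-⊠ N c (λ i → F (suc i)))) (≈-sym (R.distribˡ c (F 0 (suc N)) (Ad N (λ i → F (suc i)))))

  Ad-last : ∀ N (F : ℕ → ℕ → PS) → Ad (suc N) F ≈ Ad N (λ i j → F i (suc j)) ⊞ F (suc N) 0
  Ad-last zero F = ≈-refl
  Ad-last (suc N) F = ≈-trans (R.+-cong ≈-refl (Ad-last N (λ i → F (suc i))))
    (≈-sym (R.+-assoc (F 0 (suc (suc N))) (Ad N (λ i j → F (suc i) (suc j))) (F (suc (suc N)) 0)))

  private
    upʳ upˡ : (ℕ → ℕ → PS) → ℕ → ℕ → PS
    upʳ A i zero = 𝟘
    upʳ A i (suc j) = A i j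
    upˡ B zero j = 𝟘
    upˡ B (suc i) j = B i j

    Ad-step : ∀ N (H A B : ℕ → ℕ → PS) → (∀ i j → H (suc i) (suc j) ≈ A (suc i) j ⊞ B i (suc j)) →
      (∀ j → H 0 (suc j) ≈ A 0 j) → (∀ i → H (suc i) 0 ≈ B i 0) → Ad (suc N) H ≈ Ad N (λ i j → A i j ⊞ B i j)
    Ad-step N H A B h h₀ h₁ = begin
      Ad (suc N) H ≈⟨ Ad-cong (suc N) {H} {λ i j → upʳ A i j ⊞ upˡ B i j} pw ⟩
      Ad (suc N) (λ i j → upʳ A i j ⊞ upˡ B i j) ≈⟨ Ad-⊞ (suc N) (upʳ A) (upˡ B) ⟩
      Ad (suc N) (upʳ A) ⊞ Ad (suc N) (upˡ B) ≈⟨ R.+-cong (≈-trans (Ad-last N (upʳ A)) (R.+-identityʳ (Ad N A))) (R.+-identityˡ (Ad N B)) ⟩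
      Ad N A ⊞ Ad N B ≈⟨ ≈-sym (Ad-⊞ N A B) ⟩
      Ad N (λ i j → A i j ⊞ B i j) ∎
      where
      open ≈-Reasoning
      pw : ∀ i j → i ℕ.+ j ≡ suc N → H i j ≈ upʳ A i j ⊞ upˡ B i j
      pw zero (suc j) p = ≈-trans (h₀ j) (≈-sym (R.+-identityʳ (A 0 j)))
      pw (suc i) zero p = ≈-trans (h₁ i) (≈-sym (R.+-identityˡ (B i 0)))
      pw (suc i) (suc j) p = h i j

    _⊝_ : ℕ → ℕ → ℤ
    i ⊝ b = + i ℤ.- + b

    q^s0 : ∀ s → q^ (s ℕ.* 0) ≈ 𝟙
    q^s0 s = ≈-trans (q^≡ (ℕP.*-zeroʳ s)) q^-0

    one⊠ : ∀ g → 𝟙 ≈ g → ∀ x → 𝟙 ⊠ x ≈ g ⊠ x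
    one⊠ g p x = R.*-cong p ≈-refl

    G00 : ∀ s i → G s i 0 ≈ 𝟙
    G00 s zero = ≈-refl
    G00 s (suc i) = ≈-refl

  -- A finite model of a bilateral sum: i - b runs from -b to N - b, and the Gaussian weights tend
  -- to 1/`P∞ s` as both indices grow.
  GS : ℕ → ℕ → ℕ → (ℤ → PS) → PS
  GS s N b X = Ad N (λ i j → G s i j ⊠ X (+ i ℤ.- + b))

  -- The two Pascal rules lengthen the sum at opposite ends. Here q^(s·j) falls on the upper
  -- neighbour, which is what `θ-up` needs to turn the bracket into one new factor with parameter α;
  -- `GS-stepʳ` serves β.
  GS-stepˡ : ∀ s .{{_ : ℕ.NonZero s}} N b X →
    GS s (suc N) b X ≈ Ad N (λ i j → G s i j ⊠ (X (+ i ℤ.- + b) ⊞ q^ (s ℕ.* j) ⊠ X (+ suc i ℤ.- + b)))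
  GS-stepˡ s N b X = ≈-trans
    (Ad-step N (λ i j → G s i j ⊠ X (i ⊝ b)) (λ i j → G s i j ⊠ X (i ⊝ b)) (λ i j → G s i j ⊠ (q^ (s ℕ.* j) ⊠ X (suc i ⊝ b)))
      (λ i j → ≈-trans (R.*-cong (G-pascal s i j) ≈-refl)
        (solve 4 (λ a b c x → (a :+ b :* c) :* x := a :* x :+ c :* (b :* x)) ≈-refl (G s (suc i) j) (q^ (s ℕ.* suc j)) (G s i (suc j)) (X (suc i ⊝ b))))
      (λ j → ≈-refl)
      (λ i → ≈-trans (≈-trans (solve 1 (λ x → con (+ 1) :* x := con (+ 1) :* (con (+ 1) :* x)) ≈-refl (X (suc i ⊝ b))) (one⊠ (G s i 0) (≈-sym (G00 s i)) _))
        (R.*-cong ≈-refl (R.*-cong (≈-sym (q^s0 s)) ≈-refl))))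
    (Ad-cong N (λ i j _ → ≈-sym (R.distribˡ (G s i j) _ _)))

  GS-stepʳ : ∀ s N b X →
    GS s (suc N) (suc b) X ≈ Ad N (λ i j → G s i j ⊠ (q^ (s ℕ.* i) ⊠ X (+ i ℤ.- + suc b) ⊞ X (+ suc i ℤ.- + suc b)))
  GS-stepʳ s N b X = ≈-trans
    (Ad-step N (λ i j → G s i j ⊠ X (i ⊝ suc b)) (λ i j → G s i j ⊠ (q^ (s ℕ.* i) ⊠ X (i ⊝ suc b))) (λ i j → G s i j ⊠ X (suc i ⊝ suc b))
      (λ i j → solve 4 (λ a b c x → (a :+ b :* c) :* x := c :* (b :* x) :+ a :* x) ≈-refl (G s i (suc j)) (q^ (s ℕ.* suc i)) (G s (suc i) j) (X (suc i ⊝ suc b)))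
      (λ j → R.*-cong ≈-refl (≈-trans (≈-sym (R.*-identityˡ _)) (R.*-cong (≈-sym (q^s0 s)) ≈-refl)))
      (λ i → one⊠ (G s i 0) (≈-sym (G00 s i)) _))
    (Ad-cong N (λ i j _ → ≈-sym (R.distribˡ (G s i j) _ _)))

  private
    Ad-symSum : ∀ n (X : ℤ → PS) → Ad (n ℕ.+ n) (λ i j → X (i ⊝ n)) ≈ symSum n X
    Ad-symSum zero X = ≈-refl
    Ad-symSum (suc n) X = begin
      Ad (suc n ℕ.+ suc n) (λ i j → X (i ⊝ suc n)) ≈⟨ ≈-reflexive (cong (λ k → Ad (suc k) (λ i j → X (i ⊝ suc n))) (ℕP.+-suc n n)) ⟩
      X (0 ⊝ suc n) ⊞ Ad (suc (n ℕ.+ n)) (λ i j → X (suc i ⊝ suc n)) ≈⟨ R.+-cong ≈-refl (Ad-last (n ℕ.+ n) (λ i j → X (suc i ⊝ suc n))) ⟩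
      X -[1+ n ] ⊞ (Ad (n ℕ.+ n) (λ i j → X (suc i ⊝ suc n)) ⊞ X (suc (suc (n ℕ.+ n)) ⊝ suc n))
        ≈⟨ R.+-cong ≈-refl (R.+-cong (≈-trans (Ad-cong (n ℕ.+ n) (λ i j _ → ≈-reflexive (cong X (e₁ i)))) (Ad-symSum n X)) (≈-reflexive (cong X e₂))) ⟩
      X -[1+ n ] ⊞ (symSum n X ⊞ X (+ suc n)) ≈⟨ solve 3 (λ a s b → a :+ (s :+ b) := s :+ (b :+ a)) ≈-refl (X -[1+ n ]) (symSum n X) (X (+ suc n)) ⟩
      symSum (suc n) X ∎
      where
      open ≈-Reasoning
      e₁ : ∀ i → suc i ⊝ suc n ≡ i ⊝ n
      e₁ i = solveℤ 2 (λ i n → (con' (+ 1) +' i) +' -' (con' (+ 1) +' n) =' i +' -' n) refl (+ i) (+ n)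
      e₂ : suc (suc (n ℕ.+ n)) ⊝ suc n ≡ + suc n
      e₂ = solveℤ 1 (λ n → (con' (+ 2) +' (n +' n)) +' -' (con' (+ 1) +' n) =' con' (+ 1) +' n) refl (+ n)

  P∞ : ℕ → PS
  P∞ s = pf∞ 𝟙 s s

  P∞-unit : ∀ s .{{_ : ℕ.NonZero s}} → IsUnit (P∞ s)
  P∞-unit s = pf∞-unit 𝟙 s s

  G-limit : ∀ s .{{_ : ℕ.NonZero s}} {N} i j → N ℕ.≤ i → N ℕ.≤ j → P∞ s ⊠ G s i j ≈[ N ] 𝟙
  G-limit s {N} i j p p′ = cancelˡ-[] (P∞-unit s) (≈[]-trans (≈⇒≈[] (solve 2 (λ x g → x :* (x :* g) := g :* (x :* x)) ≈-refl (P∞ s) (G s i j)))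
    (≈[]-trans (≈[]-⊠ (≈⇒≈[] (≈-refl {G s i j})) (≈[]-⊠ (≈[]-sym (pf-limit 𝟙 s s i p)) (≈[]-sym (pf-limit 𝟙 s s j p′))))
    (≈[]-trans (≈⇒≈[] (G-product s i j)) (≈[]-trans (pf-limit 𝟙 s s (i ℕ.+ j) (ℕP.≤-trans p (ℕP.m≤m+n i j))) (≈⇒≈[] (≈-sym (R.*-identityʳ (P∞ s))))))))

  -- If i and j are both at least N, the weight times `P∞ s` is 1 modulo q^N. Otherwise i - n is at
  -- distance more than N from 0, thanks to n ≥ 2N + 1, and the term itself vanishes.
  GS-limit : ∀ s .{{_ : ℕ.NonZero s}} {X : ℤ → PS} {S} → (∀ k → Ord (∣ k ∣ ℕ.∸ 1) (X k)) → IsSum X S →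
    ∀ N n → N ℕ.+ suc N ℕ.≤ n → P∞ s ⊠ GS s (n ℕ.+ n) n X ≈[ N ] S
  GS-limit s {X} {S} h p N n l = ≈[]-trans (≈⇒≈[] (≈-sym (Ad-⊠ (n ℕ.+ n) (P∞ s) (λ i j → G s i j ⊠ X (i ⊝ n)))))
    (≈[]-trans (Ad-cong[] (n ℕ.+ n) term) (≈[]-trans (≈⇒≈[] (Ad-symSum n X)) (sums-at p N n λ k l′ → big k (ℕP.≤-trans (ℕP.≤-trans (ℕP.m≤n+m (suc N) N) l) (ℕP.<⇒≤ l′)))))
    where
    big : ∀ k → suc N ℕ.≤ ∣ k ∣ → Ord N (X k)
    big k q = ≈[]-weaken (ℕP.∸-monoˡ-≤ 1 q) (h k)
    far : ∀ i j → i ℕ.+ j ≡ n ℕ.+ n → i ℕ.< N ⊎ j ℕ.< N → suc N ℕ.≤ ∣ i ⊝ n ∣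
    far i j e (inj₁ i<N) = subst (suc N ℕ.≤_) (sym (trans (ℤP.∣i-j∣≡∣j-i∣ (+ i) (+ n)) (trans (cong ∣_∣ (ℤP.m-n≡m⊖n n i)) (cong ∣_∣ (ℤP.⊖-≥ i≤n)))))
      (ℕP.m+n≤o⇒m≤o∸n (suc N) (ℕP.≤-trans (ℕP.+-monoʳ-≤ (suc N) (ℕP.<⇒≤ i<N)) (subst (ℕ._≤ n) (ℕP.+-comm N (suc N)) l)))
      where
      i≤n : i ℕ.≤ n
      i≤n = ℕP.≤-trans (ℕP.<⇒≤ i<N) (ℕP.≤-trans (ℕP.m≤m+n N (suc N)) l)
    far i j e (inj₂ j<N) = subst (suc N ℕ.≤_) (sym (trans (cong ∣_∣ (solveℤ 3 (λ i j n → i +' -' n =' (i +' j) +' -' (n +' j)) refl (+ i) (+ j) (+ n)))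
        (trans (cong (λ x → ∣ + x ℤ.- (+ n ℤ.+ + j) ∣) e) (trans (cong ∣_∣ (solveℤ 2 (λ j n → (n +' n) +' -' (n +' j) =' n +' -' j) refl (+ j) (+ n))) (trans (cong ∣_∣ (ℤP.m-n≡m⊖n n j)) (cong ∣_∣ (ℤP.⊖-≥ j≤n)))))))
      (ℕP.m+n≤o⇒m≤o∸n (suc N) (ℕP.≤-trans (ℕP.+-monoʳ-≤ (suc N) (ℕP.<⇒≤ j<N)) (subst (ℕ._≤ n) (ℕP.+-comm N (suc N)) l)))
      where
      j≤n : j ℕ.≤ n
      j≤n = ℕP.≤-trans (ℕP.<⇒≤ j<N) (ℕP.≤-trans (ℕP.m≤m+n N (suc N)) l)
    term : ∀ i j → i ℕ.+ j ≡ n ℕ.+ n → P∞ s ⊠ (G s i j ⊠ X (i ⊝ n)) ≈[ N ] X (i ⊝ n)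
    term i j e with N ℕ.≤? i | N ℕ.≤? j
    ... | yes a | yes b = ≈[]-trans (≈⇒≈[] (≈-sym (R.*-assoc (P∞ s) (G s i j) (X (i ⊝ n)))))
      (≈[]-trans (≈[]-⊠ (G-limit s i j a b) (≈⇒≈[] (≈-refl {X (i ⊝ n)}))) (≈⇒≈[] (R.*-identityˡ (X (i ⊝ n)))))
    ... | no a | _ = ≈[]-trans (ord-⊠ʳ (P∞ s) (ord-⊠ʳ (G s i j) (big _ (far i j e (inj₁ (ℕP.≰⇒> a)))))) (≈[]-sym (big _ (far i j e (inj₁ (ℕP.≰⇒> a)))))
    ... | yes _ | no b = ≈[]-trans (ord-⊠ʳ (P∞ s) (ord-⊠ʳ (G s i j) (big _ (far i j e (inj₂ (ℕP.≰⇒> b)))))) (≈[]-sym (big _ (far i j e (inj₂ (ℕP.≰⇒> b)))))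

  -- Finite Jacobi triple product; χ m = (-σ)^m.
  module Triple (σ : PS) (χ : ℤ → PS) (χ-0 : χ (+ 0) ≈ 𝟙) (χ-suc : ∀ m → χ (ℤ.suc m) ≈ ⊟ (σ ⊠ χ m)) (σ² : σ ⊠ σ ≈ 𝟙) (α β : ℕ) where
    private
      s = α ℕ.+ β
      open ≈-Reasoning

    θ : ℤ → PS
    θ m = χ m ⊠ q^ θe α β m

    θ-up : ∀ a b i j → i ℕ.+ j ≡ a ℕ.+ b → q^ (s ℕ.* j) ⊠ θ (+ suc i ℤ.- + b) ≈ ⊟ (σ ⊠ q^ (α ℕ.+ s ℕ.* a)) ⊠ θ (+ i ℤ.- + b)
    θ-up a b i j e = begin
      q^ (s ℕ.* j) ⊠ (χ (suc i ⊝ b) ⊠ q^ θe α β (suc i ⊝ b))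
        ≈⟨ R.*-cong ≈-refl (R.*-cong (≈-trans (≈-reflexive (cong χ se)) (χ-suc (i ⊝ b))) ≈-refl) ⟩
      q^ (s ℕ.* j) ⊠ (⊟ (σ ⊠ χ (i ⊝ b)) ⊠ q^ θe α β (suc i ⊝ b))
        ≈⟨ solve 4 (λ a s c x → a :* (:- (s :* c) :* x) := :- s :* c :* (a :* x)) ≈-refl (q^ (s ℕ.* j)) σ (χ (i ⊝ b)) (q^ θe α β (suc i ⊝ b)) ⟩
      ⊟ σ ⊠ χ (i ⊝ b) ⊠ (q^ (s ℕ.* j) ⊠ q^ θe α β (suc i ⊝ b))
        ≈⟨ R.*-cong ≈-refl (≈-trans (≈-sym (q^-+ (s ℕ.* j) _)) (≈-trans (q^≡ ex) (q^-+ (α ℕ.+ s ℕ.* a) _))) ⟩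
      ⊟ σ ⊠ χ (i ⊝ b) ⊠ (q^ (α ℕ.+ s ℕ.* a) ⊠ q^ θe α β (i ⊝ b))
        ≈⟨ solve 4 (λ a s c x → :- s :* c :* (a :* x) := :- (s :* a) :* (c :* x)) ≈-refl (q^ (α ℕ.+ s ℕ.* a)) σ (χ (i ⊝ b)) (q^ θe α β (i ⊝ b)) ⟩
      ⊟ (σ ⊠ q^ (α ℕ.+ s ℕ.* a)) ⊠ θ (i ⊝ b) ∎
      where
      se : suc i ⊝ b ≡ ℤ.suc (i ⊝ b)
      se = ℤP.+-assoc (+ 1) (+ i) (ℤ.- (+ b))
      ex : s ℕ.* j ℕ.+ θe α β (suc i ⊝ b) ≡ (α ℕ.+ s ℕ.* a) ℕ.+ θe α β (i ⊝ b)
      ex = ex-≡ (s *E lit j +E θE α β (suc i ⊝ b)) ((lit α +E s *E lit a) +E θE α β (i ⊝ b))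
        (trans (solveℤ 5 (λ α β j i b → let tr = λ x → x *' (x +' con' (+ 1)) ; m = i +' -' b in
            (α +' β) *' (con' (+ 2) *' j) +' (α *' tr ((con' (+ 1) +' i) +' -' b) +' β *' tr (((con' (+ 1) +' i) +' -' b) +' con' -[1+ 0 ]))
            =' (con' (+ 2) *' α +' (α +' β) *' (con' (+ 2) *' ((i +' j) +' -' b))) +' (α *' tr m +' β *' tr (m +' con' -[1+ 0 ]))) refl (+ α) (+ β) (+ j) (+ i) (+ b))
          (cong (λ x → (+ 2 ℤ.* + α ℤ.+ (+ α ℤ.+ + β) ℤ.* (+ 2 ℤ.* x)) ℤ.+ ⟦ θE α β (i ⊝ b) ⟧²)
            (trans (cong (λ x → + x ℤ.- + b) e) (solveℤ 2 (λ a b → (a +' b) +' -' b =' a) refl (+ a) (+ b)))))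

    θ-down : ∀ b i → q^ (s ℕ.* i) ⊠ θ (+ i ℤ.- + suc b) ≈ ⊟ (σ ⊠ q^ (β ℕ.+ s ℕ.* b)) ⊠ θ (+ suc i ℤ.- + suc b)
    θ-down b i = begin
      q^ (s ℕ.* i) ⊠ (χ (i ⊝ suc b) ⊠ q^ θe α β (i ⊝ suc b))
        ≈⟨ R.*-cong ≈-refl (R.*-cong χ-down ≈-refl) ⟩
      q^ (s ℕ.* i) ⊠ (⊟ (σ ⊠ χ (suc i ⊝ suc b)) ⊠ q^ θe α β (i ⊝ suc b))
        ≈⟨ solve 4 (λ a s c x → a :* (:- (s :* c) :* x) := :- s :* c :* (a :* x)) ≈-refl (q^ (s ℕ.* i)) σ (χ (suc i ⊝ suc b)) (q^ θe α β (i ⊝ suc b)) ⟩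
      ⊟ σ ⊠ χ (suc i ⊝ suc b) ⊠ (q^ (s ℕ.* i) ⊠ q^ θe α β (i ⊝ suc b))
        ≈⟨ R.*-cong ≈-refl (≈-trans (≈-sym (q^-+ (s ℕ.* i) _)) (≈-trans (q^≡ ex) (q^-+ (β ℕ.+ s ℕ.* b) _))) ⟩
      ⊟ σ ⊠ χ (suc i ⊝ suc b) ⊠ (q^ (β ℕ.+ s ℕ.* b) ⊠ q^ θe α β (suc i ⊝ suc b))
        ≈⟨ solve 4 (λ a s c x → :- s :* c :* (a :* x) := :- (s :* a) :* (c :* x)) ≈-refl (q^ (β ℕ.+ s ℕ.* b)) σ (χ (suc i ⊝ suc b)) (q^ θe α β (suc i ⊝ suc b)) ⟩
      ⊟ (σ ⊠ q^ (β ℕ.+ s ℕ.* b)) ⊠ θ (suc i ⊝ suc b) ∎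
      where
      se : suc i ⊝ suc b ≡ ℤ.suc (i ⊝ suc b)
      se = ℤP.+-assoc (+ 1) (+ i) (ℤ.- (+ suc b))
      χ-down : χ (i ⊝ suc b) ≈ ⊟ (σ ⊠ χ (suc i ⊝ suc b))
      χ-down = ≈-sym (≈-trans (R.-‿cong (R.*-cong ≈-refl (≈-trans (≈-reflexive (cong χ se)) (χ-suc (i ⊝ suc b)))))
        (≈-trans (solve 2 (λ s c → :- (s :* :- (s :* c)) := (s :* s) :* c) ≈-refl σ (χ (i ⊝ suc b))) (≈-trans (R.*-cong σ² ≈-refl) (R.*-identityˡ (χ (i ⊝ suc b))))))
      ex : s ℕ.* i ℕ.+ θe α β (i ⊝ suc b) ≡ (β ℕ.+ s ℕ.* b) ℕ.+ θe α β (suc i ⊝ suc b)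
      ex = ex-≡ (s *E lit i +E θE α β (i ⊝ suc b)) ((lit β +E s *E lit b) +E θE α β (suc i ⊝ suc b))
        (solveℤ 4 (λ α β i b → let tr = λ x → x *' (x +' con' (+ 1)) ; m = i +' -' (con' (+ 1) +' b) ; m′ = (con' (+ 1) +' i) +' -' (con' (+ 1) +' b) in
            (α +' β) *' (con' (+ 2) *' i) +' (α *' tr m +' β *' tr (m +' con' -[1+ 0 ]))
            =' (con' (+ 2) *' β +' (α +' β) *' (con' (+ 2) *' b)) +' (α *' tr m′ +' β *' tr (m′ +' con' -[1+ 0 ]))) refl (+ α) (+ β) (+ i) (+ b))

    module _ {{_ : ℕ.NonZero s}} where
      finite : ∀ a b → GS s (a ℕ.+ b) b θ ≈ pf σ α s a ⊠ pf σ β s b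
      finite zero zero = ≈-trans (R.*-cong ≈-refl (R.*-cong χ-0 (≈-trans (q^≡ θe0) q^-0))) (R.*-cong ≈-refl (R.*-identityˡ 𝟙))
        where
        θe0 : θe α β (+ 0) ≡ 0
        θe0 = cong₂ ℕ._+_ (ℕP.*-zeroʳ α) (ℕP.*-zeroʳ β)
      finite (suc a) b = begin
        GS s (suc (a ℕ.+ b)) b θ ≈⟨ GS-stepˡ s (a ℕ.+ b) b θ ⟩
        Ad (a ℕ.+ b) (λ i j → G s i j ⊠ (θ (i ⊝ b) ⊞ q^ (s ℕ.* j) ⊠ θ (suc i ⊝ b)))
          ≈⟨ Ad-cong (a ℕ.+ b) (λ i j e → ≈-trans (R.*-cong ≈-refl (R.+-cong ≈-refl (θ-up a b i j e)))
               (solve 3 (λ g y x → g :* (x :+ :- y :* x) := (con (+ 1) :+ :- y) :* (g :* x)) ≈-refl (G s i j) (σ ⊠ q^ (α ℕ.+ s ℕ.* a)) (θ (i ⊝ b)))) ⟩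
        Ad (a ℕ.+ b) (λ i j → fac σ (α ℕ.+ s ℕ.* a) ⊠ (G s i j ⊠ θ (i ⊝ b))) ≈⟨ Ad-⊠ (a ℕ.+ b) _ _ ⟩
        fac σ (α ℕ.+ s ℕ.* a) ⊠ GS s (a ℕ.+ b) b θ ≈⟨ R.*-cong ≈-refl (finite a b) ⟩
        fac σ (α ℕ.+ s ℕ.* a) ⊠ (pf σ α s a ⊠ pf σ β s b) ≈⟨ solve 3 (λ f x y → f :* (x :* y) := x :* f :* y) ≈-refl (fac σ (α ℕ.+ s ℕ.* a)) (pf σ α s a) (pf σ β s b) ⟩
        pf σ α s (suc a) ⊠ pf σ β s b ∎
      finite zero (suc b) = begin
        GS s (suc b) (suc b) θ ≈⟨ GS-stepʳ s b b θ ⟩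
        Ad b (λ i j → G s i j ⊠ (q^ (s ℕ.* i) ⊠ θ (i ⊝ suc b) ⊞ θ (suc i ⊝ suc b)))
          ≈⟨ Ad-cong b (λ i j e → ≈-trans (R.*-cong ≈-refl (≈-trans (R.+-cong (θ-down b i) ≈-refl) (R.+-cong (R.*-cong ≈-refl (≈-reflexive (cong θ (e₁ i)))) (≈-reflexive (cong θ (e₁ i))))))
               (solve 3 (λ g y x → g :* (:- y :* x :+ x) := (con (+ 1) :+ :- y) :* (g :* x)) ≈-refl (G s i j) (σ ⊠ q^ (β ℕ.+ s ℕ.* b)) (θ (i ⊝ b)))) ⟩
        Ad b (λ i j → fac σ (β ℕ.+ s ℕ.* b) ⊠ (G s i j ⊠ θ (i ⊝ b))) ≈⟨ Ad-⊠ b _ _ ⟩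
        fac σ (β ℕ.+ s ℕ.* b) ⊠ GS s b b θ ≈⟨ R.*-cong ≈-refl (finite zero b) ⟩
        fac σ (β ℕ.+ s ℕ.* b) ⊠ (𝟙 ⊠ pf σ β s b) ≈⟨ solve 2 (λ f y → f :* (con (+ 1) :* y) := con (+ 1) :* (y :* f)) ≈-refl (fac σ (β ℕ.+ s ℕ.* b)) (pf σ β s b) ⟩
        𝟙 ⊠ pf σ β s (suc b) ∎
        where
        e₁ : ∀ i → suc i ⊝ suc b ≡ i ⊝ b
        e₁ i = solveℤ 2 (λ i n → (con' (+ 1) +' i) +' -' (con' (+ 1) +' n) =' i +' -' n) refl (+ i) (+ b)

      limit : ∀ {S} → IsSum θ S → S ≈ pf∞ σ α s ⊠ pf∞ σ β s ⊠ P∞ s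
      limit {S} p = ≈[]⇒≈ λ N → ≈[]-trans (≈[]-sym (GS-limit s (λ k → ord-⊠ʳ (χ k) (θ⁺-ord α β k)) p N (N ℕ.+ suc N) ℕP.≤-refl))
        (≈[]-trans (≈⇒≈[] (≈-trans (R.*-cong ≈-refl (finite (N ℕ.+ suc N) (N ℕ.+ suc N))) (R.*-comm (P∞ s) _)))
          (≈[]-⊠ (≈[]-⊠ (pf-limit σ α s _ (ℕP.m≤m+n N (suc N))) (pf-limit σ β s _ (ℕP.m≤m+n N (suc N)))) (≈⇒≈[] (≈-refl {P∞ s}))))

open Triple-product

-- Jacobi's cube and the product relations between the theta constants.

module Product-relations where
  module Minus = Triple 𝟙 ε ≈-refl (λ m → ≈-trans (ε-suc m) (R.-‿cong (≈-sym (R.*-identityˡ (ε m))))) (R.*-identityˡ 𝟙)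
  module Plus = Triple (⊟ 𝟙) (λ _ → 𝟙) ≈-refl (λ _ → solve 0 (con (+ 1) := :- (:- con (+ 1) :* con (+ 1))) ≈-refl) (solve 0 (:- con (+ 1) :* :- con (+ 1) := con (+ 1)) ≈-refl)

  Θ⁻-product : ∀ α β {{_ : ℕ.NonZero (α ℕ.+ β)}} → Θ⁻ α β ≈ pf∞ 𝟙 α (α ℕ.+ β) ⊠ pf∞ 𝟙 β (α ℕ.+ β) ⊠ P∞ (α ℕ.+ β)
  Θ⁻-product α β = Minus.limit α β (Θ⁻-isSum α β)

  Θ⁺-product : ∀ α β {{_ : ℕ.NonZero (α ℕ.+ β)}} → Θ⁺ α β ≈ pf∞ (⊟ 𝟙) α (α ℕ.+ β) ⊠ pf∞ (⊟ 𝟙) β (α ℕ.+ β) ⊠ P∞ (α ℕ.+ β)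
  Θ⁺-product α β = Plus.limit α β (sum-cong (λ m → ≈-sym (R.*-identityˡ (θ⁺ α β m))) ≈-refl (Θ⁺-isSum α β))

  module _ (s : ℕ) {{_ : ℕ.NonZero s}} where
    private
      open ≈-Reasoning
      open Minus 0 s using (θ; θ-up; finite)

      X : ℤ → PS
      X m = fromℤ m ⊠ θ m

      _⊝_ : ℕ → ℕ → ℤ
      i ⊝ b = + i ℤ.- + b

      step : ∀ a b → GS s (suc a ℕ.+ b) b X ≈ fac 𝟙 (s ℕ.* a) ⊠ GS s (a ℕ.+ b) b X ⊞ ⊟ (q^ (s ℕ.* a) ⊠ (pf 𝟙 0 s a ⊠ Pf s b))
      step a b = begin
        GS s (suc a ℕ.+ b) b X ≈⟨ GS-stepˡ s (a ℕ.+ b) b X ⟩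
        Ad (a ℕ.+ b) (λ i j → G s i j ⊠ (X (i ⊝ b) ⊞ q^ (s ℕ.* j) ⊠ X (suc i ⊝ b))) ≈⟨ Ad-cong (a ℕ.+ b) term ⟩
        Ad (a ℕ.+ b) (λ i j → f ⊠ (G s i j ⊠ X (i ⊝ b)) ⊞ ⊟ y ⊠ (G s i j ⊠ θ (i ⊝ b))) ≈⟨ Ad-⊞ (a ℕ.+ b) _ _ ⟩
        Ad (a ℕ.+ b) (λ i j → f ⊠ (G s i j ⊠ X (i ⊝ b))) ⊞ Ad (a ℕ.+ b) (λ i j → ⊟ y ⊠ (G s i j ⊠ θ (i ⊝ b)))
          ≈⟨ R.+-cong (Ad-⊠ (a ℕ.+ b) f _) (≈-trans (Ad-⊠ (a ℕ.+ b) (⊟ y) _) (R.*-cong ≈-refl (finite a b))) ⟩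
        f ⊠ GS s (a ℕ.+ b) b X ⊞ ⊟ y ⊠ (pf 𝟙 0 s a ⊠ Pf s b) ≈⟨ R.+-cong ≈-refl (solve 2 (λ y z → :- y :* z := :- (y :* z)) ≈-refl y (pf 𝟙 0 s a ⊠ Pf s b)) ⟩
        f ⊠ GS s (a ℕ.+ b) b X ⊞ ⊟ (y ⊠ (pf 𝟙 0 s a ⊠ Pf s b)) ∎
        where
        f = fac 𝟙 (s ℕ.* a)
        y = q^ (s ℕ.* a)
        term : ∀ i j → i ℕ.+ j ≡ a ℕ.+ b → G s i j ⊠ (X (i ⊝ b) ⊞ q^ (s ℕ.* j) ⊠ X (suc i ⊝ b)) ≈ f ⊠ (G s i j ⊠ X (i ⊝ b)) ⊞ ⊟ y ⊠ (G s i j ⊠ θ (i ⊝ b))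
        term i j e = begin
          g ⊠ (m ⊠ x ⊞ q^ (s ℕ.* j) ⊠ (fromℤ (suc i ⊝ b) ⊠ θ (suc i ⊝ b)))
            ≈⟨ R.*-cong ≈-refl (R.+-cong ≈-refl (solve 3 (λ a f t → a :* (f :* t) := f :* (a :* t)) ≈-refl (q^ (s ℕ.* j)) (fromℤ (suc i ⊝ b)) (θ (suc i ⊝ b)))) ⟩
          g ⊠ (m ⊠ x ⊞ fromℤ (suc i ⊝ b) ⊠ (q^ (s ℕ.* j) ⊠ θ (suc i ⊝ b)))
            ≈⟨ R.*-cong ≈-refl (R.+-cong ≈-refl (R.*-cong (≈-trans (≈-reflexive (cong fromℤ (ℤP.+-assoc (+ 1) (+ i) (ℤ.- (+ b))))) (fromℤ-+ (+ 1) (i ⊝ b))) (θ-up a b i j e))) ⟩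
          g ⊠ (m ⊠ x ⊞ (𝟙 ⊞ m) ⊠ (⊟ (𝟙 ⊠ y) ⊠ x))
            ≈⟨ solve 4 (λ g m x y → g :* (m :* x :+ (con (+ 1) :+ m) :* (:- (con (+ 1) :* y) :* x)) := (con (+ 1) :+ :- (con (+ 1) :* y)) :* (g :* (m :* x)) :+ :- y :* (g :* x)) ≈-refl g m x y ⟩
          f ⊠ (g ⊠ X (i ⊝ b)) ⊞ ⊟ y ⊠ (g ⊠ x) ∎
          where
          g = G s i j
          m = fromℤ (i ⊝ b)
          x = θ (i ⊝ b)

      q0 : q^ (s ℕ.* 0) ≈ 𝟙
      q0 = ≈-trans (q^≡ (ℕP.*-zeroʳ s)) q^-0

      pf-0 : ∀ a → pf 𝟙 0 s (suc a) ≈ 𝟘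
      pf-0 zero = ≈-trans (R.*-identityˡ (fac 𝟙 (s ℕ.* 0))) (≈-trans (R.+-cong ≈-refl (R.-‿cong (R.*-cong ≈-refl q0))) (solve 0 (con (+ 1) :+ :- (con (+ 1) :* con (+ 1)) := con (+ 0)) ≈-refl))
      pf-0 (suc a) = ≈-trans (R.*-cong (pf-0 a) ≈-refl) (R.zeroˡ _)

      -- The weight m is the derivative at z = 1 of z^m in the finite triple product. For α = 0 this
      -- product contains 1 - q^0 = 0, so only the derivative of that factor survives, and the other
      -- factors remain.
      finite-cube : ∀ a b → GS s (suc a ℕ.+ b) b X ≈ ⊟ (Pf s a ⊠ Pf s b)
      finite-cube zero b = ≈-trans (step zero b) (≈-trans
        (R.+-cong (R.*-cong (R.+-cong ≈-refl (R.-‿cong (R.*-cong ≈-refl q0))) ≈-refl) (R.-‿cong (R.*-cong q0 ≈-refl)))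
        (solve 2 (λ x p → (con (+ 1) :+ :- (con (+ 1) :* con (+ 1))) :* x :+ :- (con (+ 1) :* (con (+ 1) :* p)) := :- (con (+ 1) :* p)) ≈-refl (GS s b b X) (Pf s b)))
      finite-cube (suc a) b = ≈-trans (step (suc a) b) (≈-trans
        (R.+-cong (R.*-cong (≈-reflexive (cong (fac 𝟙) (ℕP.*-suc s a))) (finite-cube a b)) (R.-‿cong (R.*-cong ≈-refl (R.*-cong (pf-0 a) ≈-refl))))
        (solve 4 (λ f p p′ y → f :* :- (p :* p′) :+ :- (y :* (con (+ 0) :* p′)) := :- (p :* f :* p′)) ≈-refl (fac 𝟙 (s ℕ.+ s ℕ.* a)) (Pf s a) (Pf s b) (q^ (s ℕ.* suc a))))

      X-ord : ∀ m → Ord (∣ m ∣ ℕ.∸ 1) (X m)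
      X-ord m = ord-⊠ʳ (fromℤ m) (θ⁻-ord 0 s m)

      X-total : sumℤ 1 X ≈ ⊟ (P∞ s ⊠ P∞ s ⊠ P∞ s)
      X-total = ≈[]⇒≈ λ N → ≈[]-trans (≈[]-sym (GS-limit s X-ord (sumℤ-isSum 1 X-ord) N (N ℕ.+ suc N) ℕP.≤-refl))
        (≈[]-trans (≈⇒≈[] (R.*-cong ≈-refl (≈-trans (≈-reflexive (cong (λ n → GS s (n ℕ.+ (N ℕ.+ suc N)) (N ℕ.+ suc N) X) (ℕP.+-suc N N))) (finite-cube (N ℕ.+ N) (N ℕ.+ suc N)))))
        (≈[]-trans (≈[]-⊠ (≈⇒≈[] (≈-refl {P∞ s})) (≈[]-⊟ (≈[]-⊠ (pf-limit 𝟙 s s (N ℕ.+ N) (ℕP.m≤m+n N N)) (pf-limit 𝟙 s s (N ℕ.+ suc N) (ℕP.m≤m+n N (suc N))))))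
        (≈⇒≈[] (solve 1 (λ p → p :* :- (p :* p) := :- (p :* p :* p)) ≈-refl (P∞ s)))))

    -- With l = m - 1 the weight 2l + 1 is 2m - 1: the part 2m is the derivative computed above, and
    -- the part -1 sums to zero.
    Jac-cube : Jac s ≈ two ⊠ (P∞ s ⊠ P∞ s ⊠ P∞ s)
    Jac-cube = ≈-trans (sum-unique (sum-shift -[1+ 0 ] (jac-isSum s))
        (sum-cong term ≈-refl (sum-⊞ (sum-⊠ (⊟ two) (sumℤ-isSum 1 X-ord)) (t-pred-sum s))))
      (≈-trans (R.+-cong (R.*-cong ≈-refl X-total) ≈-refl) (solve 1 (λ p → :- con (+ 2) :* :- p :+ con (+ 0) := con (+ 2) :* p) ≈-refl (P∞ s ⊠ P∞ s ⊠ P∞ s)))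
      where
      term : ∀ m → ⊟ two ⊠ X m ⊞ ε m ⊠ q^ (s ℕ.* tri (m ℤ.- + 1)) ≈ jac s (m ℤ.+ -[1+ 0 ])
      term m = ≈-trans (solve 3 (λ f e x → :- con (+ 2) :* (f :* (e :* x)) :+ e :* x := :- e :* x :* (con (+ 2) :* f :+ con -[1+ 0 ])) ≈-refl (fromℤ m) (ε m) (q^ (s ℕ.* tri (m ℤ.- + 1))))
        (R.*-cong (R.*-cong (≈-trans (≈-sym (ε-pred m)) (≈-reflexive (cong ε (ℤP.+-comm -[1+ 0 ] m)))) ≈-refl)
          (≈-trans (R.+-cong (≈-sym (fromℤ-* (+ 2) m)) ≈-refl) (≈-trans (≈-sym (fromℤ-+ (+ 2 ℤ.* m) -[1+ 0 ]))
            (≈-reflexive (cong fromℤ (solveℤ 1 (λ m → con' (+ 2) *' m +' con' -[1+ 0 ] =' (m +' con' -[1+ 0 ]) +' ((m +' con' -[1+ 0 ]) +' con' (+ 1))) refl m))))))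

  private
    limit-≈ : ∀ {x y : ℕ → PS} {X Y} → (∀ N → x N ≈[ N ] X) → (∀ N → y N ≈[ N ] Y) → (∀ N → x N ≈ y N) → X ≈ Y
    limit-≈ p q e = ≈[]⇒≈ λ N → ≈[]-trans (≈[]-sym (p N)) (≈[]-trans (≈⇒≈[] (e N)) (q N))

    fac≡ : ∀ σ {a b} → a ≡ b → fac σ a ≈ fac σ b
    fac≡ σ p = ≈-reflexive (cong (fac σ) p)

  pf∞-split2 : ∀ σ α s .{{_ : ℕ.NonZero s}} → pf∞ σ α s ≈ pf∞ σ α (2 ℕ.* s) ⊠ pf∞ σ (α ℕ.+ s) (2 ℕ.* s)
  pf∞-split2 σ α s@(suc _) = limit-≈ (λ N → pf-limit σ α s (2 ℕ.* N) (ℕP.m≤n*m N 2))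
    (λ N → ≈[]-⊠ (pf-limit σ α (2 ℕ.* s) N ℕP.≤-refl) (pf-limit σ (α ℕ.+ s) (2 ℕ.* s) N ℕP.≤-refl)) fin
    where
    fin : ∀ n → pf σ α s (2 ℕ.* n) ≈ pf σ α (2 ℕ.* s) n ⊠ pf σ (α ℕ.+ s) (2 ℕ.* s) n
    fin zero = ≈-sym (R.*-identityˡ 𝟙)
    fin (suc n) = ≈-trans (≈-reflexive (cong (pf σ α s) (ℕP.*-suc 2 n)))
      (≈-trans (R.*-cong (R.*-cong (fin n) (fac≡ σ e₀)) (fac≡ σ e₁))
        (solve 4 (λ x y f g → x :* y :* f :* g := (x :* f) :* (y :* g)) ≈-refl (pf σ α (2 ℕ.* s) n) (pf σ (α ℕ.+ s) (2 ℕ.* s) n) _ _))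
      where
      e₀ : α ℕ.+ s ℕ.* (2 ℕ.* n) ≡ α ℕ.+ 2 ℕ.* s ℕ.* n
      e₀ = cong (α ℕ.+_) (trans (sym (ℕP.*-assoc s 2 n)) (cong (ℕ._* n) (ℕP.*-comm s 2)))
      e₁ : α ℕ.+ s ℕ.* suc (2 ℕ.* n) ≡ α ℕ.+ s ℕ.+ 2 ℕ.* s ℕ.* n
      e₁ = trans (cong (α ℕ.+_) (ℕP.*-suc s (2 ℕ.* n))) (trans (sym (ℕP.+-assoc α s _)) (cong (α ℕ.+ s ℕ.+_) (trans (sym (ℕP.*-assoc s 2 n)) (cong (ℕ._* n) (ℕP.*-comm s 2)))))

  pf∞-split3 : ∀ σ α s .{{_ : ℕ.NonZero s}} → pf∞ σ α s ≈ pf∞ σ α (3 ℕ.* s) ⊠ pf∞ σ (α ℕ.+ s) (3 ℕ.* s) ⊠ pf∞ σ (α ℕ.+ 2 ℕ.* s) (3 ℕ.* s)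
  pf∞-split3 σ α s@(suc _) = limit-≈ (λ N → pf-limit σ α s (3 ℕ.* N) (ℕP.m≤n*m N 3))
    (λ N → ≈[]-⊠ (≈[]-⊠ (pf-limit σ α (3 ℕ.* s) N ℕP.≤-refl) (pf-limit σ (α ℕ.+ s) (3 ℕ.* s) N ℕP.≤-refl)) (pf-limit σ (α ℕ.+ 2 ℕ.* s) (3 ℕ.* s) N ℕP.≤-refl)) fin
    where
    fin : ∀ n → pf σ α s (3 ℕ.* n) ≈ pf σ α (3 ℕ.* s) n ⊠ pf σ (α ℕ.+ s) (3 ℕ.* s) n ⊠ pf σ (α ℕ.+ 2 ℕ.* s) (3 ℕ.* s) n
    fin zero = solve 0 (con (+ 1) := con (+ 1) :* con (+ 1) :* con (+ 1)) ≈-refl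
    fin (suc n) = ≈-trans (≈-reflexive (cong (pf σ α s) (ℕP.*-suc 3 n)))
      (≈-trans (R.*-cong (R.*-cong (R.*-cong (fin n) (fac≡ σ e₀)) (fac≡ σ (e 1 s (ℕP.*-identityˡ s)))) (fac≡ σ (e 2 (2 ℕ.* s) refl)))
        (solve 6 (λ x y z f g h → x :* y :* z :* f :* g :* h := (x :* f) :* (y :* g) :* (z :* h)) ≈-refl (pf σ α (3 ℕ.* s) n) (pf σ (α ℕ.+ s) (3 ℕ.* s) n) (pf σ (α ℕ.+ 2 ℕ.* s) (3 ℕ.* s) n) _ _ _))
      where
      c : s ℕ.* (3 ℕ.* n) ≡ 3 ℕ.* s ℕ.* n
      c = trans (sym (ℕP.*-assoc s 3 n)) (cong (ℕ._* n) (ℕP.*-comm s 3))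
      e₀ : α ℕ.+ s ℕ.* (3 ℕ.* n) ≡ α ℕ.+ 3 ℕ.* s ℕ.* n
      e₀ = cong (α ℕ.+_) c
      e : ∀ i x → i ℕ.* s ≡ x → α ℕ.+ s ℕ.* (i ℕ.+ 3 ℕ.* n) ≡ α ℕ.+ x ℕ.+ 3 ℕ.* s ℕ.* n
      e i x refl = trans (cong (α ℕ.+_) (trans (ℕP.*-distribˡ-+ s i (3 ℕ.* n)) (cong₂ ℕ._+_ (ℕP.*-comm s i) c))) (sym (ℕP.+-assoc α (i ℕ.* s) _))

  pf∞-double : ∀ α s .{{_ : ℕ.NonZero s}} → pf∞ (⊟ 𝟙) α s ⊠ pf∞ 𝟙 α s ≈ pf∞ 𝟙 (2 ℕ.* α) (2 ℕ.* s)
  pf∞-double α s@(suc _) = limit-≈ (λ N → ≈[]-⊠ (pf-limit (⊟ 𝟙) α s N ℕP.≤-refl) (pf-limit 𝟙 α s N ℕP.≤-refl)) (λ N → pf-limit 𝟙 (2 ℕ.* α) (2 ℕ.* s) N ℕP.≤-refl) fin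
    where
    fin : ∀ n → pf (⊟ 𝟙) α s n ⊠ pf 𝟙 α s n ≈ pf 𝟙 (2 ℕ.* α) (2 ℕ.* s) n
    fin zero = R.*-identityˡ 𝟙
    fin (suc n) = ≈-trans (solve 3 (λ x y e → (x :* (con (+ 1) :+ :- (:- con (+ 1) :* e))) :* (y :* (con (+ 1) :+ :- (con (+ 1) :* e))) := (x :* y) :* (con (+ 1) :+ :- (con (+ 1) :* (e :* e)))) ≈-refl (pf (⊟ 𝟙) α s n) (pf 𝟙 α s n) (q^ (α ℕ.+ s ℕ.* n)))
      (R.*-cong (fin n) (R.+-cong ≈-refl (R.-‿cong (R.*-cong ≈-refl (≈-trans (≈-sym (q^-+ (α ℕ.+ s ℕ.* n) (α ℕ.+ s ℕ.* n))) (q^≡ e))))))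
      where
      e : (α ℕ.+ s ℕ.* n) ℕ.+ (α ℕ.+ s ℕ.* n) ≡ 2 ℕ.* α ℕ.+ 2 ℕ.* s ℕ.* n
      e = trans (cong ((α ℕ.+ s ℕ.* n) ℕ.+_) (sym (ℕP.+-identityʳ _))) (trans (ℕP.*-distribˡ-+ 2 α (s ℕ.* n)) (cong (2 ℕ.* α ℕ.+_) (sym (ℕP.*-assoc 2 s n))))

  pf∞-plus-0 : ∀ s .{{_ : ℕ.NonZero s}} → pf∞ (⊟ 𝟙) 0 s ≈ two ⊠ pf∞ (⊟ 𝟙) s s
  pf∞-plus-0 s@(suc _) = limit-≈ (λ N → pf-limit (⊟ 𝟙) 0 s (suc N) (ℕP.n≤1+n N)) (λ N → ≈[]-⊠ (≈⇒≈[] (≈-refl {two})) (pf-limit (⊟ 𝟙) s s N ℕP.≤-refl)) fin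
    where
    fin : ∀ n → pf (⊟ 𝟙) 0 s (suc n) ≈ two ⊠ pf (⊟ 𝟙) s s n
    fin zero = ≈-trans (R.*-cong ≈-refl (R.+-cong ≈-refl (R.-‿cong (R.*-cong ≈-refl (≈-trans (q^≡ (ℕP.*-zeroʳ s)) q^-0)))))
      (solve 0 (con (+ 1) :* (con (+ 1) :+ :- (:- con (+ 1) :* con (+ 1))) := con (+ 2) :* con (+ 1)) ≈-refl)
    fin (suc n) = ≈-trans (R.*-cong (fin n) (fac≡ (⊟ 𝟙) (ℕP.*-suc s n))) (R.*-assoc two (pf (⊟ 𝟙) s s n) _)

  -- In the notation of the theorem `a` = J_{3,6}, `b` = J_{1,6}, `E` = J_6 and `F` = J_2. Moreover
  -- `e` = (q;q)_∞ and `κ` = (-q;q)_∞, while `v` is half of `Θ⁺ 0 3`.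
  φ a b e u v E F κ : PS
  φ = Θ⁻ 1 1
  a = Θ⁻ 3 3
  b = Θ⁻ 1 5
  e = Θ⁻ 1 2
  u = Θ⁺ 1 2
  v = pf∞ (⊟ 𝟙) 3 3 ⊠ pf∞ (⊟ 𝟙) 3 3 ⊠ P∞ 3
  E = P∞ 6
  F = P∞ 2
  κ = pf∞ (⊟ 𝟙) 1 1

  private
    open ≈-Reasoning
    m p : ℕ → ℕ → PS
    m α s = pf∞ 𝟙 α s
    p α s = pf∞ (⊟ 𝟙) α s

    -- Euler's identity between partitions into distinct parts and into odd parts, in the base q^s.
    euler : ∀ s .{{_ : ℕ.NonZero s}} → p s s ⊠ m s (2 ℕ.* s) ≈ 𝟙
    euler s@(suc s′) = cancelˡ (pf∞-unit 𝟙 (2 ℕ.* s) (2 ℕ.* s) {{ℕ.nonZero}}) (begin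
      m (2 ℕ.* s) (2 ℕ.* s) ⊠ (p s s ⊠ m s (2 ℕ.* s)) ≈⟨ solve 3 (λ x y z → x :* (y :* z) := y :* (z :* x)) ≈-refl (m (2 ℕ.* s) (2 ℕ.* s)) (p s s) (m s (2 ℕ.* s)) ⟩
      p s s ⊠ (m s (2 ℕ.* s) ⊠ m (2 ℕ.* s) (2 ℕ.* s)) ≈⟨ R.*-cong ≈-refl (≈-sym (≈-trans (pf∞-split2 𝟙 s s) (R.*-cong ≈-refl (≈-reflexive (cong (λ x → m x (2 ℕ.* s)) (cong (s ℕ.+_) (sym (ℕP.+-identityʳ s)))))))) ⟩
      p s s ⊠ m s s ≈⟨ pf∞-double s s ⟩
      m (2 ℕ.* s) (2 ℕ.* s) ≈⟨ ≈-sym (R.*-identityʳ _) ⟩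
      m (2 ℕ.* s) (2 ℕ.* s) ⊠ 𝟙 ∎)

    e-m : e ≈ m 1 1
    e-m = ≈-trans (Θ⁻-product 1 2) (≈-sym (pf∞-split3 𝟙 1 1))

    m12 : m 1 2 ≈ m 1 6 ⊠ m 3 6 ⊠ m 5 6
    m12 = pf∞-split3 𝟙 1 2

    φ-m : φ ≈ m 1 2 ⊠ m 1 2 ⊠ m 2 2
    φ-m = Θ⁻-product 1 1

    a-m : a ≈ m 3 6 ⊠ m 3 6 ⊠ m 6 6
    a-m = Θ⁻-product 3 3

    b-m : b ≈ m 1 6 ⊠ m 5 6 ⊠ m 6 6
    b-m = Θ⁻-product 1 5

    m33 : m 3 3 ≈ m 3 6 ⊠ m 6 6
    m33 = pf∞-split2 𝟙 3 3

    m11 : m 1 1 ≈ m 1 2 ⊠ m 2 2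
    m11 = pf∞-split2 𝟙 1 1

    κ-m : κ ≈ p 1 3 ⊠ p 2 3 ⊠ p 3 3
    κ-m = pf∞-split3 (⊟ 𝟙) 1 1

  κ-unit : IsUnit κ
  κ-unit = pf∞-unit (⊟ 𝟙) 1 1

  φ-unit : IsUnit φ
  φ-unit = unit-≈ (≈-sym φ-m) (unit-⊠ (unit-⊠ (pf∞-unit 𝟙 1 2) (pf∞-unit 𝟙 1 2)) (pf∞-unit 𝟙 2 2))

  a-unit : IsUnit a
  a-unit = unit-≈ (≈-sym a-m) (unit-⊠ (unit-⊠ (pf∞-unit 𝟙 3 6) (pf∞-unit 𝟙 3 6)) (pf∞-unit 𝟙 6 6))

  b-unit : IsUnit b
  b-unit = unit-≈ (≈-sym b-m) (unit-⊠ (unit-⊠ (pf∞-unit 𝟙 1 6) (pf∞-unit 𝟙 5 6)) (pf∞-unit 𝟙 6 6))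

  Θ⁻24-F : Θ⁻ 2 4 ≈ F
  Θ⁻24-F = ≈-trans (Θ⁻-product 2 4) (≈-sym (pf∞-split3 𝟙 2 2))

  -- Multiplication by `κ` leads from φ to `e` and from `e` to `F`, and likewise from `a` to `u` and
  -- from `b` to `v`. It reduces the non-alternating theta constants to the alternating ones.
  κe : κ ⊠ e ≈ F
  κe = ≈-trans (R.*-cong ≈-refl e-m) (pf∞-double 1 1)

  κφ : κ ⊠ φ ≈ e
  κφ = begin
    κ ⊠ φ ≈⟨ R.*-cong ≈-refl φ-m ⟩
    κ ⊠ (m 1 2 ⊠ m 1 2 ⊠ m 2 2) ≈⟨ solve 3 (λ k x y → k :* (x :* x :* y) := (k :* x) :* (x :* y)) ≈-refl κ (m 1 2) (m 2 2) ⟩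
    (κ ⊠ m 1 2) ⊠ (m 1 2 ⊠ m 2 2) ≈⟨ R.*-cong (euler 1) (≈-sym m11) ⟩
    𝟙 ⊠ m 1 1 ≈⟨ R.*-identityˡ (m 1 1) ⟩
    m 1 1 ≈⟨ ≈-sym e-m ⟩
    e ∎

  κa : κ ⊠ a ≈ u
  κa = begin
    κ ⊠ a ≈⟨ R.*-cong κ-m a-m ⟩
    p 1 3 ⊠ p 2 3 ⊠ p 3 3 ⊠ (m 3 6 ⊠ m 3 6 ⊠ m 6 6)
      ≈⟨ solve 5 (λ x y z w t → x :* y :* z :* (w :* w :* t) := x :* y :* (w :* t) :* (z :* w)) ≈-refl (p 1 3) (p 2 3) (p 3 3) (m 3 6) (m 6 6) ⟩
    p 1 3 ⊠ p 2 3 ⊠ (m 3 6 ⊠ m 6 6) ⊠ (p 3 3 ⊠ m 3 6) ≈⟨ R.*-cong (R.*-cong ≈-refl (≈-sym m33)) (euler 3) ⟩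
    p 1 3 ⊠ p 2 3 ⊠ m 3 3 ⊠ 𝟙 ≈⟨ R.*-identityʳ _ ⟩
    p 1 3 ⊠ p 2 3 ⊠ m 3 3 ≈⟨ ≈-sym (Θ⁺-product 1 2) ⟩
    u ∎

  private
    κ-m16 : κ ⊠ (m 1 6 ⊠ m 5 6) ≈ p 3 3
    κ-m16 = cancelˡ (pf∞-unit 𝟙 3 6) (begin
      m 3 6 ⊠ (κ ⊠ (m 1 6 ⊠ m 5 6)) ≈⟨ solve 4 (λ c k x y → c :* (k :* (x :* y)) := k :* (x :* c :* y)) ≈-refl (m 3 6) κ (m 1 6) (m 5 6) ⟩
      κ ⊠ (m 1 6 ⊠ m 3 6 ⊠ m 5 6) ≈⟨ R.*-cong ≈-refl (≈-sym m12) ⟩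
      κ ⊠ m 1 2 ≈⟨ euler 1 ⟩
      𝟙 ≈⟨ ≈-sym (euler 3) ⟩
      p 3 3 ⊠ m 3 6 ≈⟨ R.*-comm _ _ ⟩
      m 3 6 ⊠ p 3 3 ∎)

  κb : κ ⊠ b ≈ v
  κb = begin
    κ ⊠ b ≈⟨ R.*-cong ≈-refl b-m ⟩
    κ ⊠ (m 1 6 ⊠ m 5 6 ⊠ m 6 6) ≈⟨ ≈-sym (R.*-assoc κ _ _) ⟩
    κ ⊠ (m 1 6 ⊠ m 5 6) ⊠ m 6 6 ≈⟨ R.*-cong κ-m16 ≈-refl ⟩
    p 3 3 ⊠ m 6 6 ≈⟨ solve 2 (λ x y → x :* y := x :* con (+ 1) :* y) ≈-refl (p 3 3) (m 6 6) ⟩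
    p 3 3 ⊠ 𝟙 ⊠ m 6 6 ≈⟨ R.*-cong (R.*-cong ≈-refl (≈-sym (euler 3))) ≈-refl ⟩
    p 3 3 ⊠ (p 3 3 ⊠ m 3 6) ⊠ m 6 6 ≈⟨ solve 3 (λ x y z → x :* (x :* y) :* z := x :* x :* (y :* z)) ≈-refl (p 3 3) (m 3 6) (m 6 6) ⟩
    p 3 3 ⊠ p 3 3 ⊠ (m 3 6 ⊠ m 6 6) ≈⟨ R.*-cong ≈-refl (≈-sym m33) ⟩
    v ∎

  Θ⁺03-v : Θ⁺ 0 3 ≈ two ⊠ v
  Θ⁺03-v = ≈-trans (Θ⁺-product 0 3) (≈-trans (R.*-cong (R.*-cong (pf∞-plus-0 3) ≈-refl) ≈-refl)
    (solve 3 (λ c x y → c :* x :* x :* y := c :* (x :* x :* y)) ≈-refl two (p 3 3) (m 3 3)))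

  Θ⁺01-κ : Θ⁺ 0 1 ≈ two ⊠ (κ ⊠ F)
  Θ⁺01-κ = ≈-trans (Θ⁺-product 0 1) (≈-trans (R.*-cong (R.*-cong (pf∞-plus-0 1) ≈-refl) (≈-sym e-m))
    (≈-trans (solve 3 (λ c x y → c :* x :* x :* y := c :* (x :* (x :* y))) ≈-refl two κ e) (R.*-cong ≈-refl (R.*-cong ≈-refl κe))))

  Jac-e : Jac 1 ≈ two ⊠ (e ⊠ e ⊠ e)
  Jac-e = ≈-trans (Jac-cube 1) (R.*-cong ≈-refl (R.*-cong (R.*-cong (≈-sym e-m) (≈-sym e-m)) (≈-sym e-m)))

  Jac-E : Jac 6 ≈ two ⊠ (E ⊠ E ⊠ E)
  Jac-E = Jac-cube 6

  -- Translates `E`³ into `a`, `b`, `F`. All powers of J_6 in the theorem are powers of this cube.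
  φE³ : φ ⊠ (E ⊠ E ⊠ E) ≈ a ⊠ b ⊠ b ⊠ F
  φE³ = begin
    φ ⊠ (E ⊠ E ⊠ E) ≈⟨ R.*-cong (≈-trans φ-m (R.*-cong (R.*-cong m12 m12) ≈-refl)) ≈-refl ⟩
    m 1 6 ⊠ m 3 6 ⊠ m 5 6 ⊠ (m 1 6 ⊠ m 3 6 ⊠ m 5 6) ⊠ F ⊠ (E ⊠ E ⊠ E)
      ≈⟨ solve 5 (λ x y z f e → x :* y :* z :* (x :* y :* z) :* f :* (e :* e :* e) := (y :* y :* e) :* (x :* z :* e) :* (x :* z :* e) :* f) ≈-refl (m 1 6) (m 3 6) (m 5 6) F E ⟩
    (m 3 6 ⊠ m 3 6 ⊠ E) ⊠ (m 1 6 ⊠ m 5 6 ⊠ E) ⊠ (m 1 6 ⊠ m 5 6 ⊠ E) ⊠ F ≈⟨ R.*-cong (R.*-cong (R.*-cong (≈-sym a-m) (≈-sym b-m)) (≈-sym b-m)) ≈-refl ⟩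
    a ⊠ b ⊠ b ⊠ F ∎

  E³-unit : IsUnit (E ⊠ E ⊠ E)
  E³-unit = unit-⊠ (unit-⊠ (P∞-unit 6) (P∞-unit 6)) (P∞-unit 6)

  F-unit : IsUnit F
  F-unit = P∞-unit 2

  -- `τ-Jac` presents 2τ as 2e³ divided by 2κF; with e = κφ and κe = F everything except φ² cancels.
  τ-φ : two ⊠ τ ≈ φ ⊠ φ
  τ-φ = cancelˡ (unit-⊠ unit-two (unit-⊠ κ-unit F-unit)) (begin
    two ⊠ (κ ⊠ F) ⊠ (two ⊠ τ) ≈⟨ R.*-comm _ _ ⟩
    two ⊠ τ ⊠ (two ⊠ (κ ⊠ F)) ≈⟨ R.*-cong ≈-refl (≈-sym Θ⁺01-κ) ⟩
    two ⊠ τ ⊠ Θ⁺ 0 1 ≈⟨ τ-Jac ⟩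
    Jac 1 ≈⟨ Jac-e ⟩
    two ⊠ (e ⊠ e ⊠ e) ≈⟨ R.*-cong ≈-refl (R.*-cong (R.*-cong (≈-sym κφ) (≈-sym κφ)) ≈-refl) ⟩
    two ⊠ (κ ⊠ φ ⊠ (κ ⊠ φ) ⊠ e) ≈⟨ solve 4 (λ c k f e → c :* (k :* f :* (k :* f) :* e) := c :* (k :* (k :* e)) :* (f :* f)) ≈-refl two κ φ e ⟩
    two ⊠ (κ ⊠ (κ ⊠ e)) ⊠ (φ ⊠ φ) ≈⟨ R.*-cong (R.*-cong ≈-refl (R.*-cong ≈-refl κe)) ≈-refl ⟩
    two ⊠ (κ ⊠ F) ⊠ (φ ⊠ φ) ∎)

  φτ₆ : φ ⊠ τ₆ ≈ a ⊠ b ⊠ b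
  φτ₆ = cancelˡ (unit-⊠ unit-two F-unit) (begin
    two ⊠ F ⊠ (φ ⊠ τ₆) ≈⟨ solve 4 (λ c f x y → c :* f :* (x :* y) := x :* (c :* y :* f)) ≈-refl two F φ τ₆ ⟩
    φ ⊠ (two ⊠ τ₆ ⊠ F) ≈⟨ R.*-cong ≈-refl (≈-trans (R.*-cong ≈-refl (≈-sym Θ⁻24-F)) (≈-trans τ₆-Jac Jac-E)) ⟩
    φ ⊠ (two ⊠ (E ⊠ E ⊠ E)) ≈⟨ solve 3 (λ c x y → x :* (c :* y) := c :* (x :* y)) ≈-refl two φ (E ⊠ E ⊠ E) ⟩
    two ⊠ (φ ⊠ (E ⊠ E ⊠ E)) ≈⟨ R.*-cong ≈-refl φE³ ⟩
    two ⊠ (a ⊠ b ⊠ b ⊠ F) ≈⟨ solve 4 (λ c x y f → c :* (x :* y :* y :* f) := c :* f :* (x :* y :* y)) ≈-refl two a b F ⟩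
    two ⊠ F ⊠ (a ⊠ b ⊠ b) ∎)

  Ξ-κφ³ : Ξ ≈ κ ⊠ (φ ⊠ φ ⊠ φ)
  Ξ-κφ³ = cancelˡ (unit-⊠ unit-two F-unit) (begin
    two ⊠ F ⊠ Ξ ≈⟨ R.*-assoc two F Ξ ⟩
    two ⊠ (F ⊠ Ξ) ≈⟨ R.*-cong ≈-refl (R.*-cong (≈-sym (≈-trans (Θ⁻-comm 4 2) Θ⁻24-F)) ≈-refl) ⟩
    two ⊠ (Θ⁻ 4 2 ⊠ Ξ) ≈⟨ ≈-sym Θ⁻11-Jac ⟩
    φ ⊠ Jac 1 ≈⟨ R.*-cong ≈-refl Jac-e ⟩
    φ ⊠ (two ⊠ (e ⊠ e ⊠ e)) ≈⟨ R.*-cong ≈-refl (R.*-cong ≈-refl (R.*-cong (R.*-cong (≈-sym κφ) (≈-sym κφ)) ≈-refl)) ⟩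
    φ ⊠ (two ⊠ (κ ⊠ φ ⊠ (κ ⊠ φ) ⊠ e)) ≈⟨ solve 4 (λ c k f e → f :* (c :* (k :* f :* (k :* f) :* e)) := c :* (k :* e) :* (k :* (f :* f :* f))) ≈-refl two κ φ e ⟩
    two ⊠ (κ ⊠ e) ⊠ (κ ⊠ (φ ⊠ φ ⊠ φ)) ≈⟨ R.*-cong (R.*-cong ≈-refl κe) ≈-refl ⟩
    two ⊠ F ⊠ (κ ⊠ (φ ⊠ φ ⊠ φ)) ∎)

open Product-relations

-- Dissection of a series by exponents modulo 3.

module Dissection where
  -- sub f = f(q³), and c i f collects the coefficients of the exponents ≡ i (mod 3).
  sub : PS → PS
  sub f 0 = f 0
  sub f 1 = 0ℚ
  sub f 2 = 0ℚ
  sub f (suc (suc (suc n))) = sub (tl f) n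

  c : ℕ → PS → PS
  c i f n = f (3 ℕ.* n ℕ.+ i)

  sub-ext : ∀ {f g} → (∀ n → f n ≡ g n) → ∀ n → sub f n ≡ sub g n
  sub-ext p 0 = p 0
  sub-ext p 1 = refl
  sub-ext p 2 = refl
  sub-ext p (suc (suc (suc n))) = sub-ext (p ∘ suc) n

  sub-cong : ∀ {f g} → f ≈ g → sub f ≈ sub g
  sub-cong p .at = sub-ext (p .at)

  private
    sub-+ : ∀ f g n → sub (λ m → f m ℚ.+ g m) n ≡ sub f n ℚ.+ sub g n
    sub-+ f g 0 = refl
    sub-+ f g 1 = refl
    sub-+ f g 2 = refl
    sub-+ f g (suc (suc (suc n))) = sub-+ (tl f) (tl g) n

    sub-c* : ∀ x f n → sub (λ m → x ℚ.* f m) n ≡ x ℚ.* sub f n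
    sub-c* x f 0 = refl
    sub-c* x f 1 = sym (ℚP.*-zeroʳ x)
    sub-c* x f 2 = sym (ℚP.*-zeroʳ x)
    sub-c* x f (suc (suc (suc n))) = sub-c* x (tl f) n

    ⊠-zero-head : ∀ f g n → f 0 ≡ 0ℚ → (f ⊠ g) (suc n) ≡ (tl f ⊠ g) n
    ⊠-zero-head f g n p = trans (⊠-suc f g n) (trans (cong (ℚ._+ (tl f ⊠ g) n) (trans (cong (ℚ._* g (suc n)) p) (ℚP.*-zeroˡ (g (suc n))))) (ℚP.+-identityˡ _))

    ⊠-zero-0 : ∀ f g → f 0 ≡ 0ℚ → (f ⊠ g) 0 ≡ 0ℚ
    ⊠-zero-0 f g p = trans (⊠-0 f g) (trans (cong (ℚ._* g 0) p) (ℚP.*-zeroˡ (g 0)))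

    sub-mul : ∀ f g n → (sub f ⊠ sub g) n ≡ sub (f ⊠ g) n
    sub-mul f g 0 = trans (⊠-0 (sub f) (sub g)) (sym (⊠-0 f g))
    sub-mul f g 1 = trans (⊠-suc (sub f) (sub g) 0) (cong₂ ℚ._+_ (ℚP.*-zeroʳ (f 0)) (⊠-zero-0 (tl (sub f)) (sub g) refl))
    sub-mul f g 2 = trans (⊠-suc (sub f) (sub g) 1) (cong₂ ℚ._+_ (ℚP.*-zeroʳ (f 0))
      (trans (⊠-zero-head (tl (sub f)) (sub g) 0 refl) (⊠-zero-0 (tl (tl (sub f))) (sub g) refl)))
    sub-mul f g (suc (suc (suc n))) = begin
      (sub f ⊠ sub g) (suc (suc (suc n))) ≡⟨ ⊠-suc (sub f) (sub g) (suc (suc n)) ⟩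
      f 0 ℚ.* sub (tl g) n ℚ.+ (tl (sub f) ⊠ sub g) (suc (suc n))
        ≡⟨ cong (f 0 ℚ.* sub (tl g) n ℚ.+_) (trans (⊠-zero-head (tl (sub f)) (sub g) (suc n) refl) (⊠-zero-head (tl (tl (sub f))) (sub g) n refl)) ⟩
      f 0 ℚ.* sub (tl g) n ℚ.+ (sub (tl f) ⊠ sub g) n ≡⟨ cong₂ ℚ._+_ (sym (sub-c* (f 0) (tl g) n)) (sub-mul (tl f) g n) ⟩
      sub (λ m → f 0 ℚ.* tl g m) n ℚ.+ sub (tl f ⊠ g) n ≡⟨ sym (sub-+ (λ m → f 0 ℚ.* tl g m) (tl f ⊠ g) n) ⟩
      sub (λ m → f 0 ℚ.* tl g m ℚ.+ (tl f ⊠ g) m) n ≡⟨ sub-ext (λ m → sym (⊠-suc f g m)) n ⟩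
      sub (tl (f ⊠ g)) n ∎
      where open ≡-Reasoning

  sub-⊠ : ∀ f g → sub (f ⊠ g) ≈ sub f ⊠ sub g
  sub-⊠ f g .at n = sym (sub-mul f g n)

  sub-⊞ : ∀ f g → sub (f ⊞ g) ≈ sub f ⊞ sub g
  sub-⊞ f g .at n = trans (sub-ext (⊞-at f g) n) (trans (sub-+ f g n) (sym (⊞-at (sub f) (sub g) n)))

  sub-⊟ : ∀ f → sub (⊟ f) ≈ ⊟ sub f
  sub-⊟ f .at n = trans (sub-ext (⊟-at f) n) (trans (go f n) (sym (⊟-at (sub f) n)))
    where
    go : ∀ f n → sub (λ m → ℚ.- f m) n ≡ ℚ.- sub f n
    go f 0 = refl
    go f 1 = refl
    go f 2 = refl
    go f (suc (suc (suc n))) = go (tl f) n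

  sub-constS : ∀ x → sub (constS x) ≈ constS x
  sub-constS x .at 0 = refl
  sub-constS x .at 1 = refl
  sub-constS x .at 2 = refl
  sub-constS x .at (suc (suc (suc n))) = go n
    where
    go : ∀ n → sub (λ _ → 0ℚ) n ≡ 0ℚ
    go 0 = refl
    go 1 = refl
    go 2 = refl
    go (suc (suc (suc n))) = go n

  sub-fromℤ : ∀ z → sub (fromℤ z) ≈ fromℤ z
  sub-fromℤ z = ≈-trans (sub-cong (mk≈ (fromℤ-constS z))) (≈-trans (sub-constS (ℤ→ℚ z)) (≈-sym (mk≈ (fromℤ-constS z))))

  sub-𝟙 : sub 𝟙 ≈ 𝟙
  sub-𝟙 = sub-fromℤ (+ 1)

  sub-𝟘 : sub 𝟘 ≈ 𝟘
  sub-𝟘 = sub-fromℤ (+ 0)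

  sub-ε : ∀ k → sub (ε k) ≈ ε k
  sub-ε k = go ∣ k ∣
    where
    go : ∀ n → sub (εℕ n) ≈ εℕ n
    go zero = sub-𝟙
    go (suc n) = ≈-trans (sub-⊟ (εℕ n)) (R.-‿cong (go n))

  private
    q1-at : ∀ n → (q^ 1) n ≡ mono 1 n
    q1-at = q^-at 1

    sub-q1 : sub (q^ 1) ≈ q^ 3
    sub-q1 .at n = trans (sub-ext q1-at n) (trans (go n) (sym (q^-at 3 n)))
      where
      z : ∀ n → sub (λ m → mono 1 (suc (suc m))) n ≡ mono 3 (suc (suc (suc (suc (suc (suc n))))))
      z 0 = refl
      z 1 = refl
      z 2 = refl
      z (suc (suc (suc n))) = z′ n
        where
        z′ : ∀ n → sub (λ m → mono 1 (suc (suc (suc m)))) n ≡ mono 3 (suc (suc (suc (suc (suc (suc (suc (suc (suc n)))))))))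
        z′ 0 = refl
        z′ 1 = refl
        z′ 2 = refl
        z′ (suc (suc (suc n))) = zz n
          where
          zz : ∀ n → sub (λ m → 0ℚ) n ≡ 0ℚ
          zz 0 = refl
          zz 1 = refl
          zz 2 = refl
          zz (suc (suc (suc n))) = zz n
      go : ∀ n → sub (mono 1) n ≡ mono 3 n
      go 0 = refl
      go 1 = refl
      go 2 = refl
      go 3 = refl
      go 4 = refl
      go 5 = refl
      go (suc (suc (suc (suc (suc (suc n)))))) = z n

  sub-q^ : ∀ n → sub (q^ n) ≈ q^ (3 ℕ.* n)
  sub-q^ zero = ≈-trans (sub-cong q^-0) (≈-trans sub-𝟙 (≈-sym q^-0))
  sub-q^ (suc n) = ≈-trans (sub-cong (q^-+ 1 n)) (≈-trans (sub-⊠ (q^ 1) (q^ n)) (≈-trans (R.*-cong sub-q1 (sub-q^ n))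
    (≈-trans (≈-sym (q^-+ 3 (3 ℕ.* n))) (q^≡ (sym (ℕP.*-suc 3 n))))))

  c-cong : ∀ i {f g} → f ≈ g → c i f ≈ c i g
  c-cong i p .at n = p .at (3 ℕ.* n ℕ.+ i)

  c-≈[] : ∀ i {N f g} → f ≈[ 3 ℕ.* N ℕ.+ i ] g → c i f ≈[ N ] c i g
  c-≈[] i {N} p .below n l = p .below (3 ℕ.* n ℕ.+ i) (ℕP.+-monoˡ-< i (ℕP.*-monoʳ-< 3 l))

  c-⊞ : ∀ i f g → c i (f ⊞ g) ≈ c i f ⊞ c i g
  c-⊞ i f g .at n = trans (⊞-at f g _) (sym (⊞-at (c i f) (c i g) n))

  sub-≈[] : ∀ {N f g} → f ≈[ N ] g → sub f ≈[ N ] sub g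
  sub-≈[] {N} p = mk≈[] (go p)
    where
    go : ∀ {N f g} → f ≈[ N ] g → ∀ n → n ℕ.< N → sub f n ≡ sub g n
    go p 0 l = p .below 0 l
    go p 1 l = refl
    go p 2 l = refl
    go {suc N} p (suc (suc (suc n))) (s≤s l) = go (≈[]-tl p) n (ℕP.≤-trans (ℕP.≤-trans (ℕP.n≤1+n _) (ℕP.n≤1+n _)) l)

  D3 : PS → PS → PS → PS
  D3 f g h = sub f ⊞ q^ 1 ⊠ sub g ⊞ q^ 2 ⊠ sub h

  D3-cong : ∀ {f f′ g g′ h h′} → f ≈ f′ → g ≈ g′ → h ≈ h′ → D3 f g h ≈ D3 f′ g′ h′
  D3-cong p q r = R.+-cong (R.+-cong (sub-cong p) (R.*-cong ≈-refl (sub-cong q))) (R.*-cong ≈-refl (sub-cong r))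

  private
    D3-at0 : ∀ f g h → D3 f g h 0 ≡ f 0
    D3-at0 f g h = trans (⊞-at _ _ 0) (trans (cong₂ ℚ._+_ (⊞-at _ _ 0) (q^-⊠-low 2 (sub h) 0 (s≤s z≤n)))
      (trans (ℚP.+-identityʳ _) (trans (cong (f 0 ℚ.+_) (q^-⊠-low 1 (sub g) 0 (s≤s z≤n))) (ℚP.+-identityʳ _))))

    D3-at1 : ∀ f g h → D3 f g h 1 ≡ g 0
    D3-at1 f g h = trans (⊞-at _ _ 1) (trans (cong₂ ℚ._+_ (⊞-at _ _ 1) (q^-⊠-low 2 (sub h) 1 (s≤s (s≤s z≤n))))
      (trans (ℚP.+-identityʳ _) (trans (cong (0ℚ ℚ.+_) (q^-⊠-high 1 (sub g) 0)) (ℚP.+-identityˡ _))))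

    D3-at2 : ∀ f g h → D3 f g h 2 ≡ h 0
    D3-at2 f g h = trans (⊞-at _ _ 2) (trans (cong₂ ℚ._+_ (⊞-at _ _ 2) (q^-⊠-high 2 (sub h) 0))
      (trans (cong (ℚ._+ h 0) (trans (cong (0ℚ ℚ.+_) (q^-⊠-high 1 (sub g) 1)) (ℚP.+-identityʳ 0ℚ))) (ℚP.+-identityˡ _)))

    D3-at3 : ∀ f g h n → D3 f g h (suc (suc (suc n))) ≡ D3 (tl f) (tl g) (tl h) n
    D3-at3 f g h n = trans (⊞-at _ _ (suc (suc (suc n)))) (trans (cong₂ ℚ._+_ (trans (⊞-at _ _ (suc (suc (suc n)))) (cong (sub (tl f) n ℚ.+_) (eq1 n))) (eq2 n))
      (sym (trans (⊞-at _ _ n) (cong (ℚ._+ (q^ 2 ⊠ sub (tl h)) n) (⊞-at _ _ n)))))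
      where
      eq1 : ∀ n → (q^ 1 ⊠ sub g) (suc (suc (suc n))) ≡ (q^ 1 ⊠ sub (tl g)) n
      eq1 zero = trans (q^-⊠-high 1 (sub g) 2) (sym (q^-⊠-low 1 (sub (tl g)) 0 (s≤s z≤n)))
      eq1 (suc n) = trans (q^-⊠-high 1 (sub g) (suc (suc (suc n)))) (sym (q^-⊠-high 1 (sub (tl g)) n))
      eq2 : ∀ n → (q^ 2 ⊠ sub h) (suc (suc (suc n))) ≡ (q^ 2 ⊠ sub (tl h)) n
      eq2 zero = trans (q^-⊠-high 2 (sub h) 1) (sym (q^-⊠-low 2 (sub (tl h)) 0 (s≤s z≤n)))
      eq2 (suc zero) = trans (q^-⊠-high 2 (sub h) 2) (sym (q^-⊠-low 2 (sub (tl h)) 1 (s≤s (s≤s z≤n))))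
      eq2 (suc (suc n)) = trans (q^-⊠-high 2 (sub h) (suc (suc (suc n)))) (sym (q^-⊠-high 2 (sub (tl h)) n))

    3+ : ∀ n i → 3 ℕ.* suc n ℕ.+ i ≡ suc (suc (suc (3 ℕ.* n ℕ.+ i)))
    3+ n i = cong (ℕ._+ i) (ℕP.*-suc 3 n)

    c-D3-step : ∀ i f g h n → c i (D3 f g h) (suc n) ≡ c i (D3 (tl f) (tl g) (tl h)) n
    c-D3-step i f g h n = trans (cong (D3 f g h) (3+ n i)) (D3-at3 f g h (3 ℕ.* n ℕ.+ i))

  c0-D3 : ∀ f g h → c 0 (D3 f g h) ≈ f
  c0-D3 f g h .at zero = D3-at0 f g h
  c0-D3 f g h .at (suc n) = trans (c-D3-step 0 f g h n) (c0-D3 (tl f) (tl g) (tl h) .at n)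

  c1-D3 : ∀ f g h → c 1 (D3 f g h) ≈ g
  c1-D3 f g h .at zero = D3-at1 f g h
  c1-D3 f g h .at (suc n) = trans (c-D3-step 1 f g h n) (c1-D3 (tl f) (tl g) (tl h) .at n)

  c2-D3 : ∀ f g h → c 2 (D3 f g h) ≈ h
  c2-D3 f g h .at zero = D3-at2 f g h
  c2-D3 f g h .at (suc n) = trans (c-D3-step 2 f g h n) (c2-D3 (tl f) (tl g) (tl h) .at n)

  D3-c : ∀ f → f ≈ D3 (c 0 f) (c 1 f) (c 2 f)
  D3-c f .at = go f
    where
    shift : ∀ i f n → tl (c i f) n ≡ c i (tl (tl (tl f))) n
    shift i f n = cong f (3+ n i)
    go : ∀ f n → f n ≡ D3 (c 0 f) (c 1 f) (c 2 f) n
    go f 0 = sym (D3-at0 (c 0 f) (c 1 f) (c 2 f))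
    go f 1 = sym (D3-at1 (c 0 f) (c 1 f) (c 2 f))
    go f 2 = sym (D3-at2 (c 0 f) (c 1 f) (c 2 f))
    go f (suc (suc (suc n))) = trans (go (tl (tl (tl f))) n)
      (trans (sym (D3-cong (mk≈ (shift 0 f)) (mk≈ (shift 1 f)) (mk≈ (shift 2 f)) .at n)) (sym (D3-at3 (c 0 f) (c 1 f) (c 2 f) n)))

  -- Products whose classes add up to 3 or 4 carry a factor q³, which turns into `q^ 1` inside
  -- `sub`.
  D3-⊠ : ∀ f₀ f₁ f₂ g₀ g₁ g₂ → D3 f₀ f₁ f₂ ⊠ D3 g₀ g₁ g₂ ≈
    D3 (f₀ ⊠ g₀ ⊞ q^ 1 ⊠ (f₁ ⊠ g₂ ⊞ f₂ ⊠ g₁)) (f₀ ⊠ g₁ ⊞ f₁ ⊠ g₀ ⊞ q^ 1 ⊠ (f₂ ⊠ g₂)) (f₀ ⊠ g₂ ⊞ f₁ ⊠ g₁ ⊞ f₂ ⊠ g₀)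
  D3-⊠ f₀ f₁ f₂ g₀ g₁ g₂ = ≈-sym (begin
    D3 (f₀ ⊠ g₀ ⊞ q^ 1 ⊠ (f₁ ⊠ g₂ ⊞ f₂ ⊠ g₁)) (f₀ ⊠ g₁ ⊞ f₁ ⊠ g₀ ⊞ q^ 1 ⊠ (f₂ ⊠ g₂)) (f₀ ⊠ g₂ ⊞ f₁ ⊠ g₁ ⊞ f₂ ⊠ g₀)
      ≈⟨ R.+-cong (R.+-cong
           (s+ (s* f₀ g₀) (sq* (s+ (s* f₁ g₂) (s* f₂ g₁))))
           (R.*-cong ≈-refl (s+ (s+ (s* f₀ g₁) (s* f₁ g₀)) (sq* (s* f₂ g₂)))))
           (R.*-cong q2 (s+ (s+ (s* f₀ g₂) (s* f₁ g₁)) (s* f₂ g₀))) ⟩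
    (F₀ ⊠ G₀ ⊞ x ⊠ x ⊠ x ⊠ (F₁ ⊠ G₂ ⊞ F₂ ⊠ G₁)) ⊞ x ⊠ (F₀ ⊠ G₁ ⊞ F₁ ⊠ G₀ ⊞ x ⊠ x ⊠ x ⊠ (F₂ ⊠ G₂)) ⊞ x ⊠ x ⊠ (F₀ ⊠ G₂ ⊞ F₁ ⊠ G₁ ⊞ F₂ ⊠ G₀)
      ≈⟨ solve 7 (λ x a b c d e f → (a :* d :+ x :* x :* x :* (b :* f :+ c :* e)) :+ x :* (a :* e :+ b :* d :+ x :* x :* x :* (c :* f)) :+ x :* x :* (a :* f :+ b :* e :+ c :* d)
           := (a :+ x :* b :+ x :* x :* c) :* (d :+ x :* e :+ x :* x :* f)) ≈-refl x F₀ F₁ F₂ G₀ G₁ G₂ ⟩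
    (F₀ ⊞ x ⊠ F₁ ⊞ x ⊠ x ⊠ F₂) ⊠ (G₀ ⊞ x ⊠ G₁ ⊞ x ⊠ x ⊠ G₂)
      ≈⟨ R.*-cong (R.+-cong ≈-refl (R.*-cong (≈-sym q2) ≈-refl)) (R.+-cong ≈-refl (R.*-cong (≈-sym q2) ≈-refl)) ⟩
    D3 f₀ f₁ f₂ ⊠ D3 g₀ g₁ g₂ ∎)
    where
    open ≈-Reasoning
    x = q^ 1
    F₀ = sub f₀
    F₁ = sub f₁
    F₂ = sub f₂
    G₀ = sub g₀
    G₁ = sub g₁
    G₂ = sub g₂
    q2 : q^ 2 ≈ x ⊠ x
    q2 = q^-+ 1 1
    q3 : sub (q^ 1) ≈ x ⊠ x ⊠ x
    q3 = ≈-trans (sub-q^ 1) (≈-trans (q^-+ 2 1) (R.*-cong q2 ≈-refl))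
    s* : ∀ f g → sub (f ⊠ g) ≈ sub f ⊠ sub g
    s* = sub-⊠
    s+ : ∀ {f g f′ g′} → sub f ≈ f′ → sub g ≈ g′ → sub (f ⊞ g) ≈ f′ ⊞ g′
    s+ {f} {g} p q = ≈-trans (sub-⊞ f g) (R.+-cong p q)
    sq* : ∀ {f f′} → sub f ≈ f′ → sub (q^ 1 ⊠ f) ≈ x ⊠ x ⊠ x ⊠ f′
    sq* {f} p = ≈-trans (sub-⊠ (q^ 1) f) (R.*-cong q3 p)

  D3-inj : ∀ {f₀ f₁ f₂ g₀ g₁ g₂} → D3 f₀ f₁ f₂ ≈ D3 g₀ g₁ g₂ → (f₀ ≈ g₀) × (f₁ ≈ g₁) × (f₂ ≈ g₂)
  D3-inj {f₀} {f₁} {f₂} {g₀} {g₁} {g₂} p =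
    ≈-trans (≈-sym (c0-D3 f₀ f₁ f₂)) (≈-trans (c-cong 0 p) (c0-D3 g₀ g₁ g₂)) ,
    ≈-trans (≈-sym (c1-D3 f₀ f₁ f₂)) (≈-trans (c-cong 1 p) (c1-D3 g₀ g₁ g₂)) ,
    ≈-trans (≈-sym (c2-D3 f₀ f₁ f₂)) (≈-trans (c-cong 2 p) (c2-D3 g₀ g₁ g₂))

  sub-sum : ∀ {F s} → IsSum F s → IsSum (sub ∘ F) (sub s)
  sub-sum {F} p = isSum (bound p) (λ N k l → ≈[]-trans (sub-≈[] (small p N k l)) (≈⇒≈[] sub-𝟘))
    (λ N → ≈[]-trans (≈⇒≈[] (≈-sym (go (bound p N)))) (sub-≈[] (sums p N)))
    where
    go : ∀ B → sub (symSum B F) ≈ symSum B (sub ∘ F)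
    go zero = ≈-refl
    go (suc B) = ≈-trans (sub-⊞ _ _) (R.+-cong (go B) (sub-⊞ _ _))

  private
    sub-1± : ∀ x → sub (𝟙 ⊞ x) ≈ 𝟙 ⊞ sub x
    sub-1± x = ≈-trans (sub-⊞ 𝟙 x) (R.+-cong sub-𝟙 ≈-refl)

    3*suc : ∀ n → 3 ℕ.* suc n ≡ suc (2 ℕ.+ 3 ℕ.* n)
    3*suc n = ℕP.*-suc 3 n

    sub-1+q : ∀ n → sub (1+q n) ≈ 1+q (2 ℕ.+ 3 ℕ.* n)
    sub-1+q n = ≈-trans (sub-1± (q^ suc n)) (R.+-cong ≈-refl (≈-trans (sub-q^ (suc n)) (q^≡ (3*suc n))))

    sub-1-q : ∀ n → sub (1-q n) ≈ 1-q (2 ℕ.+ 3 ℕ.* n)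
    sub-1-q n = ≈-trans (sub-1± (⊟ q^ suc n)) (R.+-cong ≈-refl (≈-trans (sub-⊟ (q^ suc n)) (R.-‿cong (≈-trans (sub-q^ (suc n)) (q^≡ (3*suc n))))))

    sub-recip : ∀ {f g} → f 0 ≡ 1ℚ → g 0 ≡ 1ℚ → sub f ≈ g → sub (inv f) ≈ inv g
    sub-recip {f} {g} p q e = cancelˡ (unit-one q) (≈-trans (R.*-cong (≈-sym e) ≈-refl)
      (≈-trans (≈-sym (sub-⊠ f (inv f))) (≈-trans (sub-cong (inv-⊠ p)) (≈-trans sub-𝟙 (≈-sym (inv-⊠ q))))))

    sub-inv⁺ : ∀ n → sub (inv (1+q n)) ≈ inv (1+q (2 ℕ.+ 3 ℕ.* n))
    sub-inv⁺ n = sub-recip (one-at-0 n) (one-at-0 (2 ℕ.+ 3 ℕ.* n)) (sub-1+q n)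

    sub-inv⁻ : ∀ n → sub (inv (1-q n)) ≈ inv (1-q (2 ℕ.+ 3 ℕ.* n))
    sub-inv⁻ n = sub-recip (one-at-0′ n) (one-at-0′ (2 ℕ.+ 3 ℕ.* n)) (sub-1-q n)

    3j-suc : ∀ n → + 3 ℤ.* + suc n ≡ + suc (2 ℕ.+ 3 ℕ.* n)
    3j-suc n = trans (sym (ℤP.pos-* 3 (suc n))) (cong +_ (3*suc n))

    3j-negsuc : ∀ n → + 3 ℤ.* -[1+ n ] ≡ -[1+ 2 ℕ.+ 3 ℕ.* n ]
    3j-negsuc n = trans (sym (ℤP.neg-distribʳ-* (+ 3) (+ suc n))) (cong ℤ.-_ (3j-suc n))

  -- Replacing q by q³ triples the kernel argument. This is why the sums to be dissected use kernels
  -- at multiples of 3: each class is again a sum of the same kernel.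
  sub-h⁺ : ∀ k → sub (h⁺ k) ≈ h⁺ (3j k)
  sub-h⁺ (+ zero) = sub-constS _
  sub-h⁺ (+ suc n) = ≈-trans (sub-inv⁺ n) (≈-reflexive (cong h⁺ (sym (3j-suc n))))
  sub-h⁺ -[1+ n ] = ≈-trans (≈-trans (sub-⊠ (q^ suc n) (inv (1+q n))) (R.*-cong (≈-trans (sub-q^ (suc n)) (q^≡ (3*suc n))) (sub-inv⁺ n))) (≈-reflexive (cong h⁺ (sym (3j-negsuc n))))

  sub-h⁻ : ∀ k → sub (h⁻ k) ≈ h⁻ (3j k)
  sub-h⁻ (+ zero) = sub-𝟘
  sub-h⁻ (+ suc n) = ≈-trans (sub-inv⁻ n) (≈-reflexive (cong h⁻ (sym (3j-suc n))))
  sub-h⁻ -[1+ n ] = ≈-trans (≈-trans (sub-⊟ _) (R.-‿cong (≈-trans (sub-⊠ (q^ suc n) (inv (1-q n))) (R.*-cong (≈-trans (sub-q^ (suc n)) (q^≡ (3*suc n))) (sub-inv⁻ n))))) (≈-reflexive (cong h⁻ (sym (3j-negsuc n))))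

  sub-h² : ∀ k → sub (h² k) ≈ h² (3j k)
  sub-h² k = ≈-trans (sub-⊠ (h⁺ k) (h⁺ (ℤ.- k))) (R.*-cong (sub-h⁺ k) (≈-trans (sub-h⁺ (ℤ.- k)) (≈-reflexive (cong h⁺ (sym (ℤP.neg-distribʳ-* (+ 3) k))))))

open Dissection

-- Trisections of the kernel sums and of the theta series.

module Trisections where
  private
    open ≈-Reasoning

    class : ∀ i (E₁ E₂ : Ex) → ⟦ E₁ ⟧² ≡ ⟦ lit i +E 3 *E E₂ ⟧² → q^ ⟦ E₁ ⟧ℕ ≈ q^ i ⊠ sub (q^ ⟦ E₂ ⟧ℕ)
    class i E₁ E₂ p = ≈-trans (q^≡ (ex-≡ E₁ (lit i +E 3 *E E₂) p)) (≈-trans (q^-+ i _) (R.*-cong ≈-refl (≈-sym (sub-q^ ⟦ E₂ ⟧ℕ))))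

    term⁺ : ∀ {x} k i E₁ E₂ {g g′} → x ≈ ε k → ⟦ E₁ ⟧² ≡ ⟦ lit i +E 3 *E E₂ ⟧² → sub g′ ≈ g →
      q^ i ⊠ sub (ε k ⊠ q^ ⟦ E₂ ⟧ℕ ⊠ g′) ≈ x ⊠ q^ ⟦ E₁ ⟧ℕ ⊠ g
    term⁺ {x} k i E₁ E₂ {g} {g′} p e h = begin
      q^ i ⊠ sub (ε k ⊠ q^ ⟦ E₂ ⟧ℕ ⊠ g′) ≈⟨ R.*-cong ≈-refl (≈-trans (sub-⊠ _ g′) (R.*-cong (≈-trans (sub-⊠ (ε k) _) (R.*-cong (sub-ε k) ≈-refl)) h)) ⟩
      q^ i ⊠ (ε k ⊠ sub (q^ ⟦ E₂ ⟧ℕ) ⊠ g) ≈⟨ solve 4 (λ a x y g → a :* (x :* y :* g) := x :* (a :* y) :* g) ≈-refl (q^ i) (ε k) (sub (q^ ⟦ E₂ ⟧ℕ)) g ⟩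
      ε k ⊠ (q^ i ⊠ sub (q^ ⟦ E₂ ⟧ℕ)) ⊠ g ≈⟨ R.*-cong (R.*-cong (≈-sym p) (≈-sym (class i E₁ E₂ e))) ≈-refl ⟩
      x ⊠ q^ ⟦ E₁ ⟧ℕ ⊠ g ∎

    term⁻ : ∀ {x} k i E₁ E₂ {g g′} → x ≈ ⊟ ε k → ⟦ E₁ ⟧² ≡ ⟦ lit i +E 3 *E E₂ ⟧² → sub g′ ≈ g →
      ⊟ (q^ i ⊠ sub (ε k ⊠ q^ ⟦ E₂ ⟧ℕ ⊠ g′)) ≈ x ⊠ q^ ⟦ E₁ ⟧ℕ ⊠ g
    term⁻ {x} k i E₁ E₂ {g} {g′} p e h = ≈-trans (R.-‿cong (term⁺ k i E₁ E₂ {g} {g′} (≈-refl {ε k}) e h))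
      (≈-trans (solve 3 (λ x y g → :- (x :* y :* g) := :- x :* y :* g) ≈-refl (ε k) (q^ ⟦ E₁ ⟧ℕ) g) (R.*-cong (R.*-cong (≈-sym p) ≈-refl) ≈-refl))

    -- On each class of the index the exponent is i plus three times a theta exponent, so the class
    -- is q^i times a series in q³. The minus signs are ε(3j ± 1) = -ε(j).
    Λ-split : ∀ α β .{{_ : ℕ.NonZero (α ℕ.+ β)}} (g : ℤ → PS) i₀ i₁ i₂ α₀ β₀ α₁ β₁ α₂ β₂
      .{{_ : ℕ.NonZero (α₀ ℕ.+ β₀)}} .{{_ : ℕ.NonZero (α₁ ℕ.+ β₁)}} .{{_ : ℕ.NonZero (α₂ ℕ.+ β₂)}} (g₀ g₁ g₂ : ℤ → PS) →
      (∀ j → ⟦ θE α β (3j j) ⟧² ≡ ⟦ lit i₀ +E 3 *E θE α₀ β₀ j ⟧²) →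
      (∀ j → ⟦ θE α β (3j+1 j) ⟧² ≡ ⟦ lit i₁ +E 3 *E θE α₁ β₁ j ⟧²) →
      (∀ j → ⟦ θE α β (3j-1 j) ⟧² ≡ ⟦ lit i₂ +E 3 *E θE α₂ β₂ j ⟧²) →
      (∀ j → sub (g₀ j) ≈ g (3j j)) → (∀ j → sub (g₁ j) ≈ g (3j+1 j)) → (∀ j → sub (g₂ j) ≈ g (3j-1 j)) →
      Λ α β g ≈ q^ i₀ ⊠ sub (Λ α₀ β₀ g₀) ⊞ ⊟ (q^ i₁ ⊠ sub (Λ α₁ β₁ g₁)) ⊞ ⊟ (q^ i₂ ⊠ sub (Λ α₂ β₂ g₂))
    Λ-split α β g i₀ i₁ i₂ α₀ β₀ α₁ β₁ α₂ β₂ g₀ g₁ g₂ e₀ e₁ e₂ h₀ h₁ h₂ = sum-unique (Λ-isSum α β g) (sum-split3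
      (sum-cong (λ j → term⁺ j i₀ (θE α β (3j j)) (θE α₀ β₀ j) (ε-3j j) (e₀ j) (h₀ j)) ≈-refl (sum-⊠ (q^ i₀) (sub-sum (Λ-isSum α₀ β₀ g₀))))
      (sum-cong (λ j → term⁻ j i₁ (θE α β (3j+1 j)) (θE α₁ β₁ j) (ε-3j+1 j) (e₁ j) (h₁ j)) ≈-refl (sum-⊟ (sum-⊠ (q^ i₁) (sub-sum (Λ-isSum α₁ β₁ g₁)))))
      (sum-cong (λ j → term⁻ j i₂ (θE α β (3j-1 j)) (θE α₂ β₂ j) (ε-3j-1 j) (e₂ j) (h₂ j)) ≈-refl (sum-⊟ (sum-⊠ (q^ i₂) (sub-sum (Λ-isSum α₂ β₂ g₂))))))

    q0⊠ : ∀ x → q^ 0 ⊠ x ≈ x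
    q0⊠ x = ≈-trans (R.*-cong q^-0 ≈-refl) (R.*-identityˡ x)

    sub-⊞⊟ : ∀ f g → sub f ⊞ ⊟ sub g ≈ sub (f ⊞ ⊟ g)
    sub-⊞⊟ f g = ≈-sym (≈-trans (sub-⊞ f (⊟ g)) (R.+-cong ≈-refl (sub-⊟ g)))

  -- h stands for a kernel with h(k)(q³) = h(3k).
  Λ20-D3 : ∀ h → (∀ k → sub (h k) ≈ h (3j k)) →
    Λ 2 0 (h ∘ 3j) ≈ D3 (Λ 4 2 (h ∘ 3j) ⊞ ⊟ Λ 2 4 (h ∘ 3j-1)) 𝟘 (⊟ Λ 6 0 (h ∘ 3j+1))
  Λ20-D3 h hs = begin
    Λ 2 0 (h ∘ 3j) ≈⟨ Λ-split 2 0 (h ∘ 3j) 0 2 0 4 2 6 0 2 4 (h ∘ 3j) (h ∘ 3j+1) (h ∘ 3j-1)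
        (solveℤ 1 (λ j → let tr = λ x → x *' (x +' con' (+ 1)) ; th = λ a b x → con' a *' tr x +' con' b *' tr (x +' con' -[1+ 0 ]) in
          th (+ 2) (+ 0) (con' (+ 3) *' j) =' con' (+ 0) +' con' (+ 3) *' th (+ 4) (+ 2) j) refl)
        (solveℤ 1 (λ j → let tr = λ x → x *' (x +' con' (+ 1)) ; th = λ a b x → con' a *' tr x +' con' b *' tr (x +' con' -[1+ 0 ]) in
          th (+ 2) (+ 0) (con' (+ 3) *' j +' con' (+ 1)) =' con' (+ 4) +' con' (+ 3) *' th (+ 6) (+ 0) j) refl)
        (solveℤ 1 (λ j → let tr = λ x → x *' (x +' con' (+ 1)) ; th = λ a b x → con' a *' tr x +' con' b *' tr (x +' con' -[1+ 0 ]) in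
          th (+ 2) (+ 0) (con' (+ 3) *' j +' con' -[1+ 0 ]) =' con' (+ 0) +' con' (+ 3) *' th (+ 2) (+ 4) j) refl)
        (λ j → hs (3j j)) (λ j → hs (3j+1 j)) (λ j → hs (3j-1 j)) ⟩
    q^ 0 ⊠ sub x ⊞ ⊟ (q^ 2 ⊠ sub y) ⊞ ⊟ (q^ 0 ⊠ sub z)
      ≈⟨ R.+-cong (R.+-cong (q0⊠ (sub x)) ≈-refl) (R.-‿cong (q0⊠ (sub z))) ⟩
    sub x ⊞ ⊟ (q^ 2 ⊠ sub y) ⊞ ⊟ sub z
      ≈⟨ solve 5 (λ x y z a b → x :+ :- (a :* y) :+ :- z := (x :+ :- z) :+ b :* con (+ 0) :+ a :* :- y) ≈-refl (sub x) (sub y) (sub z) (q^ 2) (q^ 1) ⟩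
    (sub x ⊞ ⊟ sub z) ⊞ q^ 1 ⊠ 𝟘 ⊞ q^ 2 ⊠ ⊟ sub y
      ≈⟨ R.+-cong (R.+-cong (sub-⊞⊟ x z) (R.*-cong ≈-refl (≈-sym sub-𝟘))) (R.*-cong ≈-refl (≈-sym (sub-⊟ y))) ⟩
    D3 (x ⊞ ⊟ z) 𝟘 (⊟ y) ∎
    where
    x = Λ 4 2 (h ∘ 3j)
    y = Λ 6 0 (h ∘ 3j+1)
    z = Λ 2 4 (h ∘ 3j-1)

  private
    11-split : ∀ (g g₀ g₁ g₂ : ℤ → PS) → (∀ j → sub (g₀ j) ≈ g (3j j)) → (∀ j → sub (g₁ j) ≈ g (3j+1 j)) → (∀ j → sub (g₂ j) ≈ g (3j-1 j)) →
      Λ 1 1 g ≈ D3 (Λ 3 3 g₀) (⊟ (Λ 5 1 g₁ ⊞ Λ 1 5 g₂)) 𝟘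
    11-split g g₀ g₁ g₂ h₀ h₁ h₂ = begin
      Λ 1 1 g ≈⟨ Λ-split 1 1 g 0 1 1 3 3 5 1 1 5 g₀ g₁ g₂
        (solveℤ 1 (λ j → let tr = λ x → x *' (x +' con' (+ 1)) ; th = λ a b x → con' a *' tr x +' con' b *' tr (x +' con' -[1+ 0 ]) in
          th (+ 1) (+ 1) (con' (+ 3) *' j) =' con' (+ 0) +' con' (+ 3) *' th (+ 3) (+ 3) j) refl)
        (solveℤ 1 (λ j → let tr = λ x → x *' (x +' con' (+ 1)) ; th = λ a b x → con' a *' tr x +' con' b *' tr (x +' con' -[1+ 0 ]) in
          th (+ 1) (+ 1) (con' (+ 3) *' j +' con' (+ 1)) =' con' (+ 2) +' con' (+ 3) *' th (+ 5) (+ 1) j) refl)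
        (solveℤ 1 (λ j → let tr = λ x → x *' (x +' con' (+ 1)) ; th = λ a b x → con' a *' tr x +' con' b *' tr (x +' con' -[1+ 0 ]) in
          th (+ 1) (+ 1) (con' (+ 3) *' j +' con' -[1+ 0 ]) =' con' (+ 2) +' con' (+ 3) *' th (+ 1) (+ 5) j) refl)
        h₀ h₁ h₂ ⟩
      q^ 0 ⊠ sub x ⊞ ⊟ (q^ 1 ⊠ sub y) ⊞ ⊟ (q^ 1 ⊠ sub z) ≈⟨ R.+-cong (R.+-cong (q0⊠ (sub x)) ≈-refl) ≈-refl ⟩
      sub x ⊞ ⊟ (q^ 1 ⊠ sub y) ⊞ ⊟ (q^ 1 ⊠ sub z)
        ≈⟨ solve 5 (λ x y z a b → x :+ :- (a :* y) :+ :- (a :* z) := x :+ a :* :- (y :+ z) :+ b :* con (+ 0)) ≈-refl (sub x) (sub y) (sub z) (q^ 1) (q^ 2) ⟩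
      sub x ⊞ q^ 1 ⊠ ⊟ (sub y ⊞ sub z) ⊞ q^ 2 ⊠ 𝟘
        ≈⟨ R.+-cong (R.+-cong ≈-refl (R.*-cong ≈-refl (≈-sym (≈-trans (sub-⊟ (y ⊞ z)) (R.-‿cong (sub-⊞ y z)))))) (R.*-cong ≈-refl (≈-sym sub-𝟘)) ⟩
      D3 x (⊟ (y ⊞ z)) 𝟘 ∎
      where
      x = Λ 3 3 g₀
      y = Λ 5 1 g₁
      z = Λ 1 5 g₂

  Λ11-D3 : ∀ h → (∀ k → sub (h k) ≈ h (3j k)) →
    Λ 1 1 (h ∘ 3j) ≈ D3 (Λ 3 3 (h ∘ 3j)) (⊟ (Λ 5 1 (h ∘ 3j+1) ⊞ Λ 1 5 (h ∘ 3j-1))) 𝟘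
  Λ11-D3 h hs = 11-split (h ∘ 3j) (h ∘ 3j) (h ∘ 3j+1) (h ∘ 3j-1) (λ j → hs (3j j)) (λ j → hs (3j+1 j)) (λ j → hs (3j-1 j))

  private
    Λ-one : ∀ α β .{{_ : ℕ.NonZero (α ℕ.+ β)}} → Λ α β (λ _ → 𝟙) ≈ Θ⁻ α β
    Λ-one α β = sum-unique (Λ-isSum α β (λ _ → 𝟙)) (sum-cong (λ k → ≈-sym (R.*-identityʳ (θ⁻ α β k))) ≈-refl (Θ⁻-isSum α β))

  φ-D3 : φ ≈ D3 a (⊟ (two ⊠ b)) 𝟘
  φ-D3 = begin
    φ ≈⟨ ≈-sym (Λ-one 1 1) ⟩
    Λ 1 1 (λ _ → 𝟙) ≈⟨ 11-split (λ _ → 𝟙) (λ _ → 𝟙) (λ _ → 𝟙) (λ _ → 𝟙) (λ _ → sub-𝟙) (λ _ → sub-𝟙) (λ _ → sub-𝟙) ⟩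
    D3 (Λ 3 3 (λ _ → 𝟙)) (⊟ (Λ 5 1 (λ _ → 𝟙) ⊞ Λ 1 5 (λ _ → 𝟙))) 𝟘
      ≈⟨ D3-cong (Λ-one 3 3) (R.-‿cong (≈-trans (R.+-cong (≈-trans (Λ-one 5 1) (Θ⁻-comm 5 1)) (Λ-one 1 5)) (two≈ b))) ≈-refl ⟩
    D3 a (⊟ (two ⊠ b)) 𝟘 ∎

  private
    term-w : ∀ {x w} k i E₁ E₂ w′ → x ≈ ε k → ⟦ E₁ ⟧² ≡ ⟦ lit i +E 3 *E E₂ ⟧² → w ≈ fromℤ w′ →
      q^ i ⊠ sub (fromℤ w′ ⊠ (ε k ⊠ q^ ⟦ E₂ ⟧ℕ)) ≈ x ⊠ q^ ⟦ E₁ ⟧ℕ ⊠ w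
    term-w {x} {w} k i E₁ E₂ w′ p e h = ≈-trans (R.*-cong ≈-refl (sub-cong (R.*-comm (fromℤ w′) (ε k ⊠ q^ ⟦ E₂ ⟧ℕ))))
      (term⁺ k i E₁ E₂ {w} {fromℤ w′} p e (≈-trans (sub-fromℤ w′) (≈-sym h)))

  -- The indices l = 3j and l = 3j - 1 give three times pentagonal numbers with matching weights 1 -
  -- 6m, hence `Ψ` twice. The index l = 3j + 1 gives 1 + 9j(j+1)/2 with weight 3(2j + 1), hence
  -- three times `Jac 3`.
  Jac-D3 : Jac 1 ≈ D3 (two ⊠ Ψ) (⊟ (fromℤ (+ 3) ⊠ Jac 3)) 𝟘
  Jac-D3 = ≈-trans (sum-unique (jac-isSum 1) (sum-split3
      (sum-cong (λ j → term-w (ℤ.- j) 0 (1 *E triE (3j j)) (θE 1 2 (ℤ.- j)) (1-6m (ℤ.- j)) (≈-trans (ε-3j j) (≈-sym (ε-neg j)))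
          (solveℤ 1 (λ j → let tr = λ x → x *' (x +' con' (+ 1)) ; th = λ a b x → con' a *' tr x +' con' b *' tr (x +' con' -[1+ 0 ]) in
            con' (+ 1) *' tr (con' (+ 3) *' j) =' con' (+ 0) +' con' (+ 3) *' th (+ 1) (+ 2) (-' j)) refl j)
          (≈-reflexive (cong fromℤ (solveℤ 1 (λ j → con' (+ 3) *' j +' (con' (+ 3) *' j +' con' (+ 1)) =' con' (+ 1) +' -' (con' (+ 6) *' (-' j))) refl j))))
        ≈-refl (sum-⊠ (q^ 0) (sub-sum (sum-neg Ψ-isSum))))
      (sum-cong (λ j → ≈-trans (R.-‿cong (R.*-cong (≈-refl {fromℤ (+ 3)}) (R.*-cong (≈-refl {q^ 1}) (sub-cong (R.*-comm (t 3 j) (fromℤ (2l+1 j)))))))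
          (≈-trans (R.-‿cong (R.*-cong (≈-refl {fromℤ (+ 3)}) (term-w j 1 (1 *E triE (3j+1 j)) (3 *E triE j) (2l+1 j) (≈-refl {ε j})
              (solveℤ 1 (λ j → let tr = λ x → x *' (x +' con' (+ 1)) in
                con' (+ 1) *' tr (con' (+ 3) *' j +' con' (+ 1)) =' con' (+ 2) +' con' (+ 3) *' (con' (+ 3) *' tr j)) refl j) (≈-refl {fromℤ (2l+1 j)}))))
          (≈-trans (solve 4 (λ n x y w → :- (n :* (x :* y :* w)) := :- x :* y :* (n :* w)) ≈-refl (fromℤ (+ 3)) (ε j) (q^ (1 ℕ.* tri (3j+1 j))) (fromℤ (2l+1 j)))
            (R.*-cong (R.*-cong (≈-sym (ε-3j+1 j)) ≈-refl) (≈-trans (≈-sym (fromℤ-* (+ 3) (2l+1 j)))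
              (≈-reflexive (cong fromℤ (solveℤ 1 (λ j → con' (+ 3) *' (j +' (j +' con' (+ 1))) =' (con' (+ 3) *' j +' con' (+ 1)) +' ((con' (+ 3) *' j +' con' (+ 1)) +' con' (+ 1))) refl j))))))))
        ≈-refl (sum-⊟ (sum-⊠ (fromℤ (+ 3)) (sum-⊠ (q^ 1) (sub-sum (jac-isSum 3))))))
      (sum-cong (λ j → ≈-trans (term-w j 0 (1 *E triE (3j-1 j)) (θE 1 2 j) (1-6m j) (≈-refl {ε j})
          (solveℤ 1 (λ j → let tr = λ x → x *' (x +' con' (+ 1)) ; th = λ a b x → con' a *' tr x +' con' b *' tr (x +' con' -[1+ 0 ]) in
            con' (+ 1) *' tr (con' (+ 3) *' j +' con' -[1+ 0 ]) =' con' (+ 0) +' con' (+ 3) *' th (+ 1) (+ 2) j) refl j) (≈-refl {fromℤ (1-6m j)}))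
          (≈-trans (solve 3 (λ x y w → x :* y :* w := :- x :* y :* :- w) ≈-refl (ε j) (q^ (1 ℕ.* tri (3j-1 j))) (fromℤ (1-6m j)))
            (R.*-cong (R.*-cong (≈-sym (ε-3j-1 j)) ≈-refl) (≈-trans (≈-sym (fromℤ-neg (1-6m j)))
              (≈-reflexive (cong fromℤ (solveℤ 1 (λ j → -' (con' (+ 1) +' -' (con' (+ 6) *' j)) =' (con' (+ 3) *' j +' con' -[1+ 0 ]) +' ((con' (+ 3) *' j +' con' -[1+ 0 ]) +' con' (+ 1))) refl j)))))))
        ≈-refl (sum-⊠ (q^ 0) (sub-sum Ψ-isSum)))))
    (begin
      q^ 0 ⊠ sub Ψ ⊞ ⊟ (fromℤ (+ 3) ⊠ (q^ 1 ⊠ sub (Jac 3))) ⊞ q^ 0 ⊠ sub Ψ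
        ≈⟨ R.+-cong (R.+-cong (q0⊠ (sub Ψ)) ≈-refl) (q0⊠ (sub Ψ)) ⟩
      sub Ψ ⊞ ⊟ (fromℤ (+ 3) ⊠ (q^ 1 ⊠ sub (Jac 3))) ⊞ sub Ψ
        ≈⟨ solve 4 (λ x y a b → x :+ :- (con (+ 3) :* (a :* y)) :+ x := con (+ 2) :* x :+ a :* :- (con (+ 3) :* y) :+ b :* con (+ 0)) ≈-refl (sub Ψ) (sub (Jac 3)) (q^ 1) (q^ 2) ⟩
      two ⊠ sub Ψ ⊞ q^ 1 ⊠ ⊟ (fromℤ (+ 3) ⊠ sub (Jac 3)) ⊞ q^ 2 ⊠ 𝟘
        ≈⟨ R.+-cong (R.+-cong (≈-sym (≈-trans (sub-⊠ two Ψ) (R.*-cong (sub-fromℤ (+ 2)) ≈-refl)))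
             (R.*-cong ≈-refl (≈-sym (≈-trans (sub-⊟ _) (R.-‿cong (≈-trans (sub-⊠ (fromℤ (+ 3)) (Jac 3)) (R.*-cong (sub-fromℤ (+ 3)) ≈-refl)))))))
             (R.*-cong ≈-refl (≈-sym sub-𝟘)) ⟩
      D3 (two ⊠ Ψ) (⊟ (fromℤ (+ 3) ⊠ Jac 3)) 𝟘 ∎)

  Θ⁺01-D3 : Θ⁺ 0 1 ≈ D3 (two ⊠ u) (two ⊠ v) 𝟘
  Θ⁺01-D3 = ≈-trans (sum-unique (Θ⁺-isSum 0 1) (sum-split3
      (sum-cong (λ j → ≈-sym (class 0 (θE 0 1 (3j j)) (θE 1 2 j)
          (solveℤ 1 (λ j → let tr = λ x → x *' (x +' con' (+ 1)) ; th = λ a b x → con' a *' tr x +' con' b *' tr (x +' con' -[1+ 0 ]) in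
            th (+ 0) (+ 1) (con' (+ 3) *' j) =' con' (+ 0) +' con' (+ 3) *' th (+ 1) (+ 2) j) refl j))) ≈-refl (sum-⊠ (q^ 0) (sub-sum (Θ⁺-isSum 1 2))))
      (sum-cong (λ j → ≈-sym (class 0 (θE 0 1 (3j+1 j)) (θE 2 1 j)
          (solveℤ 1 (λ j → let tr = λ x → x *' (x +' con' (+ 1)) ; th = λ a b x → con' a *' tr x +' con' b *' tr (x +' con' -[1+ 0 ]) in
            th (+ 0) (+ 1) (con' (+ 3) *' j +' con' (+ 1)) =' con' (+ 0) +' con' (+ 3) *' th (+ 2) (+ 1) j) refl j))) ≈-refl (sum-⊠ (q^ 0) (sub-sum (Θ⁺-isSum 2 1))))
      (sum-cong (λ j → ≈-sym (class 1 (θE 0 1 (3j-1 j)) (θE 0 3 j)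
          (solveℤ 1 (λ j → let tr = λ x → x *' (x +' con' (+ 1)) ; th = λ a b x → con' a *' tr x +' con' b *' tr (x +' con' -[1+ 0 ]) in
            th (+ 0) (+ 1) (con' (+ 3) *' j +' con' -[1+ 0 ]) =' con' (+ 2) +' con' (+ 3) *' th (+ 0) (+ 3) j) refl j))) ≈-refl (sum-⊠ (q^ 1) (sub-sum (Θ⁺-isSum 0 3))))))
    (begin
      q^ 0 ⊠ sub u ⊞ q^ 0 ⊠ sub (Θ⁺ 2 1) ⊞ q^ 1 ⊠ sub (Θ⁺ 0 3)
        ≈⟨ R.+-cong (R.+-cong (q0⊠ (sub u)) (≈-trans (q0⊠ _) (sub-cong (Θ⁺-comm 2 1)))) (R.*-cong ≈-refl (sub-cong Θ⁺03-v)) ⟩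
      sub u ⊞ sub u ⊞ q^ 1 ⊠ sub (two ⊠ v) ≈⟨ R.+-cong (≈-trans (≈-sym (sub-⊞ u u)) (sub-cong (two≈ u))) ≈-refl ⟩
      sub (two ⊠ u) ⊞ q^ 1 ⊠ sub (two ⊠ v) ≈⟨ ≈-sym (R.+-identityʳ _) ⟩
      sub (two ⊠ u) ⊞ q^ 1 ⊠ sub (two ⊠ v) ⊞ 𝟘 ≈⟨ R.+-cong ≈-refl (≈-sym (≈-trans (R.*-cong ≈-refl sub-𝟘) (R.zeroʳ (q^ 2)))) ⟩
      D3 (two ⊠ u) (two ⊠ v) 𝟘 ∎)

open Trisections

-- The cubic norm of φ and its consequences.

module Cubic-norm where
  -- The norm from series in q to series in q³, with respect to the components modulo 3.
  norm : PS → PS → PS → PS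
  norm f g h = f ⊠ f ⊠ f ⊞ q^ 1 ⊠ (g ⊠ g ⊠ g) ⊞ q^ 1 ⊠ q^ 1 ⊠ (h ⊠ h ⊠ h) ⊞ ⊟ (fromℤ (+ 3) ⊠ q^ 1 ⊠ (f ⊠ g ⊠ h))

  private
    open ≈-Reasoning
    norm-cong : ∀ {f f′ g g′ h h′} → f ≈ f′ → g ≈ g′ → h ≈ h′ → norm f g h ≈ norm f′ g′ h′
    norm-cong p q r = R.+-cong (R.+-cong (R.+-cong (R.*-cong (R.*-cong p p) p) (R.*-cong ≈-refl (R.*-cong (R.*-cong q q) q)))
      (R.*-cong ≈-refl (R.*-cong (R.*-cong r r) r))) (R.-‿cong (R.*-cong ≈-refl (R.*-cong (R.*-cong p q) r)))

    norm-≈[] : ∀ {N f f′ g g′ h h′} → f ≈[ N ] f′ → g ≈[ N ] g′ → h ≈[ N ] h′ → norm f g h ≈[ N ] norm f′ g′ h′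
    norm-≈[] p q r = ≈[]-⊞ (≈[]-⊞ (≈[]-⊞ (≈[]-⊠ (≈[]-⊠ p p) p) (≈[]-⊠ (≈⇒≈[] ≈-refl) (≈[]-⊠ (≈[]-⊠ q q) q)))
      (≈[]-⊠ (≈⇒≈[] ≈-refl) (≈[]-⊠ (≈[]-⊠ r r) r))) (≈[]-⊟ (≈[]-⊠ (≈⇒≈[] ≈-refl) (≈[]-⊠ (≈[]-⊠ p q) r)))

  -- With ω a primitive cube root of unity this is f(t)·f(ωt)·f(ω²t) as a series in t³; `norm`
  -- expresses the product through the components of f, so ω never occurs.
  Norm : PS → PS
  Norm f = norm (c 0 f) (c 1 f) (c 2 f)

  Norm-cong : ∀ {f g} → f ≈ g → Norm f ≈ Norm g
  Norm-cong p = norm-cong (c-cong 0 p) (c-cong 1 p) (c-cong 2 p)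

  Norm-≈[] : ∀ {N f g} → f ≈[ 3 ℕ.* N ℕ.+ 2 ] g → Norm f ≈[ N ] Norm g
  Norm-≈[] {N} p = norm-≈[] (c-≈[] 0 (≈[]-weaken (ℕP.+-monoʳ-≤ (3 ℕ.* N) z≤n) p)) (c-≈[] 1 (≈[]-weaken (ℕP.+-monoʳ-≤ (3 ℕ.* N) (s≤s z≤n)) p)) (c-≈[] 2 p)

  Norm-D3 : ∀ f g h → Norm (D3 f g h) ≈ norm f g h
  Norm-D3 f g h = norm-cong (c0-D3 f g h) (c1-D3 f g h) (c2-D3 f g h)

  f1 : ℕ → PS
  f1 = fac 𝟙

  private
    fac-sub : ∀ i j → f1 (3 ℕ.* j ℕ.+ i) ≈ 𝟙 ⊞ q^ i ⊠ sub (⊟ q^ j)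
    fac-sub i j = R.+-cong ≈-refl (≈-trans (R.-‿cong (≈-trans (R.*-identityˡ _) (≈-trans (q^≡ (ℕP.+-comm (3 ℕ.* j) i)) (q^-+ i (3 ℕ.* j)))))
      (≈-trans (solve 2 (λ x y → :- (x :* y) := x :* :- y) ≈-refl (q^ i) (q^ (3 ℕ.* j))) (R.*-cong ≈-refl (≈-sym (≈-trans (sub-⊟ (q^ j)) (R.-‿cong (sub-q^ j)))))))

    fac-D3-0 : ∀ j → f1 (3 ℕ.* j) ≈ D3 (f1 j) 𝟘 𝟘
    fac-D3-0 j = ≈-sym (≈-trans (R.+-cong (R.+-cong (≈-trans (sub-⊞ 𝟙 (⊟ (𝟙 ⊠ q^ j))) (R.+-cong sub-𝟙 (≈-trans (sub-⊟ (𝟙 ⊠ q^ j)) (R.-‿cong (≈-trans (sub-⊠ 𝟙 (q^ j)) (R.*-cong sub-𝟙 (sub-q^ j)))))))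
        (R.*-cong ≈-refl sub-𝟘)) (R.*-cong ≈-refl sub-𝟘))
      (solve 3 (λ x y z → x :+ y :* con (+ 0) :+ z :* con (+ 0) := x) ≈-refl (f1 (3 ℕ.* j)) (q^ 1) (q^ 2)))

    fac-D3-1 : ∀ j → f1 (3 ℕ.* j ℕ.+ 1) ≈ D3 𝟙 (⊟ q^ j) 𝟘
    fac-D3-1 j = ≈-trans (fac-sub 1 j) (≈-sym (≈-trans (R.+-cong (R.+-cong sub-𝟙 ≈-refl) (R.*-cong ≈-refl sub-𝟘))
      (solve 3 (λ x y z → x :+ y :+ z :* con (+ 0) := x :+ y) ≈-refl 𝟙 (q^ 1 ⊠ sub (⊟ q^ j)) (q^ 2))))

    fac-D3-2 : ∀ j → f1 (3 ℕ.* j ℕ.+ 2) ≈ D3 𝟙 𝟘 (⊟ q^ j)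
    fac-D3-2 j = ≈-trans (fac-sub 2 j) (≈-sym (≈-trans (R.+-cong (R.+-cong sub-𝟙 (R.*-cong ≈-refl sub-𝟘)) ≈-refl)
      (solve 3 (λ x y z → x :+ z :* con (+ 0) :+ y := x :+ y) ≈-refl 𝟙 (q^ 2 ⊠ sub (⊟ q^ j)) (q^ 1))))

    Norm-⊠-D3 : ∀ f {g₀ g₁ g₂ y} → y ≈ D3 g₀ g₁ g₂ → Norm (f ⊠ y) ≈ norm
      (c 0 f ⊠ g₀ ⊞ q^ 1 ⊠ (c 1 f ⊠ g₂ ⊞ c 2 f ⊠ g₁)) (c 0 f ⊠ g₁ ⊞ c 1 f ⊠ g₀ ⊞ q^ 1 ⊠ (c 2 f ⊠ g₂)) (c 0 f ⊠ g₂ ⊞ c 1 f ⊠ g₁ ⊞ c 2 f ⊠ g₀)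
    Norm-⊠-D3 f p = ≈-trans (Norm-cong (≈-trans (R.*-cong (D3-c f) p) (D3-⊠ (c 0 f) (c 1 f) (c 2 f) _ _ _))) (Norm-D3 _ _ _)

    q3i : ∀ i j → q^ (3 ℕ.* j ℕ.+ i) ≈ q^ i ⊠ (q^ j ⊠ q^ j ⊠ q^ j)
    q3i i j = ≈-trans (q^≡ (trans (ℕP.+-comm (3 ℕ.* j) i) (cong (i ℕ.+_) (trans (cong (λ x → j ℕ.+ (j ℕ.+ x)) (ℕP.+-identityʳ j)) (sym (ℕP.+-assoc j j j))))))
      (≈-trans (q^-+ i _) (R.*-cong ≈-refl (≈-trans (q^-+ (j ℕ.+ j) j) (R.*-cong (q^-+ j j) ≈-refl))))

  -- Multiplicativity is checked one linear factor at a time, as a polynomial identity. The factor 1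
  -- - t^n contributes 1 - t^(3n) if 3 does not divide n; if it does, the factor is a series in t³
  -- already and contributes its cube.
  Norm-fac-0 : ∀ f j → Norm (f ⊠ f1 (3 ℕ.* j)) ≈ Norm f ⊠ (f1 j ⊠ f1 j ⊠ f1 j)
  Norm-fac-0 f j = ≈-trans (Norm-⊠-D3 f (fac-D3-0 j)) (solve 5 (λ a b c x y →
    let F = a :* y :+ x :* (b :* con (+ 0) :+ c :* con (+ 0)) ; G = a :* con (+ 0) :+ b :* y :+ x :* (c :* con (+ 0)) ; H = a :* con (+ 0) :+ b :* con (+ 0) :+ c :* y
        N = λ f g h → f :* f :* f :+ x :* (g :* g :* g) :+ x :* x :* (h :* h :* h) :+ :- (con (+ 3) :* x :* (f :* g :* h)) in
    N F G H := N a b c :* (y :* y :* y)) ≈-refl (c 0 f) (c 1 f) (c 2 f) (q^ 1) (f1 j))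

  Norm-fac-1 : ∀ f j → Norm (f ⊠ f1 (3 ℕ.* j ℕ.+ 1)) ≈ Norm f ⊠ f1 (3 ℕ.* j ℕ.+ 1)
  Norm-fac-1 f j = ≈-trans (Norm-⊠-D3 f (fac-D3-1 j)) (≈-trans (solve 5 (λ a b c x y →
    let F = a :* con (+ 1) :+ x :* (b :* con (+ 0) :+ c :* :- y) ; G = a :* :- y :+ b :* con (+ 1) :+ x :* (c :* con (+ 0)) ; H = a :* con (+ 0) :+ b :* :- y :+ c :* con (+ 1)
        N = λ f g h → f :* f :* f :+ x :* (g :* g :* g) :+ x :* x :* (h :* h :* h) :+ :- (con (+ 3) :* x :* (f :* g :* h)) in
    N F G H := N a b c :* (con (+ 1) :+ :- (con (+ 1) :* (x :* (y :* y :* y))))) ≈-refl (c 0 f) (c 1 f) (c 2 f) (q^ 1) (q^ j))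
    (R.*-cong ≈-refl (R.+-cong ≈-refl (R.-‿cong (R.*-cong ≈-refl (≈-sym (q3i 1 j)))))))

  Norm-fac-2 : ∀ f j → Norm (f ⊠ f1 (3 ℕ.* j ℕ.+ 2)) ≈ Norm f ⊠ f1 (3 ℕ.* j ℕ.+ 2)
  Norm-fac-2 f j = ≈-trans (Norm-⊠-D3 f (fac-D3-2 j)) (≈-trans (solve 5 (λ a b c x y →
    let F = a :* con (+ 1) :+ x :* (b :* :- y :+ c :* con (+ 0)) ; G = a :* con (+ 0) :+ b :* con (+ 1) :+ x :* (c :* :- y) ; H = a :* :- y :+ b :* con (+ 0) :+ c :* con (+ 1)
        N = λ f g h → f :* f :* f :+ x :* (g :* g :* g) :+ x :* x :* (h :* h :* h) :+ :- (con (+ 3) :* x :* (f :* g :* h)) in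
    N F G H := N a b c :* (con (+ 1) :+ :- (con (+ 1) :* ((x :* x) :* (y :* y :* y))))) ≈-refl (c 0 f) (c 1 f) (c 2 f) (q^ 1) (q^ j))
    (R.*-cong ≈-refl (R.+-cong ≈-refl (R.-‿cong (R.*-cong ≈-refl (≈-sym (≈-trans (q3i 2 j) (R.*-cong (q^-+ 1 1) ≈-refl))))))))

  private
    cube : PS → PS
    cube x = x ⊠ x ⊠ x

    f1≡ : ∀ {x y} → x ≡ y → f1 x ≈ f1 y
    f1≡ p = ≈-reflexive (cong f1 p)

    Norm-at : ∀ f {x y} → x ≡ y → Norm (f ⊠ f1 x) ≈ Norm (f ⊠ f1 y)
    Norm-at f p = Norm-cong (R.*-cong ≈-refl (f1≡ p))

    -- Three factors are removed at a time: their exponents 6n + 1, 6n + 3, 6n + 5 meet the classes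
    -- 1, 0, 2 modulo 3 once each.
    Norm-pf-1 : ∀ f n → Norm (f ⊠ pf 𝟙 1 2 (3 ℕ.* n)) ≈ Norm f ⊠ (pf 𝟙 1 6 n ⊠ cube (pf 𝟙 1 2 n) ⊠ pf 𝟙 5 6 n)
    Norm-pf-1 f zero = ≈-trans (Norm-cong (R.*-identityʳ f)) (solve 1 (λ x → x := x :* (con (+ 1) :* (con (+ 1) :* con (+ 1) :* con (+ 1)) :* con (+ 1))) ≈-refl (Norm f))
    Norm-pf-1 f (suc n) = begin
      Norm (f ⊠ pf 𝟙 1 2 (3 ℕ.* suc n)) ≈⟨ Norm-cong (R.*-cong ≈-refl (≈-reflexive (cong (pf 𝟙 1 2) (ℕP.*-suc 3 n)))) ⟩
      Norm (f ⊠ (P ⊠ f1 (1 ℕ.+ 2 ℕ.* (3 ℕ.* n)) ⊠ f1 (1 ℕ.+ 2 ℕ.* suc (3 ℕ.* n)) ⊠ f1 (1 ℕ.+ 2 ℕ.* suc (suc (3 ℕ.* n)))))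
        ≈⟨ Norm-cong (solve 5 (λ f p x y z → f :* (p :* x :* y :* z) := f :* p :* x :* y :* z) ≈-refl f P _ _ _) ⟩
      Norm (f ⊠ P ⊠ f1 (1 ℕ.+ 2 ℕ.* (3 ℕ.* n)) ⊠ f1 (1 ℕ.+ 2 ℕ.* suc (3 ℕ.* n)) ⊠ f1 (1 ℕ.+ 2 ℕ.* suc (suc (3 ℕ.* n))))
        ≈⟨ ≈-trans (Norm-at _ (solveℕ 1 (λ n → con″ 1 +″ con″ 2 *″ (con″ 2 +″ con″ 3 *″ n) =″ con″ 3 *″ (con″ 1 +″ con″ 2 *″ n) +″ con″ 2) refl n)) (Norm-fac-2 _ (1 ℕ.+ 2 ℕ.* n)) ⟩
      Norm (f ⊠ P ⊠ f1 (1 ℕ.+ 2 ℕ.* (3 ℕ.* n)) ⊠ f1 (1 ℕ.+ 2 ℕ.* suc (3 ℕ.* n))) ⊠ f1 (3 ℕ.* (1 ℕ.+ 2 ℕ.* n) ℕ.+ 2)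
        ≈⟨ R.*-cong (≈-trans (Norm-at _ (solveℕ 1 (λ n → con″ 1 +″ con″ 2 *″ (con″ 1 +″ con″ 3 *″ n) =″ con″ 3 *″ (con″ 1 +″ con″ 2 *″ n)) refl n)) (Norm-fac-0 _ (1 ℕ.+ 2 ℕ.* n))) ≈-refl ⟩
      Norm (f ⊠ P ⊠ f1 (1 ℕ.+ 2 ℕ.* (3 ℕ.* n))) ⊠ cube (f1 (1 ℕ.+ 2 ℕ.* n)) ⊠ f1 (3 ℕ.* (1 ℕ.+ 2 ℕ.* n) ℕ.+ 2)
        ≈⟨ R.*-cong (R.*-cong (≈-trans (Norm-at _ (solveℕ 1 (λ n → con″ 1 +″ con″ 2 *″ (con″ 3 *″ n) =″ con″ 3 *″ (con″ 2 *″ n) +″ con″ 1) refl n)) (Norm-fac-1 _ (2 ℕ.* n))) ≈-refl) ≈-refl ⟩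
      Norm (f ⊠ P) ⊠ f1 (3 ℕ.* (2 ℕ.* n) ℕ.+ 1) ⊠ cube (f1 (1 ℕ.+ 2 ℕ.* n)) ⊠ f1 (3 ℕ.* (1 ℕ.+ 2 ℕ.* n) ℕ.+ 2)
        ≈⟨ R.*-cong (R.*-cong (R.*-cong (Norm-pf-1 f n) (f1≡ (solveℕ 1 (λ n → con″ 3 *″ (con″ 2 *″ n) +″ con″ 1 =″ con″ 1 +″ con″ 6 *″ n) refl n))) ≈-refl)
             (f1≡ (solveℕ 1 (λ n → con″ 3 *″ (con″ 1 +″ con″ 2 *″ n) +″ con″ 2 =″ con″ 5 +″ con″ 6 *″ n) refl n)) ⟩
      Norm f ⊠ (pf 𝟙 1 6 n ⊠ cube (pf 𝟙 1 2 n) ⊠ pf 𝟙 5 6 n) ⊠ f1 (1 ℕ.+ 6 ℕ.* n) ⊠ cube (f1 (1 ℕ.+ 2 ℕ.* n)) ⊠ f1 (5 ℕ.+ 6 ℕ.* n)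
        ≈⟨ solve 7 (λ N p r s x y z → N :* (p :* (r :* r :* r) :* s) :* x :* (y :* y :* y) :* z := N :* ((p :* x) :* ((r :* y) :* (r :* y) :* (r :* y)) :* (s :* z))) ≈-refl
             (Norm f) (pf 𝟙 1 6 n) (pf 𝟙 1 2 n) (pf 𝟙 5 6 n) (f1 (1 ℕ.+ 6 ℕ.* n)) (f1 (1 ℕ.+ 2 ℕ.* n)) (f1 (5 ℕ.+ 6 ℕ.* n)) ⟩
      Norm f ⊠ (pf 𝟙 1 6 (suc n) ⊠ cube (pf 𝟙 1 2 (suc n)) ⊠ pf 𝟙 5 6 (suc n)) ∎
      where P = pf 𝟙 1 2 (3 ℕ.* n)

    Norm-pf-2 : ∀ f n → Norm (f ⊠ pf 𝟙 2 2 (3 ℕ.* n)) ≈ Norm f ⊠ (pf 𝟙 2 6 n ⊠ cube (pf 𝟙 2 2 n) ⊠ pf 𝟙 4 6 n)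
    Norm-pf-2 f zero = ≈-trans (Norm-cong (R.*-identityʳ f)) (solve 1 (λ x → x := x :* (con (+ 1) :* (con (+ 1) :* con (+ 1) :* con (+ 1)) :* con (+ 1))) ≈-refl (Norm f))
    Norm-pf-2 f (suc n) = begin
      Norm (f ⊠ pf 𝟙 2 2 (3 ℕ.* suc n)) ≈⟨ Norm-cong (R.*-cong ≈-refl (≈-reflexive (cong (pf 𝟙 2 2) (ℕP.*-suc 3 n)))) ⟩
      Norm (f ⊠ (P ⊠ f1 (2 ℕ.+ 2 ℕ.* (3 ℕ.* n)) ⊠ f1 (2 ℕ.+ 2 ℕ.* suc (3 ℕ.* n)) ⊠ f1 (2 ℕ.+ 2 ℕ.* suc (suc (3 ℕ.* n)))))
        ≈⟨ Norm-cong (solve 5 (λ f p x y z → f :* (p :* x :* y :* z) := f :* p :* x :* y :* z) ≈-refl f P _ _ _) ⟩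
      Norm (f ⊠ P ⊠ f1 (2 ℕ.+ 2 ℕ.* (3 ℕ.* n)) ⊠ f1 (2 ℕ.+ 2 ℕ.* suc (3 ℕ.* n)) ⊠ f1 (2 ℕ.+ 2 ℕ.* suc (suc (3 ℕ.* n))))
        ≈⟨ ≈-trans (Norm-at _ (solveℕ 1 (λ n → con″ 2 +″ con″ 2 *″ (con″ 2 +″ con″ 3 *″ n) =″ con″ 3 *″ (con″ 2 +″ con″ 2 *″ n)) refl n)) (Norm-fac-0 _ (2 ℕ.+ 2 ℕ.* n)) ⟩
      Norm (f ⊠ P ⊠ f1 (2 ℕ.+ 2 ℕ.* (3 ℕ.* n)) ⊠ f1 (2 ℕ.+ 2 ℕ.* suc (3 ℕ.* n))) ⊠ cube (f1 (2 ℕ.+ 2 ℕ.* n))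
        ≈⟨ R.*-cong (≈-trans (Norm-at _ (solveℕ 1 (λ n → con″ 2 +″ con″ 2 *″ (con″ 1 +″ con″ 3 *″ n) =″ con″ 3 *″ (con″ 1 +″ con″ 2 *″ n) +″ con″ 1) refl n)) (Norm-fac-1 _ (1 ℕ.+ 2 ℕ.* n))) ≈-refl ⟩
      Norm (f ⊠ P ⊠ f1 (2 ℕ.+ 2 ℕ.* (3 ℕ.* n))) ⊠ f1 (3 ℕ.* (1 ℕ.+ 2 ℕ.* n) ℕ.+ 1) ⊠ cube (f1 (2 ℕ.+ 2 ℕ.* n))
        ≈⟨ R.*-cong (R.*-cong (≈-trans (Norm-at _ (solveℕ 1 (λ n → con″ 2 +″ con″ 2 *″ (con″ 3 *″ n) =″ con″ 3 *″ (con″ 2 *″ n) +″ con″ 2) refl n)) (Norm-fac-2 _ (2 ℕ.* n))) ≈-refl) ≈-refl ⟩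
      Norm (f ⊠ P) ⊠ f1 (3 ℕ.* (2 ℕ.* n) ℕ.+ 2) ⊠ f1 (3 ℕ.* (1 ℕ.+ 2 ℕ.* n) ℕ.+ 1) ⊠ cube (f1 (2 ℕ.+ 2 ℕ.* n))
        ≈⟨ R.*-cong (R.*-cong (R.*-cong (Norm-pf-2 f n) (f1≡ (solveℕ 1 (λ n → con″ 3 *″ (con″ 2 *″ n) +″ con″ 2 =″ con″ 2 +″ con″ 6 *″ n) refl n)))
             (f1≡ (solveℕ 1 (λ n → con″ 3 *″ (con″ 1 +″ con″ 2 *″ n) +″ con″ 1 =″ con″ 4 +″ con″ 6 *″ n) refl n))) ≈-refl ⟩
      Norm f ⊠ (pf 𝟙 2 6 n ⊠ cube (pf 𝟙 2 2 n) ⊠ pf 𝟙 4 6 n) ⊠ f1 (2 ℕ.+ 6 ℕ.* n) ⊠ f1 (4 ℕ.+ 6 ℕ.* n) ⊠ cube (f1 (2 ℕ.+ 2 ℕ.* n))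
        ≈⟨ solve 7 (λ N p r s x y z → N :* (p :* (r :* r :* r) :* s) :* x :* z :* (y :* y :* y) := N :* ((p :* x) :* ((r :* y) :* (r :* y) :* (r :* y)) :* (s :* z))) ≈-refl
             (Norm f) (pf 𝟙 2 6 n) (pf 𝟙 2 2 n) (pf 𝟙 4 6 n) (f1 (2 ℕ.+ 6 ℕ.* n)) (f1 (2 ℕ.+ 2 ℕ.* n)) (f1 (4 ℕ.+ 6 ℕ.* n)) ⟩
      Norm f ⊠ (pf 𝟙 2 6 (suc n) ⊠ cube (pf 𝟙 2 2 (suc n)) ⊠ pf 𝟙 4 6 (suc n)) ∎
      where P = pf 𝟙 2 2 (3 ℕ.* n)

    m : ℕ → ℕ → PS
    m α s = pf∞ 𝟙 α s

    Norm-𝟙 : Norm 𝟙 ≈ 𝟙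
    Norm-𝟙 = ≈-trans (Norm-cong (≈-sym (≈-trans (R.+-cong (R.+-cong sub-𝟙 (R.*-cong ≈-refl sub-𝟘)) (R.*-cong ≈-refl sub-𝟘))
        (solve 2 (λ y z → con (+ 1) :+ y :* con (+ 0) :+ z :* con (+ 0) := con (+ 1)) ≈-refl (q^ 1) (q^ 2)))))
      (≈-trans (Norm-D3 𝟙 𝟘 𝟘) (solve 1 (λ x → let f = con (+ 1) ; g = con (+ 0) ; h = con (+ 0) in
        f :* f :* f :+ x :* (g :* g :* g) :+ x :* x :* (h :* h :* h) :+ :- (con (+ 3) :* x :* (f :* g :* h)) := con (+ 1)) ≈-refl (q^ 1)))

    Norm-φ : Norm φ ≈ (m 1 6 ⊠ cube (m 1 2) ⊠ m 5 6) ⊠ (m 1 6 ⊠ cube (m 1 2) ⊠ m 5 6) ⊠ (m 2 6 ⊠ cube (m 2 2) ⊠ m 4 6)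
    Norm-φ = ≈[]⇒≈ λ N →
      ≈[]-trans (≈⇒≈[] (Norm-cong (Θ⁻-product 1 1)))
      (≈[]-trans (Norm-≈[] (≈[]-sym (≈[]-⊠ (≈[]-⊠ (lim 1 N) (lim 1 N)) (lim 2 N))))
      (≈[]-trans (≈⇒≈[] (finite N))
      (≈[]-⊠ (≈[]-⊠ (x N) (x N)) (y N))))
      where
      k : ℕ → ℕ
      -- N coefficients of the norm depend on 3N + 2 coefficients of the series, and 3(N + 1)
      -- factors of the products determine these.
      k N = suc N
      lim : ∀ α N → pf 𝟙 α 2 (3 ℕ.* k N) ≈[ 3 ℕ.* N ℕ.+ 2 ] pf∞ 𝟙 α 2
      lim α N = pf-limit 𝟙 α 2 (3 ℕ.* k N) (subst (3 ℕ.* N ℕ.+ 2 ℕ.≤_) (sym (ℕP.*-suc 3 N)) (subst (ℕ._≤ 3 ℕ.+ 3 ℕ.* N) (ℕP.+-comm 2 (3 ℕ.* N)) (ℕP.n≤1+n _)))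
      cl : ∀ α s .{{_ : ℕ.NonZero s}} N → pf 𝟙 α s (k N) ≈[ N ] m α s
      cl α s N = pf-limit 𝟙 α s (k N) (ℕP.n≤1+n N)
      cb : ∀ α s .{{_ : ℕ.NonZero s}} N → cube (pf 𝟙 α s (k N)) ≈[ N ] cube (m α s)
      cb α s N = ≈[]-⊠ (≈[]-⊠ (cl α s N) (cl α s N)) (cl α s N)
      x : ∀ N → pf 𝟙 1 6 (k N) ⊠ cube (pf 𝟙 1 2 (k N)) ⊠ pf 𝟙 5 6 (k N) ≈[ N ] m 1 6 ⊠ cube (m 1 2) ⊠ m 5 6
      x N = ≈[]-⊠ (≈[]-⊠ (cl 1 6 N) (cb 1 2 N)) (cl 5 6 N)
      y : ∀ N → pf 𝟙 2 6 (k N) ⊠ cube (pf 𝟙 2 2 (k N)) ⊠ pf 𝟙 4 6 (k N) ≈[ N ] m 2 6 ⊠ cube (m 2 2) ⊠ m 4 6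
      y N = ≈[]-⊠ (≈[]-⊠ (cl 2 6 N) (cb 2 2 N)) (cl 4 6 N)
      finite : ∀ N → Norm (pf 𝟙 1 2 (3 ℕ.* k N) ⊠ pf 𝟙 1 2 (3 ℕ.* k N) ⊠ pf 𝟙 2 2 (3 ℕ.* k N)) ≈
        (pf 𝟙 1 6 (k N) ⊠ cube (pf 𝟙 1 2 (k N)) ⊠ pf 𝟙 5 6 (k N)) ⊠ (pf 𝟙 1 6 (k N) ⊠ cube (pf 𝟙 1 2 (k N)) ⊠ pf 𝟙 5 6 (k N)) ⊠ (pf 𝟙 2 6 (k N) ⊠ cube (pf 𝟙 2 2 (k N)) ⊠ pf 𝟙 4 6 (k N))
      finite N = ≈-trans (Norm-pf-2 _ (k N)) (R.*-cong (≈-trans (Norm-pf-1 _ (k N)) (R.*-cong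
        (≈-trans (Norm-cong (≈-sym (R.*-identityˡ _))) (≈-trans (Norm-pf-1 𝟙 (k N)) (≈-trans (R.*-cong Norm-𝟙 ≈-refl) (R.*-identityˡ _)))) ≈-refl)) ≈-refl)

  -- The norm of φ, read off from its trisection φ = a(q³) - 2q b(q³).
  Δ : PS
  Δ = a ⊠ a ⊠ a ⊞ ⊟ (fromℤ (+ 8) ⊠ q^ 1 ⊠ (b ⊠ b ⊠ b))

  -- The norm of φ is computed a second time, factor by factor from its product. The factors modulo
  -- 6 contributed by the norm lack just those of `a` to fill a fourth copy of φ.
  aΔ : a ⊠ Δ ≈ φ ⊠ φ ⊠ φ ⊠ φ
  aΔ = begin
    a ⊠ Δ ≈⟨ R.*-cong (Θ⁻-product 3 3) (≈-trans (solve 3 (λ a b x → let f = a ; g = :- (con (+ 2) :* b) ; h = con (+ 0) in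
         a :* a :* a :+ :- (con (+ 8) :* x :* (b :* b :* b)) := f :* f :* f :+ x :* (g :* g :* g) :+ x :* x :* (h :* h :* h) :+ :- (con (+ 3) :* x :* (f :* g :* h))) ≈-refl a b (q^ 1))
         (≈-trans (≈-sym (Norm-D3 a (⊟ (two ⊠ b)) 𝟘)) (≈-trans (Norm-cong (≈-sym φ-D3)) Norm-φ))) ⟩
    (m 3 6 ⊠ m 3 6 ⊠ m 6 6) ⊠ ((m 1 6 ⊠ cube (m 1 2) ⊠ m 5 6) ⊠ (m 1 6 ⊠ cube (m 1 2) ⊠ m 5 6) ⊠ (m 2 6 ⊠ cube (m 2 2) ⊠ m 4 6))
      ≈⟨ solve 8 (λ x1 x3 x5 x2 x4 x6 y z → (x3 :* x3 :* x6) :* ((x1 :* (y :* y :* y) :* x5) :* (x1 :* (y :* y :* y) :* x5) :* (x2 :* (z :* z :* z) :* x4))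
           := (x1 :* x3 :* x5) :* (x1 :* x3 :* x5) :* (x2 :* x4 :* x6) :* (y :* y :* z) :* (y :* y :* z) :* (y :* y :* z)) ≈-refl
           (m 1 6) (m 3 6) (m 5 6) (m 2 6) (m 4 6) (m 6 6) (m 1 2) (m 2 2) ⟩
    (m 1 6 ⊠ m 3 6 ⊠ m 5 6) ⊠ (m 1 6 ⊠ m 3 6 ⊠ m 5 6) ⊠ (m 2 6 ⊠ m 4 6 ⊠ m 6 6) ⊠ y ⊠ y ⊠ y
      ≈⟨ R.*-cong (R.*-cong (R.*-cong (R.*-cong (R.*-cong (≈-sym (pf∞-split3 𝟙 1 2)) (≈-sym (pf∞-split3 𝟙 1 2))) (≈-sym (pf∞-split3 𝟙 2 2))) φy) φy) φy ⟩
    m 1 2 ⊠ m 1 2 ⊠ m 2 2 ⊠ φ ⊠ φ ⊠ φ ≈⟨ R.*-cong (R.*-cong (R.*-cong φy ≈-refl) ≈-refl) ≈-refl ⟩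
    φ ⊠ φ ⊠ φ ⊠ φ ∎
    where
    y = m 1 2 ⊠ m 1 2 ⊠ m 2 2
    φy : y ≈ φ
    φy = ≈-sym (Θ⁻-product 1 1)

  private
    -- Jacobi's series equals `Θ⁺ 0 1`·φ², whose classes are polynomials in `u`, `v`, `a`, `b`.
    -- Comparison with `Jac-D3` evaluates the weighted series `Ψ` and `Jac 3`.
    cubic : Jac 1 ≈ D3 (two ⊠ (u ⊠ (a ⊠ a) ⊞ fromℤ (+ 4) ⊠ q^ 1 ⊠ (v ⊠ (b ⊠ b)))) (two ⊠ (v ⊠ (a ⊠ a) ⊞ ⊟ (fromℤ (+ 4) ⊠ (u ⊠ (a ⊠ b))))) (two ⊠ (fromℤ (+ 4) ⊠ (u ⊠ (b ⊠ b)) ⊞ ⊟ (fromℤ (+ 4) ⊠ (v ⊠ (a ⊠ b)))))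
    cubic = begin
      Jac 1 ≈⟨ Jac-e ⟩
      two ⊠ (e ⊠ e ⊠ e) ≈⟨ R.*-cong ≈-refl (R.*-cong (R.*-cong (≈-sym κφ) (≈-sym κφ)) ≈-refl) ⟩
      two ⊠ (κ ⊠ φ ⊠ (κ ⊠ φ) ⊠ e) ≈⟨ solve 4 (λ c k f e → c :* (k :* f :* (k :* f) :* e) := (c :* (k :* (k :* e))) :* f :* f) ≈-refl two κ φ e ⟩
      two ⊠ (κ ⊠ (κ ⊠ e)) ⊠ φ ⊠ φ ≈⟨ R.*-cong (R.*-cong (≈-trans (R.*-cong ≈-refl (R.*-cong ≈-refl κe)) (≈-sym Θ⁺01-κ)) ≈-refl) ≈-refl ⟩
      Θ⁺ 0 1 ⊠ φ ⊠ φ ≈⟨ R.*-cong (R.*-cong Θ⁺01-D3 φ-D3) φ-D3 ⟩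
      D3 (two ⊠ u) (two ⊠ v) 𝟘 ⊠ D3 a (⊟ (two ⊠ b)) 𝟘 ⊠ D3 a (⊟ (two ⊠ b)) 𝟘 ≈⟨ ≈-trans (R.*-cong (D3-⊠ _ _ _ _ _ _) ≈-refl) (D3-⊠ _ _ _ _ _ _) ⟩
      _ ≈⟨ D3-cong
        (solve 5 (λ u v a b x → let y = :- (con (+ 2) :* b) ; o = con (+ 0) ; U = con (+ 2) :* u ; V = con (+ 2) :* v
                                    p = U :* a :+ x :* (V :* o :+ o :* y) ; r = U :* y :+ V :* a :+ x :* (o :* o) ; s = U :* o :+ V :* y :+ o :* a in
           p :* a :+ x :* (r :* o :+ s :* y) := con (+ 2) :* (u :* (a :* a) :+ con (+ 4) :* x :* (v :* (b :* b)))) ≈-refl u v a b (q^ 1))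
        (solve 5 (λ u v a b x → let y = :- (con (+ 2) :* b) ; o = con (+ 0) ; U = con (+ 2) :* u ; V = con (+ 2) :* v
                                    p = U :* a :+ x :* (V :* o :+ o :* y) ; r = U :* y :+ V :* a :+ x :* (o :* o) ; s = U :* o :+ V :* y :+ o :* a in
           p :* y :+ r :* a :+ x :* (s :* o) := con (+ 2) :* (v :* (a :* a) :+ :- (con (+ 4) :* (u :* (a :* b))))) ≈-refl u v a b (q^ 1))
        (solve 5 (λ u v a b x → let y = :- (con (+ 2) :* b) ; o = con (+ 0) ; U = con (+ 2) :* u ; V = con (+ 2) :* v
                                    p = U :* a :+ x :* (V :* o :+ o :* y) ; r = U :* y :+ V :* a :+ x :* (o :* o) ; s = U :* o :+ V :* y :+ o :* a in
           p :* o :+ r :* y :+ s :* a := con (+ 2) :* (con (+ 4) :* (u :* (b :* b)) :+ :- (con (+ 4) :* (v :* (a :* b))))) ≈-refl u v a b (q^ 1)) ⟩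
      D3 (two ⊠ (u ⊠ (a ⊠ a) ⊞ fromℤ (+ 4) ⊠ q^ 1 ⊠ (v ⊠ (b ⊠ b)))) (two ⊠ (v ⊠ (a ⊠ a) ⊞ ⊟ (fromℤ (+ 4) ⊠ (u ⊠ (a ⊠ b))))) (two ⊠ (fromℤ (+ 4) ⊠ (u ⊠ (b ⊠ b)) ⊞ ⊟ (fromℤ (+ 4) ⊠ (v ⊠ (a ⊠ b))))) ∎

  Ψ-κ : Ψ ≈ κ ⊠ (a ⊠ a ⊠ a ⊞ fromℤ (+ 4) ⊠ q^ 1 ⊠ (b ⊠ b ⊠ b))
  Ψ-κ = cancelˡ unit-two (≈-trans (proj₁ (D3-inj (≈-trans (≈-sym Jac-D3) cubic)))
    (R.*-cong ≈-refl (≈-trans (R.+-cong (R.*-cong (≈-sym κa) ≈-refl) (R.*-cong ≈-refl (R.*-cong (≈-sym κb) ≈-refl)))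
      (solve 4 (λ k a b x → k :* a :* (a :* a) :+ con (+ 4) :* x :* (k :* b :* (b :* b)) := k :* (a :* a :* a :+ con (+ 4) :* x :* (b :* b :* b))) ≈-refl κ a b (q^ 1)))))

  Jac3-κ : Jac 3 ≈ two ⊠ (κ ⊠ (a ⊠ a ⊠ b))
  Jac3-κ = cancelˡ (unit-fromℤ 2) (⊟-cancel (≈-trans (proj₁ (proj₂ (D3-inj (≈-trans (≈-sym Jac-D3) cubic))))
    (≈-trans (R.*-cong ≈-refl (R.+-cong (R.*-cong (≈-sym κb) ≈-refl) (R.-‿cong (R.*-cong ≈-refl (R.*-cong (≈-sym κa) ≈-refl)))))
      (solve 3 (λ k a b → con (+ 2) :* (k :* b :* (a :* a) :+ :- (con (+ 4) :* (k :* a :* (a :* b)))) := :- (con (+ 3) :* (con (+ 2) :* (k :* (a :* a :* b))))) ≈-refl κ a b))))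

open Cubic-norm

-- Class 2 modulo 3 of X/φ, Y/φ and Z/φ.

module Lambert where
  L⁺ L⁻ L² : PS
  L⁺ = Λ 6 0 (h⁺ ∘ 3j+1)
  L⁻ = Λ 6 0 (h⁻ ∘ 3j+1)
  L² = Λ 6 0 (h² ∘ 3j+1)

  -- The scalings make six times each rank class 1/φ times an integral combination of 1, `X`, `Y`,
  -- `Z`. For the kernel `h²` only 2·`Λ 2 0` - `Λ 1 1` occurs, and `Z` is 4`Y` minus 12 times it.
  X Y Z : PS
  Y = two ⊠ Λ 2 0 (h⁺ ∘ 3j)
  X = 𝟙 ⊞ six ⊠ Λ 2 0 (h⁻ ∘ 3j)
  Z = fromℤ (+ 4) ⊠ Y ⊞ ⊟ (fromℤ (+ 24) ⊠ Λ 2 0 (h² ∘ 3j)) ⊞ fromℤ (+ 12) ⊠ Λ 1 1 (h² ∘ 3j)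

  private
    open ≈-Reasoning

    G₀ : (ℤ → PS) → PS
    G₀ f = Λ 4 2 (f ∘ 3j) ⊞ ⊟ Λ 2 4 (f ∘ 3j-1)

    -- `u` and `v` share the factor `κ`; without it the regrouped sum is the combination of `G₀` and
    -- the Lambert series that class 2 requires.
    lam₀-κ : ∀ f → lam₀ f ≈ κ ⊠ (a ⊠ G₀ f ⊞ ⊟ (two ⊠ q^ 1 ⊠ b ⊠ Λ 6 0 (f ∘ 3j+1)))
    lam₀-κ f = ≈-trans (R.+-cong (R.+-cong (R.*-cong (≈-sym κa) ≈-refl) (R.-‿cong (R.*-cong (R.*-cong ≈-refl (≈-trans Θ⁺03-v (R.*-cong ≈-refl (≈-sym κb)))) ≈-refl))) (R.-‿cong (R.*-cong (≈-sym κa) ≈-refl)))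
      (solve 7 (λ k a b x s t l → k :* a :* s :+ :- (x :* (con (+ 2) :* (k :* b)) :* l) :+ :- (k :* a :* t) := k :* (a :* (s :+ :- t) :+ :- (con (+ 2) :* x :* b :* l)))
        ≈-refl κ a b (q^ 1) (Λ 4 2 (f ∘ 3j)) (Λ 2 4 (f ∘ 3j-1)) (Λ 6 0 (f ∘ 3j+1)))

    ℓ⁺ : two ⊠ lam₀ h⁺ ≈ κ ⊠ (φ ⊠ φ ⊠ φ)
    ℓ⁺ = begin
      two ⊠ lam₀ h⁺ ≈⟨ R.*-cong ≈-refl lam₀-h⁺ ⟩
      two ⊠ (e ⊠ τ) ≈⟨ solve 3 (λ c e t → c :* (e :* t) := e :* (c :* t)) ≈-refl two e τ ⟩
      e ⊠ (two ⊠ τ) ≈⟨ R.*-cong (≈-sym κφ) τ-φ ⟩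
      κ ⊠ φ ⊠ (φ ⊠ φ) ≈⟨ solve 2 (λ k f → k :* f :* (f :* f) := k :* (f :* f :* f)) ≈-refl κ φ ⟩
      κ ⊠ (φ ⊠ φ ⊠ φ) ∎

    ℓ⁻ : six ⊠ lam₀ h⁻ ≈ κ ⊠ (φ ⊠ φ ⊠ φ ⊞ ⊟ a)
    ℓ⁻ = ≈-trans lam₀-h⁻ (≈-trans (R.+-cong Ξ-κφ³ (R.-‿cong (≈-sym κa)))
      (solve 3 (λ k f a → k :* f :+ :- (k :* a) := k :* (f :+ :- a)) ≈-refl κ (φ ⊠ φ ⊠ φ) a))

    ℓ² : fromℤ (+ 12) ⊠ lam₀ h² ≈ κ ⊠ ((a ⊠ a ⊠ a ⊞ fromℤ (+ 4) ⊠ q^ 1 ⊠ (b ⊠ b ⊠ b) ⊞ two ⊠ φ) ⊠ (φ ⊠ φ))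
    ℓ² = begin
      fromℤ (+ 12) ⊠ lam₀ h² ≈⟨ solve 1 (λ x → con (+ 12) :* x := con (+ 2) :* (con (+ 6) :* x)) ≈-refl (lam₀ h²) ⟩
      two ⊠ (six ⊠ lam₀ h²) ≈⟨ R.*-cong ≈-refl lam₀-h² ⟩
      two ⊠ ((Ψ ⊞ two ⊠ e) ⊠ τ) ≈⟨ solve 3 (λ c x t → c :* (x :* t) := x :* (c :* t)) ≈-refl two (Ψ ⊞ two ⊠ e) τ ⟩
      (Ψ ⊞ two ⊠ e) ⊠ (two ⊠ τ) ≈⟨ R.*-cong (R.+-cong Ψ-κ (R.*-cong ≈-refl (≈-sym κφ))) τ-φ ⟩
      (κ ⊠ w ⊞ two ⊠ (κ ⊠ φ)) ⊠ (φ ⊠ φ) ≈⟨ solve 3 (λ k w f → (k :* w :+ con (+ 2) :* (k :* f)) :* (f :* f) := k :* ((w :+ con (+ 2) :* f) :* (f :* f))) ≈-refl κ w φ ⟩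
      κ ⊠ ((w ⊞ two ⊠ φ) ⊠ (φ ⊠ φ)) ∎
      where w = a ⊠ a ⊠ a ⊞ fromℤ (+ 4) ⊠ q^ 1 ⊠ (b ⊠ b ⊠ b)

    C DE : PS
    C = Λ 3 3 (h² ∘ 3j)
    DE = Λ 5 1 (h² ∘ 3j+1) ⊞ Λ 1 5 (h² ∘ 3j-1)

    -- The second regrouping determines the two classes of `Λ 1 1` only through 2b`C` - a`DE`, once
    -- `κ` is cancelled.
    ℓ₁ : two ⊠ (two ⊠ b ⊠ C ⊞ ⊟ (a ⊠ DE)) ≈ a ⊠ a ⊠ b ⊠ (φ ⊠ φ)
    ℓ₁ = cancelˡ κ-unit (begin
      κ ⊠ (two ⊠ (two ⊠ b ⊠ C ⊞ ⊟ (a ⊠ (D ⊞ E′))))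
        ≈⟨ solve 6 (λ k a b c d e → k :* (con (+ 2) :* (con (+ 2) :* b :* c :+ :- (a :* (d :+ e)))) := con (+ 2) :* (con (+ 2) :* (k :* b) :* c :+ :- (k :* a :* d) :+ :- (k :* a :* e))) ≈-refl κ a b C D E′ ⟩
      two ⊠ (two ⊠ (κ ⊠ b) ⊠ C ⊞ ⊟ (κ ⊠ a ⊠ D) ⊞ ⊟ (κ ⊠ a ⊠ E′))
        ≈⟨ R.*-cong ≈-refl (R.+-cong (R.+-cong (R.*-cong (≈-trans (R.*-cong ≈-refl κb) (≈-sym Θ⁺03-v)) ≈-refl) (R.-‿cong (R.*-cong κa ≈-refl))) (R.-‿cong (R.*-cong κa ≈-refl))) ⟩
      two ⊠ lam₁ h² ≈⟨ lam₁-h² ⟩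
      Jac 3 ⊠ τ ≈⟨ R.*-cong Jac3-κ ≈-refl ⟩
      two ⊠ (κ ⊠ (a ⊠ a ⊠ b)) ⊠ τ ≈⟨ solve 4 (λ c k x t → c :* (k :* x) :* t := k :* (x :* (c :* t))) ≈-refl two κ (a ⊠ a ⊠ b) τ ⟩
      κ ⊠ (a ⊠ a ⊠ b ⊠ (two ⊠ τ)) ≈⟨ R.*-cong ≈-refl (R.*-cong ≈-refl τ-φ) ⟩
      κ ⊠ (a ⊠ a ⊠ b ⊠ (φ ⊠ φ)) ∎)
      where
      D = Λ 5 1 (h² ∘ 3j+1)
      E′ = Λ 1 5 (h² ∘ 3j-1)

  φ-L : φ ⊠ (L⁺ ⊞ L⁻) ≈ two ⊠ (a ⊠ b ⊠ b)
  φ-L = ≈-trans (R.*-cong ≈-refl Λ-h⁺+h⁻) (≈-trans (solve 3 (λ f c t → f :* (c :* t) := c :* (f :* t)) ≈-refl φ two τ₆) (R.*-cong ≈-refl φτ₆))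

  module Components (p : PS) (φp : φ ⊠ p ≈ 𝟙) where
    p₀ p₁ p₂ : PS
    p₀ = c 0 p
    p₁ = c 1 p
    p₂ = c 2 p

    private
      𝟙-D3 : 𝟙 ≈ D3 𝟙 𝟘 𝟘
      𝟙-D3 = ≈-sym (≈-trans (R.+-cong (R.+-cong sub-𝟙 (R.*-cong ≈-refl sub-𝟘)) (R.*-cong ≈-refl sub-𝟘))
        (solve 2 (λ y z → con (+ 1) :+ y :* con (+ 0) :+ z :* con (+ 0) := con (+ 1)) ≈-refl (q^ 1) (q^ 2)))

      -- The three classes of φ·p = 1: a linear system for the components of p with determinant a³ -
      -- 8q b³ = `Δ`.
      eqs : (a ⊠ p₀ ⊞ q^ 1 ⊠ (⊟ (two ⊠ b) ⊠ p₂ ⊞ 𝟘 ⊠ p₁) ≈ 𝟙) × (a ⊠ p₁ ⊞ ⊟ (two ⊠ b) ⊠ p₀ ⊞ q^ 1 ⊠ (𝟘 ⊠ p₂) ≈ 𝟘) × (a ⊠ p₂ ⊞ ⊟ (two ⊠ b) ⊠ p₁ ⊞ 𝟘 ⊠ p₀ ≈ 𝟘)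
      eqs = D3-inj (≈-trans (≈-sym (≈-trans (R.*-cong φ-D3 (D3-c p)) (D3-⊠ a (⊟ (two ⊠ b)) 𝟘 p₀ p₁ p₂))) (≈-trans φp 𝟙-D3))

      e₀ : a ⊠ p₀ ≈ 𝟙 ⊞ two ⊠ q^ 1 ⊠ b ⊠ p₂
      e₀ = ≈-trans (solve 5 (λ A b x r s → A := (A :+ x :* (:- (con (+ 2) :* b) :* r :+ con (+ 0) :* s)) :+ con (+ 2) :* x :* b :* r) ≈-refl (a ⊠ p₀) b (q^ 1) p₂ p₁) (R.+-cong (proj₁ eqs) ≈-refl)

      e₁ : a ⊠ p₁ ≈ two ⊠ b ⊠ p₀
      e₁ = ≈-trans (solve 5 (λ A b x r s → A := (A :+ :- (con (+ 2) :* b) :* r :+ x :* (con (+ 0) :* s)) :+ con (+ 2) :* b :* r) ≈-refl (a ⊠ p₁) b (q^ 1) p₀ p₂) (≈-trans (R.+-cong (proj₁ (proj₂ eqs)) ≈-refl) (R.+-identityˡ _))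

      e₂ : a ⊠ p₂ ≈ two ⊠ b ⊠ p₁
      e₂ = ≈-trans (solve 4 (λ A b r s → A := (A :+ :- (con (+ 2) :* b) :* r :+ con (+ 0) :* s) :+ con (+ 2) :* b :* r) ≈-refl (a ⊠ p₂) b p₁ p₀) (≈-trans (R.+-cong (proj₂ (proj₂ eqs)) ≈-refl) (R.+-identityˡ _))

    -- Cramer's rule by substitution: a p₂ leads to p₁, a p₁ to p₀, and a p₀ back to 1 and p₂.
    Δp₂ : Δ ⊠ p₂ ≈ fromℤ (+ 4) ⊠ (b ⊠ b)
    Δp₂ = begin
      Δ ⊠ p₂ ≈⟨ solve 4 (λ a b x p → (a :* a :* a :+ :- (con (+ 8) :* x :* (b :* b :* b))) :* p := a :* a :* (a :* p) :+ :- (con (+ 8) :* x :* (b :* b :* b) :* p)) ≈-refl a b (q^ 1) p₂ ⟩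
      a ⊠ a ⊠ (a ⊠ p₂) ⊞ ⊟ w ≈⟨ R.+-cong (R.*-cong ≈-refl e₂) ≈-refl ⟩
      a ⊠ a ⊠ (two ⊠ b ⊠ p₁) ⊞ ⊟ w ≈⟨ R.+-cong (solve 3 (λ a b p → a :* a :* (con (+ 2) :* b :* p) := con (+ 2) :* a :* b :* (a :* p)) ≈-refl a b p₁) ≈-refl ⟩
      two ⊠ a ⊠ b ⊠ (a ⊠ p₁) ⊞ ⊟ w ≈⟨ R.+-cong (R.*-cong ≈-refl e₁) ≈-refl ⟩
      two ⊠ a ⊠ b ⊠ (two ⊠ b ⊠ p₀) ⊞ ⊟ w ≈⟨ R.+-cong (solve 3 (λ a b p → con (+ 2) :* a :* b :* (con (+ 2) :* b :* p) := con (+ 4) :* b :* b :* (a :* p)) ≈-refl a b p₀) ≈-refl ⟩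
      fromℤ (+ 4) ⊠ b ⊠ b ⊠ (a ⊠ p₀) ⊞ ⊟ w ≈⟨ R.+-cong (R.*-cong ≈-refl e₀) ≈-refl ⟩
      fromℤ (+ 4) ⊠ b ⊠ b ⊠ (𝟙 ⊞ two ⊠ q^ 1 ⊠ b ⊠ p₂) ⊞ ⊟ w
        ≈⟨ solve 3 (λ b x p → con (+ 4) :* b :* b :* (con (+ 1) :+ con (+ 2) :* x :* b :* p) :+ :- (con (+ 8) :* x :* (b :* b :* b) :* p) := con (+ 4) :* (b :* b)) ≈-refl b (q^ 1) p₂ ⟩
      fromℤ (+ 4) ⊠ (b ⊠ b) ∎
      where w = fromℤ (+ 8) ⊠ q^ 1 ⊠ (b ⊠ b ⊠ b) ⊠ p₂

    φ⁴p₂ : φ ⊠ φ ⊠ φ ⊠ φ ⊠ p₂ ≈ fromℤ (+ 4) ⊠ (a ⊠ b ⊠ b)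
    φ⁴p₂ = begin
      φ ⊠ φ ⊠ φ ⊠ φ ⊠ p₂ ≈⟨ R.*-cong (≈-sym aΔ) ≈-refl ⟩
      a ⊠ Δ ⊠ p₂ ≈⟨ ≈-trans (R.*-assoc a Δ p₂) (R.*-cong ≈-refl Δp₂) ⟩
      a ⊠ (fromℤ (+ 4) ⊠ (b ⊠ b)) ≈⟨ solve 2 (λ a b → a :* (con (+ 4) :* (b :* b)) := con (+ 4) :* (a :* b :* b)) ≈-refl a b ⟩
      fromℤ (+ 4) ⊠ (a ⊠ b ⊠ b) ∎

    private
      -- After a p₀ is replaced by 1 + 2q b p₂, the unknown `G₀` occurs only inside a·`G₀` - 2q b l,
      -- which the hypothesis evaluates as ℓ/n. What remains is the Lambert series l.
      c2-Λ20 : ∀ f → (∀ k → sub (f k) ≈ f (3j k)) → ∀ n ℓ → n ⊠ lam₀ f ≈ κ ⊠ ℓ →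
        a ⊠ (n ⊠ c 2 (p ⊠ Λ 2 0 (f ∘ 3j))) ≈ p₂ ⊠ ℓ ⊞ ⊟ (n ⊠ Λ 6 0 (f ∘ 3j+1))
      c2-Λ20 f hs n ℓ h = begin
        a ⊠ (n ⊠ c 2 (p ⊠ Λ 2 0 (f ∘ 3j)))
          ≈⟨ R.*-cong ≈-refl (R.*-cong ≈-refl (≈-trans (c-cong 2 (≈-trans (R.*-cong (D3-c p) (Λ20-D3 f hs)) (D3-⊠ p₀ p₁ p₂ (G₀ f) 𝟘 (⊟ l)))) (c2-D3 _ _ _))) ⟩
        a ⊠ (n ⊠ (p₀ ⊠ ⊟ l ⊞ p₁ ⊠ 𝟘 ⊞ p₂ ⊠ G₀ f))
          ≈⟨ solve 7 (λ a n p r s l g → a :* (n :* (p :* :- l :+ r :* con (+ 0) :+ s :* g)) := s :* (n :* (a :* g)) :+ :- (n :* l :* (a :* p))) ≈-refl a n p₀ p₁ p₂ l (G₀ f) ⟩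
        p₂ ⊠ (n ⊠ (a ⊠ G₀ f)) ⊞ ⊟ (n ⊠ l ⊠ (a ⊠ p₀))
          ≈⟨ R.+-cong (R.*-cong ≈-refl nG) (R.-‿cong (R.*-cong ≈-refl e₀)) ⟩
        p₂ ⊠ (ℓ ⊞ n ⊠ (two ⊠ q^ 1 ⊠ b ⊠ l)) ⊞ ⊟ (n ⊠ l ⊠ (𝟙 ⊞ two ⊠ q^ 1 ⊠ b ⊠ p₂))
          ≈⟨ solve 6 (λ p ℓ n x b l → p :* (ℓ :+ n :* (con (+ 2) :* x :* b :* l)) :+ :- (n :* l :* (con (+ 1) :+ con (+ 2) :* x :* b :* p)) := p :* ℓ :+ :- (n :* l)) ≈-refl p₂ ℓ n (q^ 1) b l ⟩
        p₂ ⊠ ℓ ⊞ ⊟ (n ⊠ l) ∎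
        where
        l = Λ 6 0 (f ∘ 3j+1)
        w = two ⊠ q^ 1 ⊠ b ⊠ l
        nG : n ⊠ (a ⊠ G₀ f) ≈ ℓ ⊞ n ⊠ w
        nG = ≈-trans (solve 3 (λ n g w → n :* g := n :* (g :+ :- w) :+ n :* w) ≈-refl n (a ⊠ G₀ f) w)
          (R.+-cong (cancelˡ κ-unit (≈-trans (≈-trans (solve 3 (λ k n x → k :* (n :* x) := n :* (k :* x)) ≈-refl κ n (a ⊠ G₀ f ⊞ ⊟ w)) (R.*-cong ≈-refl (≈-sym (lam₀-κ f)))) h)) ≈-refl)

    c2-Y : a ⊠ c 2 (p ⊠ Y) ≈ p₂ ⊠ (φ ⊠ φ ⊠ φ) ⊞ ⊟ (two ⊠ L⁺)
    c2-scale : ∀ z f → c 2 (p ⊠ (fromℤ z ⊠ f)) ≈ fromℤ z ⊠ c 2 (p ⊠ f)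
    c2-scale z f = ≈-trans (c-cong 2 (solve 3 (λ p n f → p :* (n :* f) := n :* (p :* f)) ≈-refl p (fromℤ z) f))
      (mk≈ λ n → trans (⊠-ext {g = p ⊠ f} (fromℤ-constS z) (λ _ → refl) _) (trans (constS-⊠ (ℤ→ℚ z) (p ⊠ f) _)
        (sym (trans (⊠-ext {g = c 2 (p ⊠ f)} (fromℤ-constS z) (λ _ → refl) n) (constS-⊠ (ℤ→ℚ z) (c 2 (p ⊠ f)) n)))))
    c2-Y = ≈-trans (R.*-cong ≈-refl (c2-scale (+ 2) _)) (c2-Λ20 h⁺ sub-h⁺ two _ ℓ⁺)

    -- The summand 1 of `X` contributes a p₂, which cancels the term -a p₂ coming from `ℓ⁻`.
    c2-X : a ⊠ c 2 (p ⊠ X) ≈ p₂ ⊠ (φ ⊠ φ ⊠ φ) ⊞ ⊟ (six ⊠ L⁻)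
    c2-X = begin
      a ⊠ c 2 (p ⊠ X) ≈⟨ R.*-cong ≈-refl (≈-trans (c-cong 2 (solve 2 (λ p x → p :* (con (+ 1) :+ x) := p :+ p :* x) ≈-refl p (six ⊠ Λ 2 0 (h⁻ ∘ 3j)))) (≈-trans (c-⊞ 2 p _) (R.+-cong ≈-refl (c2-scale (+ 6) _)))) ⟩
      a ⊠ (p₂ ⊞ six ⊠ c 2 (p ⊠ Λ 2 0 (h⁻ ∘ 3j))) ≈⟨ R.distribˡ a _ _ ⟩
      a ⊠ p₂ ⊞ a ⊠ (six ⊠ c 2 (p ⊠ Λ 2 0 (h⁻ ∘ 3j))) ≈⟨ R.+-cong ≈-refl (c2-Λ20 h⁻ sub-h⁻ six _ ℓ⁻) ⟩
      a ⊠ p₂ ⊞ (p₂ ⊠ (φ ⊠ φ ⊠ φ ⊞ ⊟ a) ⊞ ⊟ (six ⊠ L⁻))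
        ≈⟨ solve 4 (λ a p f l → a :* p :+ (p :* (f :+ :- a) :+ :- (con (+ 6) :* l)) := p :* f :+ :- (con (+ 6) :* l)) ≈-refl a p₂ (φ ⊠ φ ⊠ φ) L⁻ ⟩
      p₂ ⊠ (φ ⊠ φ ⊠ φ) ⊞ ⊟ (six ⊠ L⁻) ∎

    private
      -- Since a p₂ = 2b p₁, the factor p₁ comes out and the two classes enter exactly in the
      -- combination of `ℓ₁`.
      c2-Λ11 : a ⊠ (two ⊠ c 2 (p ⊠ Λ 1 1 (h² ∘ 3j))) ≈ p₁ ⊠ (a ⊠ a ⊠ b ⊠ (φ ⊠ φ))
      c2-Λ11 = begin
        a ⊠ (two ⊠ c 2 (p ⊠ Λ 1 1 (h² ∘ 3j)))
          ≈⟨ R.*-cong ≈-refl (R.*-cong ≈-refl (≈-trans (c-cong 2 (≈-trans (R.*-cong (D3-c p) (Λ11-D3 h² sub-h²)) (D3-⊠ p₀ p₁ p₂ C (⊟ DE) 𝟘))) (c2-D3 _ _ _))) ⟩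
        a ⊠ (two ⊠ (p₀ ⊠ 𝟘 ⊞ p₁ ⊠ ⊟ DE ⊞ p₂ ⊠ C))
          ≈⟨ solve 6 (λ a p r s d g → a :* (con (+ 2) :* (p :* con (+ 0) :+ r :* :- d :+ s :* g)) := con (+ 2) :* ((a :* s) :* g) :+ :- (con (+ 2) :* (a :* r :* d))) ≈-refl a p₀ p₁ p₂ DE C ⟩
        two ⊠ ((a ⊠ p₂) ⊠ C) ⊞ ⊟ (two ⊠ (a ⊠ p₁ ⊠ DE)) ≈⟨ R.+-cong (R.*-cong ≈-refl (R.*-cong e₂ ≈-refl)) ≈-refl ⟩
        two ⊠ (two ⊠ b ⊠ p₁ ⊠ C) ⊞ ⊟ (two ⊠ (a ⊠ p₁ ⊠ DE))
          ≈⟨ solve 5 (λ a b r d g → con (+ 2) :* (con (+ 2) :* b :* r :* g) :+ :- (con (+ 2) :* (a :* r :* d)) := r :* (con (+ 2) :* (con (+ 2) :* b :* g :+ :- (a :* d)))) ≈-refl a b p₁ DE C ⟩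
        p₁ ⊠ (two ⊠ (two ⊠ b ⊠ C ⊞ ⊟ (a ⊠ DE))) ≈⟨ R.*-cong ≈-refl ℓ₁ ⟩
        p₁ ⊠ (a ⊠ a ⊠ b ⊠ (φ ⊠ φ)) ∎

    -- The terms p₂φ³ of 4`Y` and of the `h²` sum cancel. The others share φ²p₂ with coefficient 3a³
    -- - (2a³ + 8q b³) = `Δ`, and `Δp₂` removes p₂ altogether.
    c2-Z : a ⊠ c 2 (p ⊠ Z) ≈ fromℤ (+ 4) ⊠ (φ ⊠ φ ⊠ (b ⊠ b)) ⊞ ⊟ (fromℤ (+ 8) ⊠ L⁺) ⊞ fromℤ (+ 24) ⊠ L²
    c2-Z = begin
      a ⊠ c 2 (p ⊠ Z)
        ≈⟨ R.*-cong ≈-refl (≈-trans (c-cong 2 (solve 4 (λ p y h k → p :* (con (+ 4) :* y :+ :- (con (+ 24) :* h) :+ con (+ 12) :* k) := p :* (con (+ 4) :* y) :+ p :* (con -[1+ 23 ] :* h) :+ p :* (con (+ 12) :* k)) ≈-refl p Y H K))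
             (≈-trans (c-⊞ 2 _ _) (R.+-cong (≈-trans (c-⊞ 2 _ _) (R.+-cong (c2-scale (+ 4) Y) (c2-scale -[1+ 23 ] H))) (c2-scale (+ 12) K)))) ⟩
      a ⊠ (fromℤ (+ 4) ⊠ c 2 (p ⊠ Y) ⊞ fromℤ -[1+ 23 ] ⊠ c 2 (p ⊠ H) ⊞ fromℤ (+ 12) ⊠ c 2 (p ⊠ K))
        ≈⟨ solve 4 (λ a y h k → a :* (con (+ 4) :* y :+ con -[1+ 23 ] :* h :+ con (+ 12) :* k) := con (+ 4) :* (a :* y) :+ :- (con (+ 2) :* (a :* (con (+ 12) :* h))) :+ con (+ 6) :* (a :* (con (+ 2) :* k)))
             ≈-refl a (c 2 (p ⊠ Y)) (c 2 (p ⊠ H)) (c 2 (p ⊠ K)) ⟩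
      fromℤ (+ 4) ⊠ (a ⊠ c 2 (p ⊠ Y)) ⊞ ⊟ (two ⊠ (a ⊠ (fromℤ (+ 12) ⊠ c 2 (p ⊠ H)))) ⊞ six ⊠ (a ⊠ (two ⊠ c 2 (p ⊠ K)))
        ≈⟨ R.+-cong (R.+-cong (R.*-cong ≈-refl c2-Y) (R.-‿cong (R.*-cong ≈-refl (c2-Λ20 h² sub-h² (fromℤ (+ 12)) _ ℓ²)))) (R.*-cong ≈-refl c2-Λ11) ⟩
      fromℤ (+ 4) ⊠ (p₂ ⊠ (φ ⊠ φ ⊠ φ) ⊞ ⊟ (two ⊠ L⁺)) ⊞ ⊟ (two ⊠ (p₂ ⊠ ((a ⊠ a ⊠ a ⊞ fromℤ (+ 4) ⊠ q^ 1 ⊠ (b ⊠ b ⊠ b) ⊞ two ⊠ φ) ⊠ (φ ⊠ φ)) ⊞ ⊟ (fromℤ (+ 12) ⊠ L²))) ⊞ six ⊠ (p₁ ⊠ (a ⊠ a ⊠ b ⊠ (φ ⊠ φ)))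
        ≈⟨ solve 8 (λ p f l a b x l2 r → con (+ 4) :* (p :* (f :* f :* f) :+ :- (con (+ 2) :* l)) :+ :- (con (+ 2) :* (p :* ((a :* a :* a :+ con (+ 4) :* x :* (b :* b :* b) :+ con (+ 2) :* f) :* (f :* f)) :+ :- (con (+ 12) :* l2))) :+ con (+ 6) :* (r :* (a :* a :* b :* (f :* f)))
             := con (+ 3) :* (a :* a :* (f :* f)) :* (con (+ 2) :* b :* r) :+ :- (f :* f :* p :* (con (+ 2) :* (a :* a :* a) :+ con (+ 8) :* x :* (b :* b :* b))) :+ :- (con (+ 8) :* l) :+ con (+ 24) :* l2)
             ≈-refl p₂ φ L⁺ a b (q^ 1) L² p₁ ⟩
      fromℤ (+ 3) ⊠ (a ⊠ a ⊠ (φ ⊠ φ)) ⊠ (two ⊠ b ⊠ p₁) ⊞ ⊟ (φ ⊠ φ ⊠ p₂ ⊠ (two ⊠ (a ⊠ a ⊠ a) ⊞ fromℤ (+ 8) ⊠ q^ 1 ⊠ (b ⊠ b ⊠ b))) ⊞ ⊟ (fromℤ (+ 8) ⊠ L⁺) ⊞ fromℤ (+ 24) ⊠ L²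
        ≈⟨ R.+-cong (R.+-cong (R.+-cong (R.*-cong ≈-refl (≈-sym e₂)) ≈-refl) ≈-refl) ≈-refl ⟩
      fromℤ (+ 3) ⊠ (a ⊠ a ⊠ (φ ⊠ φ)) ⊠ (a ⊠ p₂) ⊞ ⊟ (φ ⊠ φ ⊠ p₂ ⊠ (two ⊠ (a ⊠ a ⊠ a) ⊞ fromℤ (+ 8) ⊠ q^ 1 ⊠ (b ⊠ b ⊠ b))) ⊞ ⊟ (fromℤ (+ 8) ⊠ L⁺) ⊞ fromℤ (+ 24) ⊠ L²
        ≈⟨ solve 7 (λ p f l a b x l2 → con (+ 3) :* (a :* a :* (f :* f)) :* (a :* p) :+ :- (f :* f :* p :* (con (+ 2) :* (a :* a :* a) :+ con (+ 8) :* x :* (b :* b :* b))) :+ :- (con (+ 8) :* l) :+ con (+ 24) :* l2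
             := f :* f :* ((a :* a :* a :+ :- (con (+ 8) :* x :* (b :* b :* b))) :* p) :+ :- (con (+ 8) :* l) :+ con (+ 24) :* l2) ≈-refl p₂ φ L⁺ a b (q^ 1) L² ⟩
      φ ⊠ φ ⊠ (Δ ⊠ p₂) ⊞ ⊟ (fromℤ (+ 8) ⊠ L⁺) ⊞ fromℤ (+ 24) ⊠ L² ≈⟨ R.+-cong (R.+-cong (≈-trans (R.*-cong ≈-refl Δp₂) (solve 2 (λ f b → f :* f :* (con (+ 4) :* (b :* b)) := con (+ 4) :* (f :* f :* (b :* b))) ≈-refl φ b)) ≈-refl) ≈-refl ⟩
      fromℤ (+ 4) ⊠ (φ ⊠ φ ⊠ (b ⊠ b)) ⊞ ⊟ (fromℤ (+ 8) ⊠ L⁺) ⊞ fromℤ (+ 24) ⊠ L² ∎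
      where
      H = Λ 2 0 (h² ∘ 3j)
      K = Λ 1 1 (h² ∘ 3j)

open Lambert

-- Weighted enumeration of overpartitions and rank classes modulo 6.

module Ranks where
  wsum : (OvPtn → ℚ) → List OvPtn → ℚ
  wsum w [] = 0ℚ
  wsum w (π ∷ xs) = w π ℚ.+ wsum w xs

  wsum-++ : ∀ w xs ys → wsum w (xs ++ ys) ≡ wsum w xs ℚ.+ wsum w ys
  wsum-++ w [] ys = sym (ℚP.+-identityˡ _)
  wsum-++ w (π ∷ xs) ys = trans (cong (w π ℚ.+_) (wsum-++ w xs ys)) (sym (ℚP.+-assoc (w π) (wsum w xs) (wsum w ys)))

  wsum-map : ∀ w (f : OvPtn → OvPtn) xs → wsum w (map f xs) ≡ wsum (w ∘ f) xs
  wsum-map w f [] = refl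
  wsum-map w f (π ∷ xs) = cong (w (f π) ℚ.+_) (wsum-map w f xs)

  wsum-concatMap : ∀ w (f : ℕ → List OvPtn) (g : ℕ → ℕ) N → wsum w (concatMap f (applyUpTo g N)) ≡ sumTo N (λ m → wsum w (f (g m)))
  wsum-concatMap w f g zero = refl
  wsum-concatMap w f g (suc N) = trans (wsum-++ w (f (g 0)) _) (cong (wsum w (f (g 0)) ℚ.+_) (wsum-concatMap w f (g ∘ suc) N))

  wsum-cong : ∀ {w w′} → (∀ π → w π ≡ w′ π) → ∀ xs → wsum w xs ≡ wsum w′ xs
  wsum-cong h [] = refl
  wsum-cong h (π ∷ xs) = cong₂ ℚ._+_ (h π) (wsum-cong h xs)

  private
    +-swap : ∀ x y z t → (x ℚ.+ y) ℚ.+ (z ℚ.+ t) ≡ (x ℚ.+ z) ℚ.+ (y ℚ.+ t)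
    +-swap = let open ℚSolver renaming (solve to solveℚ; _:+_ to _⊹_; _:=_ to _≔_) in
      solveℚ 4 (λ x y z t → (x ⊹ y) ⊹ (z ⊹ t) ≔ (x ⊹ z) ⊹ (y ⊹ t)) refl

  wsum-+ : ∀ w w′ xs → wsum (λ π → w π ℚ.+ w′ π) xs ≡ wsum w xs ℚ.+ wsum w′ xs
  wsum-+ w w′ [] = sym (ℚP.+-identityˡ 0ℚ)
  wsum-+ w w′ (π ∷ xs) = trans (cong (w π ℚ.+ w′ π ℚ.+_) (wsum-+ w w′ xs)) (+-swap (w π) (w′ π) (wsum w xs) (wsum w′ xs))

  wsum-0 : ∀ xs → wsum (λ _ → 0ℚ) xs ≡ 0ℚ
  wsum-0 [] = refl
  wsum-0 (π ∷ xs) = trans (ℚP.+-identityˡ _) (wsum-0 xs)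

  -- W p ω enumerates the overpartitions with parts ≤ p, weighted by ω(number of parts); New p ω those with largest part p + 1.
  W : ℕ → (ℕ → ℚ) → PS
  W p ω n = wsum (ω ∘ numParts) (ops p n)

  New : ℕ → (ℕ → ℚ) → PS
  New p ω n = sumTo (n ℕ./ suc p) (λ m → W p (λ k → ω (suc m ℕ.+ k)) (n ℕ.∸ suc m ℕ.* suc p) ℚ.+ W p (λ k → ω (suc m ℕ.+ k)) (n ℕ.∸ suc m ℕ.* suc p))

  Rk : (ℤ → ℚ) → ℕ → PS
  Rk χ p n = wsum (χ ∘ rank) (ops p n)

  private
    ops-suc : ∀ w p n → wsum w (ops (suc p) n) ≡ wsum w (ops p n) ℚ.+ sumTo (n ℕ./ suc p) (λ m →
      wsum (λ π → w ((suc p , suc m , false) ∷ π)) (ops p (n ℕ.∸ suc m ℕ.* suc p)) ℚ.+ wsum (λ π → w ((suc p , suc m , true) ∷ π)) (ops p (n ℕ.∸ suc m ℕ.* suc p)))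
    ops-suc w p n = trans (wsum-++ w (ops p n) _) (cong (wsum w (ops p n) ℚ.+_)
      (trans (wsum-concatMap w f id (n ℕ./ suc p)) (sumTo-cong (n ℕ./ suc p) {λ m → wsum w (f m)} (λ m _ → inner m))))
      where
      xs : ℕ → List OvPtn
      xs m = ops p (n ℕ.∸ suc m ℕ.* suc p)
      cons : ℕ → Bool → OvPtn → OvPtn
      cons m b π = (suc p , suc m , b) ∷ π
      g : ℕ → Bool → List OvPtn
      g m b = map (cons m b) (xs m)
      f : ℕ → List OvPtn
      f m = concatMap (g m) (false ∷ true ∷ [])
      inner : ∀ m → wsum w (f m) ≡ wsum (w ∘ cons m false) (xs m) ℚ.+ wsum (w ∘ cons m true) (xs m)
      inner m = trans (wsum-++ w (g m false) (g m true ++ [])) (cong₂ ℚ._+_ (wsum-map w (cons m false) (xs m))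
        (trans (wsum-++ w (g m true) []) (trans (ℚP.+-identityʳ (wsum w (g m true))) (wsum-map w (cons m true) (xs m)))))

  W-suc : ∀ p ω → W (suc p) ω ≈ W p ω ⊞ New p ω
  W-suc p ω .at n = trans (ops-suc (ω ∘ numParts) p n) (sym (⊞-at (W p ω) (New p ω) n))

  Rk-suc : ∀ χ p → Rk χ (suc p) ≈ Rk χ p ⊞ New p (λ k → χ (+ suc p ℤ.- + k))
  Rk-suc χ p .at n = trans (ops-suc (χ ∘ rank) p n) (sym (⊞-at (Rk χ p) (New p (λ k → χ (+ suc p ℤ.- + k))) n))

  New-low : ∀ p ω n → n ℕ.< suc p → New p ω n ≡ 0ℚ
  New-low p ω n l rewrite ℕD.m<n⇒m/n≡0 {n} {suc p} l = refl

  private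
    New-high : ∀ p ω n → New p ω (suc p ℕ.+ n) ≡ (W p (ω ∘ suc) n ℚ.+ W p (ω ∘ suc) n) ℚ.+ New p (ω ∘ suc) n
    New-high p ω n = trans (cong (λ N → sumTo N summand) quot) (cong₂ ℚ._+_
        (cong (λ x → W p (ω ∘ suc) x ℚ.+ W p (ω ∘ suc) x) (trans (cong (suc p ℕ.+ n ℕ.∸_) (ℕP.+-identityʳ (suc p))) (ℕP.m+n∸m≡n (suc p) n)))
        (sumTo-cong (n ℕ./ suc p) {summand ∘ suc} (λ m _ → cong (λ x → W p (λ k → ω (suc (suc m ℕ.+ k))) x ℚ.+ W p (λ k → ω (suc (suc m ℕ.+ k))) x) (ℕP.[m+n]∸[m+o]≡n∸o (suc p) n (suc m ℕ.* suc p)))))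
      where
      summand : ℕ → ℚ
      summand m = W p (λ k → ω (suc m ℕ.+ k)) (suc p ℕ.+ n ℕ.∸ suc m ℕ.* suc p) ℚ.+ W p (λ k → ω (suc m ℕ.+ k)) (suc p ℕ.+ n ℕ.∸ suc m ℕ.* suc p)
      quot : (suc p ℕ.+ n) ℕ./ suc p ≡ suc (n ℕ./ suc p)
      quot = trans (ℕD.m/n≡1+[m∸n]/n {suc p ℕ.+ n} {suc p} (ℕP.m≤m+n (suc p) n)) (cong (λ x → suc (x ℕ./ suc p)) (ℕP.m+n∸m≡n (suc p) n))

  -- One copy of the largest part p + 1 is removed. If it was the only copy, the choice of its
  -- overline gives `W p` twice; otherwise the rest still has largest part p + 1.
  New-step : ∀ p ω → New p ω ≈ q^ suc p ⊠ (W p (ω ∘ suc) ⊞ W p (ω ∘ suc) ⊞ New p (ω ∘ suc))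
  New-step p ω .at n with n ℕ.<? suc p
  ... | yes l = trans (New-low p ω n l) (sym (q^-⊠-low (suc p) _ n l))
  ... | no l = subst (λ n → New p ω n ≡ (q^ suc p ⊠ Q) n) (ℕP.m+[n∸m]≡n (ℕP.≮⇒≥ l))
      (trans (New-high p ω m) (trans (sym (trans (⊞-at _ _ m) (cong (ℚ._+ New p (ω ∘ suc) m) (⊞-at _ _ m)))) (sym (q^-⊠-high (suc p) Q m))))
    where
    m = n ℕ.∸ suc p
    Q = W p (ω ∘ suc) ⊞ W p (ω ∘ suc) ⊞ New p (ω ∘ suc)

  W-rec : ∀ p ω → W (suc p) ω ≈ W p ω ⊞ q^ suc p ⊠ (W (suc p) (ω ∘ suc) ⊞ W p (ω ∘ suc))
  W-rec p ω = ≈-trans (W-suc p ω) (R.+-cong ≈-refl (≈-trans (New-step p ω) (R.*-cong ≈-refl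
    (≈-trans (solve 2 (λ x y → x :+ x :+ y := (x :+ y) :+ x) ≈-refl (W p (ω ∘ suc)) (New p (ω ∘ suc))) (R.+-cong (≈-sym (W-suc p (ω ∘ suc))) ≈-refl)))))

  W-cong : ∀ p {ω ω′} → (∀ k → ω k ≡ ω′ k) → W p ω ≈ W p ω′
  W-cong p h .at n = wsum-cong (h ∘ numParts) (ops p n)

  W-0 : ∀ p → W p (λ _ → 0ℚ) ≈ 𝟘
  W-0 p .at n = trans (wsum-0 (ops p n)) (sym (𝟘-at n))

  W-+ : ∀ p ω ω′ → W p (λ k → ω k ℚ.+ ω′ k) ≈ W p ω ⊞ W p ω′
  W-+ p ω ω′ .at n = trans (wsum-+ _ _ (ops p n)) (sym (⊞-at (W p ω) (W p ω′) n))

  Rk-cong : ∀ p {χ χ′} → (∀ r → χ r ≡ χ′ r) → Rk χ p ≈ Rk χ′ p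
  Rk-cong p h .at n = wsum-cong (h ∘ rank) (ops p n)

  Rk-+ : ∀ p χ χ′ → Rk (λ r → χ r ℚ.+ χ′ r) p ≈ Rk χ p ⊞ Rk χ′ p
  Rk-+ p χ χ′ .at n = trans (wsum-+ _ _ (ops p n)) (sym (⊞-at (Rk χ p) (Rk χ′ p) n))

  W-zero : ∀ ω → ω 0 ≡ 1ℚ → W 0 ω ≈ 𝟙
  W-zero ω h .at zero = trans (ℚP.+-identityʳ (ω 0)) (trans h (sym (𝟙-at 0)))
  W-zero ω h .at (suc n) = sym (𝟙-at (suc n))

  private
    -- An overpartition of n has at most n parts, so only the weights up to n matter.
    W-vanish : ∀ p ω n → (∀ k → k ℕ.≤ n → ω k ≡ 0ℚ) → W p ω n ≡ 0ℚ
    New-vanish : ∀ p ω n fuel → n ℕ.≤ fuel → (∀ k → k ℕ.≤ n → ω k ≡ 0ℚ) → New p ω n ≡ 0ℚ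

    W-vanish zero ω zero h = trans (ℚP.+-identityʳ (ω 0)) (h 0 z≤n)
    W-vanish zero ω (suc n) h = refl
    W-vanish (suc p) ω n h = trans (W-suc p ω .at n) (trans (⊞-at (W p ω) (New p ω) n) (trans (cong₂ ℚ._+_ (W-vanish p ω n h) (New-vanish p ω n n ℕP.≤-refl h)) (ℚP.+-identityˡ 0ℚ)))

    New-vanish p ω n fuel l h with n ℕ.<? suc p
    ... | yes l′ = New-low p ω n l′
    New-vanish p ω zero zero l h | no l′ = ⊥-elim (l′ (s≤s z≤n))
    New-vanish p ω n (suc fuel) l h | no l′ = subst (λ n → New p ω n ≡ 0ℚ) back
        (trans (New-high p ω m) (trans (cong₂ ℚ._+_ (cong₂ ℚ._+_ (W-vanish p (ω ∘ suc) m h′) (W-vanish p (ω ∘ suc) m h′)) (New-vanish p (ω ∘ suc) m fuel m≤ h′)) refl))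
      where
      m = n ℕ.∸ suc p
      back : suc p ℕ.+ m ≡ n
      back = ℕP.m+[n∸m]≡n (ℕP.≮⇒≥ l′)
      h′ : ∀ k → k ℕ.≤ m → ω (suc k) ≡ 0ℚ
      h′ k k≤m = h (suc k) (subst (suc k ℕ.≤_) back (ℕP.+-mono-≤ (s≤s {n = p} z≤n) k≤m))
      m≤ : m ℕ.≤ fuel
      m≤ = ℕP.≤-pred (ℕP.≤-trans (subst (suc m ℕ.≤_) back (ℕP.+-monoˡ-≤ m (s≤s {n = p} z≤n))) l)

  W-low : ∀ p ω ω′ n → (∀ k → k ℕ.≤ n → ω k ≡ ω′ k) → W p ω n ≡ W p ω′ n
  W-low p ω ω′ n h = trans (W-cong p (λ k → split (ω k) (ω′ k)) .at n) (trans (W-+ p ω′ (λ k → ω k ℚ.- ω′ k) .at n) (trans (⊞-at _ _ n)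
    (trans (cong (W p ω′ n ℚ.+_) (W-vanish p (λ k → ω k ℚ.- ω′ k) n (λ k l → trans (cong (ℚ._- ω′ k) (h k l)) (ℚP.+-inverseʳ (ω′ k))))) (ℚP.+-identityʳ (W p ω′ n)))))
    where
    split : ∀ x y → x ≡ y ℚ.+ (x ℚ.- y)
    split = let open ℚSolver renaming (solve to solveℚ; _:+_ to _⊹_; _:-_ to _⊸_; _:=_ to _≔_) in solveℚ 2 (λ x y → x ≔ y ⊹ (x ⊸ y)) refl

  New-0 : ∀ p {ω} → (∀ k → ω k ≡ 0ℚ) → New p ω ≈ 𝟘
  New-0 p {ω} h .at n = trans (New-vanish p ω n n ℕP.≤-refl (λ k _ → h k)) (sym (𝟘-at n))

  -- The series over all overpartitions, weighted by the rank.
  Total : (ℤ → ℚ) → PS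
  Total χ n = Rk χ n n

  Rk-stable : ∀ χ p n → n ℕ.≤ p → Rk χ p n ≡ Total χ n
  Rk-stable χ p n l with ℕP.m≤n⇒m<n∨m≡n l
  ... | inj₂ refl = refl
  Rk-stable χ (suc p) n l | inj₁ (s≤s n≤p) = trans (Rk-suc χ p .at n) (trans (⊞-at (Rk χ p) (New p (λ k → χ (+ suc p ℤ.- + k))) n)
    (trans (cong (Rk χ p n ℚ.+_) (New-low p (λ k → χ (+ suc p ℤ.- + k)) n (s≤s n≤p))) (trans (ℚP.+-identityʳ (Rk χ p n)) (Rk-stable χ p n n≤p))))

  Total-cong : ∀ {χ χ′} → (∀ r → χ r ≡ χ′ r) → Total χ ≈ Total χ′
  Total-cong h .at n = Rk-cong n h .at n

  Total-+ : ∀ χ χ′ → Total (λ r → χ r ℚ.+ χ′ r) ≈ Total χ ⊞ Total χ′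
  Total-+ χ χ′ .at n = trans (Rk-+ n χ χ′ .at n) (trans (⊞-at _ _ n) (sym (⊞-at (Total χ) (Total χ′) n)))

  private
    Rk-ord : ∀ m χ p → χ (+ 0) ≡ 0ℚ → (∀ p n → n ℕ.< m → suc p ℕ.≤ n → New p (λ k → χ (+ suc p ℤ.- + k)) n ≡ 0ℚ) → ∀ n → n ℕ.< m → Rk χ p n ≡ 0ℚ
    Rk-ord m χ zero h0 h zero l = trans (ℚP.+-identityʳ (χ (+ 0))) h0
    Rk-ord m χ zero h0 h (suc n) l = refl
    Rk-ord m χ (suc p) h0 h n l = trans (Rk-suc χ p .at n) (trans (⊞-at (Rk χ p) (New p (λ k → χ (+ suc p ℤ.- + k))) n) (trans (cong₂ ℚ._+_ (Rk-ord m χ p h0 h n l) new) (ℚP.+-identityˡ 0ℚ)))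
      where
      new : New p (λ k → χ (+ suc p ℤ.- + k)) n ≡ 0ℚ
      new with n ℕ.<? suc p
      ... | yes l′ = New-low p (λ k → χ (+ suc p ℤ.- + k)) n l′
      ... | no l′ = h p n l (ℕP.≮⇒≥ l′)

  -- The size is at least the largest part and at least the number of parts, so a rank of absolute
  -- value m or more needs size m or more. The condition 1 ≤ m excludes the empty overpartition.
  Total-ord⁺ : ∀ m χ → 1 ℕ.≤ m → (∀ r → r ℤ.< + m → χ r ≡ 0ℚ) → Ord m (Total χ)
  Total-ord⁺ m χ 1≤m h = ord-intro λ n l → Rk-ord m χ n (h (+ 0) (ℤ.+<+ 1≤m)) (λ p n l sp≤n → New-vanish p (λ k → χ (+ suc p ℤ.- + k)) n n ℕP.≤-refl
    (λ k _ → h _ (ℤP.≤-<-trans (ℤP.i≤j⇒i-k≤j {+ suc p} {+ suc p} (+ k) ℤP.≤-refl) (ℤ.+<+ (ℕP.≤-<-trans sp≤n l))))) n l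

  Total-ord⁻ : ∀ m χ → 1 ℕ.≤ m → (∀ r → ℤ.- (+ m) ℤ.< r → χ r ≡ 0ℚ) → Ord m (Total χ)
  Total-ord⁻ m χ 1≤m h = ord-intro λ n l → Rk-ord m χ n (h (+ 0) (neg 1≤m)) (λ p n l sp≤n → New-vanish p (λ k → χ (+ suc p ℤ.- + k)) n n ℕP.≤-refl
    (λ k k≤n → h _ (ℤP.<-≤-trans (ℤP.neg-mono-< (ℤ.+<+ (ℕP.≤-<-trans k≤n l))) (subst (ℤ._≤ + suc p ℤ.- + k) (ℤP.+-identityˡ (ℤ.- (+ k))) (ℤP.+-monoˡ-≤ (ℤ.- (+ k)) (ℤ.+≤+ {n = suc p} z≤n)))))) n l
    where
    neg : ∀ {m} → 1 ℕ.≤ m → ℤ.- (+ m) ℤ.< + 0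
    neg (s≤s _) = ℤ.-<+

  indicator : ℕ → ℤ → ℚ
  indicator s r = if ⌊ (r ℤD.% + 6) ℕ.≟ s ⌋ then 1ℚ else 0ℚ

  private
    length-filter : ∀ {P : OvPtn → Set} (P? : ∀ π → Dec (P π)) xs → ℤ→ℚ (+ length (filter P? xs)) ≡ wsum (λ π → if ⌊ P? π ⌋ then 1ℚ else 0ℚ) xs
    length-filter P? [] = refl
    length-filter P? (π ∷ xs) with P? π
    ... | yes _ = trans (ℤ→ℚ-+ (+ 1) (+ length (filter P? xs))) (cong (1ℚ ℚ.+_) (length-filter P? xs))
    ... | no _ = trans (length-filter P? xs) (sym (ℚP.+-identityˡ _))

  Nbar-Total : ∀ s n → ℤ→ℚ (+ Nbar6 s n) ≡ Total (indicator s) n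
  Nbar-Total s n = length-filter (λ π → (rank π ℤD.% + 6) ℕ.≟ s) (overpartitions n)

  per6 : ℕ → ℚ
  per6 0 = 1ℚ
  per6 1 = 0ℚ
  per6 2 = 0ℚ
  per6 3 = 0ℚ
  per6 4 = 0ℚ
  per6 5 = 0ℚ
  per6 (suc (suc (suc (suc (suc (suc k)))))) = per6 k

  -- μ m k = 1 if k ≥ m and k ≡ m (mod 6).
  μ : ℕ → ℕ → ℚ
  μ zero k = per6 k
  μ (suc m) zero = 0ℚ
  μ (suc m) (suc k) = μ m k

  δℕ : ℕ → ℕ → ℚ
  δℕ zero zero = 1ℚ
  δℕ zero (suc k) = 0ℚ
  δℕ (suc m) zero = 0ℚ
  δℕ (suc m) (suc k) = δℕ m k

  μ-step : ∀ m k → μ m k ≡ δℕ m k ℚ.+ μ (6 ℕ.+ m) k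
  μ-step zero 0 = refl
  μ-step zero 1 = refl
  μ-step zero 2 = refl
  μ-step zero 3 = refl
  μ-step zero 4 = refl
  μ-step zero 5 = refl
  μ-step zero (suc (suc (suc (suc (suc (suc k)))))) = sym (ℚP.+-identityˡ (per6 k))
  μ-step (suc m) zero = refl
  μ-step (suc m) (suc k) = μ-step m k

  onℤ : (ℕ → ℚ) → ℤ → ℚ
  onℤ f (+ k) = f k
  onℤ f -[1+ k ] = 0ℚ

  private
    indℕ : ℕ → ℕ → ℚ
    indℕ s k = if ⌊ (k ℕ.% 6) ℕ.≟ s ⌋ then 1ℚ else 0ℚ

    6+% : ∀ k → (6 ℕ.+ k) ℕ.% 6 ≡ k ℕ.% 6
    6+% k = trans (cong (ℕ._% 6) (ℕP.+-comm 6 k)) (ℕD.[m+n]%n≡m%n k 6)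

    indℕ-6 : ∀ s k → indℕ s (6 ℕ.+ k) ≡ indℕ s k
    indℕ-6 s k = cong (λ x → if ⌊ x ℕ.≟ s ⌋ then 1ℚ else 0ℚ) (6+% k)

    period6 : ∀ {f g : ℕ → ℚ} → (∀ k → f (6 ℕ.+ k) ≡ f k) → (∀ k → g (6 ℕ.+ k) ≡ g k) →
      f 0 ≡ g 0 → f 1 ≡ g 1 → f 2 ≡ g 2 → f 3 ≡ g 3 → f 4 ≡ g 4 → f 5 ≡ g 5 → ∀ k → f k ≡ g k
    period6 F G p₀ p₁ p₂ p₃ p₄ p₅ 0 = p₀
    period6 F G p₀ p₁ p₂ p₃ p₄ p₅ 1 = p₁
    period6 F G p₀ p₁ p₂ p₃ p₄ p₅ 2 = p₂
    period6 F G p₀ p₁ p₂ p₃ p₄ p₅ 3 = p₃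
    period6 F G p₀ p₁ p₂ p₃ p₄ p₅ 4 = p₄
    period6 F G p₀ p₁ p₂ p₃ p₄ p₅ 5 = p₅
    period6 F G p₀ p₁ p₂ p₃ p₄ p₅ (suc (suc (suc (suc (suc (suc k)))))) = trans (F k) (trans (period6 F G p₀ p₁ p₂ p₃ p₄ p₅ k) (sym (G k)))

    μ-6 : ∀ m → m ℕ.≤ 5 → ∀ k → μ m (6 ℕ.+ k) ≡ μ m k
    μ-6 0 _ k = refl
    μ-6 1 _ zero = refl
    μ-6 2 _ zero = refl
    μ-6 2 _ (suc zero) = refl
    μ-6 3 _ zero = refl
    μ-6 3 _ (suc zero) = refl
    μ-6 3 _ (suc (suc zero)) = refl
    μ-6 4 _ zero = refl
    μ-6 4 _ (suc zero) = refl
    μ-6 4 _ (suc (suc zero)) = refl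
    μ-6 4 _ (suc (suc (suc zero))) = refl
    μ-6 5 _ zero = refl
    μ-6 5 _ (suc zero) = refl
    μ-6 5 _ (suc (suc zero)) = refl
    μ-6 5 _ (suc (suc (suc zero))) = refl
    μ-6 5 _ (suc (suc (suc (suc zero)))) = refl
    μ-6 1 _ (suc k) = refl
    μ-6 2 _ (suc (suc k)) = refl
    μ-6 3 _ (suc (suc (suc k))) = refl
    μ-6 4 _ (suc (suc (suc (suc k)))) = refl
    μ-6 5 _ (suc (suc (suc (suc (suc k))))) = refl
    μ-6 (suc (suc (suc (suc (suc (suc m)))))) (s≤s (s≤s (s≤s (s≤s (s≤s ()))))) k

    ≤5 : ∀ {m} k → m ℕ.+ k ≡ 5 → m ℕ.≤ 5
    ≤5 {m} k p = subst (m ℕ.≤_) p (ℕP.m≤m+n m k)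

    ind-μ1 : ∀ k → indℕ 1 k ≡ μ 1 k
    ind-μ1 = period6 (indℕ-6 1) (μ-6 1 (≤5 4 refl)) refl refl refl refl refl refl

    ind-μ2 : ∀ k → indℕ 2 k ≡ μ 2 k
    ind-μ2 = period6 (indℕ-6 2) (μ-6 2 (≤5 3 refl)) refl refl refl refl refl refl

    ind-μ3 : ∀ k → indℕ 3 k ≡ μ 3 k
    ind-μ3 = period6 (indℕ-6 3) (μ-6 3 (≤5 2 refl)) refl refl refl refl refl refl

    ind-μ4 : ∀ k → indℕ 4 k ≡ μ 4 k
    ind-μ4 = period6 (indℕ-6 4) (μ-6 4 (≤5 1 refl)) refl refl refl refl refl refl

    ind-μ5 : ∀ k → indℕ 5 k ≡ μ 5 k
    ind-μ5 = period6 (indℕ-6 5) (μ-6 5 (≤5 0 refl)) refl refl refl refl refl refl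

    -- A negative rank -(n+1) is ≡ s exactly when n + 1 ≡ 6 - s.
    ind-neg : ∀ s s′ → s ℕ.+ s′ ≡ 6 → 1 ℕ.≤ s → 1 ℕ.≤ s′ → ∀ n → indicator s -[1+ n ] ≡ indℕ s′ (suc n)
    ind-neg s s′ e 1≤s 1≤s′ n with suc n ℕ.% 6 in eq | ℕD.m%n<n (suc n) 6
    ... | zero | _ = trans (no₀ s 1≤s) (sym (no₀ s′ 1≤s′))
      where
      no₀ : ∀ s → 1 ℕ.≤ s → (if ⌊ 0 ℕ.≟ s ⌋ then 1ℚ else 0ℚ) ≡ 0ℚ
      no₀ (suc s) _ = refl
    ... | suc r | r<6 with (6 ℕ.∸ suc r) ℕ.≟ s | suc r ℕ.≟ s′
    ... | yes _ | yes _ = refl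
    ... | no _ | no _ = refl
    ... | yes p | no q = ⊥-elim (q (ℕP.+-cancelˡ-≡ s (suc r) s′ (trans (cong (ℕ._+ suc r) (sym p)) (trans (ℕP.m∸n+n≡m (ℕP.<⇒≤ r<6)) (sym e)))))
    ... | no p | yes q = ⊥-elim (p (trans (cong (6 ℕ.∸_) q) (trans (cong (ℕ._∸ s′) (sym e)) (ℕP.m+n∸n≡m s s′))))

    -- Positive ranks in the class are counted by `μ s`; a negative rank r is ≡ s exactly when -r ≡
    -- 6 - s. For s ≥ 1 the rank 0 belongs to neither side.
    ind-split : ∀ s s′ → s ℕ.+ s′ ≡ 6 → 1 ℕ.≤ s → 1 ℕ.≤ s′ → (∀ k → indℕ s k ≡ μ s k) → (∀ k → indℕ s′ k ≡ μ s′ k) →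
      ∀ r → indicator s r ≡ onℤ (μ s) r ℚ.+ onℤ (μ s′) (ℤ.- r)
    ind-split s (suc s′) e _ _ h h′ (+ zero) = trans (h 0) (sym (ℚP.+-identityʳ (μ s 0)))
    ind-split s s′ e _ _ h h′ (+ suc k) = trans (h (suc k)) (sym (ℚP.+-identityʳ (μ s (suc k))))
    ind-split s s′ e l l′ h h′ -[1+ n ] = trans (ind-neg s s′ e l l′ n) (trans (h′ (suc n)) (sym (ℚP.+-identityˡ (μ s′ (suc n)))))

    ind-sum : ∀ r → indicator 0 r ℚ.+ (indicator 1 r ℚ.+ (indicator 2 r ℚ.+ (indicator 3 r ℚ.+ (indicator 4 r ℚ.+ indicator 5 r)))) ≡ 1ℚ
    ind-sum r with r ℤD.% + 6 | ℤD.n%d<d r (+ 6)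
    ... | 0 | _ = refl
    ... | 1 | _ = refl
    ... | 2 | _ = refl
    ... | 3 | _ = refl
    ... | 4 | _ = refl
    ... | 5 | _ = refl
    ... | suc (suc (suc (suc (suc (suc _))))) | s≤s (s≤s (s≤s (s≤s (s≤s (s≤s ())))))

  M⁺ M⁻ : ℕ → PS
  M⁺ m = Total (onℤ (μ m))
  M⁻ m = Total (λ r → onℤ (μ m) (ℤ.- r))

  NS : ℕ → PS
  NS s = Total (indicator s)

  D∞ : PS
  D∞ = Total (λ _ → 1ℚ)

  NS-split : ∀ s s′ → (∀ r → indicator s r ≡ onℤ (μ s) r ℚ.+ onℤ (μ s′) (ℤ.- r)) → NS s ≈ M⁺ s ⊞ M⁻ s′
  NS-split s s′ h = ≈-trans (Total-cong h) (Total-+ (onℤ (μ s)) (λ r → onℤ (μ s′) (ℤ.- r)))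

  NS-1 : NS 1 ≈ M⁺ 1 ⊞ M⁻ 5
  NS-1 = NS-split 1 5 (ind-split 1 5 refl (s≤s z≤n) (s≤s z≤n) ind-μ1 ind-μ5)

  NS-2 : NS 2 ≈ M⁺ 2 ⊞ M⁻ 4
  NS-2 = NS-split 2 4 (ind-split 2 4 refl (s≤s z≤n) (s≤s z≤n) ind-μ2 ind-μ4)

  NS-3 : NS 3 ≈ M⁺ 3 ⊞ M⁻ 3
  NS-3 = NS-split 3 3 (ind-split 3 3 refl (s≤s z≤n) (s≤s z≤n) ind-μ3 ind-μ3)

  NS-4 : NS 4 ≈ M⁺ 4 ⊞ M⁻ 2
  NS-4 = NS-split 4 2 (ind-split 4 2 refl (s≤s z≤n) (s≤s z≤n) ind-μ4 ind-μ2)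

  NS-5 : NS 5 ≈ M⁺ 5 ⊞ M⁻ 1
  NS-5 = NS-split 5 1 (ind-split 5 1 refl (s≤s z≤n) (s≤s z≤n) ind-μ5 ind-μ1)

  -- Class 0 contains the rank 0, which a split into positive and negative ranks does not reach; it
  -- is recovered from the total.
  NS-sum : NS 0 ⊞ (NS 1 ⊞ (NS 2 ⊞ (NS 3 ⊞ (NS 4 ⊞ NS 5)))) ≈ D∞
  NS-sum = ≈-sym (≈-trans (Total-cong (λ r → sym (ind-sum r))) (split 0 from₁ (split 1 from₂ (split 2 from₃ (split 3 from₄ (Total-+ (indicator 4) (indicator 5)))))))
    where
    from₁ from₂ from₃ from₄ : ℤ → ℚ
    from₄ r = indicator 4 r ℚ.+ indicator 5 r
    from₃ r = indicator 3 r ℚ.+ from₄ r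
    from₂ r = indicator 2 r ℚ.+ from₃ r
    from₁ r = indicator 1 r ℚ.+ from₂ r
    split : ∀ s χ {S} → Total χ ≈ S → Total (λ r → indicator s r ℚ.+ χ r) ≈ NS s ⊞ S
    split s χ p = ≈-trans (Total-+ (indicator s) χ) (R.+-cong ≈-refl p)

  C⁺ C⁻ : ℕ → PS
  C⁺ m = Total (onℤ (δℕ m))
  C⁻ m = Total (λ r → onℤ (δℕ m) (ℤ.- r))

  private
    onℤ-+ : ∀ {f g h} → (∀ k → f k ≡ g k ℚ.+ h k) → ∀ r → onℤ f r ≡ onℤ g r ℚ.+ onℤ h r
    onℤ-+ p (+ k) = p k
    onℤ-+ p -[1+ k ] = refl

  M⁺-step : ∀ m → M⁺ m ≈ C⁺ m ⊞ M⁺ (6 ℕ.+ m)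
  M⁺-step m = ≈-trans (Total-cong (onℤ-+ (μ-step m))) (Total-+ (onℤ (δℕ m)) (onℤ (μ (6 ℕ.+ m))))

  M⁻-step : ∀ m → M⁻ m ≈ C⁻ m ⊞ M⁻ (6 ℕ.+ m)
  M⁻-step m = ≈-trans (Total-cong (λ r → onℤ-+ (μ-step m) (ℤ.- r))) (Total-+ (λ r → onℤ (δℕ m) (ℤ.- r)) (λ r → onℤ (μ (6 ℕ.+ m)) (ℤ.- r)))

  private
    μ-low : ∀ m k → k ℕ.< m → μ m k ≡ 0ℚ
    μ-low (suc m) zero l = refl
    μ-low (suc m) (suc k) (s≤s l) = μ-low m k l

    onℤ-low : ∀ m r → r ℤ.< + m → onℤ (μ m) r ≡ 0ℚ
    onℤ-low m (+ k) (ℤ.+<+ l) = μ-low m k l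
    onℤ-low m -[1+ k ] _ = refl

  M⁺-ord : ∀ m → Ord (suc m) (M⁺ (suc m))
  M⁺-ord m = Total-ord⁺ (suc m) _ (s≤s z≤n) (onℤ-low (suc m))

  M⁻-ord : ∀ m → Ord (suc m) (M⁻ (suc m))
  M⁻-ord m = Total-ord⁻ (suc m) _ (s≤s z≤n) (λ r l → onℤ-low (suc m) (ℤ.- r) (subst (ℤ._< + suc m) refl (flip r l)))
    where
    flip : ∀ r → ℤ.- (+ suc m) ℤ.< r → ℤ.- r ℤ.< + suc m
    flip r l = subst (ℤ.- r ℤ.<_) (ℤP.neg-involutive (+ suc m)) (ℤP.neg-mono-< l)

open Ranks

-- Conjugation symmetry and the series of bounded rank.

module Rank-differences where
  open Algebra.Properties.Ring R.ring using (+-cancelˡ)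

  belowℕ : ℕ → ℕ → ℚ
  belowℕ zero j = 0ℚ
  belowℕ (suc k) zero = 1ℚ
  belowℕ (suc k) (suc j) = belowℕ k j

  -- D p k enumerates the overpartitions with parts ≤ p and fewer than k parts, A p k those with exactly k parts.
  D A : ℕ → ℕ → PS
  D p k = W p (belowℕ k)
  A p k = W p (δℕ k)

  belowℕ-suc : ∀ k j → belowℕ (suc k) j ≡ belowℕ k j ℚ.+ δℕ k j
  belowℕ-suc zero zero = refl
  belowℕ-suc zero (suc j) = refl
  belowℕ-suc (suc k) zero = refl
  belowℕ-suc (suc k) (suc j) = belowℕ-suc k j

  D-suc : ∀ p k → D p (suc k) ≈ D p k ⊞ A p k
  D-suc p k = ≈-trans (W-cong p (belowℕ-suc k)) (W-+ p (belowℕ k) (δℕ k))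

  D-0 : ∀ p → D p 0 ≈ 𝟘
  D-0 = W-0

  D-empty : ∀ k → D 0 (suc k) ≈ 𝟙
  D-empty k = W-zero (belowℕ (suc k)) refl

  D-rec : ∀ p k → D (suc p) (suc k) ≈ D p (suc k) ⊞ q^ suc p ⊠ (D (suc p) k ⊞ D p k)
  D-rec p k = W-rec p (belowℕ (suc k))

  D-1 : ∀ p → D p 1 ≈ 𝟙
  D-1 zero = D-empty 0
  D-1 (suc p) = ≈-trans (D-rec p 0) (≈-trans (R.+-cong (D-1 p) (R.*-cong ≈-refl (R.+-cong (D-0 (suc p)) (D-0 p))))
    (solve 1 (λ x → con (+ 1) :+ x :* (con (+ 0) :+ con (+ 0)) := con (+ 1)) ≈-refl (q^ suc p)))

  -- The mirror image of `D-rec`, with the number of parts in the role of the largest part. It holds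
  -- because the two recursions commute: expanded in either order, they give the same terms at the
  -- neighbouring lattice points.
  D-rec′ : ∀ p k → D (suc p) (suc k) ≈ D (suc p) k ⊞ q^ k ⊠ (D p (suc k) ⊞ D p k)
  D-rec′ p zero = ≈-trans (D-1 (suc p)) (≈-sym (≈-trans (R.+-cong (D-0 (suc p)) (R.*-cong q^-0 (R.+-cong (D-1 p) (D-0 p))))
    (solve 0 (con (+ 0) :+ con (+ 1) :* (con (+ 1) :+ con (+ 0)) := con (+ 1)) ≈-refl)))
  D-rec′ zero (suc zero) = ≈-trans (D-rec 0 1) (R.+-cong (≈-trans (D-empty 1) (≈-sym (D-1 1)))
    (R.*-cong ≈-refl (R.+-cong (≈-trans (D-1 1) (≈-sym (D-empty 1))) ≈-refl)))
  D-rec′ zero (suc (suc k)) = begin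
    D 1 (3 ℕ.+ k) ≈⟨ D-rec 0 (2 ℕ.+ k) ⟩
    D 0 (3 ℕ.+ k) ⊞ q^ 1 ⊠ (D 1 (2 ℕ.+ k) ⊞ D 0 (2 ℕ.+ k))
      ≈⟨ R.+-cong (D-empty (2 ℕ.+ k)) (R.*-cong ≈-refl (R.+-cong (≈-trans (D-rec′ 0 (suc k)) (R.+-cong ≈-refl (R.*-cong ≈-refl (R.+-cong (D-empty (suc k)) (D-empty k))))) (D-empty (suc k)))) ⟩
    𝟙 ⊞ q^ 1 ⊠ ((D 1 (suc k) ⊞ q^ suc k ⊠ (𝟙 ⊞ 𝟙)) ⊞ 𝟙)
      ≈⟨ solve 3 (λ x y d → con (+ 1) :+ x :* ((d :+ y :* (con (+ 1) :+ con (+ 1))) :+ con (+ 1)) := (con (+ 1) :+ x :* (d :+ con (+ 1))) :+ (x :* y) :* (con (+ 1) :+ con (+ 1)))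
          ≈-refl (q^ 1) (q^ suc k) (D 1 (suc k)) ⟩
    (𝟙 ⊞ q^ 1 ⊠ (D 1 (suc k) ⊞ 𝟙)) ⊞ (q^ 1 ⊠ q^ suc k) ⊠ (𝟙 ⊞ 𝟙)
      ≈⟨ R.+-cong (≈-sym (≈-trans (D-rec 0 (suc k)) (R.+-cong (D-empty (suc k)) (R.*-cong ≈-refl (R.+-cong ≈-refl (D-empty k))))))
           (R.*-cong (≈-sym (q^-+ 1 (suc k))) (≈-sym (R.+-cong (D-empty (2 ℕ.+ k)) (D-empty (suc k))))) ⟩
    D 1 (2 ℕ.+ k) ⊞ q^ (2 ℕ.+ k) ⊠ (D 0 (3 ℕ.+ k) ⊞ D 0 (2 ℕ.+ k)) ∎
    where open ≈-Reasoning
  D-rec′ (suc p) (suc k) = begin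
    D (2 ℕ.+ p) (2 ℕ.+ k) ≈⟨ D-rec (suc p) (suc k) ⟩
    d₁₂ ⊞ q^ (2 ℕ.+ p) ⊠ (D (2 ℕ.+ p) (suc k) ⊞ d₁₁)
      ≈⟨ R.+-cong (D-rec′ p (suc k)) (R.*-cong (q^-+ 1 (suc p)) (R.+-cong (D-rec′ (suc p) k) (D-rec′ p k))) ⟩
    (d₁₁ ⊞ q^ suc k ⊠ (d₀₂ ⊞ d₀₁)) ⊞ (q^ 1 ⊠ q^ suc p) ⊠ ((D (2 ℕ.+ p) k ⊞ q^ k ⊠ (d₁₁ ⊞ d₁₀)) ⊞ (d₁₀ ⊞ q^ k ⊠ (d₀₁ ⊞ d₀₀)))
      ≈⟨ R.+-cong (R.+-cong ≈-refl (R.*-cong (q^-+ 1 k) ≈-refl)) ≈-refl ⟩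
    (d₁₁ ⊞ (q^ 1 ⊠ q^ k) ⊠ (d₀₂ ⊞ d₀₁)) ⊞ (q^ 1 ⊠ q^ suc p) ⊠ ((D (2 ℕ.+ p) k ⊞ q^ k ⊠ (d₁₁ ⊞ d₁₀)) ⊞ (d₁₀ ⊞ q^ k ⊠ (d₀₁ ⊞ d₀₀)))
      ≈⟨ solve 10 (λ q y z d₁₁ d₁₀ d₀₂ d₀₁ d₀₀ d₂₀ w →
           (d₁₁ :+ (q :* y) :* (d₀₂ :+ d₀₁)) :+ (q :* z) :* ((d₂₀ :+ y :* (d₁₁ :+ d₁₀)) :+ (d₁₀ :+ y :* (d₀₁ :+ d₀₀)))
           := (d₁₁ :+ (q :* z) :* (d₂₀ :+ d₁₀)) :+ (q :* y) :* ((d₀₂ :+ z :* (d₁₁ :+ d₀₁)) :+ (d₀₁ :+ z :* (d₁₀ :+ d₀₀))))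
          ≈-refl (q^ 1) (q^ k) (q^ suc p) d₁₁ d₁₀ d₀₂ d₀₁ d₀₀ (D (2 ℕ.+ p) k) d₁₂ ⟩
    (d₁₁ ⊞ (q^ 1 ⊠ q^ suc p) ⊠ (D (2 ℕ.+ p) k ⊞ d₁₀)) ⊞ (q^ 1 ⊠ q^ k) ⊠ ((d₀₂ ⊞ q^ suc p ⊠ (d₁₁ ⊞ d₀₁)) ⊞ (d₀₁ ⊞ q^ suc p ⊠ (d₁₀ ⊞ d₀₀)))
      ≈⟨ ≈-sym (R.+-cong (≈-trans (D-rec (suc p) k) (R.+-cong ≈-refl (R.*-cong (q^-+ 1 (suc p)) ≈-refl))) (R.*-cong (q^-+ 1 k) (R.+-cong (D-rec p (suc k)) (D-rec p k)))) ⟩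
    D (2 ℕ.+ p) (suc k) ⊞ q^ suc k ⊠ (d₁₂ ⊞ d₁₁) ∎
    where
    open ≈-Reasoning
    d₁₂ = D (suc p) (2 ℕ.+ k)
    d₁₁ = D (suc p) (suc k)
    d₁₀ = D (suc p) k
    d₀₂ = D p (2 ℕ.+ k)
    d₀₁ = D p (suc k)
    d₀₀ = D p k

  -- Conjugation of overpartitions, obtained from the two mirror recursions and matching boundary
  -- values in place of a bijection.
  D-sym : ∀ p k → D p (suc k) ≈ D k (suc p)
  D-sym zero k = ≈-trans (D-empty k) (≈-sym (D-1 k))
  D-sym (suc p) zero = ≈-trans (D-1 (suc p)) (≈-sym (D-empty (suc p)))
  D-sym (suc p) (suc k) = ≈-trans (D-rec p (suc k)) (≈-trans (R.+-cong (D-sym p (suc k)) (R.*-cong ≈-refl (R.+-cong (D-sym (suc p) k) (D-sym p k)))) (≈-sym (D-rec′ k (suc p))))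

  A-0 : ∀ p → A p 0 ≈ 𝟙
  A-0 p = ≈-trans (≈-sym (≈-trans (D-suc p 0) (≈-trans (R.+-cong (D-0 p) ≈-refl) (R.+-identityˡ (A p 0))))) (D-1 p)

  A-rec : ∀ p k → A (suc p) k ≈ q^ k ⊠ (D p (suc k) ⊞ D p k)
  A-rec p k = +-cancelˡ (D (suc p) k) (A (suc p) k) _ (≈-trans (≈-sym (D-suc (suc p) k)) (D-rec′ p k))

  UK : ℕ → ℕ → PS
  UK m zero = A m 0
  UK m (suc K) = UK m K ⊞ A (suc K ℕ.+ m) (suc K)

  -- U m = Σ_k A (k + m) k.
  U V : ℕ → PS
  U m n = UK m n n
  V m = U (suc m) ⊞ U m

  private
    A≡ : ∀ {p p′} k → p ≡ p′ → A p k ≈ A p′ k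
    A≡ k refl = ≈-refl

    δℕ-≢ : ∀ m k → k ℕ.< m → δℕ m k ≡ 0ℚ
    δℕ-≢ (suc m) zero l = refl
    δℕ-≢ (suc m) (suc k) (s≤s l) = δℕ-≢ m k l

    δℕ-≢′ : ∀ m k → m ℕ.< k → δℕ m k ≡ 0ℚ
    δℕ-≢′ zero (suc k) l = refl
    δℕ-≢′ (suc m) (suc k) (s≤s l) = δℕ-≢′ m k l

    A-ord : ∀ p k → Ord k (A p k)
    A-ord p k = ord-intro λ n l → trans (W-low p (δℕ k) (λ _ → 0ℚ) n (λ j j≤n → δℕ-≢ k j (ℕP.≤-<-trans j≤n l))) (trans (W-0 p .at n) (𝟘-at n))

    U-limit : ∀ m K → UK m K ≈[ suc K ] U m
    U-limit m zero = mk≈[] λ { zero _ → refl ; (suc n) (s≤s ()) }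
    U-limit m (suc K) = mk≈[] λ n l → go n (ℕP.m≤n⇒m<n∨m≡n (ℕP.≤-pred l))
      where
      go : ∀ n → n ℕ.< suc K ⊎ n ≡ suc K → UK m (suc K) n ≡ U m n
      go n (inj₂ refl) = refl
      go n (inj₁ l) = trans (⊞-at (UK m K) (A (suc K ℕ.+ m) (suc K)) n) (trans (cong (UK m K n ℚ.+_) (ord-at (A-ord (suc K ℕ.+ m) (suc K)) l))
        (trans (ℚP.+-identityʳ (UK m K n)) (U-limit m K .below n l)))

    step : ∀ m J → two ⊠ D (suc J ℕ.+ suc m) (2 ℕ.+ J) ≈ two ⊠ D (J ℕ.+ suc m) (suc J) ⊞ (A (suc J ℕ.+ suc m) (suc J) ⊞ A (suc J ℕ.+ m) (suc J))
      ⊞ q^ (2 ℕ.+ m) ⊠ (A (J ℕ.+ (3 ℕ.+ m)) J ⊞ A (J ℕ.+ (2 ℕ.+ m)) J)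
    step m J = begin
      two ⊠ D (suc P) (2 ℕ.+ J)
        ≈⟨ ≈-trans (≈-sym (two≈ (D (suc P) (2 ℕ.+ J)))) (R.+-cong (D-suc (suc P) (suc J)) (≈-trans (D-rec P (suc J)) (R.+-cong (D-suc P (suc J)) ≈-refl))) ⟩
      (D (suc P) (suc J) ⊞ A (suc P) (suc J)) ⊞ ((D P (suc J) ⊞ A P (suc J)) ⊞ q^ suc P ⊠ (D (suc P) (suc J) ⊞ D P (suc J)))
        ≈⟨ R.+-cong (R.+-cong (D-rec P J) (≈-refl {A (suc P) (suc J)})) (R.+-cong (R.+-cong (≈-refl {D P (suc J)}) (A≡ (suc J) (ℕP.+-suc J m))) (≈-refl {q^ suc P ⊠ (D (suc P) (suc J) ⊞ D P (suc J))})) ⟩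
      ((D P (suc J) ⊞ q^ suc P ⊠ (D (suc P) J ⊞ D P J)) ⊞ A (suc P) (suc J)) ⊞ ((D P (suc J) ⊞ A (suc J ℕ.+ m) (suc J)) ⊞ q^ suc P ⊠ (D (suc P) (suc J) ⊞ D P (suc J)))
        ≈⟨ solve 8 (λ d Q x y z w a b → ((d :+ Q :* (x :+ y)) :+ a) :+ ((d :+ b) :+ Q :* (z :+ w)) := (d :+ d) :+ (a :+ b) :+ Q :* ((z :+ x) :+ (w :+ y)))
            ≈-refl (D P (suc J)) (q^ suc P) (D (suc P) J) (D P J) (D (suc P) (suc J)) (D P (suc J)) (A (suc P) (suc J)) (A (suc J ℕ.+ m) (suc J)) ⟩
      (D P (suc J) ⊞ D P (suc J)) ⊞ (A (suc P) (suc J) ⊞ A (suc J ℕ.+ m) (suc J)) ⊞ q^ suc P ⊠ ((D (suc P) (suc J) ⊞ D (suc P) J) ⊞ (D P (suc J) ⊞ D P J))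
        ≈⟨ R.+-cong (R.+-cong (two≈ (D P (suc J))) ≈-refl) (≈-trans (R.*-cong (≈-trans (q^≡ sucP) (q^-+ (2 ℕ.+ m) J)) ≈-refl)
             (≈-trans (solve 4 (λ x y z w → (x :* y) :* (z :+ w) := x :* (y :* z :+ y :* w)) ≈-refl (q^ (2 ℕ.+ m)) (q^ J) (D (suc P) (suc J) ⊞ D (suc P) J) (D P (suc J) ⊞ D P J))
               (R.*-cong ≈-refl (R.+-cong (≈-trans (≈-sym (A-rec (suc P) J)) (A≡ J p₃)) (≈-trans (≈-sym (A-rec P J)) (A≡ J p₂)))))) ⟩
      two ⊠ D P (suc J) ⊞ (A (suc P) (suc J) ⊞ A (suc J ℕ.+ m) (suc J)) ⊞ q^ (2 ℕ.+ m) ⊠ (A (J ℕ.+ (3 ℕ.+ m)) J ⊞ A (J ℕ.+ (2 ℕ.+ m)) J) ∎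
      where
      open ≈-Reasoning
      P = J ℕ.+ suc m
      p₂ : suc P ≡ J ℕ.+ (2 ℕ.+ m)
      p₂ = sym (ℕP.+-suc J (suc m))
      p₃ : suc (suc P) ≡ J ℕ.+ (3 ℕ.+ m)
      p₃ = trans (cong suc p₂) (sym (ℕP.+-suc J (2 ℕ.+ m)))
      sucP : suc P ≡ 2 ℕ.+ m ℕ.+ J
      sucP = trans p₂ (ℕP.+-comm J (2 ℕ.+ m))

    -- The recursion for `V` cut off at K + 1 parts. Each further part number contributes one
    -- difference of `D`, expressed by `A` through both recursions.
    partial : ∀ m K → two ⊠ D (suc K ℕ.+ suc m) (2 ℕ.+ K) ≈ (UK (suc m) (suc K) ⊞ UK m (suc K)) ⊞ q^ (2 ℕ.+ m) ⊠ (UK (3 ℕ.+ m) K ⊞ UK (2 ℕ.+ m) K)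
    partial m zero = ≈-trans (step m 0) (≈-trans (R.+-cong (R.+-cong (≈-trans (≈-trans (R.*-cong ≈-refl (D-1 (suc m))) (≈-trans (R.*-identityʳ two) (≈-trans (≈-sym (R.*-identityʳ two)) (≈-sym (two≈ 𝟙))))) (≈-sym (R.+-cong (A-0 (suc m)) (A-0 m)))) ≈-refl) ≈-refl)
      (solve 5 (λ a b c d e → (a :+ b) :+ (c :+ d) :+ e := ((a :+ c) :+ (b :+ d)) :+ e) ≈-refl (A (suc m) 0) (A m 0) (A (1 ℕ.+ suc m) 1) (A (1 ℕ.+ m) 1) _))
    partial m (suc K) = ≈-trans (step m (suc K)) (≈-trans (R.+-cong (R.+-cong (partial m K) ≈-refl) ≈-refl)
      (solve 9 (λ a b Q c d x y z w → ((a :+ b) :+ Q :* (c :+ d)) :+ (x :+ y) :+ Q :* (z :+ w) := ((a :+ x) :+ (b :+ y)) :+ Q :* ((c :+ z) :+ (d :+ w))) ≈-refl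
        (UK (suc m) (suc K)) (UK m (suc K)) (q^ (2 ℕ.+ m)) (UK (3 ℕ.+ m) K) (UK (2 ℕ.+ m) K)
        (A (2 ℕ.+ K ℕ.+ suc m) (2 ℕ.+ K)) (A (2 ℕ.+ K ℕ.+ m) (2 ℕ.+ K)) (A (suc K ℕ.+ (3 ℕ.+ m)) (suc K)) (A (suc K ℕ.+ (2 ℕ.+ m)) (suc K))))

    belowℕ-1 : ∀ k j → j ℕ.< k → belowℕ k j ≡ 1ℚ
    belowℕ-1 (suc k) zero l = refl
    belowℕ-1 (suc k) (suc j) (s≤s l) = belowℕ-1 k j l

    D-limit : ∀ {N} p k → N ℕ.≤ suc p → N ℕ.≤ k → D p k ≈[ N ] D∞
    D-limit p k N≤p N≤k = mk≈[] λ n l → trans (W-low p (belowℕ k) (λ _ → 1ℚ) n (λ j j≤n → belowℕ-1 k j (ℕP.≤-trans (s≤s j≤n) (ℕP.≤-trans l N≤k))))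
      (Rk-stable (λ _ → 1ℚ) p n (ℕP.≤-pred (ℕP.≤-trans l N≤p)))

  -- `U m` enumerates the overpartitions of rank at most m. As K grows, `D` in `partial` tends to
  -- the series of all overpartitions.
  V-rec : ∀ m → V m ⊞ q^ (2 ℕ.+ m) ⊠ V (2 ℕ.+ m) ≈ two ⊠ D∞
  V-rec m = ≈[]⇒≈ λ N → ≈[]-sym (≈[]-trans
    (≈[]-⊠ (≈⇒≈[] (≈-refl {two})) (≈[]-sym (D-limit (suc N ℕ.+ suc m) (2 ℕ.+ N) (ℕP.m≤n⇒m≤1+n (ℕP.m≤n⇒m≤1+n (ℕP.m≤m+n N _))) (ℕP.m≤n⇒m≤1+n (ℕP.n≤1+n N)))))
    (≈[]-trans (≈⇒≈[] (partial m N)) (≈[]-⊞ (≈[]-⊞ (lim (suc m) (ℕP.n≤1+n N)) (lim m (ℕP.n≤1+n N)))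
      (≈[]-⊠ (≈⇒≈[] (≈-refl {q^ (2 ℕ.+ m)})) (≈[]-⊞ (lim (3 ℕ.+ m) ℕP.≤-refl) (lim (2 ℕ.+ m) ℕP.≤-refl))))))
    where
    lim : ∀ {N} m {K} → N ℕ.≤ K → UK m K ≈[ N ] U m
    lim m {K} l = ≈[]-weaken (ℕP.m≤n⇒m≤1+n l) (U-limit m K)

  private
    New-W : ∀ p {ω ω′} → (∀ k → ω k ≡ ω′ k) → New p ω ≈ W (suc p) ω′ ⊞ ⊟ W p ω′
    New-W p {ω} {ω′} h = ≈-trans (solve 2 (λ w x → x := (w :+ x) :- w) ≈-refl (W p ω) (New p ω)) (R.+-cong (≈-trans (≈-sym (W-suc p ω)) (W-cong (suc p) h)) (R.-‿cong (W-cong p h)))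

    rank-low : ∀ m a k → a ℕ.≤ m → onℤ (δℕ (suc m)) (a ℤ.⊖ k) ≡ 0ℚ
    rank-low m a k l = go (a ℤ.⊖ k) (ℤP.m⊖n≤m a k)
      where
      go : ∀ r → r ℤ.≤ + a → onℤ (δℕ (suc m)) r ≡ 0ℚ
      go (+ j) (ℤ.+≤+ j≤a) = δℕ-≢ (suc m) j (s≤s (ℕP.≤-trans j≤a l))
      go -[1+ j ] _ = refl

    ⊖-suc : ∀ {f} a b x → onℤ f (a ℤ.⊖ b) ≡ x → onℤ f (suc a ℤ.⊖ suc b) ≡ x
    ⊖-suc {f} a b x p = trans (cong (onℤ f) (ℤP.[1+m]⊖[1+n]≡m⊖n a b)) p

    rank⁺ : ∀ m K k → onℤ (δℕ (suc m)) ((K ℕ.+ suc m) ℤ.⊖ k) ≡ δℕ K k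
    rank⁺ m zero zero = refl′ m
      where
      refl′ : ∀ m → δℕ m m ≡ 1ℚ
      refl′ zero = refl
      refl′ (suc m) = refl′ m
    rank⁺ m zero (suc k) = ⊖-suc m k 0ℚ (rank-low m m k ℕP.≤-refl)
    rank⁺ m (suc K) zero = δℕ-≢′ (suc m) (suc K ℕ.+ suc m) (s≤s (ℕP.m≤n+m (suc m) K))
    rank⁺ m (suc K) (suc k) = ⊖-suc (K ℕ.+ suc m) k (δℕ K k) (rank⁺ m K k)

    rank⁻ : ∀ m p k → onℤ (δℕ (suc m)) (k ℤ.⊖ p) ≡ δℕ (p ℕ.+ suc m) k
    rank⁻ m zero k = refl
    rank⁻ m (suc p) zero = refl
    rank⁻ m (suc p) (suc k) = ⊖-suc k p (δℕ (p ℕ.+ suc m) k) (rank⁻ m p k)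

    Rk-0 : ∀ χ → χ (+ 0) ≡ 0ℚ → Rk χ 0 ≈ 𝟘
    Rk-0 χ h .at zero = trans (ℚP.+-identityʳ (χ (+ 0))) (trans h (sym (𝟘-at 0)))
    Rk-0 χ h .at (suc n) = sym (𝟘-at (suc n))

    Rk⁺-low : ∀ m P → P ℕ.≤ m → Rk (onℤ (δℕ (suc m))) P ≈ 𝟘
    Rk⁺-low m zero l = Rk-0 (onℤ (δℕ (suc m))) refl
    Rk⁺-low m (suc P) l = ≈-trans (Rk-suc (onℤ (δℕ (suc m))) P) (≈-trans (R.+-cong (Rk⁺-low m P (ℕP.<⇒≤ l))
      (New-0 P {λ k → onℤ (δℕ (suc m)) (+ suc P ℤ.- + k)} (λ k → trans (cong (onℤ (δℕ (suc m))) (ℤP.m-n≡m⊖n (suc P) k)) (rank-low m (suc P) k l)))) (R.+-identityˡ 𝟘))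

    New⁺ : ∀ m K → New (K ℕ.+ m) (λ k → onℤ (δℕ (suc m)) (+ suc (K ℕ.+ m) ℤ.- + k)) ≈ A (K ℕ.+ suc m) K ⊞ ⊟ A (K ℕ.+ m) K
    New⁺ m K = ≈-trans (New-W (K ℕ.+ m) {λ k → onℤ (δℕ (suc m)) (+ suc (K ℕ.+ m) ℤ.- + k)} {δℕ K} (λ k → trans (cong (onℤ (δℕ (suc m))) (trans (ℤP.m-n≡m⊖n (suc (K ℕ.+ m)) k) (cong (ℤ._⊖ k) (sym (ℕP.+-suc K m))))) (rank⁺ m K k)))
      (R.+-cong (A≡ K (sym (ℕP.+-suc K m))) ≈-refl)

    Rk⁺ : ∀ m K → Rk (onℤ (δℕ (suc m))) (suc (K ℕ.+ m)) ≈ UK (suc m) K ⊞ ⊟ UK m K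
    Rk⁺ m zero = ≈-trans (Rk-suc (onℤ (δℕ (suc m))) m) (≈-trans (R.+-cong (Rk⁺-low m m ℕP.≤-refl) (New⁺ m 0)) (R.+-identityˡ (A (suc m) 0 ⊞ ⊟ A m 0)))
    Rk⁺ m (suc K) = ≈-trans (Rk-suc (onℤ (δℕ (suc m))) (suc K ℕ.+ m)) (≈-trans (R.+-cong (Rk⁺ m K) (New⁺ m (suc K)))
      (solve 4 (λ a b c d → (a :- b) :+ (c :- d) := (a :+ c) :- (b :+ d)) ≈-refl (UK (suc m) K) (UK m K) (A (suc K ℕ.+ suc m) (suc K)) (A (suc K ℕ.+ m) (suc K))))

    -- Both sides are mixed second differences of `D`, on which `D-sym` acts by exchanging the two
    -- indices.
    A-sym : ∀ p k → A (suc p) (suc k) ⊞ ⊟ A p (suc k) ≈ A (suc k) (suc p) ⊞ ⊟ A k (suc p)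
    A-sym p k = ≈-trans (mixed p k) (≈-trans (R.+-cong (R.+-cong (D-sym (suc p) (suc k)) (R.-‿cong (D-sym (suc p) k))) (R.-‿cong (R.+-cong (D-sym p (suc k)) (R.-‿cong (D-sym p k)))))
      (≈-trans (solve 4 (λ a b c d → (a :- b) :- (c :- d) := (a :- c) :- (b :- d)) ≈-refl (D (suc k) (2 ℕ.+ p)) (D k (2 ℕ.+ p)) (D (suc k) (suc p)) (D k (suc p))) (≈-sym (mixed k p))))
      where
      diff : ∀ p k → A p k ≈ D p (suc k) ⊞ ⊟ D p k
      diff p k = ≈-trans (solve 2 (λ d a → a := (d :+ a) :- d) ≈-refl (D p k) (A p k)) (R.+-cong (≈-sym (D-suc p k)) ≈-refl)
      mixed : ∀ p k → A (suc p) (suc k) ⊞ ⊟ A p (suc k) ≈ (D (suc p) (2 ℕ.+ k) ⊞ ⊟ D (suc p) (suc k)) ⊞ ⊟ (D p (2 ℕ.+ k) ⊞ ⊟ D p (suc k))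
      mixed p k = R.+-cong (diff (suc p) (suc k)) (R.-‿cong (diff p (suc k)))

    Rk⁻ : ∀ m P → Rk (λ r → onℤ (δℕ (suc m)) (ℤ.- r)) P ≈ UK (suc m) P ⊞ ⊟ UK m P
    Rk⁻ m zero = ≈-trans (Rk-0 (λ r → onℤ (δℕ (suc m)) (ℤ.- r)) refl) (≈-sym (≈-trans (R.+-cong (A-0 (suc m)) (R.-‿cong (A-0 m))) (R.-‿inverseʳ 𝟙)))
    Rk⁻ m (suc p) = ≈-trans (Rk-suc (λ r → onℤ (δℕ (suc m)) (ℤ.- r)) p) (≈-trans (R.+-cong (Rk⁻ m p)
        (≈-trans (New-W p {λ k → onℤ (δℕ (suc m)) (ℤ.- (+ suc p ℤ.- + k))} {δℕ (suc p ℕ.+ suc m)} (λ k → trans (cong (onℤ (δℕ (suc m))) (neg k)) (rank⁻ m (suc p) k)))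
          (≈-trans (A-sym p (p ℕ.+ suc m)) (R.+-cong ≈-refl (R.-‿cong (A≡ (suc p) (ℕP.+-suc p m)))))))
      (solve 4 (λ a b c d → (a :- b) :+ (c :- d) := (a :+ c) :- (b :+ d)) ≈-refl (UK (suc m) p) (UK m p) (A (suc p ℕ.+ suc m) (suc p)) (A (suc p ℕ.+ m) (suc p))))
      where
      neg : ∀ k → ℤ.- (+ suc p ℤ.- + k) ≡ k ℤ.⊖ suc p
      neg k = trans (cong ℤ.-_ (ℤP.m-n≡m⊖n (suc p) k)) (sym (ℤP.⊖-swap k (suc p)))

    at-⊟ : ∀ f g n → (f ⊞ ⊟ g) n ≡ f n ℚ.- g n
    at-⊟ f g n = trans (⊞-at f (⊟ g) n) (cong (f n ℚ.+_) (⊟-at g n))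

  C⁺-U : ∀ m → C⁺ (suc m) ≈ U (suc m) ⊞ ⊟ U m
  C⁺-U m .at n = trans (sym (Rk-stable (onℤ (δℕ (suc m))) (suc (n ℕ.+ m)) n (ℕP.m≤n⇒m≤1+n (ℕP.m≤m+n n m))))
    (trans (Rk⁺ m n .at n) (trans (at-⊟ (UK (suc m) n) (UK m n) n) (sym (at-⊟ (U (suc m)) (U m) n))))

  -- The same value as `C⁺`, since conjugation reverses the sign of the rank; here it enters through
  -- `A-sym`.
  C⁻-U : ∀ m → C⁻ (suc m) ≈ U (suc m) ⊞ ⊟ U m
  C⁻-U m .at n = trans (Rk⁻ m n .at n) (trans (at-⊟ (UK (suc m) n) (UK m n) n) (sym (at-⊟ (U (suc m)) (U m) n)))

  private
    -- Each new part size i brings the factor (1 + q^i)/(1 - q^i), which is `W-rec` with constant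
    -- weight.
    W-product : ∀ p → W p (λ _ → 1ℚ) ⊠ pf 𝟙 1 1 p ≈ pf (⊟ 𝟙) 1 1 p
    W-product zero = ≈-trans (R.*-identityʳ _) (W-zero (λ _ → 1ℚ) refl)
    W-product (suc p) = begin
      w′ ⊠ (pf 𝟙 1 1 p ⊠ fac 𝟙 (1 ℕ.+ 1 ℕ.* p))
        ≈⟨ solve 3 (λ w f x → w :* (f :* (con (+ 1) :- con (+ 1) :* x)) := (w :- x :* w) :* f) ≈-refl w′ (pf 𝟙 1 1 p) x ⟩
      (w′ ⊞ ⊟ (x ⊠ w′)) ⊠ pf 𝟙 1 1 p
        ≈⟨ R.*-cong (R.+-cong (≈-trans (W-rec p (λ _ → 1ℚ)) (R.+-cong ≈-refl (R.*-cong (q^≡ (cong suc (sym (ℕP.*-identityˡ p)))) ≈-refl))) ≈-refl) ≈-refl ⟩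
      ((w ⊞ x ⊠ (w′ ⊞ w)) ⊞ ⊟ (x ⊠ w′)) ⊠ pf 𝟙 1 1 p
        ≈⟨ solve 4 (λ w w′ x f → ((w :+ x :* (w′ :+ w)) :- x :* w′) :* f := (w :* f) :* (con (+ 1) :- con -[1+ 0 ] :* x)) ≈-refl w w′ x (pf 𝟙 1 1 p) ⟩
      (w ⊠ pf 𝟙 1 1 p) ⊠ (𝟙 ⊞ ⊟ (fromℤ -[1+ 0 ] ⊠ x))
        ≈⟨ R.*-cong (W-product p) (R.+-cong ≈-refl (R.-‿cong (R.*-cong (fromℤ-neg (+ 1)) ≈-refl))) ⟩
      pf (⊟ 𝟙) 1 1 p ⊠ fac (⊟ 𝟙) (1 ℕ.+ 1 ℕ.* p) ∎
      where
      open ≈-Reasoning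
      w = W p (λ _ → 1ℚ)
      w′ = W (suc p) (λ _ → 1ℚ)
      x = q^ (1 ℕ.+ 1 ℕ.* p)

  -- `D∞` is (-q;q)_∞/(q;q)_∞, and κφ = `e` is Gauss's formula for φ as the reciprocal quotient.
  φD∞ : φ ⊠ D∞ ≈ 𝟙
  φD∞ = cancelˡ κ-unit (begin
    κ ⊠ (φ ⊠ D∞) ≈⟨ solve 3 (λ k f d → k :* (f :* d) := d :* (k :* f)) ≈-refl κ φ D∞ ⟩
    D∞ ⊠ (κ ⊠ φ) ≈⟨ R.*-cong ≈-refl (≈-trans κφ (≈-trans (Θ⁻-product 1 2) (≈-sym (pf∞-split3 𝟙 1 1)))) ⟩
    D∞ ⊠ pf∞ 𝟙 1 1 ≈⟨ ≈[]⇒≈ (λ N → ≈[]-trans (≈[]-⊠ (≈[]-sym (lim N)) (≈[]-sym (pf-limit 𝟙 1 1 N ℕP.≤-refl)))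
        (≈[]-trans (≈⇒≈[] (W-product N)) (pf-limit (⊟ 𝟙) 1 1 N ℕP.≤-refl))) ⟩
    κ ≈⟨ ≈-sym (R.*-identityʳ κ) ⟩
    κ ⊠ 𝟙 ∎)
    where
    open ≈-Reasoning
    lim : ∀ N → W N (λ _ → 1ℚ) ≈[ N ] D∞
    lim N = mk≈[] λ n l → Rk-stable (λ _ → 1ℚ) N n (ℕP.<⇒≤ l)

open Rank-differences

-- Partial theta series and bilateral sums for the rank classes.

module Rank-classes where
  -- Uniqueness for recursions that express m by larger indices: every use of the step gains an
  -- order in q, so the error is divisible by all powers of q.
  null : ∀ (err : ℕ → PS) → (∀ m → Ord m (err m)) → (∀ N m → (∀ m′ → Ord (N ℕ.+ m′) (err m′)) → Ord (suc (N ℕ.+ m)) (err m)) → ∀ m → err m ≈ 𝟘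
  null err h st m = ≈[]⇒≈ λ N → ≈[]-weaken (ℕP.m≤m+n N m) (go N m)
    where
    go : ∀ N m → Ord (N ℕ.+ m) (err m)
    go zero m = h m
    go (suc N) m = st N m (go N)

  -- The case in which the step itself gains nothing. The gain comes from the index: the error at d
  -- + 1 + m is already small of that order.
  null-shift : ∀ d (err : ℕ → PS) → (∀ m → Ord m (err m)) → (∀ N m → Ord N (err (suc d ℕ.+ m)) → Ord N (err m)) → ∀ m → err m ≈ 𝟘
  null-shift d err h st = null err h λ N m o → st _ m (≈[]-weaken (ℕP.≤-trans (ℕP.≤-reflexive (sym (ℕP.+-suc N m))) (ℕP.+-monoʳ-≤ N (s≤s (ℕP.m≤n+m m d)))) (o (suc d ℕ.+ m)))

  sub-null : ∀ {x y} → x ⊞ ⊟ y ≈ 𝟘 → x ≈ y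
  sub-null {x} {y} p = ≈-trans (solve 2 (λ x y → x := (x :- y) :+ y) ≈-refl x y) (≈-trans (R.+-cong p ≈-refl) (R.+-identityˡ y))

  sum-δ₀ : IsSum δ 𝟙
  sum-δ₀ = sum-cong (λ k → ≈-trans (R.*-identityˡ (δ (k ℤ.+ + 0))) (≈-reflexive (cong δ (ℤP.+-identityʳ k)))) ≈-refl (sum-δ (λ _ → 𝟙) (+ 0))

  pow : ℕ → ℤ → PS
  pow m k = q^ (∣ k ∣ ℕ.* m)

  gF : ℕ → ℤ → PS
  gF m (+ n) = θ⁻ 1 1 (+ n) ⊠ pow m (+ n)
  gF m -[1+ n ] = 𝟘

  -- The partial theta series Σ (-1)^n q^(n² + nm) over n ≥ 0.
  g : ℕ → PS
  g m = sumℤ 1 (gF m)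

  g-isSum : ∀ m → IsSum (gF m) (g m)
  g-isSum m = sumℤ-isSum 1 λ where
    (+ n) → ord-⊠ˡ (pow m (+ n)) (θ⁻-ord 1 1 (+ n))
    -[1+ n ] → ≈⇒≈[] ≈-refl

  private
    unit-exponent : ∀ m → θ⁻ 1 1 (+ 0) ⊠ pow m (+ 0) ≈ 𝟙
    unit-exponent m = ≈-trans (R.*-cong (≈-trans (R.*-identityˡ (q^ 0)) q^-0) q^-0) (R.*-identityˡ 𝟙)

  g-rec : ∀ m → g m ≈ 𝟙 ⊞ ⊟ (q^ suc m ⊠ g (2 ℕ.+ m))
  g-rec m = sum-unique (sum-suc (g-isSum m)) (sum-cong term ≈-refl (sum-⊞ (sum-suc sum-δ₀) (sum-⊟ (sum-⊠ (q^ suc m) (g-isSum (2 ℕ.+ m))))))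
    where
    ex : ∀ n → q^ θe 1 1 (+ suc n) ⊠ pow m (+ suc n) ≈ q^ suc m ⊠ (q^ θe 1 1 (+ n) ⊠ pow (2 ℕ.+ m) (+ n))
    ex n = ≈-trans (≈-sym (q^-+ (θe 1 1 (+ suc n)) (suc n ℕ.* m))) (≈-trans (q^≡ (trans (cong (ℕ._+ suc n ℕ.* m) (sym (sq-θe (+ suc n))))
      (trans (solveℕ 2 (λ n m → (con″ 1 +″ n) *″ (con″ 1 +″ n) +″ (con″ 1 +″ n) *″ m =″ con″ 1 +″ m +″ (n *″ n +″ n *″ (con″ 2 +″ m))) refl n m) (cong (λ e → suc m ℕ.+ (e ℕ.+ n ℕ.* (2 ℕ.+ m))) (sq-θe (+ n))))))
      (≈-trans (q^-+ (suc m) _) (R.*-cong ≈-refl (q^-+ (θe 1 1 (+ n)) (n ℕ.* (2 ℕ.+ m))))))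
    term : ∀ k → δ (ℤ.suc k) ⊞ ⊟ (q^ suc m ⊠ gF (2 ℕ.+ m) k) ≈ gF m (ℤ.suc k)
    term (+ n) = ≈-sym (≈-trans (solve 3 (λ e x y → (:- e :* x) :* y := con (+ 0) :- e :* (x :* y)) ≈-refl (ε (+ n)) (q^ θe 1 1 (+ suc n)) (pow m (+ suc n)))
      (R.+-cong ≈-refl (R.-‿cong (≈-trans (R.*-cong ≈-refl (ex n))
        (solve 4 (λ e x y z → e :* (z :* (x :* y)) := z :* ((e :* x) :* y)) ≈-refl (ε (+ n)) (q^ θe 1 1 (+ n)) (pow (2 ℕ.+ m) (+ n)) (q^ suc m))))))
    term -[1+ zero ] = ≈-trans (solve 1 (λ x → con (+ 1) :- x :* con (+ 0) := con (+ 1)) ≈-refl (q^ suc m)) (≈-sym (unit-exponent m))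
    term -[1+ suc n ] = solve 1 (λ x → con (+ 0) :- x :* con (+ 0) := con (+ 0)) ≈-refl (q^ suc m)

  -- Both sides solve y(m) + q^(m+2) y(m+2) = 2, by `V-rec` with φ`D∞` = 1 and by `g-rec`; the
  -- factor q^(m+2) forces uniqueness.
  φV : ∀ m → φ ⊠ V m ≈ two ⊠ g (suc m)
  φV m = sub-null (null err (λ m → ord-≈ (≈-sym (st m)) (ord-⊟ (ord-⊠ˡ (err (2 ℕ.+ m)) (≈[]-weaken (ℕP.m≤n+m m 2) (q^-ord (2 ℕ.+ m))))))
    (λ N m o → ord-≈ (≈-sym (st m)) (ord-⊟ (≈[]-weaken (gain N m) (ord-⊠ (q^-ord (2 ℕ.+ m)) (o (2 ℕ.+ m)))))) m)
    where
    err : ℕ → PS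
    err m = φ ⊠ V m ⊞ ⊟ (two ⊠ g (suc m))
    gain : ∀ N m → suc (N ℕ.+ m) ℕ.≤ (2 ℕ.+ m) ℕ.+ (N ℕ.+ (2 ℕ.+ m))
    gain N m = s≤s (ℕP.≤-trans (ℕP.+-monoʳ-≤ N (ℕP.m≤n+m m 2)) (ℕP.m≤n+m (N ℕ.+ (2 ℕ.+ m)) (suc m)))
    st : ∀ m → err m ≈ ⊟ (q^ (2 ℕ.+ m) ⊠ err (2 ℕ.+ m))
    st m = begin
      φ ⊠ V m ⊞ ⊟ (two ⊠ g (suc m))
        ≈⟨ R.+-cong (solve 4 (λ f v x w → f :* v := f :* (v :+ x :* w) :- x :* (f :* w)) ≈-refl φ (V m) (q^ (2 ℕ.+ m)) (V (2 ℕ.+ m))) (R.-‿cong (R.*-cong ≈-refl (g-rec (suc m)))) ⟩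
      (φ ⊠ (V m ⊞ q^ (2 ℕ.+ m) ⊠ V (2 ℕ.+ m)) ⊞ ⊟ (q^ (2 ℕ.+ m) ⊠ (φ ⊠ V (2 ℕ.+ m)))) ⊞ ⊟ (two ⊠ (𝟙 ⊞ ⊟ (q^ (2 ℕ.+ m) ⊠ g (3 ℕ.+ m))))
        ≈⟨ R.+-cong (R.+-cong (≈-trans (R.*-cong ≈-refl (V-rec m)) (solve 3 (λ f t d → f :* (t :* d) := t :* (f :* d)) ≈-refl φ two D∞)) ≈-refl) ≈-refl ⟩
      (two ⊠ (φ ⊠ D∞) ⊞ ⊟ (q^ (2 ℕ.+ m) ⊠ (φ ⊠ V (2 ℕ.+ m)))) ⊞ ⊟ (two ⊠ (𝟙 ⊞ ⊟ (q^ (2 ℕ.+ m) ⊠ g (3 ℕ.+ m))))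
        ≈⟨ R.+-cong (R.+-cong (R.*-cong ≈-refl φD∞) ≈-refl) ≈-refl ⟩
      (two ⊠ 𝟙 ⊞ ⊟ (q^ (2 ℕ.+ m) ⊠ (φ ⊠ V (2 ℕ.+ m)))) ⊞ ⊟ (two ⊠ (𝟙 ⊞ ⊟ (q^ (2 ℕ.+ m) ⊠ g (3 ℕ.+ m))))
        ≈⟨ solve 4 (λ t x v g → (t :* con (+ 1) :- x :* v) :- t :* (con (+ 1) :- x :* g) := :- (x :* (v :- t :* g))) ≈-refl two (q^ (2 ℕ.+ m)) (φ ⊠ V (2 ℕ.+ m)) (g (3 ℕ.+ m)) ⟩
      ⊟ (q^ (2 ℕ.+ m) ⊠ err (2 ℕ.+ m)) ∎
      where open ≈-Reasoning

  -- Folding k and -k counts the central term twice, hence the extra 1.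
  g-Λ : ∀ m → two ⊠ g m ≈ Λ 1 1 (pow m) ⊞ 𝟙
  g-Λ m = ≈-trans (≈-sym (two≈ (g m))) (sum-unique (sum-⊞ (g-isSum m) (sum-neg (g-isSum m))) (sum-cong (λ k → ≈-sym (term k)) ≈-refl (sum-⊞ (Λ-isSum 1 1 (pow m)) sum-δ₀)))
    where
    term : ∀ k → gF m k ⊞ gF m (ℤ.- k) ≈ θ⁻ 1 1 k ⊠ pow m k ⊞ δ k
    term (+ zero) = R.+-cong ≈-refl (unit-exponent m)
    term (+ suc n) = ≈-refl
    term -[1+ n ] = ≈-trans (R.+-comm 𝟘 (gF m (+ suc n))) (R.+-cong (R.*-cong (R.*-cong ≈-refl (q^≡ (sym (θe-neg 1 1 (+ suc n))))) ≈-refl) ≈-refl)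

  -- With x = q^(n+1), `K n` is 1/((1 + x)(1 - x⁶)). The factor 1 - x⁶ is kept as (1 - x³)(1 + x³)
  -- for comparison with the kernels at 3j.
  x ζ ξ η K : ℕ → PS
  x n = q^ suc n
  ζ n = inv (1+q n)
  ξ n = inv (1-q (n ℕ.+ 2 ℕ.* suc n))
  η n = inv (1+q (n ℕ.+ 2 ℕ.* suc n))
  K n = ζ n ⊠ (ξ n ⊠ η n)

  x³ : ∀ n → q^ (3 ℕ.* suc n) ≈ x n ⊠ x n ⊠ x n
  x³ n = ≈-trans (q^≡ (solveℕ 1 (λ n → con″ 3 *″ (con″ 1 +″ n) =″ (con″ 1 +″ n) +″ (con″ 1 +″ n) +″ (con″ 1 +″ n)) refl n))
    (≈-trans (q^-+ (suc n ℕ.+ suc n) (suc n)) (R.*-cong (q^-+ (suc n) (suc n)) ≈-refl))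

  ζ-inv : ∀ n → (𝟙 ⊞ x n) ⊠ ζ n ≈ 𝟙
  ζ-inv n = inv-⊠ (one-at-0 n)
  ξ-inv : ∀ n → (𝟙 ⊞ ⊟ (x n ⊠ x n ⊠ x n)) ⊠ ξ n ≈ 𝟙
  ξ-inv n = ≈-trans (R.*-cong (R.+-cong ≈-refl (R.-‿cong (≈-sym (x³ n)))) ≈-refl) (inv-⊠ (one-at-0′ (n ℕ.+ 2 ℕ.* suc n)))
  η-inv : ∀ n → (𝟙 ⊞ x n ⊠ x n ⊠ x n) ⊠ η n ≈ 𝟙
  η-inv n = ≈-trans (R.*-cong (R.+-cong ≈-refl (≈-sym (x³ n))) ≈-refl) (inv-⊠ (one-at-0 (n ℕ.+ 2 ℕ.* suc n)))

  one³ : ∀ {p q r} → p ≈ 𝟙 → q ≈ 𝟙 → r ≈ 𝟙 → ∀ y → y ⊠ (p ⊠ (q ⊠ r)) ≈ y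
  one³ p q r y = ≈-trans (R.*-cong ≈-refl (≈-trans (R.*-cong p (R.*-cong q r)) (≈-trans (R.*-identityˡ (𝟙 ⊠ 𝟙)) (R.*-identityˡ 𝟙)))) (R.*-identityʳ y)

  -- For one rank m the classical summand is x^m(1 - x)/(1 + x) up to sign and q^(n²). Summing it
  -- over m, m + 6, m + 12, ... supplies the factor 1/(1 - x⁶).
  ρ : ℕ → ℤ → PS
  ρ m (+ zero) = 𝟘
  ρ m (+ suc n) = pow m (+ suc n) ⊠ ((𝟙 ⊞ ⊟ x n) ⊠ K n)
  ρ m -[1+ n ] = pow m (+ suc n) ⊠ ((𝟙 ⊞ ⊟ x n) ⊠ K n)

  T̂ : ℕ → PS
  T̂ m = ⊟ Λ 1 1 (ρ m)

  pow-+ : ∀ d m n → pow (d ℕ.+ m) (+ suc n) ≈ pow d (+ suc n) ⊠ pow m (+ suc n)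
  pow-+ d m n = ≈-trans (q^≡ (ℕP.*-distribˡ-+ (suc n) d m)) (q^-+ (suc n ℕ.* d) (suc n ℕ.* m))

  pow-1 : ∀ n → pow 1 (+ suc n) ≈ x n
  pow-1 n = q^≡ (ℕP.*-identityʳ (suc n))

  pow-suc : ∀ m n → pow (suc m) (+ suc n) ≈ x n ⊠ pow m (+ suc n)
  pow-suc m n = ≈-trans (pow-+ 1 m n) (R.*-cong (pow-1 n) ≈-refl)

  pow-0 : ∀ n → pow 0 (+ suc n) ≈ 𝟙
  pow-0 n = ≈-trans (q^≡ (ℕP.*-zeroʳ (suc n))) q^-0

  private
    pow-6 : ∀ m n → pow (6 ℕ.+ m) (+ suc n) ≈ (x n ⊠ x n ⊠ x n) ⊠ (x n ⊠ x n ⊠ x n) ⊠ pow m (+ suc n)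
    pow-6 m n = ≈-trans (pow-+ 6 m n) (R.*-cong (≈-trans (up (≈-trans (up (≈-trans (up (≈-trans (up (≈-trans (up (pow-suc 0 n)) ≈-refl)) ≈-refl)) ≈-refl)) ≈-refl))
      (≈-trans (R.*-cong ≈-refl (R.*-cong ≈-refl (R.*-cong ≈-refl (R.*-cong ≈-refl (R.*-cong ≈-refl (R.*-cong ≈-refl (pow-0 n)))))))
        (solve 1 (λ x → x :* (x :* (x :* (x :* (x :* (x :* con (+ 1)))))) := (x :* x :* x) :* (x :* x :* x)) ≈-refl (x n)))) ≈-refl)
      where
      up : ∀ {d y} → pow d (+ suc n) ≈ y → pow (suc d) (+ suc n) ≈ x n ⊠ y
      up {d} h = ≈-trans (pow-suc d n) (R.*-cong ≈-refl h)

    ρ-rec-pos : ∀ m n → ⊟ ρ m (+ suc n) ⊞ ⊟ ρ (suc m) (+ suc n) ⊞ ρ (6 ℕ.+ m) (+ suc n) ⊞ ρ (7 ℕ.+ m) (+ suc n) ≈ pow (suc m) (+ suc n) ⊞ ⊟ pow m (+ suc n)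
    ρ-rec-pos m n = begin
      ⊟ (y ⊠ w) ⊞ ⊟ (pow (suc m) (+ suc n) ⊠ w) ⊞ pow (6 ℕ.+ m) (+ suc n) ⊠ w ⊞ pow (7 ℕ.+ m) (+ suc n) ⊠ w
        ≈⟨ R.+-cong (R.+-cong (R.+-cong ≈-refl (R.-‿cong (R.*-cong (pow-suc m n) ≈-refl))) (R.*-cong (pow-6 m n) ≈-refl)) (R.*-cong (≈-trans (pow-6 (suc m) n) (R.*-cong ≈-refl (pow-suc m n))) ≈-refl) ⟩
      ⊟ (y ⊠ w) ⊞ ⊟ ((x n ⊠ y) ⊠ w) ⊞ ((x n ⊠ x n ⊠ x n) ⊠ (x n ⊠ x n ⊠ x n) ⊠ y) ⊠ w ⊞ ((x n ⊠ x n ⊠ x n) ⊠ (x n ⊠ x n ⊠ x n) ⊠ (x n ⊠ y)) ⊠ w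
        ≈⟨ solve 5 (λ x y ζ ξ η → let w = (con (+ 1) :- x) :* (ζ :* (ξ :* η)) ; c = x :* x :* x in
             :- (y :* w) :- (x :* y) :* w :+ (c :* c :* y) :* w :+ (c :* c :* (x :* y)) :* w
             := (x :* y :- y) :* (((con (+ 1) :+ x) :* ζ) :* (((con (+ 1) :- c) :* ξ) :* ((con (+ 1) :+ c) :* η)))) ≈-refl (x n) y (ζ n) (ξ n) (η n) ⟩
      (x n ⊠ y ⊞ ⊟ y) ⊠ (((𝟙 ⊞ x n) ⊠ ζ n) ⊠ (((𝟙 ⊞ ⊟ (x n ⊠ x n ⊠ x n)) ⊠ ξ n) ⊠ ((𝟙 ⊞ x n ⊠ x n ⊠ x n) ⊠ η n)))
        ≈⟨ one³ (ζ-inv n) (ξ-inv n) (η-inv n) (x n ⊠ y ⊞ ⊟ y) ⟩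
      x n ⊠ y ⊞ ⊟ y ≈⟨ R.+-cong (≈-sym (pow-suc m n)) ≈-refl ⟩
      pow (suc m) (+ suc n) ⊞ ⊟ y ∎
      where
      open ≈-Reasoning
      y = pow m (+ suc n)
      w = (𝟙 ⊞ ⊟ x n) ⊠ K n

    ρ-rec : ∀ m k → ⊟ ρ m k ⊞ ⊟ ρ (suc m) k ⊞ ρ (6 ℕ.+ m) k ⊞ ρ (7 ℕ.+ m) k ≈ pow (suc m) k ⊞ ⊟ pow m k
    ρ-rec m (+ zero) = solve 1 (λ x → :- con (+ 0) :- con (+ 0) :+ con (+ 0) :+ con (+ 0) := x :- x) ≈-refl (q^ 0)
    ρ-rec m (+ suc n) = ρ-rec-pos m n
    ρ-rec m -[1+ n ] = ρ-rec-pos m n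

    T̂-isSum : ∀ m → IsSum (λ k → ⊟ (θ⁻ 1 1 k ⊠ ρ m k)) (T̂ m)
    T̂-isSum m = sum-⊟ (Λ-isSum 1 1 (ρ m))

  -- Adding the neighbours m and m + 1 cancels 1 + x, subtracting the shift by 6 cancels 1 - x⁶.
  -- What is left is a difference of two partial theta series.
  T̂-rec : ∀ m → T̂ m ⊞ T̂ (suc m) ⊞ (⊟ T̂ (6 ℕ.+ m) ⊞ ⊟ T̂ (7 ℕ.+ m)) ≈ two ⊠ g (suc m) ⊞ ⊟ (two ⊠ g m)
  T̂-rec m = ≈-trans (sum-unique
      (sum-⊞ (sum-⊞ (T̂-isSum m) (T̂-isSum (suc m))) (sum-⊞ (sum-⊟ (T̂-isSum (6 ℕ.+ m))) (sum-⊟ (T̂-isSum (7 ℕ.+ m)))))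
      (sum-cong term ≈-refl (sum-⊞ (Λ-isSum 1 1 (pow (suc m))) (sum-⊟ (Λ-isSum 1 1 (pow m))))))
    (≈-trans (solve 2 (λ a b → a :- b := (a :+ con (+ 1)) :- (b :+ con (+ 1))) ≈-refl (Λ 1 1 (pow (suc m))) (Λ 1 1 (pow m)))
      (≈-sym (R.+-cong (g-Λ (suc m)) (R.-‿cong (g-Λ m)))))
    where
    term : ∀ k → θ⁻ 1 1 k ⊠ pow (suc m) k ⊞ ⊟ (θ⁻ 1 1 k ⊠ pow m k) ≈
      ⊟ (θ⁻ 1 1 k ⊠ ρ m k) ⊞ ⊟ (θ⁻ 1 1 k ⊠ ρ (suc m) k) ⊞ (⊟ (⊟ (θ⁻ 1 1 k ⊠ ρ (6 ℕ.+ m) k)) ⊞ ⊟ (⊟ (θ⁻ 1 1 k ⊠ ρ (7 ℕ.+ m) k)))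
    term k = ≈-trans (solve 3 (λ t a b → t :* a :- t :* b := t :* (a :- b)) ≈-refl (θ⁻ 1 1 k) (pow (suc m) k) (pow m k))
      (≈-trans (R.*-cong ≈-refl (≈-sym (ρ-rec m k)))
        (solve 5 (λ t a b c d → t :* (:- a :- b :+ c :+ d) := (:- (t :* a) :- t :* b) :+ (:- (:- (t :* c)) :- (:- (t :* d)))) ≈-refl (θ⁻ 1 1 k) (ρ m k) (ρ (suc m) k) (ρ (6 ℕ.+ m) k) (ρ (7 ℕ.+ m) k)))

  T̂-ord : ∀ m → Ord m (T̂ m)
  T̂-ord m = sum-ord (λ k → ord-⊟ (ord-⊠ʳ (θ⁻ 1 1 k) (ρ-ord k))) (T̂-isSum m)
    where
    ρ-ord : ∀ k → Ord m (ρ m k)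
    ρ-ord (+ zero) = ≈⇒≈[] ≈-refl
    ρ-ord (+ suc n) = ord-⊠ˡ _ (≈[]-weaken (ℕP.m≤m+n m (n ℕ.* m)) (q^-ord (suc n ℕ.* m)))
    ρ-ord -[1+ n ] = ord-⊠ˡ _ (≈[]-weaken (ℕP.m≤m+n m (n ℕ.* m)) (q^-ord (suc n ℕ.* m)))

  -- The difference does not change under m ↦ m + 6, as `C⁺` and `C⁻` have equal values, while its
  -- order grows with m.
  M⁻-M⁺ : ∀ m → M⁻ (suc m) ≈ M⁺ (suc m)
  M⁻-M⁺ m = sub-null (null-shift 5 err (λ m → ord-⊞ (≈[]-weaken (ℕP.n≤1+n m) (M⁻-ord m)) (ord-⊟ (≈[]-weaken (ℕP.n≤1+n m) (M⁺-ord m))))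
      (λ N m o → ord-≈ (≈-sym (st m)) (≈[]-weaken ℕP.≤-refl o)) m)
    where
    err : ℕ → PS
    err m = M⁻ (suc m) ⊞ ⊟ M⁺ (suc m)
    st : ∀ m → err m ≈ err (6 ℕ.+ m)
    st m = ≈-trans (R.+-cong (≈-trans (M⁻-step (suc m)) (R.+-cong (C⁻-U m) ≈-refl)) (R.-‿cong (≈-trans (M⁺-step (suc m)) (R.+-cong (C⁺-U m) ≈-refl))))
      (solve 3 (λ c a b → (c :+ a) :- (c :+ b) := a :- b) ≈-refl (U (suc m) ⊞ ⊟ U m) (M⁻ (7 ℕ.+ m)) (M⁺ (7 ℕ.+ m)))

  -- `φV` controls only sums of neighbours, so the error is first shown to vanish for m and m + 1
  -- together, by periodicity 6. After that it merely alternates in sign with m, and its growing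
  -- order makes it zero.
  φM⁺ : ∀ m → φ ⊠ M⁺ (suc m) ≈ T̂ (suc m)
  φM⁺ m = sub-null (null-shift 0 err err-ord (λ N m o → ord-≈ (≈-sym (back m)) (ord-⊟ o)) m)
    where
    err : ℕ → PS
    err m = φ ⊠ M⁺ (suc m) ⊞ ⊟ T̂ (suc m)
    err-ord : ∀ m → Ord m (err m)
    err-ord m = ≈[]-weaken (ℕP.n≤1+n m) (ord-⊞ (ord-⊠ʳ φ (M⁺-ord m)) (ord-⊟ (T̂-ord (suc m))))
    open ≈-Reasoning
    st : ∀ m → err m ⊞ err (suc m) ≈ err (6 ℕ.+ m) ⊞ err (7 ℕ.+ m)
    st m = begin
      (φ ⊠ M⁺ (suc m) ⊞ ⊟ T̂ (suc m)) ⊞ (φ ⊠ M⁺ (2 ℕ.+ m) ⊞ ⊟ T̂ (2 ℕ.+ m))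
        ≈⟨ R.+-cong (R.+-cong (R.*-cong ≈-refl (≈-trans (M⁺-step (suc m)) (R.+-cong (C⁺-U m) ≈-refl))) ≈-refl) (R.+-cong (R.*-cong ≈-refl (≈-trans (M⁺-step (2 ℕ.+ m)) (R.+-cong (C⁺-U (suc m)) ≈-refl))) ≈-refl) ⟩
      (φ ⊠ ((U (suc m) ⊞ ⊟ U m) ⊞ M⁺ (7 ℕ.+ m)) ⊞ ⊟ T̂ (suc m)) ⊞ (φ ⊠ ((U (2 ℕ.+ m) ⊞ ⊟ U (suc m)) ⊞ M⁺ (8 ℕ.+ m)) ⊞ ⊟ T̂ (2 ℕ.+ m))
        ≈⟨ solve 10 (λ f a b c M N s t S T → (f :* ((b :- a) :+ M) :- s) :+ (f :* ((c :- b) :+ N) :- t) :=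
             ((f :* M :- S) :+ (f :* N :- T)) :+ ((f :* (c :+ b) :- f :* (b :+ a)) :- (s :+ t :+ (:- S :- T))))
           ≈-refl φ (U m) (U (suc m)) (U (2 ℕ.+ m)) (M⁺ (7 ℕ.+ m)) (M⁺ (8 ℕ.+ m)) (T̂ (suc m)) (T̂ (2 ℕ.+ m)) (T̂ (7 ℕ.+ m)) (T̂ (8 ℕ.+ m)) ⟩
      (err (6 ℕ.+ m) ⊞ err (7 ℕ.+ m)) ⊞ ((φ ⊠ V (suc m) ⊞ ⊟ (φ ⊠ V m)) ⊞ ⊟ (T̂ (suc m) ⊞ T̂ (2 ℕ.+ m) ⊞ (⊟ T̂ (7 ℕ.+ m) ⊞ ⊟ T̂ (8 ℕ.+ m))))
        ≈⟨ R.+-cong ≈-refl (≈-trans (R.+-cong (R.+-cong (φV (suc m)) (R.-‿cong (φV m))) (R.-‿cong (T̂-rec (suc m)))) (R.-‿inverseʳ _)) ⟩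
      (err (6 ℕ.+ m) ⊞ err (7 ℕ.+ m)) ⊞ 𝟘 ≈⟨ R.+-identityʳ _ ⟩
      err (6 ℕ.+ m) ⊞ err (7 ℕ.+ m) ∎
    pair : ∀ m → err m ⊞ err (suc m) ≈ 𝟘
    pair = null-shift 5 (λ m → err m ⊞ err (suc m)) (λ m → ord-⊞ (err-ord m) (≈[]-weaken (ℕP.n≤1+n m) (err-ord (suc m)))) (λ N m o → ord-≈ (≈-sym (st m)) o)
    back : ∀ m → err m ≈ ⊟ err (suc m)
    back m = ≈-trans (solve 2 (λ a b → a := (a :+ b) :- b) ≈-refl (err m) (err (suc m))) (≈-trans (R.+-cong (pair m) ≈-refl) (R.+-identityˡ (⊟ err (suc m))))

open Rank-classes

-- Folding the terms n and -n.

module Symmetrization where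
  -- Sums see only the even part of their summand: twice each sum is the sum of its folded terms.
  sum-even : ∀ {F G s t} → F (+ 0) ≈ G (+ 0) → (∀ n → F (+ suc n) ⊞ F -[1+ n ] ≈ G (+ suc n) ⊞ G -[1+ n ]) → IsSum F s → IsSum G t → s ≈ t
  sum-even {F} {G} {s} {t} h₀ h p q = cancelˡ unit-two (≈-trans (≈-sym (two≈ s)) (≈-trans
    (sum-unique (sum-⊞ p (sum-neg p)) (sum-cong term ≈-refl (sum-⊞ q (sum-neg q)))) (two≈ t)))
    where
    term : ∀ k → G k ⊞ G (ℤ.- k) ≈ F k ⊞ F (ℤ.- k)
    term (+ zero) = ≈-sym (R.+-cong h₀ h₀)
    term (+ suc n) = ≈-sym (h n)
    term -[1+ n ] = ≈-trans (R.+-comm (G -[1+ n ]) (G (+ suc n))) (≈-trans (≈-sym (h n)) (R.+-comm (F (+ suc n)) (F -[1+ n ])))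

  -- Folding gives the two `h²` sums the common numerator 2(1 - x + x²) = 2(1 + x³)/(1 + x), which
  -- lowers the squared factor 1 + x³ of `h²` to a simple one. This dictates the coefficients 2 and
  -- -1.
  Q₀ : PS
  Q₀ = two ⊠ Λ 2 0 (h² ∘ 3j) ⊞ ⊟ Λ 1 1 (h² ∘ 3j)

  private
    P₀ e₀ : ℕ → PS
    P₀ n = q^ (2 ℕ.* triℕ n)
    e₀ n = ε (+ suc n)

    θ20⁺ : ∀ n → θ⁻ 2 0 (+ suc n) ≈ e₀ n ⊠ (x n ⊠ x n ⊠ P₀ n)
    θ20⁺ n = R.*-cong ≈-refl (≈-trans (q^≡ (solveℕ 2 (λ n t → con″ 2 *″ ((con″ 1 +″ n) +″ t) +″ con″ 0 =″ ((con″ 1 +″ n) +″ (con″ 1 +″ n)) +″ con″ 2 *″ t) refl n (triℕ n)))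
      (≈-trans (q^-+ (suc n ℕ.+ suc n) (2 ℕ.* triℕ n)) (R.*-cong (q^-+ (suc n) (suc n)) ≈-refl)))

    θ20⁻ : ∀ n → θ⁻ 2 0 -[1+ n ] ≈ e₀ n ⊠ P₀ n
    θ20⁻ n = R.*-cong ≈-refl (q^≡ (ℕP.+-identityʳ (2 ℕ.* triℕ n)))

    θ11⁺ : ∀ n → θ⁻ 1 1 (+ suc n) ≈ e₀ n ⊠ (x n ⊠ P₀ n)
    θ11⁺ n = R.*-cong ≈-refl (≈-trans (q^≡ (solveℕ 2 (λ n t → con″ 1 *″ ((con″ 1 +″ n) +″ t) +″ con″ 1 *″ t =″ (con″ 1 +″ n) +″ con″ 2 *″ t) refl n (triℕ n))) (q^-+ (suc n) (2 ℕ.* triℕ n)))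

    θ11⁻ : ∀ n → θ⁻ 1 1 -[1+ n ] ≈ e₀ n ⊠ (x n ⊠ P₀ n)
    θ11⁻ n = ≈-trans (R.*-cong ≈-refl (q^≡ (θe-neg 1 1 (+ suc n)))) (θ11⁺ n)

    module _ (n : ℕ) where
      y k y³ : PS
      y = x n
      k = K n
      y³ = y ⊠ y ⊠ y

      open ≈-Reasoning

      ζ⊠ : ∀ z → z ≈ z ⊠ ((𝟙 ⊞ y) ⊠ ζ n)
      ζ⊠ z = ≈-trans (≈-sym (R.*-identityʳ z)) (R.*-cong ≈-refl (≈-sym (ζ-inv n)))
      ξ⊠ : ∀ z → z ≈ z ⊠ ((𝟙 ⊞ ⊟ y³) ⊠ ξ n)
      ξ⊠ z = ≈-trans (≈-sym (R.*-identityʳ z)) (R.*-cong ≈-refl (≈-sym (ξ-inv n)))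
      η⊠ : ∀ z → z ≈ z ⊠ ((𝟙 ⊞ y³) ⊠ η n)
      η⊠ z = ≈-trans (≈-sym (R.*-identityʳ z)) (R.*-cong ≈-refl (≈-sym (η-inv n)))

      -- Every folded term is brought over the common factor `K n`; what is left to compare is then
      -- a polynomial in x.
      η-K : η n ≈ (𝟙 ⊞ y) ⊠ (𝟙 ⊞ ⊟ y³) ⊠ k
      η-K = ≈-trans (≈-trans (ζ⊠ (η n)) (ξ⊠ _)) (solve 5 (λ y y³ z x n → (n :* ((con (+ 1) :+ y) :* z)) :* ((con (+ 1) :- y³) :* x) := (con (+ 1) :+ y) :* (con (+ 1) :- y³) :* (z :* (x :* n))) ≈-refl y y³ (ζ n) (ξ n) (η n))

      ξ-K : ξ n ≈ (𝟙 ⊞ y) ⊠ (𝟙 ⊞ y³) ⊠ k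
      ξ-K = ≈-trans (≈-trans (ζ⊠ (ξ n)) (η⊠ _)) (solve 5 (λ y y³ z x n → (x :* ((con (+ 1) :+ y) :* z)) :* ((con (+ 1) :+ y³) :* n) := (con (+ 1) :+ y) :* (con (+ 1) :+ y³) :* (z :* (x :* n))) ≈-refl y y³ (ζ n) (ξ n) (η n))

      -- 1 - x + x² = (1 + x³)/(1 + x).
      η²-K : (𝟙 ⊞ ⊟ y ⊞ y ⊠ y) ⊠ (η n ⊠ η n) ≈ (𝟙 ⊞ ⊟ y³) ⊠ k
      η²-K = ≈-trans (≈-trans (ζ⊠ _) (ξ⊠ _)) (≈-trans
        (solve 4 (λ y z x n → let y³ = y :* y :* y in (((con (+ 1) :- y :+ y :* y) :* (n :* n)) :* ((con (+ 1) :+ y) :* z)) :* ((con (+ 1) :- y³) :* x) := ((con (+ 1) :- y³) :* (z :* (x :* n))) :* ((con (+ 1) :+ y³) :* n)) ≈-refl y (ζ n) (ξ n) (η n))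
        (≈-sym (η⊠ ((𝟙 ⊞ ⊟ y³) ⊠ k))))

      w : PS
      w = e₀ n ⊠ P₀ n ⊠ k

      h⁺-pair : θ⁻ 2 0 (+ suc n) ⊠ h⁺ (3j (+ suc n)) ⊞ θ⁻ 2 0 -[1+ n ] ⊠ h⁺ (3j -[1+ n ]) ≈ w ⊠ ((y ⊠ y ⊞ y³) ⊠ ((𝟙 ⊞ y) ⊠ (𝟙 ⊞ ⊟ y³)))
      h⁺-pair = ≈-trans (R.+-cong (R.*-cong (θ20⁺ n) η-K) (R.*-cong (θ20⁻ n) (R.*-cong (x³ n) η-K)))
        (solve 4 (λ e P y k → let y³ = y :* y :* y ; h = (con (+ 1) :+ y) :* (con (+ 1) :- y³) :* k in (e :* (y :* y :* P)) :* h :+ (e :* P) :* (y³ :* h) := (e :* P :* k) :* ((y :* y :+ y³) :* ((con (+ 1) :+ y) :* (con (+ 1) :- y³)))) ≈-refl (e₀ n) (P₀ n) y k)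

      h⁻-pair : θ⁻ 2 0 (+ suc n) ⊠ h⁻ (3j (+ suc n)) ⊞ θ⁻ 2 0 -[1+ n ] ⊠ h⁻ (3j -[1+ n ]) ≈ w ⊠ ((y ⊠ y ⊞ ⊟ y³) ⊠ ((𝟙 ⊞ y) ⊠ (𝟙 ⊞ y³)))
      h⁻-pair = ≈-trans (R.+-cong (R.*-cong (θ20⁺ n) ξ-K) (R.*-cong (θ20⁻ n) (R.-‿cong (R.*-cong (x³ n) ξ-K))))
        (solve 4 (λ e P y k → let y³ = y :* y :* y ; h = (con (+ 1) :+ y) :* (con (+ 1) :+ y³) :* k in (e :* (y :* y :* P)) :* h :+ (e :* P) :* (:- (y³ :* h)) := (e :* P :* k) :* ((y :* y :- y³) :* ((con (+ 1) :+ y) :* (con (+ 1) :+ y³)))) ≈-refl (e₀ n) (P₀ n) y k)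

      h²-pair : two ⊠ (θ⁻ 2 0 (+ suc n) ⊠ h² (3j (+ suc n)) ⊞ θ⁻ 2 0 -[1+ n ] ⊠ h² (3j -[1+ n ])) ⊞ ⊟ (θ⁻ 1 1 (+ suc n) ⊠ h² (3j (+ suc n)) ⊞ θ⁻ 1 1 -[1+ n ] ⊠ h² (3j -[1+ n ]))
        ≈ w ⊠ (two ⊠ (y³ ⊠ (𝟙 ⊞ ⊟ y³)))
      h²-pair = begin
        two ⊠ (θ⁻ 2 0 (+ suc n) ⊠ h² (3j (+ suc n)) ⊞ θ⁻ 2 0 -[1+ n ] ⊠ h² (3j -[1+ n ])) ⊞ ⊟ (θ⁻ 1 1 (+ suc n) ⊠ h² (3j (+ suc n)) ⊞ θ⁻ 1 1 -[1+ n ] ⊠ h² (3j -[1+ n ]))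
          ≈⟨ R.+-cong (R.*-cong ≈-refl (R.+-cong (R.*-cong (θ20⁺ n) h²⁺) (R.*-cong (θ20⁻ n) h²⁻))) (R.-‿cong (R.+-cong (R.*-cong (θ11⁺ n) h²⁺) (R.*-cong (θ11⁻ n) h²⁻))) ⟩
        two ⊠ ((e₀ n ⊠ (y ⊠ y ⊠ P₀ n)) ⊠ (y³ ⊠ (η n ⊠ η n)) ⊞ (e₀ n ⊠ P₀ n) ⊠ (y³ ⊠ (η n ⊠ η n))) ⊞ ⊟ ((e₀ n ⊠ (y ⊠ P₀ n)) ⊠ (y³ ⊠ (η n ⊠ η n)) ⊞ (e₀ n ⊠ (y ⊠ P₀ n)) ⊠ (y³ ⊠ (η n ⊠ η n)))
          ≈⟨ solve 5 (λ e P y y³ h → con (+ 2) :* ((e :* (y :* y :* P)) :* (y³ :* h) :+ (e :* P) :* (y³ :* h)) :- ((e :* (y :* P)) :* (y³ :* h) :+ (e :* (y :* P)) :* (y³ :* h))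
               := (e :* P) :* (con (+ 2) :* (y³ :* ((con (+ 1) :- y :+ y :* y) :* h)))) ≈-refl (e₀ n) (P₀ n) y y³ (η n ⊠ η n) ⟩
        (e₀ n ⊠ P₀ n) ⊠ (two ⊠ (y³ ⊠ ((𝟙 ⊞ ⊟ y ⊞ y ⊠ y) ⊠ (η n ⊠ η n)))) ≈⟨ R.*-cong ≈-refl (R.*-cong ≈-refl (R.*-cong ≈-refl η²-K)) ⟩
        (e₀ n ⊠ P₀ n) ⊠ (two ⊠ (y³ ⊠ ((𝟙 ⊞ ⊟ y³) ⊠ k)))
          ≈⟨ solve 5 (λ e P y³ t k → (e :* P) :* (t :* (y³ :* ((con (+ 1) :- y³) :* k))) := (e :* P :* k) :* (t :* (y³ :* (con (+ 1) :- y³)))) ≈-refl (e₀ n) (P₀ n) y³ two k ⟩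
        w ⊠ (two ⊠ (y³ ⊠ (𝟙 ⊞ ⊟ y³))) ∎
        where
        h²⁺ : h² (3j (+ suc n)) ≈ y³ ⊠ (η n ⊠ η n)
        h²⁺ = ≈-trans (R.*-cong ≈-refl (R.*-cong (x³ n) ≈-refl)) (solve 2 (λ y³ h → h :* (y³ :* h) := y³ :* (h :* h)) ≈-refl y³ (η n))
        h²⁻ : h² (3j -[1+ n ]) ≈ y³ ⊠ (η n ⊠ η n)
        h²⁻ = ≈-trans (R.*-cong (R.*-cong (x³ n) ≈-refl) ≈-refl) (R.*-assoc y³ (η n) (η n))

      ρ-pair : ∀ m z → pow m (+ suc n) ≈ z → θ⁻ 1 1 (+ suc n) ⊠ ρ m (+ suc n) ⊞ θ⁻ 1 1 -[1+ n ] ⊠ ρ m -[1+ n ] ≈ w ⊠ (two ⊠ (y ⊠ (z ⊠ (𝟙 ⊞ ⊟ y))))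
      ρ-pair m z p = ≈-trans (R.+-cong (R.*-cong (θ11⁺ n) (R.*-cong p ≈-refl)) (R.*-cong (θ11⁻ n) (R.*-cong p ≈-refl)))
        (solve 5 (λ e P y z k → let s = (e :* (y :* P)) :* (z :* ((con (+ 1) :- y) :* k)) in s :+ s := (e :* P :* k) :* (con (+ 2) :* (y :* (z :* (con (+ 1) :- y))))) ≈-refl (e₀ n) (P₀ n) y z k)

      pow-+1 : ∀ {m z} → pow m (+ suc n) ≈ z → pow (suc m) (+ suc n) ≈ y ⊠ z
      pow-+1 {m} p = ≈-trans (pow-suc m n) (R.*-cong ≈-refl p)

      pow₁ : pow 1 (+ suc n) ≈ y ⊠ 𝟙
      pow₁ = pow-+1 {0} (pow-0 n)
      pow₂ : pow 2 (+ suc n) ≈ y ⊠ (y ⊠ 𝟙)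
      pow₂ = pow-+1 {1} pow₁
      pow₃ : pow 3 (+ suc n) ≈ y ⊠ (y ⊠ (y ⊠ 𝟙))
      pow₃ = pow-+1 {2} pow₂
      pow₄ : pow 4 (+ suc n) ≈ y ⊠ (y ⊠ (y ⊠ (y ⊠ 𝟙)))
      pow₄ = pow-+1 {3} pow₃
      pow₅ : pow 5 (+ suc n) ≈ y ⊠ (y ⊠ (y ⊠ (y ⊠ (y ⊠ 𝟙))))
      pow₅ = pow-+1 {4} pow₄

    Q : ℤ → PS
    Q k = two ⊠ (θ⁻ 2 0 k ⊠ h² (3j k)) ⊞ ⊟ (θ⁻ 1 1 k ⊠ h² (3j k))

    H⁺ H⁻ : ℤ → PS
    H⁺ k = θ⁻ 2 0 k ⊠ h⁺ (3j k)
    H⁻ k = θ⁻ 2 0 k ⊠ h⁻ (3j k)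

    Τ : ℕ → ℤ → PS
    Τ m k = θ⁻ 1 1 k ⊠ ρ m k

    H⁺-sum : IsSum H⁺ (Λ 2 0 (h⁺ ∘ 3j))
    H⁺-sum = Λ-isSum 2 0 (h⁺ ∘ 3j)
    H⁻-sum : IsSum H⁻ (Λ 2 0 (h⁻ ∘ 3j))
    H⁻-sum = Λ-isSum 2 0 (h⁻ ∘ 3j)
    Q-sum : IsSum Q Q₀
    Q-sum = sum-⊞ (sum-⊠ two (Λ-isSum 2 0 (h² ∘ 3j))) (sum-⊟ (Λ-isSum 1 1 (h² ∘ 3j)))
    Τ-sum : ∀ m → IsSum (Τ m) (Λ 1 1 (ρ m))
    Τ-sum m = Λ-isSum 1 1 (ρ m)

    Q-pair : ∀ n → Q (+ suc n) ⊞ Q -[1+ n ] ≈ w n ⊠ (two ⊠ (y³ n ⊠ (𝟙 ⊞ ⊟ y³ n)))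
    Q-pair n = ≈-trans (solve 5 (λ t a b p q → (t :* a :- p) :+ (t :* b :- q) := t :* (a :+ b) :- (p :+ q)) ≈-refl two (θ⁻ 2 0 (+ suc n) ⊠ h² (3j (+ suc n))) (θ⁻ 2 0 -[1+ n ] ⊠ h² (3j -[1+ n ]))
      (θ⁻ 1 1 (+ suc n) ⊠ h² (3j (+ suc n))) (θ⁻ 1 1 -[1+ n ] ⊠ h² (3j -[1+ n ]))) (h²-pair n)

    H⁺-0 : two ⊠ H⁺ (+ 0) ≈ 𝟙
    H⁺-0 = ≈-trans (R.*-cong ≈-refl (≈-trans (R.*-cong (≈-trans (R.*-identityˡ (q^ 0)) q^-0) ≈-refl) (R.*-identityˡ half))) half-two

    H⁻-0 : H⁻ (+ 0) ≈ 𝟘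
    H⁻-0 = R.zeroʳ (θ⁻ 2 0 (+ 0))

    -- At k = 0 the kernel `h²` has the value 1/4, so the central term is 2/4 - 1/4.
    Q-0 : two ⊠ (two ⊠ Q (+ 0)) ≈ 𝟙
    Q-0 = ≈-trans (R.*-cong ≈-refl (R.*-cong ≈-refl (R.+-cong (R.*-cong ≈-refl (R.*-cong (≈-trans (R.*-identityˡ (q^ 0)) q^-0) ≈-refl)) (R.-‿cong (R.*-cong (≈-trans (R.*-identityˡ (q^ 0)) q^-0) ≈-refl)))))
      (≈-trans (solve 1 (λ h → con (+ 2) :* (con (+ 2) :* (con (+ 2) :* (con (+ 1) :* (h :* h)) :- con (+ 1) :* (h :* h))) := (con (+ 2) :* h) :* (con (+ 2) :* h)) ≈-refl half)
        (≈-trans (R.*-cong half-two half-two) (R.*-identityˡ 𝟙)))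

  two² : PS
  two² = two ⊠ two

  -- The three identities hold summand by summand once the terms n and -n are combined.
  T̂₁₅ : T̂ 1 ⊞ T̂ 5 ⊞ Λ 2 0 (h⁺ ∘ 3j) ⊞ Λ 2 0 (h⁻ ∘ 3j) ≈ two ⊠ Q₀
  T̂₁₅ = sum-even base pair (sum-⊞ (sum-⊞ (sum-⊞ (sum-⊟ (Τ-sum 1)) (sum-⊟ (Τ-sum 5))) H⁺-sum) H⁻-sum) (sum-⊠ two Q-sum)
    where
    base : ⊟ Τ 1 (+ 0) ⊞ ⊟ Τ 5 (+ 0) ⊞ H⁺ (+ 0) ⊞ H⁻ (+ 0) ≈ two ⊠ Q (+ 0)
    base = cancelˡ unit-two (≈-trans (≈-trans (R.*-cong (≈-refl {two}) (R.+-cong ≈-refl H⁻-0)) (≈-trans (solve 3 (λ t e h → t :* (:- (e :* con (+ 0)) :- (e :* con (+ 0)) :+ h :+ con (+ 0)) := t :* h) ≈-refl two (θ⁻ 1 1 (+ 0)) (H⁺ (+ 0))) H⁺-0)) (≈-sym Q-0))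
    pair : ∀ n → (⊟ Τ 1 (+ suc n) ⊞ ⊟ Τ 5 (+ suc n) ⊞ H⁺ (+ suc n) ⊞ H⁻ (+ suc n)) ⊞ (⊟ Τ 1 -[1+ n ] ⊞ ⊟ Τ 5 -[1+ n ] ⊞ H⁺ -[1+ n ] ⊞ H⁻ -[1+ n ]) ≈ two ⊠ Q (+ suc n) ⊞ two ⊠ Q -[1+ n ]
    pair n = ≈-trans (solve 8 (λ a b y³ d a′ b′ c′ d′ → (:- a :- b :+ y³ :+ d) :+ (:- a′ :- b′ :+ c′ :+ d′) := :- (a :+ a′) :- (b :+ b′) :+ (y³ :+ c′) :+ (d :+ d′)) ≈-refl
        (Τ 1 (+ suc n)) (Τ 5 (+ suc n)) (H⁺ (+ suc n)) (H⁻ (+ suc n)) (Τ 1 -[1+ n ]) (Τ 5 -[1+ n ]) (H⁺ -[1+ n ]) (H⁻ -[1+ n ]))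
      (≈-trans (R.+-cong (R.+-cong (R.+-cong (R.-‿cong (ρ-pair n 1 _ (pow₁ n))) (R.-‿cong (ρ-pair n 5 _ (pow₅ n)))) (h⁺-pair n)) (h⁻-pair n))
      (≈-trans (solve 2 (λ w y → let y³ = y :* y :* y ; o = con (+ 1) ; t = con (+ 2) in
          :- (w :* (t :* (y :* ((y :* o) :* (o :- y))))) :- (w :* (t :* (y :* ((y :* (y :* (y :* (y :* (y :* o))))) :* (o :- y))))) :+ w :* ((y :* y :+ y³) :* ((o :+ y) :* (o :- y³))) :+ w :* ((y :* y :- y³) :* ((o :+ y) :* (o :+ y³)))
          := t :* (w :* (t :* (y³ :* (o :- y³))))) ≈-refl (w n) (x n))
      (≈-trans (R.*-cong ≈-refl (≈-sym (Q-pair n))) (R.distribˡ two (Q (+ suc n)) (Q -[1+ n ])))))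

  T̂₂₄ : T̂ 2 ⊞ T̂ 4 ⊞ two ⊠ Q₀ ⊞ Λ 2 0 (h⁻ ∘ 3j) ≈ Λ 2 0 (h⁺ ∘ 3j)
  T̂₂₄ = sum-even base pair (sum-⊞ (sum-⊞ (sum-⊞ (sum-⊟ (Τ-sum 2)) (sum-⊟ (Τ-sum 4))) (sum-⊠ two Q-sum)) H⁻-sum) H⁺-sum
    where
    base : ⊟ Τ 2 (+ 0) ⊞ ⊟ Τ 4 (+ 0) ⊞ two ⊠ Q (+ 0) ⊞ H⁻ (+ 0) ≈ H⁺ (+ 0)
    base = cancelˡ unit-two (≈-trans (≈-trans (R.*-cong (≈-refl {two}) (R.+-cong ≈-refl H⁻-0)) (≈-trans (solve 3 (λ t e h → t :* (:- (e :* con (+ 0)) :- (e :* con (+ 0)) :+ h :+ con (+ 0)) := t :* h) ≈-refl two (θ⁻ 1 1 (+ 0)) (two ⊠ Q (+ 0))) Q-0)) (≈-sym H⁺-0))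
    pair : ∀ n → (⊟ Τ 2 (+ suc n) ⊞ ⊟ Τ 4 (+ suc n) ⊞ two ⊠ Q (+ suc n) ⊞ H⁻ (+ suc n)) ⊞ (⊟ Τ 2 -[1+ n ] ⊞ ⊟ Τ 4 -[1+ n ] ⊞ two ⊠ Q -[1+ n ] ⊞ H⁻ -[1+ n ]) ≈ H⁺ (+ suc n) ⊞ H⁺ -[1+ n ]
    pair n = ≈-trans (solve 9 (λ t a b y³ d a′ b′ c′ d′ → (:- a :- b :+ t :* y³ :+ d) :+ (:- a′ :- b′ :+ t :* c′ :+ d′) := :- (a :+ a′) :- (b :+ b′) :+ t :* (y³ :+ c′) :+ (d :+ d′)) ≈-refl two
        (Τ 2 (+ suc n)) (Τ 4 (+ suc n)) (Q (+ suc n)) (H⁻ (+ suc n)) (Τ 2 -[1+ n ]) (Τ 4 -[1+ n ]) (Q -[1+ n ]) (H⁻ -[1+ n ]))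
      (≈-trans (R.+-cong (R.+-cong (R.+-cong (R.-‿cong (ρ-pair n 2 _ (pow₂ n))) (R.-‿cong (ρ-pair n 4 _ (pow₄ n)))) (R.*-cong ≈-refl (Q-pair n))) (h⁻-pair n))
      (≈-trans (solve 2 (λ w y → let y³ = y :* y :* y ; o = con (+ 1) ; t = con (+ 2) in
          :- (w :* (t :* (y :* ((y :* (y :* o)) :* (o :- y))))) :- (w :* (t :* (y :* ((y :* (y :* (y :* (y :* o)))) :* (o :- y))))) :+ t :* (w :* (t :* (y³ :* (o :- y³)))) :+ w :* ((y :* y :- y³) :* ((o :+ y) :* (o :+ y³)))
          := w :* ((y :* y :+ y³) :* ((o :+ y) :* (o :- y³)))) ≈-refl (w n) (x n))
      (≈-sym (h⁺-pair n))))

  T̂₃ : two² ⊠ T̂ 3 ⊞ two² ⊠ Λ 2 0 (h⁺ ∘ 3j) ≈ 𝟙 ⊞ two² ⊠ Λ 2 0 (h⁻ ∘ 3j) ⊞ two² ⊠ Q₀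
  T̂₃ = sum-even base pair (sum-⊞ (sum-⊠ two² (sum-⊟ (Τ-sum 3))) (sum-⊠ two² H⁺-sum)) (sum-⊞ (sum-⊞ sum-δ₀ (sum-⊠ two² H⁻-sum)) (sum-⊠ two² Q-sum))
    where
    base : two² ⊠ (⊟ Τ 3 (+ 0)) ⊞ two² ⊠ H⁺ (+ 0) ≈ 𝟙 ⊞ two² ⊠ H⁻ (+ 0) ⊞ two² ⊠ Q (+ 0)
    base = ≈-trans (≈-trans (solve 3 (λ t e h → (t :* t) :* (:- (e :* con (+ 0))) :+ (t :* t) :* h := t :* (t :* h)) ≈-refl two (θ⁻ 1 1 (+ 0)) (H⁺ (+ 0))) (R.*-cong ≈-refl H⁺-0))
      (≈-sym (≈-trans (R.+-cong (R.+-cong ≈-refl (R.*-cong ≈-refl H⁻-0)) (≈-trans (R.*-assoc two two (Q (+ 0))) Q-0)) (solve 1 (λ t → con (+ 1) :+ (t :* t) :* con (+ 0) :+ con (+ 1) := con (+ 2) :* con (+ 1)) ≈-refl two)))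
    pair : ∀ n → (two² ⊠ (⊟ Τ 3 (+ suc n)) ⊞ two² ⊠ H⁺ (+ suc n)) ⊞ (two² ⊠ (⊟ Τ 3 -[1+ n ]) ⊞ two² ⊠ H⁺ -[1+ n ]) ≈ (δ (+ suc n) ⊞ two² ⊠ H⁻ (+ suc n) ⊞ two² ⊠ Q (+ suc n)) ⊞ (δ -[1+ n ] ⊞ two² ⊠ H⁻ -[1+ n ] ⊞ two² ⊠ Q -[1+ n ])
    pair n = ≈-trans (solve 5 (λ t a b a′ b′ → (t :* (:- a) :+ t :* b) :+ (t :* (:- a′) :+ t :* b′) := t :* (:- (a :+ a′) :+ (b :+ b′))) ≈-refl two² (Τ 3 (+ suc n)) (H⁺ (+ suc n)) (Τ 3 -[1+ n ]) (H⁺ -[1+ n ]))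
      (≈-trans (R.*-cong ≈-refl (R.+-cong (R.-‿cong (ρ-pair n 3 _ (pow₃ n))) (h⁺-pair n)))
      (≈-trans (R.*-cong ≈-refl (solve 2 (λ w y → let y³ = y :* y :* y ; o = con (+ 1) ; t = con (+ 2) in
          :- (w :* (t :* (y :* ((y :* (y :* (y :* o))) :* (o :- y))))) :+ w :* ((y :* y :+ y³) :* ((o :+ y) :* (o :- y³)))
          := w :* ((y :* y :- y³) :* ((o :+ y) :* (o :+ y³))) :+ w :* (t :* (y³ :* (o :- y³)))) ≈-refl (w n) (x n)))
      (≈-trans (R.*-cong ≈-refl (≈-sym (R.+-cong (h⁻-pair n) (Q-pair n))))
      (solve 5 (λ t a a′ b b′ → t :* ((a :+ a′) :+ (b :+ b′)) := (con (+ 0) :+ t :* a :+ t :* b) :+ (con (+ 0) :+ t :* a′ :+ t :* b′)) ≈-refl two² (H⁻ (+ suc n)) (H⁻ -[1+ n ]) (Q (+ suc n)) (Q -[1+ n ])))))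

open Symmetrization

-- Rank classes as combinations of 1, X, Y, Z, and their class 2.

module Linear-relations where
  open Components D∞ φD∞

  lin : ℤ → ℤ → ℤ → PS
  lin i j k = 𝟙 ⊞ fromℤ i ⊠ Z ⊞ fromℤ j ⊠ X ⊞ fromℤ k ⊠ Y

  private
    lift : ∀ {N} i j → N ≈ M⁺ (suc i) ⊞ M⁻ (suc j) → N ≈ D∞ ⊠ (T̂ (suc i) ⊞ T̂ (suc j))
    lift {N} i j h = begin
      N ≈⟨ ≈-trans (≈-sym (R.*-identityˡ N)) (R.*-cong (≈-sym φD∞) h) ⟩
      (φ ⊠ D∞) ⊠ (M⁺ (suc i) ⊞ M⁻ (suc j)) ≈⟨ R.*-cong ≈-refl (R.+-cong ≈-refl (M⁻-M⁺ j)) ⟩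
      (φ ⊠ D∞) ⊠ (M⁺ (suc i) ⊞ M⁺ (suc j)) ≈⟨ solve 4 (λ f d m n → (f :* d) :* (m :+ n) := d :* (f :* m :+ f :* n)) ≈-refl φ D∞ (M⁺ (suc i)) (M⁺ (suc j)) ⟩
      D∞ ⊠ (φ ⊠ M⁺ (suc i) ⊞ φ ⊠ M⁺ (suc j)) ≈⟨ R.*-cong ≈-refl (R.+-cong (φM⁺ i) (φM⁺ j)) ⟩
      D∞ ⊠ (T̂ (suc i) ⊞ T̂ (suc j)) ∎
      where open ≈-Reasoning

    H⁺ H⁻ H² K² : PS
    H⁺ = Λ 2 0 (h⁺ ∘ 3j)
    H⁻ = Λ 2 0 (h⁻ ∘ 3j)
    H² = Λ 2 0 (h² ∘ 3j)
    K² = Λ 1 1 (h² ∘ 3j)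

    N₁ : six ⊠ (T̂ 1 ⊞ T̂ 5) ≈ lin -[1+ 0 ] -[1+ 0 ] (+ 1)
    N₁ = ≈-trans (solve 3 (λ s a b → con (+ 6) :* s := con (+ 6) :* (s :+ a :+ b) :- con (+ 6) :* a :- con (+ 6) :* b) ≈-refl (T̂ 1 ⊞ T̂ 5) H⁺ H⁻)
      (≈-trans (R.+-cong (R.+-cong (R.*-cong ≈-refl T̂₁₅) ≈-refl) ≈-refl)
      (solve 4 (λ a b c d → let y = con (+ 2) :* a ; x = con (+ 1) :+ con (+ 6) :* b in
        con (+ 6) :* (con (+ 2) :* (con (+ 2) :* c :- d)) :- con (+ 6) :* a :- con (+ 6) :* b
        := con (+ 1) :+ con -[1+ 0 ] :* (con (+ 4) :* y :+ :- (con (+ 24) :* c) :+ con (+ 12) :* d) :+ con -[1+ 0 ] :* x :+ con (+ 1) :* y) ≈-refl H⁺ H⁻ H² K²))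

    N₂ : six ⊠ (T̂ 2 ⊞ T̂ 4) ≈ lin (+ 1) -[1+ 0 ] -[1+ 0 ]
    N₂ = ≈-trans (solve 3 (λ s a b → con (+ 6) :* s := con (+ 6) :* (s :+ a :+ b) :- con (+ 6) :* a :- con (+ 6) :* b) ≈-refl (T̂ 2 ⊞ T̂ 4) (two ⊠ Q₀) H⁻)
      (≈-trans (R.+-cong (R.+-cong (R.*-cong ≈-refl T̂₂₄) ≈-refl) ≈-refl)
      (solve 4 (λ a b c d → let y = con (+ 2) :* a ; x = con (+ 1) :+ con (+ 6) :* b in
        con (+ 6) :* a :- con (+ 6) :* (con (+ 2) :* (con (+ 2) :* c :- d)) :- con (+ 6) :* b
        := con (+ 1) :+ con (+ 1) :* (con (+ 4) :* y :+ :- (con (+ 24) :* c) :+ con (+ 12) :* d) :+ con -[1+ 0 ] :* x :+ con -[1+ 0 ] :* y) ≈-refl H⁺ H⁻ H² K²))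

    N₃ : six ⊠ (T̂ 3 ⊞ T̂ 3) ≈ lin -[1+ 0 ] (+ 2) -[1+ 1 ]
    N₃ = ≈-trans (solve 2 (λ s a → con (+ 6) :* (s :+ s) := con (+ 3) :* ((con (+ 2) :* con (+ 2)) :* s :+ (con (+ 2) :* con (+ 2)) :* a) :- con (+ 12) :* a) ≈-refl (T̂ 3) H⁺)
      (≈-trans (R.+-cong (R.*-cong ≈-refl T̂₃) ≈-refl)
      (solve 4 (λ a b c d → let y = con (+ 2) :* a ; x = con (+ 1) :+ con (+ 6) :* b ; f = con (+ 2) :* con (+ 2) in
        con (+ 3) :* (con (+ 1) :+ f :* b :+ f :* (con (+ 2) :* c :- d)) :- con (+ 12) :* a
        := con (+ 1) :+ con -[1+ 0 ] :* (con (+ 4) :* y :+ :- (con (+ 24) :* c) :+ con (+ 12) :* d) :+ con (+ 2) :* x :+ con -[1+ 1 ] :* y) ≈-refl H⁺ H⁻ H² K²))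

    scaled : ∀ {N s t} → N ≈ D∞ ⊠ s → six ⊠ s ≈ t → six ⊠ N ≈ D∞ ⊠ t
    scaled {N} {s} h e = ≈-trans (R.*-cong ≈-refl h) (≈-trans (solve 3 (λ c d s → c :* (d :* s) := d :* (c :* s)) ≈-refl six D∞ s) (R.*-cong ≈-refl e))

  NS-lin₁ : six ⊠ NS 1 ≈ D∞ ⊠ lin -[1+ 0 ] -[1+ 0 ] (+ 1)
  NS-lin₁ = scaled (lift 0 4 NS-1) N₁

  NS-lin₂ : six ⊠ NS 2 ≈ D∞ ⊠ lin (+ 1) -[1+ 0 ] -[1+ 0 ]
  NS-lin₂ = scaled (lift 1 3 NS-2) N₂

  NS-lin₃ : six ⊠ NS 3 ≈ D∞ ⊠ lin -[1+ 0 ] (+ 2) -[1+ 1 ]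
  NS-lin₃ = scaled (lift 2 2 NS-3) N₃

  -- The total minus the other five classes. Classes 4 and 5 repeat the values of 2 and 1 because
  -- the two sums `T̂` enter symmetrically.
  NS-lin₀ : six ⊠ NS 0 ≈ D∞ ⊠ lin (+ 1) (+ 2) (+ 2)
  NS-lin₀ = begin
    six ⊠ NS 0 ≈⟨ solve 6 (λ a b c d e f → con (+ 6) :* a := con (+ 6) :* (a :+ (b :+ (c :+ (d :+ (e :+ f))))) :- (con (+ 6) :* b :+ con (+ 6) :* c :+ con (+ 6) :* d :+ con (+ 6) :* e :+ con (+ 6) :* f)) ≈-refl (NS 0) (NS 1) (NS 2) (NS 3) (NS 4) (NS 5) ⟩
    six ⊠ (NS 0 ⊞ (NS 1 ⊞ (NS 2 ⊞ (NS 3 ⊞ (NS 4 ⊞ NS 5))))) ⊞ ⊟ (six ⊠ NS 1 ⊞ six ⊠ NS 2 ⊞ six ⊠ NS 3 ⊞ six ⊠ NS 4 ⊞ six ⊠ NS 5)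
      ≈⟨ R.+-cong (R.*-cong ≈-refl NS-sum) (R.-‿cong (R.+-cong (R.+-cong (R.+-cong (R.+-cong NS-lin₁ NS-lin₂) NS-lin₃) NS-lin₄) NS-lin₅)) ⟩
    six ⊠ D∞ ⊞ ⊟ (D∞ ⊠ lin -[1+ 0 ] -[1+ 0 ] (+ 1) ⊞ D∞ ⊠ lin (+ 1) -[1+ 0 ] -[1+ 0 ] ⊞ D∞ ⊠ lin -[1+ 0 ] (+ 2) -[1+ 1 ] ⊞ D∞ ⊠ lin (+ 1) -[1+ 0 ] -[1+ 0 ] ⊞ D∞ ⊠ lin -[1+ 0 ] -[1+ 0 ] (+ 1))
      ≈⟨ solve 4 (λ d x y z → let l = λ i j k → con (+ 1) :+ con i :* z :+ con j :* x :+ con k :* y in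
           con (+ 6) :* d :- (d :* l -[1+ 0 ] -[1+ 0 ] (+ 1) :+ d :* l (+ 1) -[1+ 0 ] -[1+ 0 ] :+ d :* l -[1+ 0 ] (+ 2) -[1+ 1 ] :+ d :* l (+ 1) -[1+ 0 ] -[1+ 0 ] :+ d :* l -[1+ 0 ] -[1+ 0 ] (+ 1))
           := d :* l (+ 1) (+ 2) (+ 2)) ≈-refl D∞ X Y Z ⟩
    D∞ ⊠ lin (+ 1) (+ 2) (+ 2) ∎
    where
    open ≈-Reasoning
    NS-lin₄ : six ⊠ NS 4 ≈ D∞ ⊠ lin (+ 1) -[1+ 0 ] -[1+ 0 ]
    NS-lin₄ = scaled (lift 3 1 NS-4) (≈-trans (R.*-cong ≈-refl (R.+-comm (T̂ 4) (T̂ 2))) N₂)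
    NS-lin₅ : six ⊠ NS 5 ≈ D∞ ⊠ lin -[1+ 0 ] -[1+ 0 ] (+ 1)
    NS-lin₅ = scaled (lift 4 0 NS-5) (≈-trans (R.*-cong ≈-refl (R.+-comm (T̂ 5) (T̂ 1))) N₁)

  -- The quotients of the theorem enter only through the products that characterise them, so their
  -- definitions stay folded.
  module Values {t₁ t₂ t₃ s₁ s₂ : PS} (φ⁴t₁ : φ ⊠ φ ⊠ φ ⊠ φ ⊠ t₁ ≈ a ⊠ b ⊠ b) (φt₂ : φ ⊠ t₂ ≈ b ⊠ b) (at₃ : a ⊠ t₃ ≈ φ ⊠ φ ⊠ (b ⊠ b))
    (as₁ : a ⊠ s₁ ≈ L⁺) (as₂ : a ⊠ s₂ ≈ L⁺ ⊞ ⊟ L²) where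
    open ≈-Reasoning

    private
      φ³p₂ : φ ⊠ (p₂ ⊠ (φ ⊠ φ ⊠ φ)) ≈ fromℤ (+ 4) ⊠ (a ⊠ (φ ⊠ t₂))
      φ³p₂ = ≈-trans (solve 2 (λ f p → f :* (p :* (f :* f :* f)) := f :* f :* f :* f :* p) ≈-refl φ p₂) (≈-trans φ⁴p₂
        (R.*-cong ≈-refl (≈-trans (R.*-assoc a b b) (R.*-cong ≈-refl (≈-sym φt₂)))))

      V₁ : c 2 D∞ ≈ fromℤ (+ 4) ⊠ t₁
      V₁ = cancelˡ (unit-⊠ (unit-⊠ (unit-⊠ φ-unit φ-unit) φ-unit) φ-unit) (≈-trans φ⁴p₂ (≈-trans (R.*-cong ≈-refl (≈-sym φ⁴t₁))
        (solve 2 (λ f t → con (+ 4) :* (f :* t) := f :* (con (+ 4) :* t)) ≈-refl (φ ⊠ φ ⊠ φ ⊠ φ) t₁)))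

      VY : c 2 (D∞ ⊠ Y) ≈ fromℤ (+ 4) ⊠ t₂ ⊞ ⊟ (two ⊠ s₁)
      VY = cancelˡ (unit-⊠ φ-unit a-unit) (begin
        (φ ⊠ a) ⊠ c 2 (D∞ ⊠ Y) ≈⟨ ≈-trans (R.*-assoc φ a _) (R.*-cong ≈-refl c2-Y) ⟩
        φ ⊠ (p₂ ⊠ (φ ⊠ φ ⊠ φ) ⊞ ⊟ (two ⊠ L⁺)) ≈⟨ R.distribˡ φ _ _ ⟩
        φ ⊠ (p₂ ⊠ (φ ⊠ φ ⊠ φ)) ⊞ φ ⊠ ⊟ (two ⊠ L⁺) ≈⟨ R.+-cong φ³p₂ (R.*-cong ≈-refl (R.-‿cong (R.*-cong ≈-refl (≈-sym as₁)))) ⟩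
        fromℤ (+ 4) ⊠ (a ⊠ (φ ⊠ t₂)) ⊞ φ ⊠ ⊟ (two ⊠ (a ⊠ s₁))
          ≈⟨ solve 4 (λ f a t s → con (+ 4) :* (a :* (f :* t)) :+ f :* (:- (con (+ 2) :* (a :* s))) := (f :* a) :* (con (+ 4) :* t :+ :- (con (+ 2) :* s))) ≈-refl φ a t₂ s₁ ⟩
        (φ ⊠ a) ⊠ (fromℤ (+ 4) ⊠ t₂ ⊞ ⊟ (two ⊠ s₁)) ∎)

      -- `φ-L` expresses `L⁻` by `L⁺` and a theta quotient; the theorem contains only denominators
      -- with 1 + q^(3n+1).
      φL⁻ : φ ⊠ L⁻ ≈ two ⊠ (a ⊠ (φ ⊠ t₂)) ⊞ ⊟ (φ ⊠ (a ⊠ s₁))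
      φL⁻ = begin
        φ ⊠ L⁻ ≈⟨ solve 3 (λ f l m → f :* m := f :* (l :+ m) :- f :* l) ≈-refl φ L⁺ L⁻ ⟩
        φ ⊠ (L⁺ ⊞ L⁻) ⊞ ⊟ (φ ⊠ L⁺) ≈⟨ R.+-cong (≈-trans φ-L (R.*-cong ≈-refl (≈-trans (R.*-assoc a b b) (R.*-cong ≈-refl (≈-sym φt₂))))) (R.-‿cong (R.*-cong ≈-refl (≈-sym as₁))) ⟩
        two ⊠ (a ⊠ (φ ⊠ t₂)) ⊞ ⊟ (φ ⊠ (a ⊠ s₁)) ∎

      VX : c 2 (D∞ ⊠ X) ≈ fromℤ -[1+ 7 ] ⊠ t₂ ⊞ six ⊠ s₁
      VX = cancelˡ (unit-⊠ φ-unit a-unit) (begin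
        (φ ⊠ a) ⊠ c 2 (D∞ ⊠ X) ≈⟨ ≈-trans (R.*-assoc φ a _) (R.*-cong ≈-refl c2-X) ⟩
        φ ⊠ (p₂ ⊠ (φ ⊠ φ ⊠ φ) ⊞ ⊟ (six ⊠ L⁻)) ≈⟨ solve 3 (λ f p l → f :* (p :+ :- (con (+ 6) :* l)) := f :* p :- con (+ 6) :* (f :* l)) ≈-refl φ (p₂ ⊠ (φ ⊠ φ ⊠ φ)) L⁻ ⟩
        φ ⊠ (p₂ ⊠ (φ ⊠ φ ⊠ φ)) ⊞ ⊟ (six ⊠ (φ ⊠ L⁻)) ≈⟨ R.+-cong φ³p₂ (R.-‿cong (R.*-cong ≈-refl φL⁻)) ⟩
        fromℤ (+ 4) ⊠ (a ⊠ (φ ⊠ t₂)) ⊞ ⊟ (six ⊠ (two ⊠ (a ⊠ (φ ⊠ t₂)) ⊞ ⊟ (φ ⊠ (a ⊠ s₁))))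
          ≈⟨ solve 4 (λ f a t s → con (+ 4) :* (a :* (f :* t)) :- con (+ 6) :* (con (+ 2) :* (a :* (f :* t)) :- f :* (a :* s)) := (f :* a) :* (con -[1+ 7 ] :* t :+ con (+ 6) :* s)) ≈-refl φ a t₂ s₁ ⟩
        (φ ⊠ a) ⊠ (fromℤ -[1+ 7 ] ⊠ t₂ ⊞ six ⊠ s₁) ∎)

      -- -8`L⁺` + 24`L²` = 16`L⁺` - 24(`L⁺` - `L²`), and the bracket is the sum with squared
      -- denominators.
      VZ : c 2 (D∞ ⊠ Z) ≈ fromℤ (+ 4) ⊠ t₃ ⊞ fromℤ (+ 16) ⊠ s₁ ⊞ fromℤ -[1+ 23 ] ⊠ s₂
      VZ = cancelˡ a-unit (≈-trans c2-Z (≈-trans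
        (solve 3 (λ x l m → con (+ 4) :* x :+ :- (con (+ 8) :* l) :+ con (+ 24) :* m := con (+ 4) :* x :+ con (+ 16) :* l :+ con -[1+ 23 ] :* (l :- m)) ≈-refl (φ ⊠ φ ⊠ (b ⊠ b)) L⁺ L²)
        (≈-trans (R.+-cong (R.+-cong (R.*-cong ≈-refl (≈-sym at₃)) (R.*-cong ≈-refl (≈-sym as₁))) (R.*-cong ≈-refl (≈-sym as₂)))
        (solve 4 (λ a t s r → con (+ 4) :* (a :* t) :+ con (+ 16) :* (a :* s) :+ con -[1+ 23 ] :* (a :* r) := a :* (con (+ 4) :* t :+ con (+ 16) :* s :+ con -[1+ 23 ] :* r)) ≈-refl a t₃ s₁ s₂))))

    c2-lin : ∀ i j k → c 2 (D∞ ⊠ lin i j k) ≈ fromℤ (+ 4) ⊠ t₁ ⊞ fromℤ i ⊠ (fromℤ (+ 4) ⊠ t₃ ⊞ fromℤ (+ 16) ⊠ s₁ ⊞ fromℤ -[1+ 23 ] ⊠ s₂)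
      ⊞ fromℤ j ⊠ (fromℤ -[1+ 7 ] ⊠ t₂ ⊞ six ⊠ s₁) ⊞ fromℤ k ⊠ (fromℤ (+ 4) ⊠ t₂ ⊞ ⊟ (two ⊠ s₁))
    c2-lin i j k = ≈-trans (c-cong 2 (solve 4 (λ d x y z → d :* (con (+ 1) :+ x :+ y :+ z) := d :+ d :* x :+ d :* y :+ d :* z) ≈-refl D∞ (fromℤ i ⊠ Z) (fromℤ j ⊠ X) (fromℤ k ⊠ Y)))
      (≈-trans (c-⊞ 2 _ _) (R.+-cong (≈-trans (c-⊞ 2 _ _) (R.+-cong (≈-trans (c-⊞ 2 _ _) (R.+-cong V₁ (≈-trans (c2-scale i Z) (R.*-cong ≈-refl VZ)))) (≈-trans (c2-scale j X) (R.*-cong ≈-refl VX)))) (≈-trans (c2-scale k Y) (R.*-cong ≈-refl VY))))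

    c2-NS : ∀ {s} i j k → six ⊠ NS s ≈ D∞ ⊠ lin i j k → six ⊠ c 2 (NS s) ≈ fromℤ (+ 4) ⊠ t₁ ⊞ fromℤ i ⊠ (fromℤ (+ 4) ⊠ t₃ ⊞ fromℤ (+ 16) ⊠ s₁ ⊞ fromℤ -[1+ 23 ] ⊠ s₂)
      ⊞ fromℤ j ⊠ (fromℤ -[1+ 7 ] ⊠ t₂ ⊞ six ⊠ s₁) ⊞ fromℤ k ⊠ (fromℤ (+ 4) ⊠ t₂ ⊞ ⊟ (two ⊠ s₁))
    c2-NS {s} i j k h = ≈-trans (R.*-cong ≈-refl (c-cong 2 as-D∞)) (≈-trans (≈-sym (c2-scale (+ 6) (φ ⊠ NS s)))
      (≈-trans (c-cong 2 (≈-trans (solve 3 (λ d f n → d :* (con (+ 6) :* (f :* n)) := (f :* d) :* (con (+ 6) :* n)) ≈-refl D∞ φ (NS s))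
        (≈-trans (R.*-cong φD∞ h) (R.*-identityˡ _)))) (c2-lin i j k)))
      where
      -- `c2-scale` speaks of multiples of `D∞`, so `NS s` is first written as `D∞` times φ·`NS s`.
      as-D∞ : NS s ≈ D∞ ⊠ (φ ⊠ NS s)
      as-D∞ = ≈-trans (≈-sym (≈-trans (R.*-cong φD∞ ≈-refl) (R.*-identityˡ (NS s)))) (solve 3 (λ f d n → (f :* d) :* n := d :* (f :* n)) ≈-refl φ D∞ (NS s))

open Linear-relations

-- Matching with the definitions of the statement.

module Evaluation where
  open import Data.Nat.Combinatorics using (_C_; nC1≡n)

  ⊗≈ : ∀ f g → f ⊗ g ≈ f ⊠ g
  ⊗≈ f g .at n = sym (⊠-at f g n)

  ⊕≈ : ∀ f g → f ⊕ g ≈ f ⊞ g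
  ⊕≈ f g .at n = sym (⊞-at f g n)

  ⊖≈ : ∀ f g → f ⊖ g ≈ f ⊞ ⊟ g
  ⊖≈ f g .at n = sym (trans (⊞-at f (⊟ g) n) (cong (f n ℚ.+_) (⊟-at g n)))

  mono≈ : ∀ e → mono e ≈ q^ e
  mono≈ e .at n = sym (q^-at e n)

  one≈ : oneS ≈ 𝟙
  one≈ .at n = sym (𝟙-at n)

  private
    ⊗-cong : ∀ {f f′ g g′} → f ≈ f′ → g ≈ g′ → f ⊗ g ≈ f′ ⊠ g′
    ⊗-cong {f} {f′} {g} p p′ = ≈-trans (⊗≈ f g) (R.*-cong p p′)

    ⊕-cong : ∀ {f f′ g g′} → f ≈ f′ → g ≈ g′ → f ⊕ g ≈ f′ ⊞ g′
    ⊕-cong {f} {f′} {g} p p′ = ≈-trans (⊕≈ f g) (R.+-cong p p′)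

    ⊖-cong : ∀ {f f′ g g′} → f ≈ f′ → g ≈ g′ → f ⊖ g ≈ f′ ⊞ ⊟ g′
    ⊖-cong {f} {f′} {g} p p′ = ≈-trans (⊖≈ f g) (R.+-cong p (R.-‿cong p′))

    prodTo : ℕ → (ℕ → PS) → PS
    prodTo zero f = 𝟙
    prodTo (suc n) f = f 0 ⊠ prodTo n (f ∘ suc)

    prodTo-snoc : ∀ n f → prodTo (suc n) f ≈ prodTo n f ⊠ f n
    prodTo-snoc zero f = R.*-comm (f 0) 𝟙
    prodTo-snoc (suc n) f = ≈-trans (R.*-cong ≈-refl (prodTo-snoc n (f ∘ suc))) (≈-sym (R.*-assoc (f 0) (prodTo n (f ∘ suc)) (f (suc n))))

    prodS-prodTo : ∀ n (f g : ℕ → PS) → (∀ i → f i ≈ g i) → prodS (applyUpTo f n) ≈ prodTo n g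
    prodS-prodTo zero f g h = one≈
    prodS-prodTo (suc n) f g h = ⊗-cong (h 0) (prodS-prodTo n (f ∘ suc) (g ∘ suc) (h ∘ suc))

    pf-prodTo : ∀ α s n → pf 𝟙 α s n ≈ prodTo n (λ i → fac 𝟙 (α ℕ.+ s ℕ.* i))
    pf-prodTo α s zero = ≈-refl
    pf-prodTo α s (suc n) = ≈-trans (R.*-cong (pf-prodTo α s n) ≈-refl) (≈-sym (prodTo-snoc n (λ i → fac 𝟙 (α ℕ.+ s ℕ.* i))))

  poch-pf : ∀ α s → poch α s ≈ pf∞ 𝟙 α s
  poch-pf α s .at n = trans (cong (λ xs → prodS xs n) (map-applyUpTo id factor (suc n)))
    (trans (prodS-prodTo (suc n) factor (λ i → fac 𝟙 (α ℕ.+ s ℕ.* i)) (λ i → ⊖-cong one≈ (≈-trans (mono≈ _) (≈-sym (R.*-identityˡ _)))) .at n) (sym (pf-prodTo α s (suc n) .at n)))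
    where
    factor : ℕ → PS
    factor i = oneS ⊖ mono (α ℕ.+ s ℕ.* i)

  J-E : J 6 ≈ E
  J-E = poch-pf 6 6

  J-F : J 2 ≈ F
  J-F = poch-pf 2 2

  Jam-a : Jam 3 6 ≈ a
  Jam-a = ≈-trans (⊗-cong (⊗-cong (poch-pf 3 6) (poch-pf 3 6)) (poch-pf 6 6)) (≈-sym (Θ⁻-product 3 3))

  Jam-b : Jam 1 6 ≈ b
  Jam-b = ≈-trans (⊗-cong (⊗-cong (poch-pf 1 6) (poch-pf 5 6)) (poch-pf 6 6)) (≈-sym (Θ⁻-product 1 5))

  private
    power : PS → ℕ → PS
    power f zero = 𝟙
    power f (suc k) = f ⊠ power f k

    ^S-power : ∀ {f g} k → f ≈ g → f ^S k ≈ power g k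
    ^S-power zero p = one≈
    ^S-power (suc k) p = ⊗-cong p (^S-power k p)

    -- Turns a quotient into the product equation that characterises it. At the call sites the
    -- constant term 1 of the denominator is found by evaluation.
    ⊘-cancel : ∀ {f g f′ g′} → g 0 ≡ 1ℚ → f ≈ f′ → g ≈ g′ → g′ ⊠ (f ⊘ g) ≈ f′
    ⊘-cancel {f} {g} {f′} {g′} h p p′ = begin
      g′ ⊠ (f ⊘ g) ≈⟨ R.*-cong (≈-sym p′) (⊗-cong p ≈-refl) ⟩
      g ⊠ (f′ ⊠ inv g) ≈⟨ solve 3 (λ g f i → g :* (f :* i) := f :* (g :* i)) ≈-refl g f′ (inv g) ⟩
      f′ ⊠ (g ⊠ inv g) ≈⟨ R.*-cong ≈-refl (inv-⊠ h) ⟩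
      f′ ⊠ 𝟙 ≈⟨ R.*-identityʳ f′ ⟩
      f′ ∎
      where open ≈-Reasoning

    eq₁ : power b 6 ⊠ power F 4 ⊠ power a 3 ⊠ T1 ≈ power E 12
    eq₁ = ⊘-cancel {J 6 ^S 12} {(Jam 1 6 ^S 6) ⊗ (J 2 ^S 4) ⊗ (Jam 3 6 ^S 3)} refl (^S-power 12 J-E) (⊗-cong (⊗-cong (^S-power 6 Jam-b) (^S-power 4 J-F)) (^S-power 3 Jam-a))

    eq₂ : F ⊠ a ⊠ T2 ≈ power E 3
    eq₂ = ⊘-cancel {J 6 ^S 3} {J 2 ⊗ Jam 3 6} refl (^S-power 3 J-E) (⊗-cong J-F Jam-a)

    eq₃ : power E 6 ⊠ T3 ≈ power b 6 ⊠ power F 2 ⊠ a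
    eq₃ = ⊘-cancel {(Jam 1 6 ^S 6) ⊗ (J 2 ^S 2) ⊗ Jam 3 6} {J 6 ^S 6} refl (⊗-cong (⊗-cong (^S-power 6 Jam-b) (^S-power 2 J-F)) Jam-a) (^S-power 6 J-E)

    aS : ∀ k → a ⊠ S k ≈ bsum k
    aS k = ⊘-cancel {bsum k} {Jam 3 6} refl ≈-refl Jam-a

    E³ : PS
    E³ = E ⊠ E ⊠ E

    -- The numerator `E`¹² is a product of four cubes, and each takes one factor φ to become a b²
    -- `F`.
    φ⁴T1 : φ ⊠ φ ⊠ φ ⊠ φ ⊠ T1 ≈ a ⊠ b ⊠ b
    φ⁴T1 = cancelˡ (unit-⊠ (unit-⊠ (unit-⊠ b² (unit-⊠ b² b²)) (unit-⊠ F² F²)) (unit-⊠ a-unit (unit-⊠ a-unit a-unit))) (begin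
      d ⊠ (φ ⊠ φ ⊠ φ ⊠ φ ⊠ T1) ≈⟨ solve 5 (λ a b f p t → let b² = b :* b ; f² = f :* f ; o = con (+ 1) in
          (b² :* (b² :* b²)) :* (f² :* f²) :* (a :* (a :* a)) :* (p :* p :* p :* p :* t)
          := p :* p :* p :* p :* ((b :* (b :* (b :* (b :* (b :* (b :* o)))))) :* (f :* (f :* (f :* (f :* o)))) :* (a :* (a :* (a :* o))) :* t)) ≈-refl a b F φ T1 ⟩
      φ ⊠ φ ⊠ φ ⊠ φ ⊠ (power b 6 ⊠ power F 4 ⊠ power a 3 ⊠ T1) ≈⟨ R.*-cong ≈-refl eq₁ ⟩
      φ ⊠ φ ⊠ φ ⊠ φ ⊠ power E 12 ≈⟨ solve 2 (λ p e → let o = con (+ 1) ; c = e :* e :* e in p :* p :* p :* p :* (e :* (e :* (e :* (e :* (e :* (e :* (e :* (e :* (e :* (e :* (e :* (e :* o))))))))))))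
          := (p :* c) :* (p :* c) :* ((p :* c) :* (p :* c))) ≈-refl φ E ⟩
      (φ ⊠ E³) ⊠ (φ ⊠ E³) ⊠ ((φ ⊠ E³) ⊠ (φ ⊠ E³)) ≈⟨ R.*-cong (R.*-cong φE³ φE³) (R.*-cong φE³ φE³) ⟩
      (a ⊠ b ⊠ b ⊠ F) ⊠ (a ⊠ b ⊠ b ⊠ F) ⊠ ((a ⊠ b ⊠ b ⊠ F) ⊠ (a ⊠ b ⊠ b ⊠ F))
        ≈⟨ solve 3 (λ a b f → let b² = b :* b ; f² = f :* f ; y = a :* b :* b :* f in y :* y :* (y :* y) := (b² :* (b² :* b²)) :* (f² :* f²) :* (a :* (a :* a)) :* (a :* b :* b)) ≈-refl a b F ⟩
      d ⊠ (a ⊠ b ⊠ b) ∎)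
      where
      open ≈-Reasoning
      b² : IsUnit (b ⊠ b)
      b² = unit-⊠ b-unit b-unit
      F² : IsUnit (F ⊠ F)
      F² = unit-⊠ F-unit F-unit
      d : PS
      d = ((b ⊠ b) ⊠ ((b ⊠ b) ⊠ (b ⊠ b))) ⊠ ((F ⊠ F) ⊠ (F ⊠ F)) ⊠ (a ⊠ (a ⊠ a))

    φT2 : φ ⊠ T2 ≈ b ⊠ b
    φT2 = cancelˡ (unit-⊠ F-unit a-unit) (begin
      F ⊠ a ⊠ (φ ⊠ T2) ≈⟨ solve 4 (λ f a p t → f :* a :* (p :* t) := p :* (f :* a :* t)) ≈-refl F a φ T2 ⟩
      φ ⊠ (F ⊠ a ⊠ T2) ≈⟨ R.*-cong ≈-refl eq₂ ⟩
      φ ⊠ power E 3 ≈⟨ solve 2 (λ p e → p :* (e :* (e :* (e :* con (+ 1)))) := p :* (e :* e :* e)) ≈-refl φ E ⟩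
      φ ⊠ E³ ≈⟨ φE³ ⟩
      a ⊠ b ⊠ b ⊠ F ≈⟨ solve 3 (λ f a b → a :* b :* b :* f := f :* a :* (b :* b)) ≈-refl F a b ⟩
      F ⊠ a ⊠ (b ⊠ b) ∎)
      where open ≈-Reasoning

    aT3 : a ⊠ T3 ≈ φ ⊠ φ ⊠ (b ⊠ b)
    aT3 = cancelˡ (unit-⊠ E³-unit E³-unit) (begin
      (E³ ⊠ E³) ⊠ (a ⊠ T3) ≈⟨ solve 3 (λ e a t → let c = e :* e :* e in (c :* c) :* (a :* t) := a :* ((e :* (e :* (e :* (e :* (e :* (e :* con (+ 1))))))) :* t)) ≈-refl E a T3 ⟩
      a ⊠ (power E 6 ⊠ T3) ≈⟨ R.*-cong ≈-refl eq₃ ⟩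
      a ⊠ (power b 6 ⊠ power F 2 ⊠ a)
        ≈⟨ solve 3 (λ a b f → let o = con (+ 1) ; y = a :* b :* b :* f in a :* ((b :* (b :* (b :* (b :* (b :* (b :* o)))))) :* (f :* (f :* o)) :* a) := (y :* y) :* (b :* b)) ≈-refl a b F ⟩
      ((a ⊠ b ⊠ b ⊠ F) ⊠ (a ⊠ b ⊠ b ⊠ F)) ⊠ (b ⊠ b) ≈⟨ R.*-cong (R.*-cong (≈-sym φE³) (≈-sym φE³)) ≈-refl ⟩
      ((φ ⊠ E³) ⊠ (φ ⊠ E³)) ⊠ (b ⊠ b) ≈⟨ solve 3 (λ p c b → ((p :* c) :* (p :* c)) :* b := (c :* c) :* (p :* p :* b)) ≈-refl φ E³ (b ⊠ b) ⟩
      (E³ ⊠ E³) ⊠ (φ ⊠ φ ⊠ (b ⊠ b)) ∎)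
      where open ≈-Reasoning

    val : ℕ → ℕ → ℚ
    val k m = (sgn m ℤ.* + ((m ℕ.+ k ℕ.∸ 1) C (k ℕ.∸ 1))) ℚ./ 1

    -- Replaces the case distinction on the remainder in `coeffGeom` by a function, so that
    -- equations between remainders act by congruence.
    on-zero : ℕ → ℚ → ℚ
    on-zero zero r = r
    on-zero (suc _) r = 0ℚ

    geo : (e : ℕ) → .{{_ : ℕ.NonZero e}} → ℕ → ℕ → ℚ
    geo e k d = on-zero (d ℕ.% e) (val k (d ℕ./ e))

    coeffGeom-geo : ∀ A e .{{_ : ℕ.NonZero e}} k N → coeffGeom A e k N ≡ onℤ (geo e k) (+ N ℤ.- A)
    coeffGeom-geo A e k N with + N ℤ.- A
    ... | -[1+ _ ] = refl
    ... | + d with d ℕ.% e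
    ...   | suc _ = refl
    ...   | zero = refl

    onℤ-q^ : ∀ f α N → onℤ f (+ N ℤ.- + α) ≡ (q^ α ⊠ f) N
    onℤ-q^ f α N = trans (cong (onℤ f) (ℤP.m-n≡m⊖n N α)) (go (ℕP.≤-<-connex α N))
      where
      go : α ℕ.≤ N ⊎ N ℕ.< α → onℤ f (N ℤ.⊖ α) ≡ (q^ α ⊠ f) N
      go (inj₁ l) = trans (cong (onℤ f) (ℤP.⊖-≥ l)) (trans (sym (q^-⊠-high α f (N ℕ.∸ α))) (cong (q^ α ⊠ f) (ℕP.m+[n∸m]≡n l)))
      go (inj₂ l) = trans (cong (onℤ f) (trans (ℤP.⊖-< l) (cong (λ d → ℤ.- + d) (sym (ℕP.suc-pred (α ℕ.∸ N) {{ℕ.>-nonZero (ℕP.m<n⇒0<n∸m l)}}))))) (sym (q^-⊠-low α f N l))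

    coeffGeom-at : ∀ α e .{{_ : ℕ.NonZero e}} k N → coeffGeom (+ α) e k N ≡ (q^ α ⊠ geo e k) N
    coeffGeom-at α e k N = trans (coeffGeom-geo (+ α) e k N) (onℤ-q^ (geo e k) α N)

    module _ (b : ℕ) where
      private
        e′ : ℕ
        e′ = suc b

      geo-low : ∀ k d → suc d ℕ.< e′ → geo e′ k (suc d) ≡ 0ℚ
      geo-low k d l = cong (λ r → on-zero r (val k (suc d ℕ./ e′))) (ℕD.m<n⇒m%n≡m l)

      geo-suc : ∀ k d → geo e′ k (e′ ℕ.+ d) ≡ on-zero (d ℕ.% e′) (val k (suc (d ℕ./ e′)))
      geo-suc k d = cong₂ (λ r m → on-zero r (val k m)) (trans (cong (ℕ._% e′) (ℕP.+-comm e′ d)) (ℕD.[m+n]%n≡m%n d e′))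
        (trans (ℕD.m/n≡1+[m∸n]/n {e′ ℕ.+ d} {e′} (ℕP.m≤m+n e′ d)) (cong (λ x → suc (x ℕ./ e′)) (ℕP.m+n∸m≡n e′ d)))

      geo-step : ∀ k (v : ℕ → ℚ) → (∀ m → val k (suc m) ℚ.+ val k m ≡ v m) → ∀ d → geo e′ k (e′ ℕ.+ d) ℚ.+ geo e′ k d ≡ on-zero (d ℕ.% e′) (v (d ℕ./ e′))
      geo-step k v h d = trans (cong (ℚ._+ geo e′ k d) (geo-suc k d)) (go (d ℕ.% e′))
        where
        go : ∀ r → on-zero r (val k (suc (d ℕ./ e′))) ℚ.+ on-zero r (val k (d ℕ./ e′)) ≡ on-zero r (v (d ℕ./ e′))
        go zero = h (d ℕ./ e′)
        go (suc _) = refl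

      1+q-⊠ : ∀ {f r} → f 0 ≡ r 0 → (∀ d → suc d ℕ.< e′ → f (suc d) ≡ r (suc d)) → (∀ d → f (e′ ℕ.+ d) ℚ.+ f d ≡ r (e′ ℕ.+ d)) → 1+q b ⊠ f ≈ r
      1+q-⊠ {f} {r} h₀ hl hh = ≈-trans (≈-trans (R.distribʳ f 𝟙 (q^ e′)) (R.+-cong (R.*-identityˡ f) ≈-refl)) (mk≈ λ n → trans (⊞-at f (q^ e′ ⊠ f) n) (go n (ℕP.≤-<-connex e′ n)))
        where
        go : ∀ n → e′ ℕ.≤ n ⊎ n ℕ.< e′ → f n ℚ.+ (q^ e′ ⊠ f) n ≡ r n
        go n (inj₁ l) = subst (λ n → f n ℚ.+ (q^ e′ ⊠ f) n ≡ r n) (ℕP.m+[n∸m]≡n l) (trans (cong (f (e′ ℕ.+ (n ℕ.∸ e′)) ℚ.+_) (q^-⊠-high e′ f (n ℕ.∸ e′))) (hh (n ℕ.∸ e′)))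
        go zero (inj₂ l) = trans (cong (f 0 ℚ.+_) (q^-⊠-low e′ f 0 l)) (trans (ℚP.+-identityʳ (f 0)) h₀)
        go (suc n) (inj₂ l) = trans (cong (f (suc n) ℚ.+_) (q^-⊠-low e′ f (suc n) l)) (trans (ℚP.+-identityʳ (f (suc n))) (hl n l))

      val₁ : ∀ m → val 1 (suc m) ℚ.+ val 1 m ≡ 0ℚ
      val₁ m = trans (sym (ℤ→ℚ-+ (ℤ.- s ℤ.* + 1) (s ℤ.* + 1))) (cong ℤ→ℚ (solveℤ 1 (λ s → -' s *' con' (+ 1) +' s *' con' (+ 1) =' con' (+ 0)) refl s))
        where
        s = sgn m

      val₂ : ∀ m → val 2 (suc m) ℚ.+ val 2 m ≡ val 1 (suc m)
      val₂ m = trans (cong₂ ℚ._+_ (cong (λ x → (ℤ.- s ℤ.* + x) ℚ./ 1) (at′ (suc m))) (cong (λ x → (s ℤ.* + x) ℚ./ 1) (at′ m)))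
        (trans (sym (ℤ→ℚ-+ (ℤ.- s ℤ.* + suc (suc m)) (s ℤ.* + suc m))) (cong ℤ→ℚ (solveℤ 2 (λ s m → -' s *' (con' (+ 1) +' (con' (+ 1) +' m)) +' s *' (con' (+ 1) +' m) =' -' s *' con' (+ 1)) refl s (+ m))))
        where
        s = sgn m
        at′ : ∀ m → (m ℕ.+ 2 ℕ.∸ 1) C 1 ≡ suc m
        at′ m = trans (nC1≡n (m ℕ.+ 2 ℕ.∸ 1)) (trans (ℕP.+-∸-assoc m {2} {1} (s≤s z≤n)) (ℕP.+-comm m 1))

      geo-0 : ∀ k → geo e′ k 0 ≡ val k 0
      geo-0 k = refl

      geo-1 : 1+q b ⊠ geo e′ 1 ≈ 𝟙
      geo-1 = 1+q-⊠ (trans (geo-0 1) (sym (𝟙-at 0))) (λ d l → trans (geo-low 1 d l) (sym (𝟙-at (suc d))))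
        (λ d → trans (geo-step 1 (λ _ → 0ℚ) val₁ d) (trans (vanish (d ℕ.% e′)) (sym (𝟙-at (e′ ℕ.+ d)))))
        where
        vanish : ∀ r → on-zero r 0ℚ ≡ 0ℚ
        vanish zero = refl
        vanish (suc _) = refl

      -- The coefficients are (-1)^m (m + 1); consecutive ones add up to a bare sign, the
      -- coefficient of the simple geometric series.
      geo-2 : 1+q b ⊠ geo e′ 2 ≈ geo e′ 1
      geo-2 = 1+q-⊠ (trans (geo-0 2) (sym (geo-0 1))) (λ d l → trans (geo-low 2 d l) (sym (geo-low 1 d l))) (λ d → trans (geo-step 2 (λ m → val 1 (suc m)) val₂ d) (sym (geo-suc 1 d)))

      1+q-unit : IsUnit (1+q b)
      1+q-unit = unit-one (one-at-0 b)

      geo≈inv : geo e′ 1 ≈ inv (1+q b)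
      geo≈inv = cancelˡ 1+q-unit (≈-trans geo-1 (≈-sym (inv-⊠ (one-at-0 b))))

      geo≈inv² : geo e′ 2 ≈ inv (1+q b) ⊠ inv (1+q b)
      geo≈inv² = cancelˡ 1+q-unit (≈-trans geo-2 (≈-trans geo≈inv (≈-sym (≈-trans (≈-sym (R.*-assoc (1+q b) i i)) (≈-trans (R.*-cong (inv-⊠ (one-at-0 b)) ≈-refl) (R.*-identityˡ i))))))
        where
        i = inv (1+q b)

    termCoeff-1 : ∀ α B → ¬ B ≡ + 0 → ∀ N → termCoeff (+ α) B 1 N ≡ (q^ α ⊠ h⁺ B) N
    termCoeff-1 α (+ zero) h N = ⊥-elim (h refl)
    termCoeff-1 α (+ suc b) h N = trans (coeffGeom-at α (suc b) 1 N) (R.*-cong (≈-refl {q^ α}) (geo≈inv b) .at N)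
    termCoeff-1 α -[1+ b ] h N = trans (coeffGeom-at (α ℕ.+ 1 ℕ.* suc b) (suc b) 1 N) (≈-trans (R.*-cong (≈-trans (q^-+ α (1 ℕ.* suc b)) (R.*-cong (≈-refl {q^ α}) (q^≡ (ℕP.*-identityˡ (suc b))))) (geo≈inv b)) (R.*-assoc (q^ α) (q^ suc b) (inv (1+q b))) .at N)

    termCoeff-2 : ∀ α B → ¬ B ≡ + 0 → ∀ N → termCoeff (+ α) B 2 N ≡ (q^ α ⊠ (h⁺ B ⊠ h⁺ B)) N
    termCoeff-2 α (+ zero) h N = ⊥-elim (h refl)
    termCoeff-2 α (+ suc b) h N = trans (coeffGeom-at α (suc b) 2 N) (R.*-cong (≈-refl {q^ α}) (geo≈inv² b) .at N)
    termCoeff-2 α -[1+ b ] h N = trans (coeffGeom-at (α ℕ.+ 2 ℕ.* suc b) (suc b) 2 N) (≈-trans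
      (R.*-cong (≈-trans (q^-+ α (2 ℕ.* suc b)) (R.*-cong (≈-refl {q^ α}) (≈-trans (q^≡ (cong (suc b ℕ.+_) (ℕP.+-identityʳ (suc b)))) (q^-+ (suc b) (suc b))))) (geo≈inv² b))
      (solve 3 (λ p x i → (p :* (x :* x)) :* (i :* i) := p :* ((x :* i) :* (x :* i))) ≈-refl (q^ α) (q^ suc b) (inv (1+q b))) .at N)

    sumTo-snoc : ∀ n f → sumTo (suc n) f ≡ sumTo n f ℚ.+ f n
    sumTo-snoc zero f = ℚP.+-comm (f 0) 0ℚ
    sumTo-snoc (suc n) f = trans (cong (f 0 ℚ.+_) (sumTo-snoc n (f ∘ suc))) (sym (ℚP.+-assoc (f 0) (sumTo n (f ∘ suc)) (f (suc n))))

    sumTo-symSum : ∀ B (F : ℤ → PS) N → sumTo (suc (2 ℕ.* B)) (λ i → F (+ i ℤ.- + B) N) ≡ symSum B F N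
    sumTo-symSum zero F N = ℚP.+-identityʳ (F (+ 0) N)
    sumTo-symSum (suc B) F N = trans (cong (λ k → F -[1+ B ] N ℚ.+ sumTo k (λ i → F (+ suc i ℤ.- + suc B) N)) (cong suc (ℕP.+-suc B (B ℕ.+ 0))))
      (trans (cong (F -[1+ B ] N ℚ.+_) (trans (sumTo-snoc (suc (B ℕ.+ (B ℕ.+ 0))) (λ i → F (+ suc i ℤ.- + suc B) N)) (cong₂ ℚ._+_
        (trans (sumTo-cong (suc (2 ℕ.* B)) (λ i _ → cong (λ k → F k N) (shift i))) (sumTo-symSum B F N)) (cong (λ k → F k N) top))))
      (trans (rearrange (F -[1+ B ] N) (symSum B F N) (F (+ suc B) N)) (sym (trans (⊞-at (symSum B F) _ N) (cong (symSum B F N ℚ.+_) (⊞-at (F (+ suc B)) (F -[1+ B ]) N))))))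
      where
      shift : ∀ i → + suc i ℤ.- + suc B ≡ + i ℤ.- + B
      shift i = trans (ℤP.[1+m]⊖[1+n]≡m⊖n i B) (sym (ℤP.m-n≡m⊖n i B))
      top : + suc (suc (B ℕ.+ (B ℕ.+ 0))) ℤ.- + suc B ≡ + suc B
      top = trans (shift (suc (B ℕ.+ (B ℕ.+ 0)))) (trans (ℤP.m-n≡m⊖n (suc (B ℕ.+ (B ℕ.+ 0))) B) (trans (ℤP.⊖-≥ (ℕP.m≤n⇒m≤1+n (ℕP.m≤m+n B _))) (cong +_ (trans (cong (λ x → suc (B ℕ.+ x) ℕ.∸ B) (ℕP.+-identityʳ B)) (trans (cong (ℕ._∸ B) (sym (ℕP.+-suc B B))) (ℕP.m+n∸m≡n B (suc B)))))))
      rearrange : ∀ x y z → x ℚ.+ (y ℚ.+ z) ≡ y ℚ.+ (z ℚ.+ x)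
      rearrange x y z = trans (ℚP.+-comm x (y ℚ.+ z)) (ℚP.+-assoc y z x)

    sgn-ε : ∀ n f N → ℤ→ℚ (sgn n) ℚ.* f N ≡ (εℕ n ⊠ f) N
    sgn-ε zero f N = trans (ℚP.*-identityˡ (f N)) (sym (R.*-identityˡ f .at N))
    sgn-ε (suc n) f N = trans (cong (ℚ._* f N) (ℤ→ℚ-neg (sgn n))) (trans (sym (ℚP.neg-distribˡ-* (ℤ→ℚ (sgn n)) (f N))) (trans (cong ℚ.-_ (sgn-ε n f N))
      (trans (sym (⊟-at (εℕ n ⊠ f) N)) (solve 2 (λ e f → :- (e :* f) := :- e :* f) ≈-refl (εℕ n) f .at N))))

    exponent : ∀ j → + 3 ℤ.* j ℤ.* j ℤ.+ + 3 ℤ.* j ≡ + θe 6 0 j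
    exponent j = sym (trans (ex-shift (θE 6 0 j) (lit 0) (+ 3 ℤ.* j ℤ.* j ℤ.+ + 3 ℤ.* j) (solveℤ 1 (λ j → let tr = λ x → x *' (x +' con' (+ 1)) in
      con' (+ 6) *' tr j +' con' (+ 0) *' tr (j -' con' (+ 1)) =' con' (+ 2) *' con' (+ 0) +' con' (+ 2) *' (con' (+ 3) *' j *' j +' con' (+ 3) *' j)) refl j)) (ℤP.+-identityˡ _))

    -- The truncation |n| ≤ N + 1 of `bsum` is precisely the window of `sumℤ 1` at N, so the two
    -- agree coefficient by coefficient without a limit argument.
    bsum-Λ : ∀ k (h : ℤ → PS) → (∀ α B → ¬ B ≡ + 0 → ∀ N → termCoeff (+ α) B k N ≡ (q^ α ⊠ h B) N) → bsum k ≈ Λ 6 0 (h ∘ 3j+1)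
    bsum-Λ k h p .at N = trans (foldr-upTo (suc (suc (suc (2 ℕ.* N)))) summand) (trans (cong (λ n → sumTo (suc n) summand) (sym 2[1+N]))
        (trans (sumTo-cong (suc (2 ℕ.* suc N)) {summand} (λ i _ → each (+ i ℤ.- + suc N)))
          (trans (sumTo-symSum (suc N) (λ j → θ⁻ 6 0 j ⊠ h (3j+1 j)) N) (cong (λ B → symSum B (λ j → θ⁻ 6 0 j ⊠ h (3j+1 j)) N) (ℕP.+-comm 1 N)))))
      where
      term : ℤ → ℚ
      term j = (sgn ∣ j ∣ ℚ./ 1) ℚ.* termCoeff (+ 3 ℤ.* j ℤ.* j ℤ.+ + 3 ℤ.* j) (+ 3 ℤ.* j ℤ.+ + 1) k N
      summand : ℕ → ℚ
      summand i = term (+ i ℤ.- + suc N)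
      2[1+N] : 2 ℕ.* suc N ≡ suc (suc (2 ℕ.* N))
      2[1+N] = ℕP.*-distribˡ-+ 2 1 N
      each : ∀ j → term j ≡ (θ⁻ 6 0 j ⊠ h (3j+1 j)) N
      each j = trans (cong (ℤ→ℚ (sgn ∣ j ∣) ℚ.*_) (trans (cong (λ A → termCoeff A (3j+1 j) k N) (exponent j)) (p (θe 6 0 j) (3j+1 j) (3j+1≢0 j) N)))
        (trans (sgn-ε ∣ j ∣ (q^ θe 6 0 j ⊠ h (3j+1 j)) N) (≈-sym (R.*-assoc (ε j) (q^ θe 6 0 j) (h (3j+1 j))) .at N))

    bsum-1 : bsum 1 ≈ L⁺
    bsum-1 = bsum-Λ 1 h⁺ termCoeff-1

    -- 1/(1 + x)² = 1/(1 + x) - x/(1 + x)² at x = q^(3n+1).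
    bsum-2 : bsum 2 ≈ L⁺ ⊞ ⊟ L²
    bsum-2 = ≈-trans (bsum-Λ 2 (λ k → h⁺ k ⊠ h⁺ k) termCoeff-2) (sum-unique (Λ-isSum 6 0 (λ j → h⁺ (3j+1 j) ⊠ h⁺ (3j+1 j)))
      (sum-cong (λ j → square (θ⁻ 6 0 j) (3j+1 j)) ≈-refl (sum-⊞ (Λ-isSum 6 0 (h⁺ ∘ 3j+1)) (sum-⊟ (Λ-isSum 6 0 (h² ∘ 3j+1))))))
      where
      square : ∀ t k → t ⊠ h⁺ k ⊞ ⊟ (t ⊠ h² k) ≈ t ⊠ (h⁺ k ⊠ h⁺ k)
      square t k = ≈-trans (R.+-cong (R.*-cong ≈-refl (≈-trans (≈-sym (R.*-identityʳ (h⁺ k))) (R.*-cong ≈-refl (≈-sym (h⁺-neg k))))) ≈-refl)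
        (solve 3 (λ t x y → t :* (x :* (x :+ y)) :- t :* (x :* y) := t :* (x :* x)) ≈-refl t (h⁺ k) (h⁺ (ℤ.- k)))

    open Values φ⁴T1 φT2 aT3 (≈-trans (aS 1) bsum-1) (≈-trans (aS 2) bsum-2)

    scal : ∀ d z f → fromℤ (+ suc d) ⊠ ((z ℚ./ suc d) · f) ≈ fromℤ z ⊠ f
    scal d z f .at n = trans (mul (+ suc d) ((z ℚ./ suc d) · f)) (trans (sym (ℚP.*-assoc (ℤ→ℚ (+ suc d)) (z ℚ./ suc d) (f n))) (trans (cong (ℚ._* f n) (ℤ→ℚ-*-/ d z)) (sym (mul z f))))
      where
      mul : ∀ z f → (fromℤ z ⊠ f) n ≡ ℤ→ℚ z ℚ.* f n
      mul z f = trans (⊠-ext {g = f} (fromℤ-constS z) (λ _ → refl) n) (constS-⊠ (ℤ→ℚ z) f n)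

  -- Both sides are multiplied by 6, which clears the thirds of the statement and the factor of
  -- `c2-NS` together. The other three classes follow the same pattern.
  series₀ : c 2 (NS 0) ≈ rhs0
  series₀ = cancelˡ (unit-fromℤ 5) (≈-trans (c2-NS (+ 1) (+ 2) (+ 2) NS-lin₀) (≈-trans
    (solve 5 (λ t₁ t₂ t₃ s₁ s₂ → con (+ 4) :* t₁ :+ con (+ 1) :* (con (+ 4) :* t₃ :+ con (+ 16) :* s₁ :+ con -[1+ 23 ] :* s₂) :+ con (+ 2) :* (con -[1+ 7 ] :* t₂ :+ con (+ 6) :* s₁) :+ con (+ 2) :* (con (+ 4) :* t₂ :+ :- (con (+ 2) :* s₁))
        := con (+ 2) :* (con (+ 2) :* t₁ :- con (+ 4) :* t₂ :+ con (+ 2) :* t₃ :- con (+ 3) :* (con (+ 4) :* s₂) :+ con (+ 3) :* (con (+ 4) :* s₁))) ≈-refl T1 T2 T3 (S 1) (S 2))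
    (≈-sym (≈-trans (R.*-cong ≈-refl (⊕-cong (⊖-cong (⊕-cong (⊖-cong ≈-refl ≈-refl) ≈-refl) ≈-refl) ≈-refl))
    (≈-trans (solve 5 (λ t₁ t₂ t₃ s₂ s₁ → con (+ 6) :* (t₁ :- t₂ :+ t₃ :- s₂ :+ s₁) := con (+ 2) :* (con (+ 3) :* t₁ :- con (+ 3) :* t₂ :+ con (+ 3) :* t₃ :- con (+ 3) :* (con (+ 1) :* s₂) :+ con (+ 3) :* (con (+ 1) :* s₁))) ≈-refl
        (q (+ 2) 2 · T1) (q (+ 4) 2 · T2) (q (+ 2) 2 · T3) (q (+ 4) 0 · S 2) (q (+ 4) 0 · S 1))
      (R.*-cong ≈-refl (R.+-cong (R.+-cong (R.+-cong (R.+-cong (scal 2 (+ 2) T1) (R.-‿cong (scal 2 (+ 4) T2))) (scal 2 (+ 2) T3)) (R.-‿cong (R.*-cong ≈-refl (scal 0 (+ 4) (S 2))))) (R.*-cong ≈-refl (scal 0 (+ 4) (S 1))))))))))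

  series₁ : c 2 (NS 1) ≈ rhs1
  series₁ = cancelˡ (unit-fromℤ 5) (≈-trans (c2-NS -[1+ 0 ] -[1+ 0 ] (+ 1) NS-lin₁) (≈-trans
    (solve 5 (λ t₁ t₂ t₃ s₁ s₂ → con (+ 4) :* t₁ :+ con -[1+ 0 ] :* (con (+ 4) :* t₃ :+ con (+ 16) :* s₁ :+ con -[1+ 23 ] :* s₂) :+ con -[1+ 0 ] :* (con -[1+ 7 ] :* t₂ :+ con (+ 6) :* s₁) :+ con (+ 1) :* (con (+ 4) :* t₂ :+ :- (con (+ 2) :* s₁))
        := con (+ 2) :* (con (+ 2) :* t₁ :+ con (+ 3) :* (con (+ 2) :* t₂) :- con (+ 2) :* t₃ :+ con (+ 3) :* (con (+ 4) :* s₂) :- con (+ 3) :* (con (+ 4) :* s₁))) ≈-refl T1 T2 T3 (S 1) (S 2))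
    (≈-sym (≈-trans (R.*-cong ≈-refl (⊖-cong (⊕-cong (⊖-cong (⊕-cong ≈-refl ≈-refl) ≈-refl) ≈-refl) ≈-refl))
    (≈-trans (solve 5 (λ t₁ t₂ t₃ s₂ s₁ → con (+ 6) :* (t₁ :+ t₂ :- t₃ :+ s₂ :- s₁) := con (+ 2) :* (con (+ 3) :* t₁ :+ con (+ 3) :* (con (+ 1) :* t₂) :- con (+ 3) :* t₃ :+ con (+ 3) :* (con (+ 1) :* s₂) :- con (+ 3) :* (con (+ 1) :* s₁))) ≈-refl
        (q (+ 2) 2 · T1) (q (+ 2) 0 · T2) (q (+ 2) 2 · T3) (q (+ 4) 0 · S 2) (q (+ 4) 0 · S 1))
      (R.*-cong ≈-refl (R.+-cong (R.+-cong (R.+-cong (R.+-cong (scal 2 (+ 2) T1) (R.*-cong ≈-refl (scal 0 (+ 2) T2))) (R.-‿cong (scal 2 (+ 2) T3))) (R.*-cong ≈-refl (scal 0 (+ 4) (S 2)))) (R.-‿cong (R.*-cong ≈-refl (scal 0 (+ 4) (S 1)))))))))))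

  series₂ : c 2 (NS 2) ≈ rhs2
  series₂ = cancelˡ (unit-fromℤ 5) (≈-trans (c2-NS (+ 1) -[1+ 0 ] -[1+ 0 ] NS-lin₂) (≈-trans
    (solve 5 (λ t₁ t₂ t₃ s₁ s₂ → con (+ 4) :* t₁ :+ con (+ 1) :* (con (+ 4) :* t₃ :+ con (+ 16) :* s₁ :+ con -[1+ 23 ] :* s₂) :+ con -[1+ 0 ] :* (con -[1+ 7 ] :* t₂ :+ con (+ 6) :* s₁) :+ con -[1+ 0 ] :* (con (+ 4) :* t₂ :+ :- (con (+ 2) :* s₁))
        := con (+ 2) :* (con (+ 2) :* t₁ :+ con (+ 2) :* t₂ :+ con (+ 2) :* t₃ :- con (+ 3) :* (con (+ 4) :* s₂) :+ con (+ 3) :* (con (+ 2) :* s₁))) ≈-refl T1 T2 T3 (S 1) (S 2))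
    (≈-sym (≈-trans (R.*-cong ≈-refl (⊕-cong (⊖-cong (⊕-cong (⊕-cong ≈-refl ≈-refl) ≈-refl) ≈-refl) ≈-refl))
    (≈-trans (solve 5 (λ t₁ t₂ t₃ s₂ s₁ → con (+ 6) :* (t₁ :+ t₂ :+ t₃ :- s₂ :+ s₁) := con (+ 2) :* (con (+ 3) :* t₁ :+ con (+ 3) :* t₂ :+ con (+ 3) :* t₃ :- con (+ 3) :* (con (+ 1) :* s₂) :+ con (+ 3) :* (con (+ 1) :* s₁))) ≈-refl
        (q (+ 2) 2 · T1) (q (+ 2) 2 · T2) (q (+ 2) 2 · T3) (q (+ 4) 0 · S 2) (q (+ 2) 0 · S 1))
      (R.*-cong ≈-refl (R.+-cong (R.+-cong (R.+-cong (R.+-cong (scal 2 (+ 2) T1) (scal 2 (+ 2) T2)) (scal 2 (+ 2) T3)) (R.-‿cong (R.*-cong ≈-refl (scal 0 (+ 4) (S 2))))) (R.*-cong ≈-refl (scal 0 (+ 2) (S 1))))))))))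

  series₃ : c 2 (NS 3) ≈ rhs3
  series₃ = cancelˡ (unit-fromℤ 5) (≈-trans (c2-NS -[1+ 0 ] (+ 2) -[1+ 1 ] NS-lin₃) (≈-trans
    (solve 5 (λ t₁ t₂ t₃ s₁ s₂ → con (+ 4) :* t₁ :+ con -[1+ 0 ] :* (con (+ 4) :* t₃ :+ con (+ 16) :* s₁ :+ con -[1+ 23 ] :* s₂) :+ con (+ 2) :* (con -[1+ 7 ] :* t₂ :+ con (+ 6) :* s₁) :+ con -[1+ 1 ] :* (con (+ 4) :* t₂ :+ :- (con (+ 2) :* s₁))
        := con (+ 2) :* (con (+ 2) :* t₁ :- con (+ 3) :* (con (+ 4) :* t₂) :- con (+ 2) :* t₃ :+ con (+ 3) :* (con (+ 4) :* s₂))) ≈-refl T1 T2 T3 (S 1) (S 2))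
    (≈-sym (≈-trans (R.*-cong ≈-refl (⊕-cong (⊖-cong (⊖-cong ≈-refl ≈-refl) ≈-refl) ≈-refl))
    (≈-trans (solve 4 (λ t₁ t₂ t₃ s₂ → con (+ 6) :* (t₁ :- t₂ :- t₃ :+ s₂) := con (+ 2) :* (con (+ 3) :* t₁ :- con (+ 3) :* (con (+ 1) :* t₂) :- con (+ 3) :* t₃ :+ con (+ 3) :* (con (+ 1) :* s₂))) ≈-refl
        (q (+ 2) 2 · T1) (q (+ 4) 0 · T2) (q (+ 2) 2 · T3) (q (+ 4) 0 · S 2))
      (R.*-cong ≈-refl (R.+-cong (R.+-cong (R.+-cong (scal 2 (+ 2) T1) (R.-‿cong (R.*-cong ≈-refl (scal 0 (+ 4) T2)))) (R.-‿cong (scal 2 (+ 2) T3))) (R.*-cong ≈-refl (scal 0 (+ 4) (S 2))))))))))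

  rbar-NS : ∀ s n → rbar s 2 n ≡ c 2 (NS s) n
  rbar-NS s n = Nbar-Total s (3 ℕ.* n ℕ.+ 2)

open Evaluation

theorem1p3 : ((n : ℕ) → rbar 0 2 n ≡ rhs0 n)
           × ((n : ℕ) → rbar 1 2 n ≡ rhs1 n)
           × ((n : ℕ) → rbar 2 2 n ≡ rhs2 n)
           × ((n : ℕ) → rbar 3 2 n ≡ rhs3 n)
theorem1p3 = (λ n → trans (rbar-NS 0 n) (series₀ .at n)) , (λ n → trans (rbar-NS 1 n) (series₁ .at n)) , (λ n → trans (rbar-NS 2 n) (series₂ .at n)) , (λ n → trans (rbar-NS 3 n) (series₃ .at n))
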